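{- Fix a positive integer $n$, and let $\alpha$ be a composition of length $n$ with $\lambda=\mathrm{sort}(\alpha)$ and $n>\ell(\lambda)$. Then \[ f_{\alpha}(X;q,0)=\sum_{\beta}K_{\alpha,\beta}(q)\,\mathcal{A}_{\beta}(X), \] where the sum runs over compositions $\beta$ of length $n$ with $\mathrm{sort}(\beta)\le \mathrm{sort}(\alpha)$ in dominance order, and \[ K_{\alpha,\beta}(q)=\sum_{\substack{Q\in \mathrm{SSYT}(\mathrm{sort}(\beta)',\mathrm{sort}(\alpha)')\\ \mathrm{type}(\rho^{ -1}(M_\beta,Q))=\alpha}} q^{\mathrm{charge}(Q)} . \]
   Context: Compositions: a (weak) composition is a finite sequence of nonnegative integers; $\mathrm{sort}(\alpha)$ is the partition obtained by sorting the positive parts of $\alpha$ in weakly decreasing order; $\lambda'$ is the conjugate of a partition $\lambda$; $\le$ on partitions is dominance order. $\mathrm{SSYT}(\mu,\nu)$ is the set of semistandard Young tableaux of shape $\mu$ and content $\nu$ (French convention: row 1 at the bottom, rows weakly increase left to right, columns strictly increase bottom to top). $\mathrm{charge}$ is the Lascoux–Schützenberger charge statistic on semistandard tableaux. Multiline queues (MLQs): fix $n$. For a partition $\lambda$ with $L=\lambda_1$ and $n>\ell(\lambda)$, an MLQ of shape $\lambda$ is a tuple $M=(B_1,\dots,B_L)$ of subsets of $[n]$ with $|B_r|=\lambda'_r$, pictured as an $L\times n$ array with rows $1,\dots,L$ from bottom to top and columns $1,\dots,n$ left to right (cyclically, column $n+1$ = column $1$), with a ball at site $(r,j)$ iff $j\in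 B_r$. $\mathrm{MLQ}_\lambda$ is the set of these; $x^M=\prod_r\prod_{b\in B_r}x_b$, in variables $X=(x_1,\dots,x_n)$. Ferrari–Martin (FM) labelling: for $r=L,L-1,\dots,2$: every unlabelled ball in row $r$ gets label $r$; then the balls of row $r$ are processed in order of decreasing label (left to right among equal labels), each paired to the first not-yet-paired ball in row $r-1$ weakly to its right, cyclically wrapping from column $n$ to column $1$ if necessary; that ball receives the same label. Finally unlabelled balls in row $1$ get label $1$. $L_M(r,j)$ is the label at site $(r,j)$ (0 if empty). $\mathrm{type}(M)=(L_M(1,1),\dots,L_M(1,n))$. A pairing wraps if the ball in row $r-1$ is in a column strictly smaller than the ball in row $r$; $\mathrm{maj}(M)=\sum(\ell-r+1)$ over all wrapping pairings from row $r$ to row $r-1$ of balls of label $\ell$. $M$ is nonwrapping if $\mathrm{maj}(M)=0$; $\mathrm{NMLQ}_\lambda$ is the set of nonwrapping MLQs. $\mathrm{MLQ}[\alpha]=\{M:\mathrm{type}(M)=\alpha\}$, $\mathrm{NMLQ}[\alpha]$ its nonwrapping elements. For a composition $\beta$ of length $n$, $M_\beta$ is the MLQ with $B_r=\{i:\beta_i\ge r\}$. Polynomials: $f_\alpha(X;q,0)=\sum_{M\in\mathrm{MLQ}[\alpha]}q^{\mathrm{maj}(M)}x^M$ (the ASEP polynomial at $t=0$), and $\mathcal{A}_\beta(X)=\sum_{M\in \mathrm{NMLQ}[\beta]}x^M$ (the Demazure atom). Collapsing map: for $j\ge1$ and a tuple $N=(B_1,\dots,B_L)$ of subsets of $[n]$,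 the column word $cw(N)$ lists the row indices of balls reading columns left to right, each column top to bottom. Bracketing w.r.t. $j$: replace each $j$ by ")" and each $j+1$ by "(" (ignore other letters), and iteratively match a "(" with a ")" to its right when no unmatched parenthesis lies between them. $e^{\downarrow}_j(N)$ moves the ball corresponding to the leftmost unmatched $j+1$ of $cw(N)$ from row $j+1$ to row $j$ in the same column (identity if none); $e^{\downarrow\star}_j$ applies $e^{\downarrow}_j$ until it acts trivially. For $M=(B_1,\dots,B_L)\in\mathrm{MLQ}_\lambda$: set $M_1=M$, $Q_1$ a single row of $|B_1|$ boxes filled with $1$; for $i=1,\dots,L-1$ let $M_{i+1}=e^{\downarrow\star}_1e^{\downarrow\star}_2\cdots e^{\downarrow\star}_i(M_i)$ ($e^{\downarrow\star}_i$ applied first), and obtain $Q_{i+1}$ from $Q_i$ by adding $|B^{(i+1)}_j|-|B^{(i)}_j|$ boxes to row $j$ for $j\le i$ and $|B^{(i+1)}_{i+1}|$ boxes in row $i+1$, all filled with $i+1$, where $M_i=(B^{(i)}_1,\dots,B^{(i)}_L)$. Put $\rho_N(M)=M_L$, $\rho_Q(M)=Q_L$, $\rho(M)=(\rho_N(M),\rho_Q(M))$. It is known that $\rho$ is a bijection $\mathrm{MLQ}_\lambda\to\bigcup_{\mu\le\lambda}\mathrm{NMLQ}_\mu\times\mathrm{SSYT}(\mu',\lambda')$; $\rho^{ -1}(M_\beta,Q)$ denotes the preimage of the pair $(M_\beta,Q)$. -}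

module Defs where

-- Everything is finite and computational.  Conventions:
--  * a (weak) composition of length n is a List ℕ of length n;
--  * a partition is a weakly decreasing List ℕ of positive parts;
--  * a subset of [n] is a List Bool of length n (column j ↦ index j-1);
--  * an MLQ / tuple (B_1,…,B_L) is a List of rows, row B_1 first (bottom);
--  * a tableau is a List of rows, row 1 (bottom, French) first;
--  * a polynomial in q and X = (x_1..x_n) with ℕ coefficients is given by
--    its coefficient function: (q-degree d) ↦ (exponent vector e) ↦ ℕ.

open import Data.Nat using (ℕ; zero; suc; _+_; _*_; _∸_; _⊔_; _≤ᵇ_; _<ᵇ_; _≡ᵇ_)
open import Data.Bool using (Bool; true; false; if_then_else_; _∧_; _∨_; not)
open import Data.List using (List; []; _∷_; _++_; map; length; concatMap;
  concat; replicate; reverse; upTo; downFrom; applyUpTo; foldr; foldl; zipWith;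
  zip; filterᵇ; take)
open import Data.Nat.ListAction using (sum)
open import Data.Bool.ListAction using (and; all)
open import Data.Product using (_×_; _,_; proj₁; proj₂)
open import Data.Maybe using (Maybe; just; nothing)

nth : {A : Set} → A → List A → ℕ → A
nth d []       _       = d
nth d (x ∷ xs) zero    = x
nth d (x ∷ xs) (suc k) = nth d xs k

setAt : {A : Set} → List A → ℕ → A → List A
setAt []       _       a = []
setAt (x ∷ xs) zero    a = a ∷ xs
setAt (x ∷ xs) (suc k) a = x ∷ setAt xs k a

iter : {A : Set} → ℕ → (A → A) → A → A
iter zero    f a = a
iter (suc k) f a = iter k f (f a)

eqList : {A : Set} → (A → A → Bool) → List A → List A → Bool
eqList eq []       []       = true
eqList eq (x ∷ xs) (y ∷ ys) = eq x y ∧ eqList eq xs ys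
eqList eq _        _        = false

eqBool : Bool → Bool → Bool
eqBool true  b = b
eqBool false b = not b

eqℕs : List ℕ → List ℕ → Bool
eqℕs = eqList _≡ᵇ_

maxL : List ℕ → ℕ
maxL = foldr _⊔_ 0

count : {A : Set} → (A → Bool) → List A → ℕ
count p xs = length (filterᵇ p xs)

oneTo : ℕ → List ℕ
oneTo k = map suc (upTo k)

downTo1 : ℕ → List ℕ
downTo1 k = map suc (downFrom k)

insertDesc : ℕ → List ℕ → List ℕ
insertDesc x []       = x ∷ []
insertDesc x (y ∷ ys) = if y <ᵇ x then x ∷ y ∷ ys else y ∷ insertDesc x ys

sortC : List ℕ → List ℕ
sortC α = foldr insertDesc [] (filterᵇ (λ a → 0 <ᵇ a) α)

conj : List ℕ → List ℕ
conj λp = map (λ r → count (λ a → r ≤ᵇ a) λp) (oneTo (maxL λp))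

dominatedᵇ : List ℕ → List ℕ → Bool
dominatedᵇ μ λp = (sum μ ≡ᵇ sum λp) ∧
  all (λ k → sum (take k μ) ≤ᵇ sum (take k λp)) (oneTo (length μ + length λp))

vecsUpTo : ℕ → ℕ → List (List ℕ)
vecsUpTo zero    m = [] ∷ []
vecsUpTo (suc n) m = concatMap (λ v → map (_∷ v) (upTo (suc m))) (vecsUpTo n m)

-- compositions β of length n with sort(β) ≤ sort(α) in dominance order
-- (such β have all parts ≤ max α, so enumerating {0..max α}^n suffices)
compsBelow : ℕ → List ℕ → List (List ℕ)
compsBelow n α = filterᵇ (λ β → dominatedᵇ (sortC β) (sortC α)) (vecsUpTo n (maxL α))

Row : Set
Row = List Bool

MLQ : Set
MLQ = List Row

eqMLQ : MLQ → MLQ → Bool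
eqMLQ = eqList (eqList eqBool)

card : Row → ℕ
card r = count (λ b → b) r

subsets : ℕ → ℕ → List Row
subsets zero    zero    = [] ∷ []
subsets zero    (suc k) = []
subsets (suc n) zero    = map (false ∷_) (subsets n zero)
subsets (suc n) (suc k) = map (true ∷_) (subsets n k) ++ map (false ∷_) (subsets n (suc k))

rowsOfSizes : ℕ → List ℕ → List MLQ
rowsOfSizes n []       = [] ∷ []
rowsOfSizes n (c ∷ cs) = concatMap (λ B → map (B ∷_) (rowsOfSizes n cs)) (subsets n c)

mlqs : ℕ → List ℕ → List MLQ
mlqs n λp = rowsOfSizes n (conj λp)

weight : ℕ → MLQ → List ℕ
weight n M = foldr (zipWith _+_) (replicate n 0)
  (map (map (λ b → if b then 1 else 0)) M)

mkM : ℕ → List ℕ → MLQ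
mkM L β = map (λ r → map (λ b → r ≤ᵇ b) β) (oneTo L)

-- Ferrari–Martin labelling

-- columns j, j+1, …, n-1, 0, …, j-1 (0-indexed): cyclic scan weakly right of j
cycFrom : ℕ → ℕ → List ℕ
cycFrom n j = filterᵇ (λ i → j ≤ᵇ i) (upTo n) ++ filterᵇ (λ i → i <ᵇ j) (upTo n)

-- first ball in the given column order that is not yet paired (label 0)
firstFree : Row → List ℕ → List ℕ → Maybe ℕ
firstFree occ labs []       = nothing
firstFree occ labs (k ∷ ks) =
  if nth false occ k ∧ (nth 0 labs k ≡ᵇ 0) then just k else firstFree occ labs ks

-- pair the ball of label ℓ in column j of row r to row r-1;
-- state = (labels assigned so far in row r-1, maj accumulated)
pairBall : ℕ → ℕ → Row → ℕ × ℕ → List ℕ × ℕ → List ℕ × ℕ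
pairBall n r occ (ℓ , j) (labs , m) with firstFree occ labs (cycFrom n j)
... | nothing = (labs , m)
... | just k  = (setAt labs k ℓ , (if k <ᵇ j then m + (ℓ + 1 ∸ r) else m))

order : ℕ → ℕ → List ℕ → List (ℕ × ℕ)
order n L labs = concatMap (λ ℓ → map (λ j → (ℓ , j))
  (filterᵇ (λ j → nth 0 labs j ≡ᵇ ℓ) (upTo n))) (downTo1 L)

fillLabels : ℕ → Row → List ℕ → List ℕ
fillLabels r occ labs =
  zipWith (λ b l → if b then (if l ≡ᵇ 0 then r else l) else 0) occ labs

-- r = index of the current (labelled) row, rows below given top-first
fmGo : ℕ → ℕ → ℕ → List ℕ → List Row → List ℕ × ℕ
fmGo n L r labs []           = (labs , 0)
fmGo n L r labs (occ ∷ rest) =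
  let st  = foldl (λ s b → pairBall n r occ b s) (replicate n 0 , 0) (order n L labs)
      res = fmGo n L (r ∸ 1) (fillLabels (r ∸ 1) occ (proj₁ st)) rest
  in (proj₁ res , proj₂ st + proj₂ res)

fm : ℕ → MLQ → List ℕ × ℕ
fm n M with reverse M
... | []         = (replicate n 0 , 0)
... | top ∷ rest = fmGo n (length M) (length M) (fillLabels (length M) top (replicate n 0)) rest

type : ℕ → MLQ → List ℕ
type n M = proj₁ (fm n M)

maj : ℕ → MLQ → ℕ
maj n M = proj₂ (fm n M)

-- f_α(X;q,0) = Σ_{M ∈ MLQ[α]} q^{maj M} x^M
fCoeff : ℕ → List ℕ → ℕ → List ℕ → ℕ
fCoeff n α d e = count (λ M → eqℕs (type n M) α ∧ (maj n M ≡ᵇ d) ∧ eqℕs (weight n M) e)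
  (mlqs n (sortC α))

-- A_β(X) = Σ_{M ∈ NMLQ[β]} x^M
atomCoeff : ℕ → List ℕ → List ℕ → ℕ
atomCoeff n β e = count (λ M → eqℕs (type n M) β ∧ (maj n M ≡ᵇ 0) ∧ eqℕs (weight n M) e)
  (mlqs n (sortC β))

Tab : Set
Tab = List (List ℕ)

-- a Young diagram does not see empty rows: drop trailing empty rows
trimT : Tab → Tab
trimT Q = reverse (dropE (reverse Q))
  where
  dropE : Tab → Tab
  dropE []        = []
  dropE ([] ∷ rs) = dropE rs
  dropE rs        = rs

eqTab : Tab → Tab → Bool
eqTab P Q = eqList eqℕs (trimT P) (trimT Q)

seqs : ℕ → ℕ → List (List ℕ)
seqs zero    k = [] ∷ []
seqs (suc m) k = concatMap (λ s → map (_∷ s) (oneTo k)) (seqs m k)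

fillings : List ℕ → ℕ → List Tab
fillings []       k = [] ∷ []
fillings (m ∷ ms) k = concatMap (λ r → map (r ∷_) (fillings ms k)) (seqs m k)

weaklyInc : List ℕ → Bool
weaklyInc (a ∷ b ∷ xs) = (a ≤ᵇ b) ∧ weaklyInc (b ∷ xs)
weaklyInc _            = true

strictAbove : List ℕ → List ℕ → Bool
strictAbove lower upper = and (zipWith _<ᵇ_ lower upper)

colsStrict : Tab → Bool
colsStrict (r ∷ s ∷ rs) = strictAbove r s ∧ colsStrict (s ∷ rs)
colsStrict _            = true

hasContent : List ℕ → Tab → Bool
hasContent ν Q = all (λ a → count (λ x → x ≡ᵇ a) (concat Q) ≡ᵇ nth 0 ν (a ∸ 1))
  (oneTo (length ν))

-- SSYT(μ, ν), French convention (row 1 at the bottom, listed first)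
ssyt : List ℕ → List ℕ → List Tab
ssyt μ ν = filterᵇ (λ Q → all weaklyInc Q ∧ colsStrict Q ∧ hasContent ν Q)
  (fillings μ (length ν))

-- charge (Lascoux–Schützenberger) of a word with partition content.
-- A word is a list of (position , letter).
rightmostBelow : ℕ → ℕ → List (ℕ × ℕ) → Maybe ℕ
rightmostBelow a b = foldl (λ acc pl → if (proj₂ pl ≡ᵇ a) ∧ (proj₁ pl <ᵇ b)
  then just (proj₁ pl) else acc) nothing

rightmost : ℕ → List (ℕ × ℕ) → Maybe ℕ
rightmost a = foldl (λ acc pl → if proj₂ pl ≡ᵇ a then just (proj₁ pl) else acc) nothing

-- cyclic leftward scan: letter a, to the left of position prev, else wrap around
pick : ℕ → ℕ → List (ℕ × ℕ) → Maybe ℕ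
pick a prev w with rightmostBelow a prev w
... | just p  = just p
... | nothing = rightmost a w

-- select letters a, a+1, …; index increases when a letter lies to the right
-- of the previous one; returns (selected positions, sum of indices)
walk : ℕ → ℕ → ℕ → ℕ → List (ℕ × ℕ) → List ℕ × ℕ
walk zero    a prev idx w = ([] , 0)
walk (suc f) a prev idx w with pick a prev w
... | nothing = ([] , 0)
... | just p  =
  let idx' = if prev <ᵇ p then suc idx else idx
      rest = walk f (suc a) p idx' w
  in (p ∷ proj₁ rest , idx' + proj₂ rest)

-- extract the first standard subword (starting from the rightmost 1)
extract : List (ℕ × ℕ) → List ℕ × ℕ
extract w with rightmost 1 w
... | nothing = ([] , 0)
... | just p  = let r = walk (maxL (map proj₂ w) ∸ 1) 2 p 0 w in (p ∷ proj₁ r , proj₂ r)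

memb : ℕ → List ℕ → Bool
memb x = foldr (λ y b → (x ≡ᵇ y) ∨ b) false

chargeGo : ℕ → List (ℕ × ℕ) → ℕ
chargeGo zero    w = 0
chargeGo (suc f) w =
  let s = extract w
  in proj₂ s + chargeGo f (filterᵇ (λ pl → not (memb (proj₁ pl) (proj₁ s))) w)

chargeWord : List ℕ → ℕ
chargeWord u = chargeGo (length u) (zip (upTo (length u)) u)

-- reading word (French): rows from top to bottom, each left to right
charge : Tab → ℕ
charge Q = chargeWord (concat (reverse Q))

-- column word: columns left to right, each top to bottom; letters are row
-- indices, remembered together with their column: (row , column)
colWord : ℕ → MLQ → List (ℕ × ℕ)
colWord n N = concatMap (λ j → concatMap (λ r →
    if nth false (nth [] N (r ∸ 1)) j then (r , j) ∷ [] else [])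
  (downTo1 (length N))) (upTo n)

-- bracketing w.r.t. i: i = ")", i+1 = "("; stack of unmatched "(" columns
-- (most recent first)
bracket : ℕ → List (ℕ × ℕ) → List ℕ → List ℕ
bracket i []             st = st
bracket i ((r , c) ∷ ws) st =
  if r ≡ᵇ suc i then bracket i ws (c ∷ st)
  else if r ≡ᵇ i then bracket i ws (pop st)
  else bracket i ws st
  where
  pop : List ℕ → List ℕ
  pop []       = []
  pop (_ ∷ xs) = xs

lastM : List ℕ → Maybe ℕ
lastM []       = nothing
lastM (x ∷ []) = just x
lastM (_ ∷ xs) = lastM xs

-- e↓_i : move the leftmost unmatched i+1 from row i+1 to row i
eDown : ℕ → ℕ → MLQ → MLQ
eDown n i N with lastM (bracket i (colWord n N) [])
... | nothing = N
... | just c  = setAt (setAt N i (setAt (nth [] N i) c false))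
                      (i ∸ 1) (setAt (nth [] N (i ∸ 1)) c true)

-- e↓⋆_i : each nontrivial step removes a ball from row i+1 (≤ n balls),
-- and a trivial step is a fixed point, so n iterations suffice
eDownStar : ℕ → ℕ → MLQ → MLQ
eDownStar n i = iter n (eDown n i)

rhoStep : ℕ → MLQ × Tab → ℕ → MLQ × Tab
rhoStep n (M , Q) i =
  let M' = foldl (λ N k → eDownStar n k N) M (downTo1 i)
      Q' = map (λ j → nth [] Q j ++ replicate (card (nth [] M' j) ∸ card (nth [] M j)) (suc i))
               (upTo i)
           ++ (replicate (card (nth [] M' i)) (suc i) ∷ [])
  in (M' , Q')

rho : ℕ → MLQ → MLQ × Tab
rho n M = foldl (rhoStep n) (M , (replicate (card (nth [] M 0)) 1 ∷ []))
  (oneTo (length M ∸ 1))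

-- ρ⁻¹(M_β, Q) for M ∈ MLQ_λ (search; ρ is a bijection, so unique if present)
rhoInv : ℕ → List ℕ → List ℕ → Tab → Maybe MLQ
rhoInv n λp β Q = first (mlqs n λp)
  where
  first : List MLQ → Maybe MLQ
  first []       = nothing
  first (M ∷ Ms) = if eqMLQ (proj₁ (rho n M)) (mkM (maxL λp) β) ∧ eqTab (proj₂ (rho n M)) Q
                   then just M else first Ms

invTypeIs : ℕ → List ℕ → List ℕ → Tab → Bool
invTypeIs n α β Q with rhoInv n (sortC α) β Q
... | nothing = false
... | just M  = eqℕs (type n M) α

KCoeff : ℕ → List ℕ → List ℕ → ℕ → ℕ
KCoeff n α β d = count (λ Q → invTypeIs n α β Q ∧ (charge Q ≡ᵇ d))
  (ssyt (conj (sortC β)) (conj (sortC α)))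

rhsCoeff : ℕ → List ℕ → ℕ → List ℕ → ℕ
rhsCoeff n α d e = sum (map (λ β → KCoeff n α β d * atomCoeff n β e) (compsBelow n α))

{-# OPTIONS --safe #-}
module Submission where

-- The balls of two adjacent rows can be collapsed (E) or interchanged by the queue (the combinatorial R).
-- Both operators commute with the crystal operators f_j that act on two adjacent columns: a finite check
-- on a 2×2 block together with a carrier, of which only the values 0, 1 and ≥ 2 matter. Every matrix can be
-- raised to a column-highest-weight one, and there a collapsed matrix is determined by its weight. Hence all
-- ways of collapsing agree, and whatever is invariant under the f_j depends on the recording tableau only.
--
-- Bijectivity of ρ: E can be undone once the sizes of the rows are known, and these are recorded by Q.
-- Conversely Q is recorded by the matrix of its reading word, and raising this matrix and then following
-- the path of N downwards produces the preimage of (N , Q).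
--
-- Types: the set S_k of sites with label ≥ k is the bottom row after row k has been moved down by R. Undoing
-- the collapse of the bottom row keeps, level by level, the leftmost second-class customers of a queue, and
-- queues serve second-class customers in order of arrival; so S_k depends only on the labels of N and on
-- sizes recorded by Q. Therefore type M is a function of type N and Q, and N may be replaced by M_β.
--
-- Statistics: maj M counts the wraps of all queues involved, hence it is a function of Q and can be computed
-- on the matrix of the reading word. There charge counts the wraps of the same queues run upwards, and both
-- the downward and the upward greedy pairing minimise the total winding.

open import Defs
open import Data.Nat using (ℕ; zero; suc; pred; _+_; _*_; _∸_; _⊔_; _⊓_; _≤_; _<_; z≤n; s≤s; s≤s⁻¹; _≤ᵇ_; _<ᵇ_; _≡ᵇ_; _≟_; _≤?_; _<?_)
open import Data.Nat.Properties
open import Data.Bool using (Bool; true; false; if_then_else_; _∧_; _∨_; not; T)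
open import Data.Bool.Properties using (∧-zeroʳ; ∧-identityʳ; ∨-zeroʳ; ∨-identityʳ)
open import Data.List using (List; []; _∷_; length; _++_; _ʳ++_; map; concatMap; filterᵇ; upTo; applyUpTo; reverse; replicate; foldl; zipWith; take; drop; zip; concat)
open import Data.List.Properties using (∷-injectiveˡ; ∷-injectiveʳ)
import Data.List.Properties as LP
import Data.Vec.Properties as VP
open import Data.Vec as Vec using (Vec; []; _∷_; toList)
open import Data.Product using (Σ; ∃; _×_; _,_; proj₁; proj₂)
open import Data.Sum using (_⊎_; inj₁; inj₂; [_,_]′)
open import Data.Maybe using (Maybe; just; nothing)
open import Data.Empty using (⊥; ⊥-elim)
open import Data.List.Relation.Unary.All as All using (All; []; _∷_)
import Data.List.Relation.Unary.All.Properties as AllP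
open import Data.List.Membership.Propositional using (_∈_)
open import Data.List.Membership.Propositional.Properties using (∈-++⁺ˡ; ∈-++⁺ʳ; ∈-++⁻; ∈-map⁺; ∈-map⁻; ∈-∃++; ∈-upTo⁺; ∈-upTo⁻)
open import Data.List.Relation.Unary.Any using (here; there)
open import Data.List.Relation.Unary.Unique.Propositional using (Unique; []; _∷_)
import Data.List.Relation.Unary.Unique.Propositional.Properties as UP
open import Data.Nat.ListAction using (sum)
open import Data.Bool.ListAction using (all)
open import Data.Unit using (⊤; tt)
open import Function using (case_of_)
open import Relation.Binary.Definitions using (tri<; tri≈; tri>)
open import Relation.Nullary using (Dec; yes; no)
open import Relation.Binary.PropositionalEquality using (_≡_; _≢_; refl; sym; trans; cong; cong₂; subst; subst₂; module ≡-Reasoning)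

-- Commutation with f_j stands in for the braid relations of E and the Yang-Baxter equation of R: an
-- identity between composites is tested on column-highest-weight matrices, and determinism of
-- `Step` carries it down. In this way a row can be moved to the bottom by R before collapsing
-- without changing the collapse, which is what connects labels, defined by R, with ρ, defined by E.
-- Labels enter only through threshold sets, one queue for each level, since the order in which
-- balls of equal label are processed is invisible there.
--
-- Three mismatches shape the statements. The matrix of a reading word has as many columns as the
-- tableau has cells, so it is compared with an MLQ only after both have been given empty columns.
-- The map ρ keeps the number of rows, while an MLQ of the smaller shape has fewer, so empty top
-- rows are added and removed. Charge scans words to the left and letters upwards, the labelling
-- scans columns to the right and rows downwards; the sets chosen in between differ, so rows are
-- reversed and only the totals are compared.

Mat : ℕ → Set
Mat n = List (Vec Bool n)

-- Two rows are matched from the right: the carrier counts the balls of the lower row b that are still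
-- unmatched, and a ball of the upper row s that meets the carrier 0 falls into the lower row.

cv : Bool → Bool → ℕ → ℕ
cv true  true  v = v
cv true  false v = suc v
cv false true  v = pred v
cv false false v = v

lw : Bool → Bool → ℕ → Bool
lw true  _     _       = true
lw false false _       = false
lw false true  zero    = true
lw false true  (suc _) = false

ub : Bool → Bool → ℕ → Bool
ub true  s     _       = s
ub false false _       = false
ub false true  zero    = false
ub false true  (suc _) = true

car : ∀ {n} → ℕ → Vec Bool n → Vec Bool n → ℕ
car v []       []       = v
car v (b ∷ bs) (s ∷ ss) = cv b s (car v bs ss)

low : ∀ {n} → ℕ → Vec Bool n → Vec Bool n → Vec Bool n
low v []       []       = []
low v (b ∷ bs) (s ∷ ss) = lw b s (car v bs ss) ∷ low v bs ss

upp : ∀ {n} → ℕ → Vec Bool n → Vec Bool n → Vec Bool n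
upp v []       []       = []
upp v (b ∷ bs) (s ∷ ss) = ub b s (car v bs ss) ∷ upp v bs ss

-- The Ferrari–Martin pairing of s into b as a queue with arrivals s and services b: dep is the set of
-- departures, and (dep , res) is the combinatorial R-matrix when the queue starts at its stationary
-- length wraps b s, which is the number of wrapping pairings.

cq : Bool → Bool → ℕ → ℕ
cq true  true  u = u
cq true  false u = pred u
cq false true  u = suc u
cq false false u = u

dp : Bool → Bool → ℕ → Bool
dp false _     _       = false
dp true  true  _       = true
dp true  false zero    = false
dp true  false (suc _) = true

rs : Bool → Bool → ℕ → Bool
rs false s     _       = s
rs true  true  _       = true
rs true  false zero    = true
rs true  false (suc _) = false

que : ∀ {n} → ℕ → Vec Bool n → Vec Bool n → ℕ
que u []       []       = u
que u (b ∷ bs) (s ∷ ss) = que (cq b s u) bs ss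

dep : ∀ {n} → ℕ → Vec Bool n → Vec Bool n → Vec Bool n
dep u []       []       = []
dep u (b ∷ bs) (s ∷ ss) = dp b s u ∷ dep (cq b s u) bs ss

res : ∀ {n} → ℕ → Vec Bool n → Vec Bool n → Vec Bool n
res u []       []       = []
res u (b ∷ bs) (s ∷ ss) = rs b s u ∷ res (cq b s u) bs ss

wraps : ∀ {n} → Vec Bool n → Vec Bool n → ℕ
wraps b s = que 0 b s

-- Columns j and j+1 are read from the bottom row to the top row; ⊕ is a ball in column j only, ⊖ a ball
-- in column j+1 only, and a ⊕ cancels against a later ⊖. Step j is the crystal operator f_j.

data Sgn : Set where
  ⊕ ⊙ ⊖ : Sgn

sg : Bool → Bool → Sgn
sg true  true  = ⊙
sg true  false = ⊕
sg false true  = ⊖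
sg false false = ⊙

sgn : ∀ {n} → ℕ → Vec Bool n → Sgn
sgn zero    (a ∷ b ∷ _) = sg a b
sgn (suc j) (_ ∷ r)     = sgn j r
sgn zero    (_ ∷ [])    = ⊙
sgn _       []          = ⊙

sw : ∀ {n} → ℕ → Vec Bool n → Vec Bool n
sw zero    (a ∷ b ∷ r) = b ∷ a ∷ r
sw (suc j) (a ∷ r)     = a ∷ sw j r
sw zero    (a ∷ [])    = a ∷ []
sw _       []          = []

εs : Sgn → ℕ → ℕ
εs ⊕ k = pred k
εs ⊙ k = k
εs ⊖ k = suc k

φs : Sgn → ℕ → ℕ
φs ⊕ zero    = 1
φs ⊕ (suc _) = 0
φs ⊙ _       = 0
φs ⊖ _       = 0

eps : ∀ {n} → ℕ → Mat n → ℕ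
eps j []      = 0
eps j (r ∷ M) = εs (sgn j r) (eps j M)

phi : ∀ {n} → ℕ → Mat n → ℕ
phi j []      = 0
phi j (r ∷ M) = φs (sgn j r) (eps j M) + phi j M

data Step {n} (j : ℕ) : Mat n → Mat n → Set where
  act  : ∀ {r M} → sgn j r ≡ ⊕ → eps j M ≡ 0 → Step j (r ∷ M) (sw j r ∷ M)
  skip : ∀ {r M M'} → φs (sgn j r) (eps j M) ≡ 0 → Step j M M' → Step j (r ∷ M) (r ∷ M')

-- Existence and determinism of crystal steps

sgn-sw : ∀ {n} j (r : Vec Bool n) → sgn j r ≡ ⊕ → sgn j (sw j r) ≡ ⊖
sgn-sw zero    (true ∷ false ∷ r) _ = refl
sgn-sw zero    (true ∷ true ∷ r)  ()
sgn-sw zero    (false ∷ true ∷ r) ()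
sgn-sw zero    (false ∷ false ∷ r) ()
sgn-sw zero    (_ ∷ [])           ()
sgn-sw (suc j) (_ ∷ r)            p = sgn-sw j r p
sgn-sw zero    []                 ()

sgn-sw′ : ∀ {n} j (r : Vec Bool n) → sgn j r ≡ ⊖ → sgn j (sw j r) ≡ ⊕
sgn-sw′ zero    (false ∷ true ∷ r) _ = refl
sgn-sw′ zero    (true ∷ true ∷ r)  ()
sgn-sw′ zero    (true ∷ false ∷ r) ()
sgn-sw′ zero    (false ∷ false ∷ r) ()
sgn-sw′ zero    (_ ∷ [])           ()
sgn-sw′ (suc j) (_ ∷ r)            p = sgn-sw′ j r p
sgn-sw′ zero    []                 ()

sw-sw : ∀ {n} j (r : Vec Bool n) → sw j (sw j r) ≡ r
sw-sw zero    (a ∷ b ∷ r) = refl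
sw-sw (suc j) (a ∷ r)     = cong (a ∷_) (sw-sw j r)
sw-sw zero    (a ∷ [])    = refl
sw-sw zero    []          = refl
sw-sw (suc j) []          = refl

step-eps : ∀ {n j} {M M' : Mat n} → Step j M M' → eps j M' ≡ suc (eps j M)
step-eps {j = j} (act {r} {M} p e) rewrite sgn-sw j r p | p | e = refl
step-eps {j = j} (skip {r} {M} p st) rewrite step-eps st with sgn j r | eps j M
... | ⊕ | suc k = refl
... | ⊙ | k = refl
... | ⊖ | k = refl

step-det : ∀ {n j} {M A B : Mat n} → Step j M A → Step j M B → A ≡ B
step-det (act _ _) (act _ _) = refl
step-det (act p e) (skip q _) rewrite p | e = case q where
  case : 1 ≡ 0 → _
  case ()
step-det (skip q _) (act p e) rewrite p | e = case q where
  case : 1 ≡ 0 → _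
  case ()
step-det (skip _ s) (skip _ t) = cong (_ ∷_) (step-det s t)

-- An `act` step has ε equal to 0 in the rows above, while a `skip` step has just raised it there,
-- so the two cannot share a target. The targets are linked by an equation because `sw j r` is not a
-- pattern.
step-codet′ : ∀ {n j} {A B M M' : Mat n} → Step j A M → Step j B M' → M ≡ M' → A ≡ B
step-codet′ {j = j} (act {r} _ _) (act {r'} _ _) e =
  cong₂ _∷_ (trans (sym (sw-sw j r)) (trans (cong (sw j) (∷-injectiveˡ e)) (sw-sw j r'))) (∷-injectiveʳ e)
step-codet′ (act _ e) (skip _ t) refl with trans (sym e) (step-eps t)
... | ()
step-codet′ (skip _ t) (act _ e) refl with trans (sym e) (step-eps t)
... | ()
step-codet′ (skip _ s) (skip _ t) refl = cong (_ ∷_) (step-codet′ s t refl)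

step-codet : ∀ {n j} {A B M : Mat n} → Step j A M → Step j B M → A ≡ B
step-codet s t = step-codet′ s t refl

step-down : ∀ {n} j (M : Mat n) → phi j M ≢ 0 → ∃ λ M' → Step j M M'
step-down j [] p = ⊥-elim (p refl)
step-down j (r ∷ M) p with sgn j r in eq | eps j M in eqe
... | ⊕ | zero = _ , act eq eqe
... | ⊕ | suc k = let (M' , st) = step-down j M p in r ∷ M' , skip (cong₂ φs eq eqe) st
... | ⊙ | k = let (M' , st) = step-down j M p in r ∷ M' , skip (cong₂ φs eq eqe) st
... | ⊖ | k = let (M' , st) = step-down j M p in r ∷ M' , skip (cong₂ φs eq eqe) st

step-phi : ∀ {n j} {M M' : Mat n} → Step j M M' → phi j M ≢ 0
step-phi {j = j} (act {r} {M} p e) q rewrite p | e = case q where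
  case : suc (phi j M) ≡ 0 → ⊥
  case ()
step-phi {j = j} (skip {r} {M} p st) q rewrite p = step-phi st q

-- After cancellation the signs read ⊖...⊖⊕...⊕ from the bottom. Thus f_j turns the lowest free ⊕
-- into the highest free ⊖, and the recursion looks for the latter in order to undo it.
step-up : ∀ {n} j (M : Mat n) → eps j M ≢ 0 → ∃ λ M' → Step j M' M
step-up j [] p = ⊥-elim (p refl)
step-up j (r ∷ M) p with sgn j r in eq | eps j M in eqe
... | ⊕ | zero = ⊥-elim (p refl)
... | ⊕ | suc zero = ⊥-elim (p refl)
... | ⊕ | suc (suc k) =
  let (M' , st) = step-up j M (λ z → case (trans (sym eqe) z))
  in r ∷ M' , skip (cong₂ φs eq (suc-injective (trans (sym (step-eps st)) eqe))) st
  where case : suc (suc k) ≡ 0 → ⊥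
        case ()
... | ⊙ | k = let (M' , st) = step-up j M (λ z → p (trans (sym eqe) z)) in r ∷ M' , skip (cong (λ x → φs x (eps j M')) eq) st
... | ⊖ | zero = sw j r ∷ M , subst (λ x → Step j (sw j r ∷ M) (x ∷ M)) (sw-sw j r) (act (sgn-sw′ j r eq) eqe)
... | ⊖ | suc k =
  let (M' , st) = step-up j M (λ z → case (trans (sym eqe) z))
  in r ∷ M' , skip (cong (λ x → φs x (eps j M')) eq) st
  where case : suc k ≡ 0 → ⊥
        case ()

-- The numbers ε and φ of a block of two rows after cancellation. By `ε₂` and `φ₂`, the tensor
-- product rule, they and the ε of the rows above fix the contribution of the block to `eps` and
-- `phi`.
sig : Sgn → Sgn → ℕ × ℕ
sig ⊕ ⊕ = 0 , 2
sig ⊕ ⊙ = 0 , 1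
sig ⊕ ⊖ = 0 , 0
sig ⊙ ⊕ = 0 , 1
sig ⊙ ⊙ = 0 , 0
sig ⊙ ⊖ = 1 , 0
sig ⊖ ⊕ = 1 , 1
sig ⊖ ⊙ = 1 , 0
sig ⊖ ⊖ = 2 , 0

onP : {A : Set} → Sgn → A → A → A
onP ⊕ a b = a
onP ⊙ a b = b
onP ⊖ a b = b

-- Lower and upper row after f_j has acted inside the block; a ⊕ of the lower row takes precedence.
-- The formulas describe the action only for a block with positive φ, which is the hypothesis of
-- `op-fire`.
f₁ : ∀ {n} → ℕ → Vec Bool n → Vec Bool n
f₁ j b = onP (sgn j b) (sw j b) b

f₂ : ∀ {n} → ℕ → Vec Bool n → Vec Bool n → Vec Bool n
f₂ j b s = onP (sgn j b) s (sw j s)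

ε₂ : ∀ x y k → εs x (εs y k) ≡ proj₁ (sig x y) + (k ∸ proj₂ (sig x y))
ε₂ ⊕ ⊕ zero = refl
ε₂ ⊕ ⊕ (suc zero) = refl
ε₂ ⊕ ⊕ (suc (suc k)) = refl
ε₂ ⊕ ⊙ zero = refl
ε₂ ⊕ ⊙ (suc k) = refl
ε₂ ⊕ ⊖ k = refl
ε₂ ⊙ ⊕ zero = refl
ε₂ ⊙ ⊕ (suc k) = refl
ε₂ ⊙ ⊙ k = refl
ε₂ ⊙ ⊖ k = refl
ε₂ ⊖ ⊕ zero = refl
ε₂ ⊖ ⊕ (suc k) = refl
ε₂ ⊖ ⊙ k = refl
ε₂ ⊖ ⊖ k = refl

φ₂ : ∀ x y k → φs x (εs y k) + φs y k ≡ proj₂ (sig x y) ∸ k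
φ₂ ⊕ ⊕ zero = refl
φ₂ ⊕ ⊕ (suc zero) = refl
φ₂ ⊕ ⊕ (suc (suc k)) = sym (0∸n≡0 k)
φ₂ ⊕ ⊙ zero = refl
φ₂ ⊕ ⊙ (suc k) = sym (0∸n≡0 k)
φ₂ ⊕ ⊖ zero = refl
φ₂ ⊕ ⊖ (suc k) = refl
φ₂ ⊙ ⊕ zero = refl
φ₂ ⊙ ⊕ (suc k) = sym (0∸n≡0 k)
φ₂ ⊙ ⊙ k = sym (0∸n≡0 k)
φ₂ ⊙ ⊖ k = sym (0∸n≡0 k)
φ₂ ⊖ ⊕ zero = refl
φ₂ ⊖ ⊕ (suc k) = sym (0∸n≡0 k)
φ₂ ⊖ ⊙ k = sym (0∸n≡0 k)
φ₂ ⊖ ⊖ k = sym (0∸n≡0 k)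

-- Local conditions under which a two-row operator commutes with f_j whatever rows lie above:
-- `op-sig` keeps the decision whether f_j acts inside the block, and `op-fire` compares the results
-- when it does.
record Op {n} (F G : Vec Bool n → Vec Bool n → Vec Bool n) : Set where
  field
    op-sig  : ∀ j b s → sig (sgn j (F b s)) (sgn j (G b s)) ≡ sig (sgn j b) (sgn j s)
    op-fire : ∀ j b s → 0 < proj₂ (sig (sgn j b) (sgn j s)) →
              F (f₁ j b) (f₂ j b s) ≡ f₁ j (F b s) × G (f₁ j b) (f₂ j b s) ≡ f₂ j (F b s) (G b s)

twoRow : ∀ {n} → (F G : Vec Bool n → Vec Bool n → Vec Bool n) → Mat n → Mat n
twoRow F G (b ∷ s ∷ M) = F b s ∷ G b s ∷ M
twoRow F G M           = M

-- f_j acts inside the block exactly when the φ of the block exceeds the ε of the rows above. This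
-- test depends on `sig` alone, so it has the same outcome before and after an operator satisfying
-- `Op`.
step₂-elim : ∀ {n j} {b s : Vec Bool n} {M X} → Step j (b ∷ s ∷ M) X →
  (proj₂ (sig (sgn j b) (sgn j s)) ∸ eps j M ≢ 0 × X ≡ f₁ j b ∷ f₂ j b s ∷ M) ⊎
  (proj₂ (sig (sgn j b) (sgn j s)) ∸ eps j M ≡ 0 × ∃ λ M' → Step j M M' × X ≡ b ∷ s ∷ M')
step₂-elim {j = j} {b} {s} {M} (act p e) = inj₁ (nz , eq)
  where
  nz : proj₂ (sig (sgn j b) (sgn j s)) ∸ eps j M ≢ 0
  nz z with trans (sym z) (trans (sym (φ₂ (sgn j b) (sgn j s) (eps j M))) (cong (_+ φs (sgn j s) (eps j M)) (cong₂ φs p e)))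
  ... | ()
  eq : _≡_ {A = Mat _} (sw j b ∷ s ∷ M) (f₁ j b ∷ f₂ j b s ∷ M)
  eq rewrite p = refl
step₂-elim {j = j} {b} {s} {M} (skip q (act p e)) = inj₁ (nz , eq)
  where
  nz : proj₂ (sig (sgn j b) (sgn j s)) ∸ eps j M ≢ 0
  nz z with trans (sym z) (trans (sym (φ₂ (sgn j b) (sgn j s) (eps j M))) (cong₂ _+_ q (cong₂ φs p e)))
  ... | ()
  eq : _≡_ {A = Mat _} (b ∷ sw j s ∷ M) (f₁ j b ∷ f₂ j b s ∷ M)
  eq = aux (sgn j b) q
    where
    aux : ∀ x → φs x (eps j (s ∷ M)) ≡ 0 → _≡_ {A = Mat _} (b ∷ sw j s ∷ M) (onP x (sw j b) b ∷ onP x s (sw j s) ∷ M)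
    aux ⊙ _ = refl
    aux ⊖ _ = refl
    aux ⊕ h with trans (sym h) (cong (φs ⊕) (cong₂ εs p e))
    ... | ()
step₂-elim {j = j} {b} {s} {M} (skip q (skip p st)) =
  inj₂ (trans (sym (φ₂ (sgn j b) (sgn j s) (eps j M))) (cong₂ _+_ q p) , _ , st , refl)

step₂-here : ∀ {n} j (b s : Vec Bool n) M → proj₂ (sig (sgn j b) (sgn j s)) ∸ eps j M ≢ 0 →
  Step j (b ∷ s ∷ M) (f₁ j b ∷ f₂ j b s ∷ M)
step₂-here j b s M nz with sgn j b in eb | sgn j s in es | eps j M in ee
... | ⊕ | ⊕ | zero = act eb (trans (cong₂ εs es ee) refl)
... | ⊕ | ⊕ | suc zero = act eb (trans (cong₂ εs es ee) refl)
... | ⊕ | ⊕ | suc (suc k) = ⊥-elim (nz (0∸n≡0 k))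
... | ⊕ | ⊙ | zero = act eb (trans (cong₂ εs es ee) refl)
... | ⊕ | ⊙ | suc k = ⊥-elim (nz (0∸n≡0 k))
... | ⊕ | ⊖ | k = ⊥-elim (nz (0∸n≡0 k))
... | ⊙ | ⊕ | zero = skip (cong₂ φs eb (cong₂ εs es ee)) (act es ee)
... | ⊙ | ⊕ | suc k = ⊥-elim (nz (0∸n≡0 k))
... | ⊙ | ⊙ | k = ⊥-elim (nz (0∸n≡0 k))
... | ⊙ | ⊖ | k = ⊥-elim (nz (0∸n≡0 k))
... | ⊖ | ⊕ | zero = skip (cong₂ φs eb (cong₂ εs es ee)) (act es ee)
... | ⊖ | ⊕ | suc k = ⊥-elim (nz (0∸n≡0 k))
... | ⊖ | ⊙ | k = ⊥-elim (nz (0∸n≡0 k))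
... | ⊖ | ⊖ | k = ⊥-elim (nz (0∸n≡0 k))

step₂-there : ∀ {n j} {b s : Vec Bool n} {M M'} → proj₂ (sig (sgn j b) (sgn j s)) ∸ eps j M ≡ 0 →
  Step j M M' → Step j (b ∷ s ∷ M) (b ∷ s ∷ M')
step₂-there {j = j} {b} {s} {M} z st =
  skip (m+n≡0⇒m≡0 _ q) (skip (m+n≡0⇒n≡0 (φs (sgn j b) (eps j (s ∷ M))) q) st)
  where
  q : φs (sgn j b) (eps j (s ∷ M)) + φs (sgn j s) (eps j M) ≡ 0
  q = trans (φ₂ (sgn j b) (sgn j s) (eps j M)) z

record Morph {n} (g : Mat n → Mat n) : Set where
  field
    m-eps  : ∀ j M → eps j (g M) ≡ eps j M
    m-phi  : ∀ j M → phi j (g M) ≡ phi j M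
    m-step : ∀ {j M M'} → Step j M M' → Step j (g M) (g M')

open Op
open Morph

twoRow-morph : ∀ {n} {F G : Vec Bool n → Vec Bool n → Vec Bool n} → Op F G → Morph (twoRow F G)
twoRow-morph {n} {F} {G} o = record { m-eps = me ; m-phi = mp ; m-step = ms }
  where
  me : ∀ j M → eps j (twoRow F G M) ≡ eps j M
  me j [] = refl
  me j (_ ∷ []) = refl
  me j (b ∷ s ∷ M) = trans (ε₂ (sgn j (F b s)) (sgn j (G b s)) (eps j M))
    (trans (cong (λ z → proj₁ z + (eps j M ∸ proj₂ z)) (op-sig o j b s)) (sym (ε₂ (sgn j b) (sgn j s) (eps j M))))
  mp : ∀ j M → phi j (twoRow F G M) ≡ phi j M
  mp j [] = refl
  mp j (_ ∷ []) = refl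
  mp j (b ∷ s ∷ M) = trans (l (F b s) (G b s)) (trans (cong (λ z → proj₂ z ∸ eps j M + phi j M) (op-sig o j b s)) (sym (l b s)))
    where
    l : ∀ b s → phi j (b ∷ s ∷ M) ≡ proj₂ (sig (sgn j b) (sgn j s)) ∸ eps j M + phi j M
    l b s = trans (sym (+-assoc (φs (sgn j b) (eps j (s ∷ M))) _ _)) (cong (_+ phi j M) (φ₂ (sgn j b) (sgn j s) (eps j M)))
  ms : ∀ {j M M'} → Step j M M' → Step j (twoRow F G M) (twoRow F G M')
  ms {M = _ ∷ []} (act p e) = act p e
  ms {M = _ ∷ []} (skip q ())
  ms {j} {M = b ∷ s ∷ M} {M'} st with step₂-elim st
  ... | inj₁ (nz , refl) = subst (Step j (F b s ∷ G b s ∷ M)) (cong₂ (λ x y → x ∷ y ∷ M) (sym (proj₁ fr)) (sym (proj₂ fr)))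
        (step₂-here j (F b s) (G b s) M (λ z → nz (trans (cong (λ z → proj₂ z ∸ eps j M) (sym (op-sig o j b s))) z)))
    where
    fr = op-fire o j b s (n≢0⇒n>0 (λ z → nz (trans (cong (_∸ eps j M) z) (0∸n≡0 (eps j M)))))
  ... | inj₂ (z , M1 , st1 , refl) = step₂-there (trans (cong (λ z → proj₂ z ∸ eps j M) (op-sig o j b s)) z) st1

id-morph : ∀ {n} → Morph {n} (λ M → M)
id-morph = record { m-eps = λ _ _ → refl ; m-phi = λ _ _ → refl ; m-step = λ s → s }

∘-morph : ∀ {n} {g h : Mat n → Mat n} → Morph g → Morph h → Morph (λ M → g (h M))
∘-morph {h = h} mg mh = record
  { m-eps = λ j M → trans (m-eps mg j (h M)) (m-eps mh j M)
  ; m-phi = λ j M → trans (m-phi mg j (h M)) (m-phi mh j M)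
  ; m-step = λ s → m-step mg (m-step mh s) }

under : ∀ {n} → (Mat n → Mat n) → Mat n → Mat n
under g []      = []
under g (r ∷ M) = r ∷ g M

under-morph : ∀ {n} {g : Mat n → Mat n} → Morph g → Morph (under g)
under-morph {n} {g} mg = record { m-eps = me ; m-phi = mp ; m-step = ms }
  where
  me : ∀ j M → eps j (under g M) ≡ eps j M
  me j [] = refl
  me j (r ∷ M) = cong (εs (sgn j r)) (m-eps mg j M)
  mp : ∀ j M → phi j (under g M) ≡ phi j M
  mp j [] = refl
  mp j (r ∷ M) = cong₂ _+_ (cong (φs (sgn j r)) (m-eps mg j M)) (m-phi mg j M)
  ms : ∀ {j M M'} → Step j M M' → Step j (under g M) (under g M')
  ms {j} (act {r} {M} p e) = act p (trans (m-eps mg j M) e)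
  ms {j} (skip {r} {M} q st) = skip (trans (cong (φs (sgn j r)) (m-eps mg j M)) q) (m-step mg st)

-- Commutation of E and R with the column operators

f₁-∷ : ∀ {n} j x (b : Vec Bool n) → f₁ (suc j) (x ∷ b) ≡ x ∷ f₁ j b
f₁-∷ j x b with sgn j b
... | ⊕ = refl
... | ⊙ = refl
... | ⊖ = refl

f₂-∷ : ∀ {n} j x y (b s : Vec Bool n) → f₂ (suc j) (x ∷ b) (y ∷ s) ≡ y ∷ f₂ j b s
f₂-∷ j x y b s with sgn j b
... | ⊕ = refl
... | ⊙ = refl
... | ⊖ = refl

sig-E : ∀ b₁ b₂ s₁ s₂ v → sig (sg (lw b₁ s₁ (cv b₂ s₂ v)) (lw b₂ s₂ v)) (sg (ub b₁ s₁ (cv b₂ s₂ v)) (ub b₂ s₂ v)) ≡ sig (sg b₁ b₂) (sg s₁ s₂)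
sig-E true  true  true  true  v = refl
sig-E true  true  true  false v = refl
sig-E true  true  false true  v = refl
sig-E true  true  false false v = refl
sig-E true  false true  true  zero = refl
sig-E true  false true  true  (suc v) = refl
sig-E true  false true  false v = refl
sig-E true  false false true  zero = refl
sig-E true  false false true  (suc v) = refl
sig-E true  false false false v = refl
sig-E false true  true  true  zero = refl
sig-E false true  true  true  (suc v) = refl
sig-E false true  true  false v = refl
sig-E false true  false true  v = refl
sig-E false true  false false v = refl
sig-E false false true  true  zero = refl
sig-E false false true  true  (suc zero) = refl
sig-E false false true  true  (suc (suc v)) = refl
sig-E false false true  false zero = refl
sig-E false false true  false (suc v) = refl
sig-E false false false true  zero = refl
sig-E false false false true  (suc v) = refl
sig-E false false false false v = refl

sig-R : ∀ b₁ b₂ s₁ s₂ u → sig (sg (dp b₁ s₁ u) (dp b₂ s₂ (cq b₁ s₁ u))) (sg (rs b₁ s₁ u) (rs b₂ s₂ (cq b₁ s₁ u))) ≡ sig (sg b₁ b₂) (sg s₁ s₂)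
sig-R true  true  true  true  v = refl
sig-R true  true  true  false zero = refl
sig-R true  true  true  false (suc v) = refl
sig-R true  true  false true  zero = refl
sig-R true  true  false true  (suc v) = refl
sig-R true  true  false false zero = refl
sig-R true  true  false false (suc zero) = refl
sig-R true  true  false false (suc (suc v)) = refl
sig-R true  false true  true  v = refl
sig-R true  false true  false v = refl
sig-R true  false false true  zero = refl
sig-R true  false false true  (suc v) = refl
sig-R true  false false false zero = refl
sig-R true  false false false (suc v) = refl
sig-R false true  true  true  v = refl
sig-R false true  true  false v = refl
sig-R false true  false true  v = refl
sig-R false true  false false zero = refl
sig-R false true  false false (suc v) = refl
sig-R false false true  true  v = refl
sig-R false false true  false v = refl
sig-R false false false true  v = refl
sig-R false false false false v = refl

-- The third equation, an unchanged carrier beyond the two columns, lets the recursion leave all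
-- columns further left as they are. Each column changes the carrier by at most one, so over two
-- columns all values from 2 on behave alike.
fire-E : ∀ {n} v j (b s : Vec Bool n) → 0 < proj₂ (sig (sgn j b) (sgn j s)) →
  low v (f₁ j b) (f₂ j b s) ≡ f₁ j (low v b s) × upp v (f₁ j b) (f₂ j b s) ≡ f₂ j (low v b s) (upp v b s) ×
  car v (f₁ j b) (f₂ j b s) ≡ car v b s
fire-E v zero (true ∷ true ∷ b) (true ∷ true ∷ s) ()
fire-E v zero (true ∷ true ∷ b) (true ∷ false ∷ s) _ with car v b s
... | zero = refl , refl , refl
... | suc zero = refl , refl , refl
... | suc (suc _) = refl , refl , refl
fire-E v zero (true ∷ true ∷ b) (false ∷ true ∷ s) ()
fire-E v zero (true ∷ true ∷ b) (false ∷ false ∷ s) ()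
fire-E v zero (true ∷ false ∷ b) (true ∷ true ∷ s) _ with car v b s
... | zero = refl , refl , refl
... | suc zero = refl , refl , refl
... | suc (suc _) = refl , refl , refl
fire-E v zero (true ∷ false ∷ b) (true ∷ false ∷ s) _ with car v b s
... | zero = refl , refl , refl
... | suc zero = refl , refl , refl
... | suc (suc _) = refl , refl , refl
fire-E v zero (true ∷ false ∷ b) (false ∷ true ∷ s) ()
fire-E v zero (true ∷ false ∷ b) (false ∷ false ∷ s) _ with car v b s
... | zero = refl , refl , refl
... | suc zero = refl , refl , refl
... | suc (suc _) = refl , refl , refl
fire-E v zero (false ∷ true ∷ b) (true ∷ true ∷ s) ()
fire-E v zero (false ∷ true ∷ b) (true ∷ false ∷ s) _ with car v b s
... | zero = refl , refl , refl
... | suc zero = refl , refl , refl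
... | suc (suc _) = refl , refl , refl
fire-E v zero (false ∷ true ∷ b) (false ∷ true ∷ s) ()
fire-E v zero (false ∷ true ∷ b) (false ∷ false ∷ s) ()
fire-E v zero (false ∷ false ∷ b) (true ∷ true ∷ s) ()
fire-E v zero (false ∷ false ∷ b) (true ∷ false ∷ s) _ with car v b s
... | zero = refl , refl , refl
... | suc zero = refl , refl , refl
... | suc (suc _) = refl , refl , refl
fire-E v zero (false ∷ false ∷ b) (false ∷ true ∷ s) ()
fire-E v zero (false ∷ false ∷ b) (false ∷ false ∷ s) ()
fire-E v zero (_ ∷ []) (_ ∷ []) ()
fire-E v zero [] [] ()
fire-E v (suc j) [] [] ()
fire-E v (suc j) (x ∷ b) (y ∷ s) h with fire-E v j b s h
... | p , q , r rewrite f₁-∷ j x b | f₂-∷ j x y b s | p | q | r =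
  sym (f₁-∷ j _ (low v b s)) , sym (f₂-∷ j true _ (low v b s) (upp v b s)) , refl

-- Here the scan runs to the right, so the recursion changes the starting length. The third equation
-- with start 0 is the invariance of `wraps` under f_j.
fire-R : ∀ {n} v j (b s : Vec Bool n) → 0 < proj₂ (sig (sgn j b) (sgn j s)) →
  dep v (f₁ j b) (f₂ j b s) ≡ f₁ j (dep v b s) × res v (f₁ j b) (f₂ j b s) ≡ f₂ j (dep v b s) (res v b s) ×
  que v (f₁ j b) (f₂ j b s) ≡ que v b s
fire-R v zero (true ∷ true ∷ b) (true ∷ true ∷ s) ()
fire-R zero zero (true ∷ true ∷ b) (true ∷ false ∷ s) _ = refl , refl , refl
fire-R (suc zero) zero (true ∷ true ∷ b) (true ∷ false ∷ s) _ = refl , refl , refl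
fire-R (suc (suc v)) zero (true ∷ true ∷ b) (true ∷ false ∷ s) _ = refl , refl , refl
fire-R v zero (true ∷ true ∷ b) (false ∷ true ∷ s) ()
fire-R v zero (true ∷ true ∷ b) (false ∷ false ∷ s) ()
fire-R zero zero (true ∷ false ∷ b) (true ∷ true ∷ s) _ = refl , refl , refl
fire-R (suc zero) zero (true ∷ false ∷ b) (true ∷ true ∷ s) _ = refl , refl , refl
fire-R (suc (suc v)) zero (true ∷ false ∷ b) (true ∷ true ∷ s) _ = refl , refl , refl
fire-R zero zero (true ∷ false ∷ b) (true ∷ false ∷ s) _ = refl , refl , refl
fire-R (suc zero) zero (true ∷ false ∷ b) (true ∷ false ∷ s) _ = refl , refl , refl
fire-R (suc (suc v)) zero (true ∷ false ∷ b) (true ∷ false ∷ s) _ = refl , refl , refl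
fire-R v zero (true ∷ false ∷ b) (false ∷ true ∷ s) ()
fire-R zero zero (true ∷ false ∷ b) (false ∷ false ∷ s) _ = refl , refl , refl
fire-R (suc zero) zero (true ∷ false ∷ b) (false ∷ false ∷ s) _ = refl , refl , refl
fire-R (suc (suc v)) zero (true ∷ false ∷ b) (false ∷ false ∷ s) _ = refl , refl , refl
fire-R v zero (false ∷ true ∷ b) (true ∷ true ∷ s) ()
fire-R zero zero (false ∷ true ∷ b) (true ∷ false ∷ s) _ = refl , refl , refl
fire-R (suc zero) zero (false ∷ true ∷ b) (true ∷ false ∷ s) _ = refl , refl , refl
fire-R (suc (suc v)) zero (false ∷ true ∷ b) (true ∷ false ∷ s) _ = refl , refl , refl
fire-R v zero (false ∷ true ∷ b) (false ∷ true ∷ s) ()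
fire-R v zero (false ∷ true ∷ b) (false ∷ false ∷ s) ()
fire-R v zero (false ∷ false ∷ b) (true ∷ true ∷ s) ()
fire-R zero zero (false ∷ false ∷ b) (true ∷ false ∷ s) _ = refl , refl , refl
fire-R (suc zero) zero (false ∷ false ∷ b) (true ∷ false ∷ s) _ = refl , refl , refl
fire-R (suc (suc v)) zero (false ∷ false ∷ b) (true ∷ false ∷ s) _ = refl , refl , refl
fire-R v zero (false ∷ false ∷ b) (false ∷ true ∷ s) ()
fire-R v zero (false ∷ false ∷ b) (false ∷ false ∷ s) ()
fire-R v zero (_ ∷ []) (_ ∷ []) ()
fire-R v zero [] [] ()
fire-R v (suc j) [] [] ()
fire-R v (suc j) (x ∷ b) (y ∷ s) h with fire-R (cq x y v) j b s h
... | p , q , r rewrite f₁-∷ j x b | f₂-∷ j x y b s | p | q | r =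
  sym (f₁-∷ j _ (dep (cq x y v) b s)) , sym (f₂-∷ j true _ (dep (cq x y v) b s) (res (cq x y v) b s)) , refl

op-E : ∀ {n} v → Op {n} (low v) (upp v)
op-E v = record { op-sig = os ; op-fire = λ j b s h → let (p , q , _) = fire-E v j b s h in p , q }
  where
  os : ∀ {n} j (b s : Vec Bool n) → sig (sgn j (low v b s)) (sgn j (upp v b s)) ≡ sig (sgn j b) (sgn j s)
  os zero (b₁ ∷ b₂ ∷ b) (s₁ ∷ s₂ ∷ s) = sig-E b₁ b₂ s₁ s₂ (car v b s)
  os zero (_ ∷ []) (_ ∷ []) = refl
  os (suc j) (_ ∷ b) (_ ∷ s) = os j b s
  os zero [] [] = refl
  os (suc j) [] [] = refl

sig-dep : ∀ {n} u j (b s : Vec Bool n) → sig (sgn j (dep u b s)) (sgn j (res u b s)) ≡ sig (sgn j b) (sgn j s)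
sig-dep u zero (b₁ ∷ b₂ ∷ b) (s₁ ∷ s₂ ∷ s) = sig-R b₁ b₂ s₁ s₂ u
sig-dep u zero (_ ∷ []) (_ ∷ []) = refl
sig-dep u (suc j) (x ∷ b) (y ∷ s) = sig-dep (cq x y u) j b s
sig-dep u zero [] [] = refl
sig-dep u (suc j) [] [] = refl

-- The starting length `wraps b s` itself depends on the rows. The instance of `fire-R` with start 0
-- shows that it survives the action; the instance with start `wraps b s` then compares the rows.
op-R : ∀ {n} → Op {n} (λ b s → dep (wraps b s) b s) (λ b s → res (wraps b s) b s)
op-R = record { op-sig = λ j b s → sig-dep (wraps b s) j b s ; op-fire = of }
  where
  of : ∀ {n} j (b s : Vec Bool n) → 0 < proj₂ (sig (sgn j b) (sgn j s)) →
    dep (wraps (f₁ j b) (f₂ j b s)) (f₁ j b) (f₂ j b s) ≡ f₁ j (dep (wraps b s) b s) ×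
    res (wraps (f₁ j b) (f₂ j b s)) (f₁ j b) (f₂ j b s) ≡ f₂ j (dep (wraps b s) b s) (res (wraps b s) b s)
  of j b s h with fire-R 0 j b s h | fire-R (wraps b s) j b s h
  ... | _ , _ , r | p , q , _ = trans (cong (λ u → dep u (f₁ j b) (f₂ j b s)) r) p ,
                                trans (cong (λ u → res u (f₁ j b) (f₂ j b s)) r) q

-- Invariants of a step: row sizes and wraps

tw : Bool → ℕ
tw true  = 1
tw false = 0

size : ∀ {n} → Vec Bool n → ℕ
size []      = 0
size (b ∷ r) = tw b + size r

size-sw : ∀ {n} j (r : Vec Bool n) → size (sw j r) ≡ size r
size-sw zero    (a ∷ b ∷ r) = trans (sym (+-assoc (tw b) (tw a) _)) (trans (cong (_+ size r) (+-comm (tw b) (tw a))) (+-assoc (tw a) (tw b) _))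
size-sw (suc j) (a ∷ r)     = cong (tw a +_) (size-sw j r)
size-sw zero    (a ∷ [])    = refl
size-sw zero    []          = refl
size-sw (suc j) []          = refl

step-sizes : ∀ {n j} {M M' : Mat n} → Step j M M' → map size M ≡ map size M'
step-sizes {j = j} (act {r} p e) = cong₂ _∷_ (sym (size-sw j r)) refl
step-sizes (skip q st) = cong (_ ∷_) (step-sizes st)

wraps₁₂ : ∀ {n} → Mat n → ℕ
wraps₁₂ (b ∷ s ∷ M) = wraps b s
wraps₁₂ _           = 0

step-wraps : ∀ {n j} {M M' : Mat n} → Step j M M' → wraps₁₂ M ≡ wraps₁₂ M'
step-wraps {M = _ ∷ []} (act p e) = refl
step-wraps {M = _ ∷ []} (skip q ())
step-wraps {j = j} {b ∷ s ∷ M} st with step₂-elim st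
... | inj₁ (nz , refl) = sym (proj₂ (proj₂ (fire-R 0 j b s (n≢0⇒n>0 (λ z → nz (trans (cong (_∸ eps j M) z) (0∸n≡0 (eps j M))))))))
... | inj₂ (z , M1 , st1 , refl) = refl

-- Row-highest-weight matrices

Dom : ∀ {n} → Vec Bool n → Vec Bool n → Set
Dom []       []       = ⊤
Dom (b ∷ bs) (s ∷ ss) = Dom bs ss × size (s ∷ ss) ≤ size (b ∷ bs)

-- `Dom` compares the numbers of balls in all final segments of columns: the upper row can be paired
-- weakly to the right into the lower one without wrapping. Hence `HW` expresses that the matrix is
-- nonwrapping, see `hw-majA` and `majA-hw`.
HW : ∀ {n} → Mat n → Set
HW []          = ⊤
HW (_ ∷ [])    = ⊤
HW (b ∷ s ∷ M) = Dom b s × HW (s ∷ M)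

dom-size : ∀ {n} (b s : Vec Bool n) → Dom b s → size s ≤ size b
dom-size []      []      _ = z≤n
dom-size (_ ∷ _) (_ ∷ _) d = proj₂ d

dom-trans : ∀ {n} (a b c : Vec Bool n) → Dom a b → Dom b c → Dom a c
dom-trans []      []      []      _ _ = tt
dom-trans (_ ∷ a) (_ ∷ b) (_ ∷ c) (p , q) (p' , q') = dom-trans a b c p p' , ≤-trans q' q

-- The carrier holds the unmatched balls of `b` and the `v` initial ones that are still unmatched,
-- and every other such ball is matched with one ball of the upper row; the matched upper balls are
-- exactly those that stay.
car-size : ∀ {n} v (b s : Vec Bool n) → car v b s + size (upp v b s) ≡ v + size b
car-size v [] [] = refl
car-size v (true ∷ b) (true ∷ s) = trans (+-suc _ _) (trans (cong suc (car-size v b s)) (sym (+-suc v _)))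
car-size v (true ∷ b) (false ∷ s) = trans (cong suc (car-size v b s)) (sym (+-suc v _))
car-size v (false ∷ b) (false ∷ s) = car-size v b s
car-size v (false ∷ b) (true ∷ s) with car v b s | car-size v b s
... | zero  | e = e
... | suc k | e = trans (+-suc k _) e

tw-E : ∀ b s v → tw (lw b s v) + tw (ub b s v) ≡ tw b + tw s
tw-E true  s     v       = refl
tw-E false false v       = refl
tw-E false true  zero    = refl
tw-E false true  (suc v) = refl

tw-R : ∀ b s u → tw (dp b s u) + tw (rs b s u) ≡ tw b + tw s
tw-R false s     u       = refl
tw-R true  true  u       = refl
tw-R true  false zero    = refl
tw-R true  false (suc u) = refl

+-mid : ∀ a b c d → (a + b) + (c + d) ≡ (a + c) + (b + d)
+-mid a b c d = trans (+-assoc a b (c + d)) (trans (cong (a +_) (trans (sym (+-assoc b c d)) (trans (cong (_+ d) (+-comm b c)) (+-assoc c b d)))) (sym (+-assoc a c (b + d))))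

+-swapʳ : ∀ a b c → (a + b) + c ≡ (a + c) + b
+-swapʳ a b c = trans (+-assoc a b c) (trans (cong (a +_) (+-comm b c)) (sym (+-assoc a c b)))

low-upp-size : ∀ {n} v (b s : Vec Bool n) → size (low v b s) + size (upp v b s) ≡ size b + size s
low-upp-size v [] [] = refl
low-upp-size v (b ∷ bs) (s ∷ ss) = trans (+-mid (tw (lw b s (car v bs ss))) _ _ _)
  (trans (cong₂ _+_ (tw-E b s (car v bs ss)) (low-upp-size v bs ss)) (+-mid (tw b) (tw s) _ _))

dom-upp : ∀ {n} (b s : Vec Bool n) → Dom b (upp 0 b s)
dom-upp [] [] = tt
dom-upp (b ∷ bs) (s ∷ ss) = dom-upp bs ss ,
  ≤-trans (m≤n+m _ (car 0 (b ∷ bs) (s ∷ ss))) (≤-reflexive (car-size 0 (b ∷ bs) (s ∷ ss)))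

size-low : ∀ {n} (b s : Vec Bool n) → size (low 0 b s) ≡ car 0 b s + size s
size-low b s = +-cancelʳ-≡ (size (upp 0 b s)) _ _ (trans (low-upp-size 0 b s)
  (trans (cong (_+ size s) (sym (car-size 0 b s)))
  (trans (+-assoc (car 0 b s) _ _) (trans (cong (car 0 b s +_) (+-comm (size (upp 0 b s)) (size s))) (sym (+-assoc (car 0 b s) _ _))))))

dom-low : ∀ {n} (b s : Vec Bool n) → Dom (low 0 b s) s
dom-low [] [] = tt
dom-low (b ∷ bs) (s ∷ ss) = dom-low bs ss ,
  ≤-trans (m≤n+m _ (car 0 (b ∷ bs) (s ∷ ss))) (≤-reflexive (sym (size-low (b ∷ bs) (s ∷ ss))))

Sub : ∀ {n} → Vec Bool n → Vec Bool n → Set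
Sub []       []       = ⊤
Sub (a ∷ as) (b ∷ bs) = tw a ≤ tw b × Sub as bs

sub-upp : ∀ {n} v (b s : Vec Bool n) → Sub (upp v b s) s
sub-upp v [] [] = tt
sub-upp v (b ∷ bs) (s ∷ ss) = l b s (car v bs ss) , sub-upp v bs ss
  where
  l : ∀ b s v → tw (ub b s v) ≤ tw s
  l true  s     v       = ≤-refl
  l false false v       = ≤-refl
  l false true  zero    = z≤n
  l false true  (suc v) = ≤-refl

sub-low : ∀ {n} v (b s : Vec Bool n) → Sub b (low v b s)
sub-low v [] [] = tt
sub-low v (b ∷ bs) (s ∷ ss) = l b s (car v bs ss) , sub-low v bs ss
  where
  l : ∀ b s v → tw b ≤ tw (lw b s v)
  l true  s     v       = ≤-refl
  l false false v       = ≤-refl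
  l false true  zero    = z≤n
  l false true  (suc v) = ≤-refl

-- A ball of `x` falls only where the carrier is 0, and from there on the new lower row has as many
-- balls as `x`, which `y` dominates. All its other balls lie in `y'` and hence in `y`.
dom-low-sub : ∀ {n} (y y' x : Vec Bool n) → Dom y x → Sub y' y → Dom y (low 0 y' x)
dom-low-sub [] [] [] _ _ = tt
dom-low-sub (y ∷ ys) (y' ∷ ys') (x ∷ xs) (d , e) (p , q) = ih , l y' x (car 0 ys' xs) refl p e
  where
  ih = dom-low-sub ys ys' xs d q
  m = dom-size ys (low 0 ys' xs) ih
  l : ∀ y' x v → car 0 ys' xs ≡ v → tw y' ≤ tw y → tw x + size xs ≤ tw y + size ys →
      tw (lw y' x v) + size (low 0 ys' xs) ≤ tw y + size ys
  l true  x     v       _ p e = +-mono-≤ p m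
  l false false v       _ p e = ≤-trans m (m≤n+m _ (tw y))
  l false true  zero    c p e = subst (λ z → suc z ≤ tw y + size ys) (sym (trans (size-low ys' xs) (cong (_+ size xs) c))) e
  l false true  (suc v) _ p e = ≤-trans m (m≤n+m _ (tw y))

-- A ball is lost only where the carrier is 0, and from there on the new upper row has as many balls
-- as `z`, which dominates `y`. Elsewhere the balls of `y'`, and with them those of `y`, are still
-- present.
dom-upp-sub : ∀ {n} (z y y' : Vec Bool n) → Dom z y → Sub y y' → Dom (upp 0 z y') y
dom-upp-sub [] [] [] _ _ = tt
dom-upp-sub (z ∷ zs) (y ∷ ys) (y' ∷ ys') (d , e) (p , q) = ih , l z y' (car 0 zs ys') refl p e
  where
  ih = dom-upp-sub zs ys ys' d q
  m = dom-size (upp 0 zs ys') ys ih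
  l : ∀ z y' v → car 0 zs ys' ≡ v → tw y ≤ tw y' → tw y + size ys ≤ tw z + size zs →
      tw y + size ys ≤ tw (ub z y' v) + size (upp 0 zs ys')
  l true  y'    v       _ p e = +-mono-≤ p m
  l false false v       _ p e = +-mono-≤ p m
  l false true  zero    c p e = ≤-trans e (≤-reflexive (trans (sym (car-size 0 zs ys')) (cong (_+ size (upp 0 zs ys')) c)))
  l false true  (suc v) _ p e = +-mono-≤ p m

-- Column weights

toN : ∀ {n} → Vec Bool n → Vec ℕ n
toN = Vec.map tw

wt : ∀ {n} → Mat n → Vec ℕ n
wt []      = Vec.replicate _ 0
wt (r ∷ M) = Vec.zipWith _+_ (toN r) (wt M)

record Keep {n} (g : Mat n → Mat n) : Set where
  field
    k-wt  : ∀ M → wt (g M) ≡ wt M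
    k-len : ∀ M → length (g M) ≡ length M
open Keep

zip-assoc : ∀ {n} (a b c : Vec ℕ n) → Vec.zipWith _+_ a (Vec.zipWith _+_ b c) ≡ Vec.zipWith _+_ (Vec.zipWith _+_ a b) c
zip-assoc [] [] [] = refl
zip-assoc (a ∷ as) (b ∷ bs) (c ∷ cs) = cong₂ _∷_ (sym (+-assoc a b c)) (zip-assoc as bs cs)

E-wt : ∀ {n} v (b s : Vec Bool n) → Vec.zipWith _+_ (toN (low v b s)) (toN (upp v b s)) ≡ Vec.zipWith _+_ (toN b) (toN s)
E-wt v [] [] = refl
E-wt v (b ∷ bs) (s ∷ ss) = cong₂ _∷_ (tw-E b s (car v bs ss)) (E-wt v bs ss)

R-wt : ∀ {n} u (b s : Vec Bool n) → Vec.zipWith _+_ (toN (dep u b s)) (toN (res u b s)) ≡ Vec.zipWith _+_ (toN b) (toN s)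
R-wt u [] [] = refl
R-wt u (b ∷ bs) (s ∷ ss) = cong₂ _∷_ (tw-R b s u) (R-wt (cq b s u) bs ss)

twoRow-keep : ∀ {n} {F G : Vec Bool n → Vec Bool n → Vec Bool n} →
  (∀ b s → Vec.zipWith _+_ (toN (F b s)) (toN (G b s)) ≡ Vec.zipWith _+_ (toN b) (toN s)) → Keep (twoRow F G)
twoRow-keep {n} {F} {G} h = record { k-wt = kw ; k-len = kl }
  where
  kw : ∀ M → wt (twoRow F G M) ≡ wt M
  kw [] = refl
  kw (_ ∷ []) = refl
  kw (b ∷ s ∷ M) = trans (zip-assoc (toN (F b s)) (toN (G b s)) (wt M))
    (trans (cong (λ z → Vec.zipWith _+_ z (wt M)) (h b s)) (sym (zip-assoc (toN b) (toN s) (wt M))))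
  kl : ∀ M → length (twoRow F G M) ≡ length M
  kl [] = refl
  kl (_ ∷ []) = refl
  kl (b ∷ s ∷ M) = refl

∘-keep : ∀ {n} {g h : Mat n → Mat n} → Keep g → Keep h → Keep (λ M → g (h M))
∘-keep {h = h} kg kh = record { k-wt = λ M → trans (k-wt kg (h M)) (k-wt kh M) ; k-len = λ M → trans (k-len kg (h M)) (k-len kh M) }

under-keep : ∀ {n} {g : Mat n → Mat n} → Keep g → Keep (under g)
under-keep {g = g} kg = record { k-wt = kw ; k-len = kl }
  where
  kw : ∀ M → wt (under g M) ≡ wt M
  kw [] = refl
  kw (r ∷ M) = cong (Vec.zipWith _+_ (toN r)) (k-wt kg M)
  kl : ∀ M → length (under g M) ≡ length M
  kl [] = refl
  kl (r ∷ M) = cong suc (k-len kg M)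

id-keep : ∀ {n} → Keep {n} (λ M → M)
id-keep = record { k-wt = λ _ → refl ; k-len = λ _ → refl }

-- Matrices that are highest weight for both crystals

at : ∀ {n} → ℕ → Vec Bool n → Bool
at _       []      = false
at zero    (b ∷ _) = b
at (suc j) (_ ∷ r) = at j r

sgn-at : ∀ {n} j (r : Vec Bool n) → at (suc j) r ≡ true → sgn j r ≡ sg (at j r) true
sgn-at zero    (a ∷ true ∷ r) refl = refl
sgn-at (suc j) (_ ∷ r)        e    = sgn-at j r e
sgn-at zero    (_ ∷ [])       ()
sgn-at zero    []             ()
sgn-at (suc j) []             ()

Initial : ∀ {n} → Vec Bool n → Set
Initial r = ∀ j → at (suc j) r ≡ true → at j r ≡ true

init-zero : ∀ {n} (r : Vec Bool n) → Initial r → at 0 r ≡ false → size r ≡ 0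
init-zero []          _ _ = refl
init-zero (false ∷ r) i _ = init-zero r (λ j → i (suc j)) (l (at 0 r) refl)
  where
  l : ∀ x → at 0 r ≡ x → x ≡ false
  l true  e with i 0 e
  ... | ()
  l false e = refl

dom-init : ∀ {n} (l r : Vec Bool n) → Initial l → Dom l r → ∀ j → at j r ≡ true → at j l ≡ true
dom-init []          []         i d       j       ()
dom-init (true ∷ l)  (true ∷ r) i d       zero    refl = refl
dom-init (false ∷ l) (true ∷ r) i (_ , e) zero    refl with ≤-trans e (≤-reflexive (init-zero (false ∷ l) i refl))
... | ()
dom-init (_ ∷ l)     (_ ∷ r)    i (d , _) (suc j) e    = dom-init l r (λ k → i (suc k)) d j e

-- The matrix with L rows whose columns are stacks of heights `w` standing on the bottom row.
colTop : ∀ {n} → ℕ → Vec ℕ n → Mat n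
colTop zero    w = []
colTop (suc L) w = Vec.map (0 <ᵇ_) w ∷ colTop L (Vec.map pred w)

Base : ∀ {n} → Vec Bool n → Vec ℕ n → Set
Base []          []      = ⊤
Base (true ∷ r)  (_ ∷ w) = Base r w
Base (false ∷ r) (k ∷ w) = k ≡ 0 × Base r w

base-top : ∀ {n} (r : Vec Bool n) w → Base r w →
  Vec.map (0 <ᵇ_) (Vec.zipWith _+_ (toN r) w) ≡ r × Vec.map pred (Vec.zipWith _+_ (toN r) w) ≡ w
base-top []          []      _ = refl , refl
base-top (true ∷ r)  (k ∷ w) b with base-top r w b
... | p , q = cong (true ∷_) p , cong (k ∷_) q
base-top (false ∷ r) (k ∷ w) (refl , b) with base-top r w b
... | p , q = cong (false ∷_) p , cong (0 ∷_) q

base-zero : ∀ {n} (r : Vec Bool n) → Base r (Vec.replicate _ 0)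
base-zero []          = tt
base-zero (true ∷ r)  = base-zero r
base-zero (false ∷ r) = refl , base-zero r

base-cons : ∀ {n} (r s : Vec Bool n) w → (∀ j → at j s ≡ true → at j r ≡ true) → Base s w → Base r (Vec.zipWith _+_ (toN s) w)
base-cons []          []          []      h b = tt
base-cons (true ∷ r)  (true ∷ s)  (k ∷ w) h b = base-cons r s w (λ j → h (suc j)) b
base-cons (true ∷ r)  (false ∷ s) (k ∷ w) h (_ , b) = base-cons r s w (λ j → h (suc j)) b
base-cons (false ∷ r) (true ∷ s)  (k ∷ w) h b with h 0 refl
... | ()
base-cons (false ∷ r) (false ∷ s) (k ∷ w) h (e , b) = e , base-cons r s w (λ j → h (suc j)) b

AllInitial : ∀ {n} → Mat n → Set
AllInitial []      = ⊤
AllInitial (r ∷ M) = Initial r × AllInitial M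

-- The condition on `eps` is restricted to columns j + 1 occupied in the row below, because only
-- this form descends to the next rows: below an occupied site of `r` the initial row `l` is
-- occupied by dominance, so ε of `r ∷ M` vanishes there, which excludes ⊖ in `r` and passes ε = 0
-- on to `M`. In a column pair with ⊕ in `r` the rows above may still have ε = 1.
colTop-hw′ : ∀ {n} (l : Vec Bool n) (M : Mat n) → Initial l → HW (l ∷ M) → (∀ j → at (suc j) l ≡ true → eps j M ≡ 0) →
  Base l (wt M) × AllInitial M × M ≡ colTop (length M) (wt M)
colTop-hw′ l [] i h e = base-zero l , tt , refl
colTop-hw′ l (r ∷ M) i (d , h) e = base-cons l r (wt M) (dom-init l r i d) (proj₁ ih) , ((λ j p → proj₁ (bit j p)) , proj₁ (proj₂ ih)) ,
  cong₂ _∷_ (sym (proj₁ bt)) (trans (proj₂ (proj₂ ih)) (cong (colTop (length M)) (sym (proj₂ bt))))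
  where
  bit : ∀ j → at (suc j) r ≡ true → at j r ≡ true × eps j M ≡ 0
  bit j p with at j r | sgn-at j r p | e j (dom-init l r i d (suc j) p)
  ... | true  | q | z = refl , trans (cong (λ x → εs x (eps j M)) (sym q)) z
  ... | false | q | z with trans (sym z) (cong (λ x → εs x (eps j M)) q)
  ... | ()
  ih = colTop-hw′ r M (λ j p → proj₁ (bit j p)) h (λ j p → proj₂ (bit j p))
  bt = base-top r (wt M) (proj₁ ih)

colTop-hw : ∀ {n} (M : Mat n) → HW M → (∀ j → eps j M ≡ 0) → AllInitial M × M ≡ colTop (length M) (wt M)
colTop-hw [] h e = tt , refl
colTop-hw {n} (r ∷ M) h e = ((λ j p → proj₁ (bit j p)) , proj₁ (proj₂ ih)) , cong₂ _∷_ (sym (proj₁ bt)) (trans (proj₂ (proj₂ ih)) (cong (colTop (length M)) (sym (proj₂ bt))))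
  where
  bit : ∀ j → at (suc j) r ≡ true → at j r ≡ true × eps j M ≡ 0
  bit j p with at j r | sgn-at j r p | e j
  ... | true  | q | z = refl , trans (cong (λ x → εs x (eps j M)) (sym q)) z
  ... | false | q | z with trans (sym z) (cong (λ x → εs x (eps j M)) q)
  ... | ()
  ih = colTop-hw′ r M (λ j p → proj₁ (bit j p)) h (λ j p → proj₂ (bit j p))
  bt = base-top r (wt M) (proj₁ ih)

-- Raising to column-highest weight and descending again

data Path {n} : Mat n → Mat n → Set where
  stop : ∀ {A} → Path A A
  _▸_  : ∀ {A B C j} → Path A B → Step j B C → Path A C

path-inv : ∀ {n} {X : Set} (I : Mat n → X) → (∀ {j A B} → Step j A B → I A ≡ I B) → ∀ {A B} → Path A B → I A ≡ I B
path-inv I h stop    = refl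
path-inv I h (p ▸ s) = trans (path-inv I h p) (h s)

-- Sum of the column indices of the balls. A step moves one ball by one column to the right, so this
-- sum bounds the number of raisings in `to-top`.
mom : ∀ {n} → Vec Bool n → ℕ
mom []      = 0
mom (_ ∷ r) = mom r + size r

moment : ∀ {n} → Mat n → ℕ
moment []      = 0
moment (r ∷ M) = mom r + moment M

mom-sw : ∀ {n} j (r : Vec Bool n) → sgn j r ≡ ⊕ → mom (sw j r) ≡ suc (mom r)
mom-sw zero    (true ∷ false ∷ r) _ = +-suc (mom r + size r) (size r)
mom-sw (suc j) (_ ∷ r)            p = cong₂ _+_ (mom-sw j r p) (size-sw j r)
mom-sw zero    (true ∷ true ∷ r)  ()
mom-sw zero    (false ∷ true ∷ r) ()
mom-sw zero    (false ∷ false ∷ r) ()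
mom-sw zero    (_ ∷ [])           ()
mom-sw zero    []                 ()
mom-sw (suc j) []                 ()

step-moment : ∀ {n j} {A B : Mat n} → Step j A B → moment B ≡ suc (moment A)
step-moment {j = j} (act {r} {M} p _) = cong (_+ moment M) (mom-sw j r p)
step-moment (skip {r} _ st) = trans (cong (mom r +_) (step-moment st)) (+-suc (mom r) _)

sgn-big : ∀ {n} j (r : Vec Bool n) → n ≤ j → sgn j r ≡ ⊙
sgn-big zero    []      _ = refl
sgn-big (suc j) []      _ = refl
sgn-big (suc j) (_ ∷ r) (s≤s p) = sgn-big j r p

eps-big : ∀ {n} j (M : Mat n) → n ≤ j → eps j M ≡ 0
eps-big j []      p = refl
eps-big j (r ∷ M) p rewrite sgn-big j r p = eps-big j M p

eps-search : ∀ {n} (M : Mat n) k → (∃ λ j → eps j M ≢ 0) ⊎ (∀ j → j < k → eps j M ≡ 0)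
eps-search M zero = inj₂ λ _ ()
eps-search M (suc k) with eps k M ≟ 0 | eps-search M k
... | no p  | _      = inj₁ (k , p)
... | yes p | inj₁ q = inj₁ q
... | yes p | inj₂ q = inj₂ λ j l → case (m≤n⇒m<n∨m≡n l) of λ where
    (inj₁ (s≤s a)) → q j a
    (inj₂ refl) → p

ColHW : ∀ {n} → Mat n → Set
ColHW M = ∀ j → eps j M ≡ 0

to-top : ∀ {n} (M : Mat n) → ∃ λ A → Path A M × ColHW A
to-top {n} M = go (moment M) M refl
  where
  go : ∀ k (M : Mat n) → moment M ≡ k → ∃ λ A → Path A M × ColHW A
  go k M e with eps-search M n
  ... | inj₂ q = M , stop , λ j → [ q j , eps-big j M ]′ (<-≤-connex j n)
  go k M e | inj₁ (j , p) with step-up j M p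
  ... | M' , st with k | trans (sym e) (step-moment st)
  ... | suc k' | q = let (A , pa , h) = go k' M' (sym (suc-injective q)) in A , pa ▸ st , h

morph-top : ∀ {n} {g : Mat n → Mat n} → Morph g → ∀ {A} → ColHW A → ColHW (g A)
morph-top mg h j = trans (m-eps mg j _) (h j)

-- A step from `g B` lifts to `B` because both have the same φ, and by determinism the image of the
-- lifted step is the given one.
morph-down : ∀ {n} {g : Mat n → Mat n} → Morph g → ∀ {A C} → Path (g A) C → ∃ λ B → Path A B × g B ≡ C
morph-down {g = g} mg {A} stop = A , stop , refl
morph-down {g = g} mg (_▸_ {j = j} p st) with morph-down mg p
... | B , pb , refl with step-down j B (λ z → step-phi st (trans (m-phi mg j B) z))
... | B' , st' = B' , pb ▸ st' , step-det (m-step mg st') st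

morph-eq : ∀ {n} {g h : Mat n → Mat n} → Morph g → Morph h → ∀ {A B} → Path A B → g A ≡ h A → g B ≡ h B
morph-eq mg mh stop    e = e
morph-eq {n} {g} {h} mg mh (_▸_ {j = j} p s) e =
  step-det (m-step mg s) (subst (λ x → Step j x (h _)) (sym (morph-eq mg mh p e)) (m-step mh s))

step-length : ∀ {n j} {A B : Mat n} → Step j A B → length A ≡ length B
step-length (act _ _)   = refl
step-length (skip _ st) = cong suc (step-length st)

-- The two maps are compared at the top of the path to `M`, not at `M`; this is why `HW` is asked
-- for all matrices of the length of `M`.
collapse-unique : ∀ {n} {g h : Mat n → Mat n} → Morph g → Keep g → Morph h → Keep h →
  ∀ M → (∀ A → length A ≡ length M → HW (g A)) → (∀ A → length A ≡ length M → HW (h A)) → g M ≡ h M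
collapse-unique {n} {g} {h} mg kg mh kh M Hg Hh with to-top M
... | A , p , top = morph-eq mg mh p (trans (eq mg kg Hg) (sym (eq mh kh Hh)))
  where
  lenA : length A ≡ length M
  lenA = path-inv length step-length p
  eq : ∀ {g : Mat n → Mat n} → Morph g → Keep g → (∀ A → length A ≡ length M → HW (g A)) → g A ≡ colTop (length A) (wt A)
  eq {g} mg kg Hg = trans (proj₂ (colTop-hw (g A) (Hg A lenA) (morph-top mg top))) (cong₂ colTop (k-len kg A) (k-wt kg A))

-- Operators composed of E and R

sizes : ∀ {n} → Mat n → List ℕ
sizes = map size

opE : ∀ {n} → Mat n → Mat n
opE = twoRow (low 0) (upp 0)

opR : ∀ {n} → Mat n → Mat n
opR = twoRow (λ b s → dep (wraps b s) b s) (λ b s → res (wraps b s) b s)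

-- The innermost E acts on rows i and i + 1, the outermost on rows 1 and 2: this is the composite of
-- the starred operators from i down to 1 in one round of ρ. Consequently `stage i` is the matrix
-- with index i + 1 in the definition of ρ.
ins : ∀ {n} → ℕ → Mat n → Mat n
ins zero    M = M
ins (suc i) M = opE (under (ins i) M)

stage : ∀ {n} → ℕ → Mat n → Mat n
stage zero    M = M
stage (suc i) M = ins (suc i) (stage i M)

-- The order opposite to `ins`: the bottom row is inserted into the rows above, and what E leaves in
-- the upper of two rows is inserted into the next one.
push : ∀ {n} → ℕ → Mat n → Mat n
push zero    M = M
push (suc k) M = under (push k) (opE M)

coll : ∀ {n} → ℕ → Mat n → Mat n
coll zero    M = M
coll (suc k) M = push k (under (coll k) M)

-- R carries row k + 1 to the bottom through the k rows below it; what arrives there is the label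
-- set `Sset k`.
bring : ∀ {n} → ℕ → Mat n → Mat n
bring zero    M = M
bring (suc k) M = opR (under (bring k) M)

opE-morph : ∀ {n} → Morph (opE {n})
opE-morph = twoRow-morph (op-E 0)

opR-morph : ∀ {n} → Morph (opR {n})
opR-morph = twoRow-morph op-R

opE-keep : ∀ {n} → Keep (opE {n})
opE-keep = twoRow-keep (E-wt 0)

opR-keep : ∀ {n} → Keep (opR {n})
opR-keep = twoRow-keep (λ b s → R-wt (wraps b s) b s)

ins-morph : ∀ {n} i → Morph (ins {n} i)
ins-morph zero    = id-morph
ins-morph (suc i) = ∘-morph opE-morph (under-morph (ins-morph i))

ins-keep : ∀ {n} i → Keep (ins {n} i)
ins-keep zero    = id-keep
ins-keep (suc i) = ∘-keep opE-keep (under-keep (ins-keep i))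

stage-morph : ∀ {n} i → Morph (stage {n} i)
stage-morph zero    = id-morph
stage-morph (suc i) = ∘-morph (ins-morph (suc i)) (stage-morph i)

stage-keep : ∀ {n} i → Keep (stage {n} i)
stage-keep zero    = id-keep
stage-keep (suc i) = ∘-keep (ins-keep (suc i)) (stage-keep i)

push-morph : ∀ {n} i → Morph (push {n} i)
push-morph zero    = id-morph
push-morph (suc i) = ∘-morph (under-morph (push-morph i)) opE-morph

push-keep : ∀ {n} i → Keep (push {n} i)
push-keep zero    = id-keep
push-keep (suc i) = ∘-keep (under-keep (push-keep i)) opE-keep

coll-morph : ∀ {n} i → Morph (coll {n} i)
coll-morph zero    = id-morph
coll-morph (suc i) = ∘-morph (push-morph i) (under-morph (coll-morph i))

coll-keep : ∀ {n} i → Keep (coll {n} i)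
coll-keep zero    = id-keep
coll-keep (suc i) = ∘-keep (push-keep i) (under-keep (coll-keep i))

bring-morph : ∀ {n} i → Morph (bring {n} i)
bring-morph zero    = id-morph
bring-morph (suc i) = ∘-morph opR-morph (under-morph (bring-morph i))

bring-keep : ∀ {n} i → Keep (bring {n} i)
bring-keep zero    = id-keep
bring-keep (suc i) = ∘-keep opR-keep (under-keep (bring-keep i))

-- Collapsing: ins and stage follow the definition of ρ, coll collapses from the top row downwards

sub-size : ∀ {n} (a b : Vec Bool n) → Sub a b → size a ≤ size b
sub-size []      []      _       = z≤n
sub-size (_ ∷ a) (_ ∷ b) (p , q) = +-mono-≤ p (sub-size a b q)

sub-dom : ∀ {n} (a b : Vec Bool n) → Sub a b → Dom b a
sub-dom []      []      _       = tt
sub-dom (_ ∷ a) (_ ∷ b) (p , q) = sub-dom a b q , +-mono-≤ p (sub-size a b q)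

sub-refl : ∀ {n} (a : Vec Bool n) → Sub a a
sub-refl []      = tt
sub-refl (_ ∷ a) = ≤-refl , sub-refl a

dom-E : ∀ {n} (b s : Vec Bool n) → Dom (low 0 b s) (upp 0 b s)
dom-E b s = dom-trans (low 0 b s) b (upp 0 b s) (sub-dom b _ (sub-low 0 b s)) (dom-upp b s)

hw-tail : ∀ {n} (r : Vec Bool n) (M : Mat n) → HW (r ∷ M) → HW M
hw-tail r []      h = tt
hw-tail r (_ ∷ _) h = proj₂ h

HWk : ∀ {n} → ℕ → Mat n → Set
HWk k M = HW (take k M)

-- The row `b` as it was before an insertion, kept as an intermediate: it lies in the new bottom row
-- and dominates the new second row. The next E below then passes dominance on through it by
-- `dom-upp-sub`.
Inter : ∀ {n} → Vec Bool n → Mat n → Set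
Inter b []          = ⊤
Inter b (_ ∷ [])    = ⊤
Inter b (r ∷ x ∷ _) = Sub b r × Dom b x

private
  inter-step : ∀ {n} i (b y : Vec Bool n) X → Dom b y → (i ≢ 0 → Inter y X) →
    HWk (suc i) X → HWk (suc (suc i)) (opE (b ∷ X))
  inter-step i b y [] d t h = tt
  inter-step zero b y (y' ∷ X) d t h = dom-E b y' , tt
  inter-step (suc i) b y (y' ∷ []) d t h = dom-E b y' , tt
  inter-step (suc i) b y (y' ∷ x ∷ X) d t (_ , h) with t (λ ())
  ... | p , q = dom-E b y' , dom-trans (upp 0 b y') y x (dom-upp-sub b y y' d p) q , h

ins-inter : ∀ {n} i (b : Vec Bool n) M → Inter b (ins (suc i) (b ∷ M))
ins-inter i b M with ins i M
... | []    = tt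
... | y ∷ X = sub-low 0 b y , dom-upp b y

ins-hw : ∀ {n} i (M : Mat n) → HWk i M → HWk (suc i) (ins i M)
ins-hw zero [] h = tt
ins-hw zero (_ ∷ M) h = tt
ins-hw (suc i) [] h = tt
ins-hw {n} (suc i) (b ∷ []) h = aux (ins i []) (k-len (ins-keep i) [])
  where
  aux : ∀ (X : Mat n) → length X ≡ 0 → HWk (suc (suc i)) (opE (b ∷ X))
  aux [] _ = tt
ins-hw (suc zero) (b ∷ y ∷ M) h = dom-E b y , tt
ins-hw (suc (suc i)) (b ∷ y ∷ M) (d , h) =
  inter-step (suc i) b y (ins (suc i) (y ∷ M)) d (λ _ → ins-inter i y M) (ins-hw (suc i) (y ∷ M) h)

stage-hwk : ∀ {n} i (M : Mat n) → HWk (suc i) (stage i M)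
stage-hwk zero []      = tt
stage-hwk zero (_ ∷ M) = tt
stage-hwk (suc i) M = ins-hw (suc i) (stage i M) (stage-hwk i M)

take-all : ∀ {A : Set} k (xs : List A) → length xs ≤ k → take k xs ≡ xs
take-all zero    []       _       = refl
take-all (suc k) []       _       = refl
take-all (suc k) (x ∷ xs) (s≤s p) = cong (x ∷_) (take-all k xs p)

stage-hw : ∀ {n} i (M : Mat n) → length M ≤ suc i → HW (stage i M)
stage-hw i M p = subst HW (take-all (suc i) _ (≤-trans (≤-reflexive (k-len (stage-keep i) M)) p)) (stage-hwk i M)

-- The old row `y` separates the two new rows: `low 0 b y` dominates `y`, and `y` dominates the row
-- formed by its own remaining balls and those falling from `x`.
push-hw : ∀ {n} k (b : Vec Bool n) M → length M ≤ k → HW M → HW (push k (b ∷ M))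
push-hw zero    b []          _       h = tt
push-hw (suc k) b []          _       h = aux (push k []) (k-len (push-keep k) [])
  where
  aux : ∀ X → length X ≡ 0 → HW (b ∷ X)
  aux [] _ = tt
push-hw (suc k) b (y ∷ [])    (s≤s p) h = aux (push k (upp 0 b y ∷ [])) (hd k) (push-hw k (upp 0 b y) [] p tt)
  where
  hd : ∀ k → ∃ λ X → push k (upp 0 b y ∷ []) ≡ upp 0 b y ∷ X
  hd zero    = _ , refl
  hd (suc k) = _ , refl
  aux : ∀ X → (∃ λ Y → X ≡ upp 0 b y ∷ Y) → HW X → HW (low 0 b y ∷ X)
  aux .(upp 0 b y ∷ Y) (Y , refl) h = dom-E b y , h
push-hw (suc (suc k)) b (y ∷ x ∷ M) (s≤s p) (d , h) =
  dom-trans (low 0 b y) y (low 0 (upp 0 b y) x) (dom-low b y) (dom-low-sub y (upp 0 b y) x d (sub-upp 0 b y)) ,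
  push-hw (suc k) (upp 0 b y) (x ∷ M) p h

coll-hw : ∀ {n} k (M : Mat n) → length M ≤ k → HW (coll k M)
coll-hw zero    []      _ = tt
coll-hw (suc k) []      _ = aux (push k []) (k-len (push-keep k) [])
  where
  aux : ∀ X → length X ≡ 0 → HW X
  aux [] _ = tt
coll-hw (suc k) (b ∷ M) (s≤s p) = push-hw k b (coll k M) (≤-trans (≤-reflexive (k-len (coll-keep k) M)) p) (coll-hw k M p)

stage≡coll : ∀ {n} (M : Mat n) i → length M ≤ suc i → stage i M ≡ coll (length M) M
stage≡coll M i p = collapse-unique (stage-morph i) (stage-keep i) (coll-morph (length M)) (coll-keep (length M)) M
  (λ A e → stage-hw i A (≤-trans (≤-reflexive e) p)) (λ A e → coll-hw (length M) A (≤-reflexive e))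

-- R keeps the weight and commutes with f_j, so collapsing after `bring` is one more way of
-- collapsing `M` itself.
coll-bring : ∀ {n} (M : Mat n) k → coll (length M) (bring k M) ≡ coll (length M) M
coll-bring M k = collapse-unique (∘-morph (coll-morph (length M)) (bring-morph k)) (∘-keep (coll-keep (length M)) (bring-keep k))
  (coll-morph (length M)) (coll-keep (length M)) M
  (λ A e → coll-hw (length M) (bring k A) (≤-reflexive (trans (k-len (bring-keep k) A) e)))
  (λ A e → coll-hw (length M) A (≤-reflexive e))

-- Columns are compared from the left. If only one of the lower rows has a ball in the first column,
-- the other has received one by falling, so its carrier there is 0. By `car-size` the rest of that
-- lower row is as large as the common upper image and so no larger than the rest of the first lower
-- row, against the equal sizes.
E-inj : ∀ {n} (b s b' s' : Vec Bool n) → low 0 b s ≡ low 0 b' s' → upp 0 b s ≡ upp 0 b' s' → size b ≡ size b' → b ≡ b' × s ≡ s'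
E-inj [] [] [] [] _ _ _ = refl , refl
E-inj (b ∷ bs) (s ∷ ss) (b' ∷ bs') (s' ∷ ss') l u e = go b s b' s' (VP.∷-injectiveˡ l) (VP.∷-injectiveˡ u) e
  where
  tl = VP.∷-injectiveʳ l
  tu = VP.∷-injectiveʳ u
  tails : size bs ≡ size bs' → bs ≡ bs' × ss ≡ ss'
  tails = E-inj bs ss bs' ss' tl tu
  cr : size bs ≡ size bs' → car 0 bs ss ≡ car 0 bs' ss'
  cr p = cong₂ (car 0) (proj₁ (tails p)) (proj₂ (tails p))
  absurd : ∀ {n} (b s b' s' : Vec Bool n) → upp 0 b s ≡ upp 0 b' s' → car 0 b' s' ≡ 0 → suc (size b) ≡ size b' → ⊥
  absurd b s b' s' u c p = 1+n≰n (≤-trans (≤-reflexive p) (≤-trans (≤-reflexive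
     (trans (sym (car-size 0 b' s')) (trans (cong (_+ size (upp 0 b' s')) c) (cong size (sym u)))))
     (≤-trans (m≤n+m _ (car 0 b s)) (≤-reflexive (car-size 0 b s)))))
  heads : ∀ b s s' v → lw b s v ≡ lw b s' v → ub b s v ≡ ub b s' v → s ≡ s'
  heads true  s     s'    v       p q = q
  heads false true  true  v       p q = refl
  heads false false false v       p q = refl
  heads false true  false zero    () q
  heads false true  false (suc v) p ()
  heads false false true  zero    () q
  heads false false true  (suc v) p ()
  same : ∀ b s s' → lw b s (car 0 bs ss) ≡ lw b s' (car 0 bs' ss') → ub b s (car 0 bs ss) ≡ ub b s' (car 0 bs' ss') →
    size bs ≡ size bs' → b ∷ bs ≡ b ∷ bs' × s ∷ ss ≡ s' ∷ ss'
  same b s s' p q e rewrite sym (cr e) = cong (b ∷_) (proj₁ (tails e)) , cong₂ _∷_ (heads b s s' _ p q) (proj₂ (tails e))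
  half : ∀ {n} (b s b' s' : Vec Bool n) x y → upp 0 b s ≡ upp 0 b' s' → true ≡ lw false y (car 0 b' s') →
    x ≡ ub false y (car 0 b' s') → suc (size b) ≡ size b' → ⊥
  half b s b' s' x false u () q e
  half b s b' s' x true u p q e with car 0 b' s' in c
  ... | zero = absurd b s b' s' u c e
  half b s b' s' x true u () q e | suc _
  go : ∀ b s b' s' → lw b s (car 0 bs ss) ≡ lw b' s' (car 0 bs' ss') → ub b s (car 0 bs ss) ≡ ub b' s' (car 0 bs' ss') →
    tw b + size bs ≡ tw b' + size bs' → b ∷ bs ≡ b' ∷ bs' × s ∷ ss ≡ s' ∷ ss'
  go true  s true  s' p q e = same true s s' p q (suc-injective e)
  go false s false s' p q e = same false s s' p q e
  go true  s false s' p q e = ⊥-elim (half bs ss bs' ss' s s' tu p q e)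
  go false s true  s' p q e = ⊥-elim (half bs' ss' bs ss s' s (sym tu) (sym p) (sym q) (sym e))

opE-inj : ∀ {n} (b b' : Vec Bool n) X X' → opE (b ∷ X) ≡ opE (b' ∷ X') → size b ≡ size b' → b ≡ b' × X ≡ X'
opE-inj b b' []      []        e z = ∷-injectiveˡ e , refl
opE-inj b b' (s ∷ X) (s' ∷ X') e z with E-inj b s b' s' (∷-injectiveˡ e) (∷-injectiveˡ (∷-injectiveʳ e)) z
... | p , q = p , cong₂ _∷_ q (∷-injectiveʳ (∷-injectiveʳ e))
opE-inj b b' []      (s' ∷ X') () z
opE-inj b b' (s ∷ X) []        () z

ins-inj : ∀ {n} i (M M' : Mat n) → sizes M ≡ sizes M' → ins i M ≡ ins i M' → M ≡ M'
ins-inj zero    M       M'        _ e = e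
ins-inj (suc i) []      []        _ e = refl
ins-inj (suc i) (b ∷ M) (b' ∷ M') z e with opE-inj b b' _ _ e (∷-injectiveˡ z)
... | p , q = cong₂ _∷_ p (ins-inj i M M' (∷-injectiveʳ z) q)

stage-inj : ∀ {n} i (M M' : Mat n) → (∀ j → j < i → sizes (stage j M) ≡ sizes (stage j M')) → stage i M ≡ stage i M' → M ≡ M'
stage-inj zero    M M' z e = e
stage-inj (suc i) M M' z e = stage-inj i M M' (λ j p → z j (m≤n⇒m≤1+n p)) (ins-inj (suc i) _ _ (z i ≤-refl) e)

init-size : ∀ {n} (r s : Vec Bool n) → Initial r → Initial s → size r ≡ size s → r ≡ s
init-size [] [] _ _ _ = refl
init-size (true ∷ r) (true ∷ s) i j e = cong (true ∷_) (init-size r s (λ k → i (suc k)) (λ k → j (suc k)) (suc-injective e))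
init-size (false ∷ r) (false ∷ s) i j e = cong (false ∷_) (init-size r s (λ k → i (suc k)) (λ k → j (suc k)) e)
init-size (true ∷ r) (false ∷ s) i j e with trans e (init-zero (false ∷ s) j refl)
... | ()
init-size (false ∷ r) (true ∷ s) i j e with trans (sym e) (init-zero (false ∷ r) i refl)
... | ()

inits-size : ∀ {n} (M M' : Mat n) → AllInitial M → AllInitial M' → sizes M ≡ sizes M' → M ≡ M'
inits-size []      []        _       _         _ = refl
inits-size (r ∷ M) (r' ∷ M') (i , a) (i' , a') e = cong₂ _∷_ (init-size r r' i i' (∷-injectiveˡ e)) (inits-size M M' a a' (∷-injectiveʳ e))
inits-size []      (_ ∷ _)   _       _         ()
inits-size (_ ∷ _) []        _       _         ()

-- At column-highest weight the rows of a collapsed matrix are initial segments, hence fixed by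
-- their sizes. With the sizes of all stages known, the stages can be undone, which identifies the
-- two tops.
common-top : ∀ {n} i (M M' : Mat n) → length M ≤ suc i → (∀ j → j ≤ i → sizes (stage j M) ≡ sizes (stage j M')) →
  ∃ λ A → Path A M × Path A M' × ColHW A
common-top i M M' len z with to-top M | to-top M'
... | A , p , t | A' , p' , t' = A , p , subst (λ X → Path X M') (sym A≡A') p' , t
  where
  inv : ∀ {n} {A B : Mat n} j → Path A B → sizes (stage j A) ≡ sizes (stage j B)
  inv j = path-inv (λ X → sizes (stage j X)) (λ s → step-sizes (m-step (stage-morph j) s))
  zA : ∀ j → j ≤ i → sizes (stage j A) ≡ sizes (stage j A')
  zA j q = trans (inv j p) (trans (z j q) (sym (inv j p')))
  lenS : ∀ {n} (X Y : Mat n) → sizes X ≡ sizes Y → length X ≡ length Y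
  lenS X Y e = trans (sym (LP.length-map size X)) (trans (cong length e) (LP.length-map size Y))
  lenA : length A ≤ suc i
  lenA = ≤-trans (≤-reflexive (path-inv length step-length p)) len
  lenA' : length A' ≤ suc i
  lenA' = ≤-trans (≤-reflexive (sym (lenS A A' (zA 0 z≤n)))) lenA
  topEq : stage i A ≡ stage i A'
  topEq = inits-size _ _ (proj₁ (colTop-hw _ (stage-hw i A lenA) (morph-top (stage-morph i) t)))
                         (proj₁ (colTop-hw _ (stage-hw i A' lenA') (morph-top (stage-morph i) t'))) (zA i ≤-refl)
  A≡A' : A ≡ A'
  A≡A' = stage-inj i A A' (λ j q → zA j (<⇒≤ q)) topEq

-- Label sets and the recovery of the bottom row

empty : ∀ n → Vec Bool n
empty n = Vec.replicate n false

size-empty : ∀ n → size (empty n) ≡ 0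
size-empty zero    = refl
size-empty (suc n) = size-empty n

-- The bottom sites with label at least k + 1, see `fm-sets`; levels are counted from 0. Each queue
-- starts at its stationary length, so that wrapping customers are served as well.
Sset : ∀ {n} → ℕ → Mat n → Vec Bool n
Sset k       []      = empty _
Sset zero    (b ∷ M) = b
Sset (suc k) (b ∷ M) = dep (wraps b (Sset k M)) b (Sset k M)

head : ∀ {n} → Mat n → Vec Bool n
head []      = empty _
head (b ∷ _) = b

bring-Sset : ∀ {n} k (M : Mat n) → k < length M → head (bring k M) ≡ Sset k M
bring-Sset zero    (b ∷ M) _       = refl
bring-Sset (suc k) (b ∷ M) (s≤s p) with bring k M | bring-Sset k M p | k-len (bring-keep k) M
bring-Sset (suc k) (b ∷ y ∷ M) (s≤s p) | s ∷ X | refl | _ = refl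

-- Y together with the leftmost p elements of X \ Y
keep : ∀ {n} → ℕ → Vec Bool n → Vec Bool n → Vec Bool n
keep p       []          []          = []
keep p       (x ∷ X)     (true ∷ Y)  = true ∷ keep p X Y
keep p       (false ∷ X) (false ∷ Y) = false ∷ keep p X Y
keep zero    (true ∷ X)  (false ∷ Y) = false ∷ keep zero X Y
keep (suc p) (true ∷ X)  (false ∷ Y) = true ∷ keep p X Y

-- The departures are the balls of `b` that are matched with balls staying above. The other balls of
-- `low` are unmatched balls of `b` or fallen ones, and in a bracketing every unmatched closing
-- bracket precedes every unmatched opening one; so those of `b` are the leftmost. The carrier
-- counts u waiting customers and p unmatched balls still to come.
keep-E : ∀ {n} u p (b s : Vec Bool n) → car 0 b s ≡ u + p → b ≡ keep p (low 0 b s) (dep u (low 0 b s) (upp 0 b s))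
keep-E u p [] [] e = refl
keep-E u p (true ∷ b) (true ∷ s) e = cong (true ∷_) (keep-E u p b s e)
keep-E u p (false ∷ b) (false ∷ s) e = cong (false ∷_) (keep-E u p b s e)
keep-E zero (suc p) (true ∷ b) (false ∷ s) e = cong (true ∷_) (keep-E zero p b s (suc-injective e))
keep-E zero zero (true ∷ b) (false ∷ s) ()
keep-E (suc u) p (true ∷ b) (false ∷ s) e = cong (true ∷_) (keep-E u p b s (suc-injective e))
keep-E u p (false ∷ b) (true ∷ s) e with car 0 b s in c
keep-E zero    zero    (false ∷ b) (true ∷ s) e  | zero = cong (false ∷_) (keep-E 0 0 b s c)
keep-E zero    (suc p) (false ∷ b) (true ∷ s) () | zero
keep-E (suc u) p       (false ∷ b) (true ∷ s) () | zero
... | suc v = cong (false ∷_) (keep-E (suc u) p b s (trans c (cong suc e)))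

keep-none : ∀ {n} (b : Vec Bool n) → keep (size b) b (dep 0 b (empty n)) ≡ b
keep-none []          = refl
keep-none (true ∷ b)  = cong (true ∷_) (keep-none b)
keep-none (false ∷ b) = cong (false ∷_) (keep-none b)

-- Inverse of `push` on the bottom row, where `c i` is the size of the row being inserted at level
-- i. The difference `c 0 ∸ c 1` is the final carrier of E, the number of inserted balls left
-- without partner.
rebuild : ∀ {n} → Mat n → (ℕ → ℕ) → Vec Bool n
rebuild []      c = empty _
rebuild (r ∷ M) c = keep (c 0 ∸ c 1) r (dep 0 r (rebuild M (λ i → c (suc i))))

pushSize : ∀ {n} → Mat n → ℕ → ℕ
pushSize M i = nth 0 (sizes (push i M)) i

length-0 : ∀ {A : Set} (xs : List A) → length xs ≡ 0 → xs ≡ []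
length-0 [] _ = refl

push-[] : ∀ {n} k → push {n} k [] ≡ []
push-[] k = length-0 _ (k-len (push-keep k) [])

rebuild-push : ∀ {n} k (b : Vec Bool n) M → length M ≤ k → rebuild (push k (b ∷ M)) (pushSize (b ∷ M)) ≡ b
rebuild-push {n} k b [] p = aux k
  where
  aux : ∀ k → rebuild (push k (b ∷ [])) (pushSize (b ∷ [])) ≡ b
  aux zero = keep-none b
  aux (suc k) rewrite push-[] {n} k = keep-none b
rebuild-push (suc k) b (y ∷ M) (s≤s p) =
  trans (cong₂ (λ c z → keep c (low 0 b y) (dep 0 (low 0 b y) z)) ceq (rebuild-push k (upp 0 b y) M p))
        (sym (keep-E 0 (car 0 b y) b y refl))
  where
  ceq : size b ∸ size (upp 0 b y) ≡ car 0 b y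
  ceq = trans (cong (_∸ size (upp 0 b y)) (sym (car-size 0 b y))) (m+n∸n≡m (car 0 b y) (size (upp 0 b y)))

-- The queue serves second-class customers in order of arrival, so it commutes with keep.

dep-keep : ∀ {n} p m k y x' x (B X Y : Vec Bool n) → Sub Y X → x' ≡ m + y → x ≡ k + x' → k ≡ 0 ⊎ p ≡ 0 →
  dep x' B (keep p X Y) ≡ keep (m + p) (dep x B X) (dep y B Y)
-- Invariant: y first-class customers, m second-class customers that are kept and k that are not
-- kept are waiting; x' and x are the lengths of the queues for `keep p X Y` and `X`. Customers that
-- are not kept arrive only after the last kept one, whence `k ≡ 0 ⊎ p ≡ 0`, and the next m + p
-- second-class departures are the kept ones.
dep-keep p m k y x' x [] [] [] _ _ _ _ = refl
dep-keep p m k y x' x (b ∷ B) (false ∷ X) (true ∷ Y) (() , s) e f c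
dep-keep p m k y x' x (false ∷ B) (true ∷ X) (true ∷ Y) (_ , s) e f c =
  cong (false ∷_) (dep-keep p m k (suc y) (suc x') (suc x) B X Y s (trans (cong suc e) (sym (+-suc m y))) (trans (cong suc f) (sym (+-suc k x'))) c)
dep-keep p m k y x' x (true ∷ B) (true ∷ X) (true ∷ Y) (_ , s) e f c = cong (true ∷_) (dep-keep p m k y x' x B X Y s e f c)
dep-keep p m k y x' x (false ∷ B) (false ∷ X) (false ∷ Y) (_ , s) e f c = cong (false ∷_) (dep-keep p m k y x' x B X Y s e f c)
dep-keep zero m k y x' x (false ∷ B) (true ∷ X) (false ∷ Y) (_ , s) e f c =
  cong (false ∷_) (dep-keep 0 m (suc k) y x' (suc x) B X Y s e (cong suc f) (inj₂ refl))
dep-keep (suc p) m .0 y x' x (false ∷ B) (true ∷ X) (false ∷ Y) (_ , s) e f (inj₁ refl) =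
  cong (false ∷_) (trans (dep-keep p (suc m) 0 y (suc x') (suc x) B X Y s (cong suc e) (cong suc f) (inj₁ refl))
                         (cong (λ q → keep q (dep (suc x) B X) (dep y B Y)) (sym (+-suc m p))))
dep-keep (suc p) m k y x' x (false ∷ B) (true ∷ X) (false ∷ Y) _ e f (inj₂ ())
dep-keep p m k (suc y) x' x (true ∷ B) (false ∷ X) (false ∷ Y) (_ , s) e f c rewrite +-suc m y | e | +-suc k (m + y) | f =
  cong (true ∷_) (dep-keep p m k y (m + y) (k + (m + y)) B X Y s refl refl c)
dep-keep p (suc m) k zero x' x (true ∷ B) (false ∷ X) (false ∷ Y) (_ , s) e f c rewrite e | +-suc k (m + 0) | f =
  cong (true ∷_) (dep-keep p m k 0 (m + 0) (k + (m + 0)) B X Y s refl refl c)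
dep-keep p zero zero zero x' x (true ∷ B) (false ∷ X) (false ∷ Y) (_ , s) e f c rewrite e | f =
  cong (false ∷_) (dep-keep p 0 0 0 0 0 B X Y s refl refl c)
dep-keep .0 zero (suc k) zero x' x (true ∷ B) (false ∷ X) (false ∷ Y) (_ , s) e f (inj₂ refl) rewrite e | f =
  cong (false ∷_) (dep-keep 0 0 k 0 0 (k + 0) B X Y s refl refl (inj₂ refl))
dep-keep p zero (suc k) zero x' x (true ∷ B) (false ∷ X) (false ∷ Y) (_ , s) e f (inj₁ ())
dep-keep zero m k (suc y) x' x (true ∷ B) (true ∷ X) (false ∷ Y) (_ , s) e f c rewrite +-suc m y | e | +-suc k (m + y) | f =
  cong (true ∷_) (dep-keep 0 m (suc k) y (m + y) (suc (k + (m + y))) B X Y s refl refl (inj₂ refl))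
dep-keep zero (suc m) k zero x' x (true ∷ B) (true ∷ X) (false ∷ Y) (_ , s) e f c rewrite e | +-suc k (m + 0) | f =
  cong (true ∷_) (dep-keep 0 m (suc k) 0 (m + 0) (suc (k + (m + 0))) B X Y s refl refl (inj₂ refl))
dep-keep zero zero k zero x' x (true ∷ B) (true ∷ X) (false ∷ Y) (_ , s) e f c rewrite e =
  cong (false ∷_) (dep-keep 0 0 k 0 0 x B X Y s refl f (inj₂ refl))
dep-keep (suc p) m .0 (suc y) x' x (true ∷ B) (true ∷ X) (false ∷ Y) (_ , s) e f (inj₁ refl) =
  cong (true ∷_) (trans (dep-keep p (suc m) 0 y x' x B X Y s (trans e (+-suc m y)) f (inj₁ refl))
                        (cong (λ q → keep q (dep x B X) (dep y B Y)) (sym (+-suc m p))))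
dep-keep (suc p) m .0 zero x' x (true ∷ B) (true ∷ X) (false ∷ Y) (_ , s) e f (inj₁ refl) rewrite +-suc m p =
  cong (true ∷_) (dep-keep p m 0 0 x' x B X Y s e f (inj₁ refl))
dep-keep (suc p) m k y x' x (true ∷ B) (true ∷ X) (false ∷ Y) _ e f (inj₂ ())

sub-trans : ∀ {n} (a b c : Vec Bool n) → Sub a b → Sub b c → Sub a c
sub-trans []      []      []      _       _         = tt
sub-trans (_ ∷ a) (_ ∷ b) (_ ∷ c) (p , q) (p' , q') = ≤-trans p p' , sub-trans a b c q q'

sub-empty : ∀ {n} (a : Vec Bool n) → Sub (empty n) a
sub-empty []      = tt
sub-empty (_ ∷ a) = z≤n , sub-empty a

sub-dep : ∀ {n} u (B X : Vec Bool n) → Sub (dep u B X) B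
sub-dep u [] [] = tt
sub-dep u (b ∷ B) (x ∷ X) = l b x u , sub-dep (cq b x u) B X
  where
  l : ∀ b x u → tw (dp b x u) ≤ tw b
  l false x     u       = z≤n
  l true  true  u       = ≤-refl
  l true  false zero    = z≤n
  l true  false (suc u) = ≤-refl

cq-mono : ∀ b x x' {u u'} → tw x ≤ tw x' → u ≤ u' → cq b x u ≤ cq b x' u'
cq-mono true  true  true  _ q = q
cq-mono true  false false _ q = pred-mono-≤ q
cq-mono true  false true  _ q = ≤-trans pred[n]≤n q
cq-mono false true  true  _ q = s≤s q
cq-mono false false false _ q = q
cq-mono false false true  _ q = m≤n⇒m≤1+n q
cq-mono b     true  false () q

dep-mono : ∀ {n} u u' (B X X' : Vec Bool n) → u ≤ u' → Sub X X' → Sub (dep u B X) (dep u' B X')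
dep-mono u u' [] [] [] _ _ = tt
dep-mono u u' (b ∷ B) (x ∷ X) (x' ∷ X') q (p , s) = l b x x' p q , dep-mono _ _ B X X' (cq-mono b x x' p q) s
  where
  l : ∀ b x x' {u u'} → tw x ≤ tw x' → u ≤ u' → tw (dp b x u) ≤ tw (dp b x' u')
  l false x     x'    _ q = z≤n
  l true  true  true  _ q = ≤-refl
  l true  false true  {zero}  _ q = z≤n
  l true  false true  {suc u} _ q = ≤-refl
  l true  false false {zero}  _ q = z≤n
  l true  false false {suc u} _ (s≤s q) = ≤-refl
  l true  true  false () q

sub-keep : ∀ {n} p (X Y : Vec Bool n) → Sub Y X → Sub (keep p X Y) X
sub-keep p [] [] _ = tt
sub-keep p (true ∷ X) (true ∷ Y) (_ , s) = ≤-refl , sub-keep p X Y s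
sub-keep p (false ∷ X) (true ∷ Y) (() , s)
sub-keep p (false ∷ X) (false ∷ Y) (_ , s) = ≤-refl , sub-keep p X Y s
sub-keep zero (true ∷ X) (false ∷ Y) (_ , s) = z≤n , sub-keep 0 X Y s
sub-keep (suc p) (true ∷ X) (false ∷ Y) (_ , s) = ≤-refl , sub-keep p X Y s

que-dom : ∀ {n} u (b s : Vec Bool n) → Dom b s → u + size s ≤ size b → que u b s ≡ 0
que-dom u [] [] _ q = n≤0⇒n≡0 (subst (_≤ 0) (+-identityʳ u) q)
que-dom u (true ∷ b) (true ∷ s) (d , _) q = que-dom u b s d (s≤s⁻¹ (subst (_≤ suc (size b)) (+-suc u (size s)) q))
que-dom u (false ∷ b) (true ∷ s) (d , _) q = que-dom (suc u) b s d (subst (_≤ size b) (+-suc u (size s)) q)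
que-dom u (false ∷ b) (false ∷ s) (d , _) q = que-dom u b s d q
que-dom zero (true ∷ b) (false ∷ s) (d , _) q = que-dom 0 b s d (dom-size b s d)
que-dom (suc u) (true ∷ b) (false ∷ s) (d , _) q = que-dom u b s d (s≤s⁻¹ q)

wraps-dom : ∀ {n} (b s : Vec Bool n) → Dom b s → wraps b s ≡ 0
wraps-dom b s d = que-dom 0 b s d (dom-size b s d)

Lset : ∀ {n} → ℕ → Mat n → Vec Bool n
Lset k       []      = empty _
Lset zero    (b ∷ M) = b
Lset (suc k) (b ∷ M) = dep 0 b (Lset k M)

lset-sub : ∀ {n} k (M : Mat n) → Sub (Lset k M) (head M)
lset-sub k       []      = sub-empty (empty _)
lset-sub zero    (b ∷ M) = sub-refl b
lset-sub (suc k) (b ∷ M) = sub-dep 0 b (Lset k M)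

hw-head : ∀ {n} (b : Vec Bool n) M → HW (b ∷ M) → Dom b (head M)
hw-head b [] h = sub-dom (empty _) b (sub-empty b)
hw-head b (_ ∷ _) h = proj₁ h

sset-lset : ∀ {n} k (M : Mat n) → HW M → Sset k M ≡ Lset k M
sset-lset k       []      h = refl
sset-lset zero    (b ∷ M) h = refl
sset-lset (suc k) (b ∷ M) h rewrite sset-lset k M (hw-tail b M h) = cong (λ u → dep u b (Lset k M)) (wraps-dom b (Lset k M)
  (dom-trans b (head M) (Lset k M) (hw-head b M h) (sub-dom _ _ (lset-sub k M))))

lset-nest : ∀ {n} k (M : Mat n) → Sub (Lset (suc k) M) (Lset k M)
lset-nest k       []      = sub-refl _
lset-nest zero    (b ∷ M) = sub-dep 0 b (Lset 0 M)
lset-nest (suc k) (b ∷ M) = dep-mono 0 0 b _ _ z≤n (lset-nest k M)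

-- The value of `rebuild` after all queues have been moved inwards past `keep`: what remains of the
-- matrix is the family of its label sets in the bottom row, see `rebuild-relabel`.
relabel : ∀ {n} → ℕ → (ℕ → Vec Bool n) → (ℕ → ℕ) → Vec Bool n
relabel zero    U c = empty _
relabel (suc L) U c = keep (c 0 ∸ c 1) (U 0) (relabel L (λ i → U (suc i)) (λ i → c (suc i)))

relabel-sub : ∀ {n} L (U : ℕ → Vec Bool n) c → (∀ i → Sub (U (suc i)) (U i)) → Sub (relabel L U c) (U 0)
relabel-sub zero    U c h = sub-empty _
relabel-sub (suc L) U c h = sub-keep (c 0 ∸ c 1) (U 0) _ (sub-trans _ _ _ (relabel-sub L _ _ (λ i → h (suc i))) (h 0))

dep-empty : ∀ {n} (B : Vec Bool n) → dep 0 B (empty n) ≡ empty n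
dep-empty []          = refl
dep-empty (true ∷ B)  = cong (false ∷_) (dep-empty B)
dep-empty (false ∷ B) = cong (false ∷_) (dep-empty B)

dep-relabel : ∀ {n} L (B : Vec Bool n) (U : ℕ → Vec Bool n) c → (∀ i → Sub (U (suc i)) (U i)) →
  dep 0 B (relabel L U c) ≡ relabel L (λ i → dep 0 B (U i)) c
dep-relabel zero    B U c h = dep-empty B
dep-relabel (suc L) B U c h =
  trans (dep-keep (c 0 ∸ c 1) 0 0 0 0 0 B (U 0) _ (sub-trans _ _ _ (relabel-sub L _ _ (λ i → h (suc i))) (h 0)) refl refl (inj₁ refl))
        (cong (keep (c 0 ∸ c 1) (dep 0 B (U 0))) (dep-relabel L B (λ i → U (suc i)) _ (λ i → h (suc i))))

rebuild-relabel : ∀ {n} (M : Mat n) c → rebuild M c ≡ relabel (length M) (λ i → Lset i M) c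
rebuild-relabel []      c = refl
rebuild-relabel (b ∷ M) c = cong (keep (c 0 ∸ c 1) b)
  (trans (cong (dep 0 b) (rebuild-relabel M _)) (dep-relabel (length M) b (λ i → Lset i M) _ (λ i → lset-nest i M)))

relabel-cong : ∀ {n} L (U V : ℕ → Vec Bool n) c d → (∀ i → U i ≡ V i) → (∀ i → c i ≡ d i) → relabel L U c ≡ relabel L V d
relabel-cong zero    U V c d p q = refl
relabel-cong (suc L) U V c d p q rewrite q 0 | q 1 | p 0 =
  cong (keep (d 0 ∸ d 1) (V 0)) (relabel-cong L _ _ _ _ (λ i → p (suc i)) (λ i → q (suc i)))

-- All arguments of relabel other than the label sets of the collapsed matrix are invariant under steps.
bottom-row : ∀ {n} L (X : Mat n) → length X ≡ suc L →
  head X ≡ relabel (suc L) (λ i → Sset i (coll (suc L) X)) (pushSize (under (coll L) X))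
bottom-row L (b ∷ M) e = sym (trans (relabel-cong (suc L) _ _ c c (λ i → sset-lset i C (coll-hw (suc L) (b ∷ M) (≤-reflexive e))) (λ _ → refl))
  (trans (cong (λ l → relabel l (λ i → Lset i C) c) (sym (trans (k-len (coll-keep (suc L)) (b ∷ M)) e)))
  (trans (sym (rebuild-relabel C c)) (rebuild-push L b (coll L M) (≤-reflexive (trans (k-len (coll-keep L) M) (suc-injective e)))))))
  where
  C = coll (suc L) (b ∷ M)
  c = pushSize (under (coll L) (b ∷ M))

-- Once R has moved row k + 1 to the bottom, `bottom-row` computes `Sset k M` from the label sets of
-- the collapse, which `coll-bring` leaves unchanged, and from row sizes that are constant along
-- paths, hence equal because of the common top `A`.
sets-determined : ∀ {n} L (M M' A : Mat n) → length M ≡ suc L → Path A M → Path A M' →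
  (∀ i → Sset i (coll (suc L) M) ≡ Sset i (coll (suc L) M')) → ∀ k → k < suc L → Sset k M ≡ Sset k M'
sets-determined {n} L M M' A e p p' h k lt = trans (sym (bring-Sset k M (≤-trans lt (≤-reflexive (sym e)))))
  (trans (bottom-row L X (trans (k-len (bring-keep k) M) e))
  (trans (relabel-cong (suc L) _ _ _ _ (λ i → trans (cong (Sset i) (cb M e)) (trans (h i) (sym (cong (Sset i) (cb M' e'))))) cs)
  (trans (sym (bottom-row L X' (trans (k-len (bring-keep k) M') e'))) (bring-Sset k M' (≤-trans lt (≤-reflexive (sym e')))))))
  where
  X = bring k M
  X' = bring k M'
  e' : length M' ≡ suc L
  e' = trans (sym (path-inv length step-length p')) (trans (path-inv length step-length p) e)
  cb : ∀ M → length M ≡ suc L → coll (suc L) (bring k M) ≡ coll (suc L) M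
  cb M q = subst (λ l → coll l (bring k M) ≡ coll l M) q (coll-bring M k)
  inv : ∀ i {A B : Mat n} → Path A B → pushSize (under (coll L) (bring k A)) i ≡ pushSize (under (coll L) (bring k B)) i
  inv i = path-inv (λ Y → pushSize (under (coll L) (bring k Y)) i) (λ s → cong (λ z → nth 0 z i)
    (step-sizes (m-step (push-morph i) (m-step (under-morph (coll-morph L)) (m-step (bring-morph k) s)))))
  cs : ∀ i → pushSize (under (coll L) X) i ≡ pushSize (under (coll L) X') i
  cs i = trans (sym (inv i p)) (inv i p')

-- Energies

Wk : ∀ {n} → ℕ → Mat n → ℕ
Wk k       []      = 0
Wk zero    (b ∷ M) = 0
Wk (suc k) (b ∷ M) = Wk k M + wraps b (Sset k M)

sumTo : ℕ → (ℕ → ℕ) → ℕ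
sumTo zero    f = 0
sumTo (suc k) f = f 0 + sumTo k (λ i → f (suc i))

sumTo-cong : ∀ k {f g : ℕ → ℕ} → (∀ i → i < k → f i ≡ g i) → sumTo k f ≡ sumTo k g
sumTo-cong zero    h = refl
sumTo-cong (suc k) h = cong₂ _+_ (h 0 (s≤s z≤n)) (sumTo-cong k (λ i p → h (suc i) (s≤s p)))

sumTo-+ : ∀ k (f g : ℕ → ℕ) → sumTo k (λ i → f i + g i) ≡ sumTo k f + sumTo k g
sumTo-+ zero    f g = refl
sumTo-+ (suc k) f g = trans (cong (f 0 + g 0 +_) (sumTo-+ k _ _)) (+-mid (f 0) (g 0) _ _)

-- A wrap of label ℓ out of row r has weight ℓ - r + 1, the number of thresholds k with r ≤ k ≤ ℓ.
-- So maj is a sum of queue wraps, one queue for each pair of adjacent rows and each threshold.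
majA : ∀ {n} → Mat n → ℕ
majA []      = 0
majA (b ∷ M) = majA M + sumTo (length M) (λ k → wraps b (Sset k M))

majA-Wk : ∀ {n} (M : Mat n) → majA M ≡ sumTo (length M) (λ k → Wk k M)
majA-Wk []      = refl
majA-Wk (b ∷ M) = trans (cong (_+ sumTo (length M) (λ k → wraps b (Sset k M))) (majA-Wk M))
  (sym (sumTo-+ (length M) (λ k → Wk k M) _))

-- Applying R above the bottom row makes `Sset k M` the second row, so every summand is a `wraps₁₂`
-- of the image under a morphism.
step-Wk : ∀ {n j} k {M M' : Mat n} → k < length M → Step j M M' → Wk k M ≡ Wk k M'
step-Wk zero    lt (act _ _) = refl
step-Wk zero    lt (skip _ _) = refl
step-Wk {n} {j} (suc k) {b ∷ M} {b' ∷ M'} (s≤s lt) st = cong₂ _+_ (tl lt st)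
  (trans (sym (l b M lt)) (trans (step-wraps (m-step (under-morph (bring-morph k)) st)) (l b' M' (subst (k <_) (suc-injective (step-length st)) lt))))
  where
  l : ∀ (b : Vec Bool n) M → k < length M → wraps₁₂ (under (bring k) (b ∷ M)) ≡ wraps b (Sset k M)
  l b M p with bring k M | bring-Sset k M p | k-len (bring-keep k) M
  l b (_ ∷ M) p | s ∷ X | refl | _ = refl
  l b (_ ∷ M) p | [] | _ | ()
  l b [] () | _ | _ | _
  tl : ∀ {b b' M M'} → k < length M → Step j (b ∷ M) (b' ∷ M') → Wk k M ≡ Wk k M'
  tl p (act _ _)  = refl
  tl p (skip _ s) = step-Wk k p s

path-majA : ∀ {n} {A B : Mat n} → Path A B → majA A ≡ majA B
path-majA stop = refl
path-majA {A = A} (_▸_ {B = B} {C} p s) = trans (path-majA p) (trans (majA-Wk B) (trans (sumTo-cong (length B) (λ k lt → step-Wk k lt s))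
  (trans (cong (λ l → sumTo l (λ k → Wk k C)) (step-length s)) (sym (majA-Wk C)))))

-- Adding empty columns

toN-empty : ∀ k → Vec.zipWith _+_ (toN (empty k)) (Vec.replicate k 0) ≡ Vec.replicate k 0
toN-empty zero    = refl
toN-empty (suc k) = cong (0 ∷_) (toN-empty k)

que-empty : ∀ {k} u → que u (empty k) (empty k) ≡ u
que-empty {zero}  u = refl
que-empty {suc k} u = que-empty {k} u

dep-empty′ : ∀ {k} u → dep u (empty k) (empty k) ≡ empty k
dep-empty′ {zero}  u = refl
dep-empty′ {suc k} u = cong (false ∷_) (dep-empty′ {k} u)

car-empty : ∀ {k} → car 0 (empty k) (empty k) ≡ 0
car-empty {zero}  = refl
car-empty {suc k} = car-empty {k}

low-empty : ∀ {k} → low 0 (empty k) (empty k) ≡ empty k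
low-empty {zero}  = refl
low-empty {suc k} = cong (false ∷_) (low-empty {k})

upp-empty : ∀ {k} → upp 0 (empty k) (empty k) ≡ empty k
upp-empty {zero}  = refl
upp-empty {suc k} = cong (false ∷_) (upp-empty {k})

module _ (m : ℕ) where

  pad : ∀ {n} → Vec Bool n → Vec Bool (n + m)
  pad r = r Vec.++ empty m

  padM : ∀ {n} → Mat n → Mat (n + m)
  padM = map pad

  que-pad : ∀ {n} u (b s : Vec Bool n) → que u (pad b) (pad s) ≡ que u b s
  que-pad u []      []      = que-empty {m} u
  que-pad u (b ∷ bs) (s ∷ ss) = que-pad (cq b s u) bs ss

  dep-pad : ∀ {n} u (b s : Vec Bool n) → dep u (pad b) (pad s) ≡ pad (dep u b s)
  dep-pad u []      []      = dep-empty′ {m} u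
  dep-pad u (b ∷ bs) (s ∷ ss) = cong (dp b s u ∷_) (dep-pad (cq b s u) bs ss)

  car-pad : ∀ {n} (b s : Vec Bool n) → car 0 (pad b) (pad s) ≡ car 0 b s
  car-pad []      []      = car-empty {m}
  car-pad (b ∷ bs) (s ∷ ss) = cong (cv b s) (car-pad bs ss)

  low-pad : ∀ {n} (b s : Vec Bool n) → low 0 (pad b) (pad s) ≡ pad (low 0 b s)
  low-pad []      []      = low-empty {m}
  low-pad (b ∷ bs) (s ∷ ss) = cong₂ _∷_ (cong (lw b s) (car-pad bs ss)) (low-pad bs ss)

  upp-pad : ∀ {n} (b s : Vec Bool n) → upp 0 (pad b) (pad s) ≡ pad (upp 0 b s)
  upp-pad []      []      = upp-empty {m}
  upp-pad (b ∷ bs) (s ∷ ss) = cong₂ _∷_ (cong (ub b s) (car-pad bs ss)) (upp-pad bs ss)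

  empty-pad : ∀ {n} → empty (n + m) ≡ pad (empty n)
  empty-pad {zero}  = refl
  empty-pad {suc n} = cong (false ∷_) (empty-pad {n})

  Sset-pad : ∀ {n} k (M : Mat n) → Sset k (padM M) ≡ pad (Sset k M)
  Sset-pad {n} k     []      = empty-pad {n}
  Sset-pad zero    (b ∷ M) = refl
  Sset-pad (suc k) (b ∷ M) rewrite Sset-pad k M | que-pad 0 b (Sset k M) = dep-pad _ b (Sset k M)

  majA-pad : ∀ {n} (M : Mat n) → majA (padM M) ≡ majA M
  majA-pad []      = refl
  majA-pad (b ∷ M) = cong₂ _+_ (majA-pad M) (trans (cong (λ l → sumTo l (λ k → wraps (pad b) (Sset k (padM M)))) (LP.length-map pad M))
    (sumTo-cong (length M) (λ k _ → trans (cong (wraps (pad b)) (Sset-pad k M)) (que-pad 0 b (Sset k M)))))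

  opE-pad : ∀ {n} (M : Mat n) → opE (padM M) ≡ padM (opE M)
  opE-pad []          = refl
  opE-pad (_ ∷ [])    = refl
  opE-pad (b ∷ s ∷ M) = cong₂ (λ x y → x ∷ y ∷ padM M) (low-pad b s) (upp-pad b s)

  ins-pad : ∀ {n} i (M : Mat n) → ins i (padM M) ≡ padM (ins i M)
  ins-pad zero    M       = refl
  ins-pad (suc i) []      = refl
  ins-pad (suc i) (b ∷ M) = trans (cong (λ X → opE (pad b ∷ X)) (ins-pad i M)) (opE-pad (b ∷ ins i M))

  stage-pad : ∀ {n} i (M : Mat n) → stage i (padM M) ≡ padM (stage i M)
  stage-pad zero    M = refl
  stage-pad (suc i) M = trans (cong (ins (suc i)) (stage-pad i M)) (ins-pad (suc i) (stage i M))

  size-pad : ∀ {n} (r : Vec Bool n) → size (pad r) ≡ size r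
  size-pad []      = size-empty m
  size-pad (b ∷ r) = cong (tw b +_) (size-pad r)

  sizes-pad : ∀ {n} (M : Mat n) → sizes (padM M) ≡ sizes M
  sizes-pad []      = refl
  sizes-pad (r ∷ M) = cong₂ _∷_ (size-pad r) (sizes-pad M)

  pad-inj : ∀ {n} (r s : Vec Bool n) → pad r ≡ pad s → r ≡ s
  pad-inj []      []      _ = refl
  pad-inj (a ∷ r) (b ∷ s) e = cong₂ _∷_ (VP.∷-injectiveˡ e) (pad-inj r s (VP.∷-injectiveʳ e))

  padM-inj : ∀ {n} (M M' : Mat n) → padM M ≡ padM M' → M ≡ M'
  padM-inj []      []        _ = refl
  padM-inj (r ∷ M) (r' ∷ M') e = cong₂ _∷_ (pad-inj r r' (∷-injectiveˡ e)) (padM-inj M M' (∷-injectiveʳ e))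
  padM-inj []      (_ ∷ _)   ()
  padM-inj (_ ∷ _) []        ()

  -- A column of weight 0 is empty. This serves for preimages under `stage`, which have the weight
  -- of their image.
  unpad : ∀ {n} (M : Mat (n + m)) (w : Vec ℕ n) → wt M ≡ w Vec.++ Vec.replicate m 0 → ∃ λ M' → M ≡ padM {n} M'
  unpad [] w e = [] , refl
  unpad {n} (r ∷ M) w e with split n r (wt M) w e
    where
    zeros : ∀ {k} (r : Vec Bool k) W → Vec.zipWith _+_ (toN r) W ≡ Vec.replicate k 0 → r ≡ empty k × W ≡ Vec.replicate k 0
    zeros [] [] e = refl , refl
    zeros (false ∷ r) (x ∷ W) e with zeros r W (VP.∷-injectiveʳ e)
    ... | p , q = cong (false ∷_) p , cong₂ _∷_ (VP.∷-injectiveˡ e) q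
    zeros (true ∷ r) (x ∷ W) ()
    split : ∀ n (r : Vec Bool (n + m)) W w → Vec.zipWith _+_ (toN r) W ≡ w Vec.++ Vec.replicate m 0 →
      (∃ λ r' → r ≡ pad {n} r') × ∃ λ w' → W ≡ w' Vec.++ Vec.replicate m 0
    split zero r W [] e with zeros r W e
    ... | p , q = ([] , p) , [] , q
    split (suc n) (a ∷ r) (x ∷ W) (y ∷ w) e with split n r W w (VP.∷-injectiveʳ e)
    ... | (r' , p) , w' , q = (a ∷ r' , cong (a ∷_) p) , x ∷ w' , cong (x ∷_) q
  ... | (r' , p) , w' , q with unpad M w' q
  ... | M' , e' = r' ∷ M' , cong₂ _∷_ p e'

  wt-pad : ∀ {n} (M : Mat n) → wt (padM M) ≡ wt M Vec.++ Vec.replicate m 0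
  wt-pad {n} [] = l n
    where
    l : ∀ n → Vec.replicate (n + m) 0 ≡ Vec.replicate n 0 Vec.++ Vec.replicate m 0
    l zero    = refl
    l (suc n) = cong (0 ∷_) (l n)
  wt-pad (r ∷ M) = trans (cong (Vec.zipWith _+_ (toN (pad r))) (wt-pad M)) (l r (wt M))
    where
    l : ∀ {n} (r : Vec Bool n) w → Vec.zipWith _+_ (toN (pad r)) (w Vec.++ Vec.replicate m 0) ≡ Vec.zipWith _+_ (toN r) w Vec.++ Vec.replicate m 0
    l []      []      = toN-empty m
    l (b ∷ r) (x ∷ w) = cong (tw b + x ∷_) (l r w)

-- Conservation, coupling and greediness of queues

cq-dp : ∀ b s u → cq b s u + tw (dp b s u) ≡ u + tw s
cq-dp false true u = trans (+-identityʳ (suc u)) (+-comm 1 u)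
cq-dp false false u = refl
cq-dp true true u = refl
cq-dp true false zero = refl
cq-dp true false (suc u) = trans (+-comm u 1) (sym (+-identityʳ (suc u)))

que-total : ∀ {n} u (b s : Vec Bool n) → que u b s + size (dep u b s) ≡ u + size s
que-total u [] [] = refl
que-total u (b ∷ bs) (s ∷ ss) = trans (sym (+-assoc (que u' bs ss) (tw (dp b s u)) _)) (trans (cong (_+ size (dep u' bs ss)) (+-comm (que u' bs ss) (tw (dp b s u))))
  (trans (+-assoc (tw (dp b s u)) _ _) (trans (cong (tw (dp b s u) +_) (que-total u' bs ss)) (trans (sym (+-assoc (tw (dp b s u)) u' (size ss)))
  (trans (cong (_+ size ss) (trans (+-comm (tw (dp b s u)) u') (cq-dp b s u))) (+-assoc u (tw s) _))))))
  where
  u' = cq b s u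

que-mono : ∀ {n} {u u'} (b s : Vec Bool n) → u ≤ u' → que u b s ≤ que u' b s
que-mono [] [] p = p
que-mono (b ∷ bs) (s ∷ ss) p = que-mono bs ss (cq-mono b s s ≤-refl p)

-- Either the two queues couple, or the longer one is never idle.
couple : ∀ {n} {u u'} (b s : Vec Bool n) → u' ≤ u → que u b s ≡ que u' b s ⊎ que u b s + size b ≡ u + size s
couple [] [] p = inj₂ refl
couple {u = u} (true ∷ b) (true ∷ s) p with couple b s p
... | inj₁ e = inj₁ e
... | inj₂ e = inj₂ (trans (+-suc _ (size b)) (trans (cong suc e) (sym (+-suc u (size s)))))
couple {u = u} (false ∷ b) (true ∷ s) p with couple b s (s≤s p)
... | inj₁ e = inj₁ e
... | inj₂ e = inj₂ (trans e (sym (+-suc u (size s))))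
couple (false ∷ b) (false ∷ s) p = couple b s p
couple {u = zero} {zero} (true ∷ b) (false ∷ s) p = inj₁ refl
couple {u = suc u} (true ∷ b) (false ∷ s) p with couple {u = u} b s (pred-mono-≤ p)
... | inj₁ e = inj₁ e
... | inj₂ e = inj₂ (trans (+-suc _ (size b)) (cong suc e))

-- If the queue started at `wraps b s` couples with the one started empty, both end at `wraps b s`.
-- Otherwise it is never idle, and with at least as many services as arrivals it cannot end longer
-- than it began; monotonicity gives the other inequality.
que-fix : ∀ {n} (b s : Vec Bool n) → size s ≤ size b → que (wraps b s) b s ≡ wraps b s
que-fix b s p with couple {u = wraps b s} {0} b s z≤n
... | inj₁ e = e
... | inj₂ e = ≤-antisym (+-cancelʳ-≤ (size b) _ _ (≤-trans (≤-reflexive e) (+-monoʳ-≤ (wraps b s) p))) (que-mono b s z≤n)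

size-dep : ∀ {n} (b s : Vec Bool n) → size s ≤ size b → size (dep (wraps b s) b s) ≡ size s
size-dep b s p = +-cancelˡ-≡ (wraps b s) _ _ (trans (cong (_+ size (dep (wraps b s) b s)) (sym (que-fix b s p))) (que-total (wraps b s) b s))

pre : ∀ {n} → ℕ → Vec Bool n → ℕ
pre zero    _       = 0
pre (suc c) []      = 0
pre (suc c) (b ∷ r) = tw b + pre c r

pre-all : ∀ {n} (r : Vec Bool n) → pre n r ≡ size r
pre-all []      = refl
pre-all (b ∷ r) = cong (tw b +_) (pre-all r)

pre-dep : ∀ {n} u (b s : Vec Bool n) c → pre c (dep u b s) ≤ u + pre c s
pre-dep u b s zero = z≤n
pre-dep u [] [] (suc c) = z≤n
pre-dep u (b ∷ bs) (s ∷ ss) (suc c) = ≤-trans (+-monoʳ-≤ (tw (dp b s u)) (pre-dep (cq b s u) bs ss c))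
  (≤-reflexive (trans (sym (+-assoc (tw (dp b s u)) _ _)) (trans (cong (_+ pre c ss) (trans (+-comm (tw (dp b s u)) _) (cq-dp b s u))) (+-assoc u (tw s) _))))

-- The numbers `p` and `q` collect the prefix counts already passed and the offsets. The set `z` can
-- gain on the departures only at an idle service; there the queue is empty, and the hypothesis for
-- the prefix ending in this column is the bound required.
greedy : ∀ {n} u p q (b S z : Vec Bool n) → Sub z b → p ≤ q → (∀ c → pre c z + p ≤ u + pre c S + q) →
  ∀ c → pre c z + p ≤ pre c (dep u b S) + q
greedy u p q b S z s g h zero = g
greedy u p q [] [] [] s g h (suc c) = g
greedy u p q (b ∷ bs) (x ∷ S) (y ∷ z) (sy , s) g h (suc c) =
  ≤-trans (≤-reflexive (rot (tw y) (pre c z) p)) (≤-trans (greedy (cq b x u) (tw y + p) (tw (dp b x u) + q) bs S z s g' h' c)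
    (≤-reflexive (sym (rot (tw (dp b x u)) _ q))))
  where
  rot : ∀ a b c → a + b + c ≡ b + (a + c)
  rot a b c = trans (cong (_+ c) (+-comm a b)) (+-assoc b a c)
  g'' : ∀ y b x u → tw y ≤ tw b → tw y + 0 + p ≤ u + (tw x + 0) + q → tw y + p ≤ tw (dp b x u) + q
  g'' false b x u _ _ = ≤-trans g (m≤n+m q _)
  g'' true true true u _ _ = s≤s g
  g'' true true false zero _ k = k
  g'' true true false (suc u) _ _ = s≤s g
  g'' true false x u () _
  g' : tw y + p ≤ tw (dp b x u) + q
  g' = g'' y b x u sy (h 1)
  h' : ∀ c → pre c z + (tw y + p) ≤ cq b x u + pre c S + (tw (dp b x u) + q)
  h' c = ≤-trans (≤-reflexive (sym (rot (tw y) (pre c z) p))) (≤-trans (h (suc c)) (≤-reflexive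
    (trans (cong (_+ q) (trans (sym (+-assoc u (tw x) _)) (trans (cong (_+ pre c S) (sym (cq-dp b x u))) (trans (+-assoc (cq b x u) _ _)
      (trans (cong (cq b x u +_) (+-comm (tw (dp b x u)) (pre c S))) (sym (+-assoc (cq b x u) _ _))))))) (+-assoc (cq b x u + pre c S) _ q))))

-- The greedy queue stays ahead of any other system z of positions in b, wraps included.
ahead : ∀ {n} W V v (b S x z : Vec Bool n) → size S ≤ size b → size z ≡ size S → Sub z b →
  (∀ c → pre c x + W ≤ pre c S + V) → (∀ c → pre c z ≤ v + pre c x) →
  ∀ c → pre c z + (W + wraps b S) ≤ pre c (dep (wraps b S) b S) + (V + v)
ahead {n} W V v b S x z p e s h f = greedy H (W + H) (V + v) b S z s start (λ c → ≤-trans (≤-reflexive (l1 (pre c z))) (≤-trans (+-monoʳ-≤ H (hyp c)) (≤-reflexive (sym (+-assoc H _ _)))))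
  where
  H = wraps b S
  l1 : ∀ a → a + (W + H) ≡ H + (a + W)
  l1 a = trans (sym (+-assoc a W H)) (+-comm (a + W) H)
  hyp : ∀ c → pre c z + W ≤ pre c S + (V + v)
  hyp c = ≤-trans (+-monoˡ-≤ W (f c)) (≤-trans (≤-reflexive (+-assoc v _ W)) (≤-trans (+-monoʳ-≤ v (h c)) (≤-reflexive (trans (+-comm v _) (+-assoc (pre c S) V v)))))
  start0 : size z + W ≤ size (dep 0 b S) + (V + v)
  start0 = subst₂ (λ a b → a + W ≤ b + (V + v)) (pre-all z) (pre-all (dep 0 b S)) (greedy 0 W (V + v) b S z s (hyp 0) hyp n)
  start : W + H ≤ V + v
  start = +-cancelˡ-≤ (size (dep 0 b S)) _ _ (≤-trans (≤-reflexive (trans (cong (size (dep 0 b S) +_) (+-comm W H)) (trans (sym (+-assoc (size (dep 0 b S)) H W))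
    (cong (_+ W) (trans (+-comm (size (dep 0 b S)) H) (trans (que-total 0 b S) (sym e))))))) start0)

-- Rows as sets of columns, and their reversal

vecOf : ∀ n → (ℕ → Bool) → Vec Bool n
vecOf zero    f = []
vecOf (suc n) f = f 0 ∷ vecOf n (λ i → f (suc i))

at-vecOf : ∀ n f i → i < n → at i (vecOf n f) ≡ f i
at-vecOf (suc n) f zero    _       = refl
at-vecOf (suc n) f (suc i) (s≤s p) = at-vecOf n (λ i → f (suc i)) i p

ext : ∀ {n} (r s : Vec Bool n) → (∀ i → i < n → at i r ≡ at i s) → r ≡ s
ext []      []      h = refl
ext (a ∷ r) (b ∷ s) h = cong₂ _∷_ (h 0 (s≤s z≤n)) (ext r s (λ i p → h (suc i) (s≤s p)))

at-big : ∀ {n} i (r : Vec Bool n) → n ≤ i → at i r ≡ false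
at-big i       []      _       = refl
at-big (suc i) (_ ∷ r) (s≤s p) = at-big i r p

put : ∀ {n} → ℕ → Vec Bool n → Vec Bool n
put _       []      = []
put zero    (_ ∷ r) = true ∷ r
put (suc i) (b ∷ r) = b ∷ put i r

at-put : ∀ {n} i (r : Vec Bool n) → i < n → at i (put i r) ≡ true
at-put zero    (_ ∷ r) _       = refl
at-put (suc i) (_ ∷ r) (s≤s p) = at-put i r p

at-put-≢ : ∀ {n} i j (r : Vec Bool n) → i ≢ j → at i (put j r) ≡ at i r
at-put-≢ i       j       []      _ = refl
at-put-≢ zero    zero    (_ ∷ r) h = ⊥-elim (h refl)
at-put-≢ zero    (suc j) (_ ∷ r) h = refl
at-put-≢ (suc i) zero    (_ ∷ r) h = refl
at-put-≢ (suc i) (suc j) (_ ∷ r) h = at-put-≢ i j r (λ e → h (cong suc e))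

size-put : ∀ {n} i (r : Vec Bool n) → i < n → at i r ≡ false → size (put i r) ≡ suc (size r)
size-put zero    (false ∷ r) _       _ = refl
size-put (suc i) (b ∷ r)     (s≤s p) e = trans (cong (tw b +_) (size-put i r p e)) (+-suc (tw b) _)

sub-at : ∀ {n} (a b : Vec Bool n) → Sub a b → ∀ i → at i a ≡ true → at i b ≡ true
sub-at []          []          _       i       ()
sub-at (true ∷ a)  (true ∷ b)  _       zero    _ = refl
sub-at (true ∷ a)  (false ∷ b) (() , _) zero    _
sub-at (false ∷ a) (_ ∷ b)     _       zero    ()
sub-at (_ ∷ a)     (_ ∷ b)     (_ , s) (suc i) e = sub-at a b s i e

at-sub : ∀ {n} (a b : Vec Bool n) → (∀ i → at i a ≡ true → at i b ≡ true) → Sub a b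
at-sub []          []          h = tt
at-sub (false ∷ a) (_ ∷ b)     h = z≤n , at-sub a b (λ i → h (suc i))
at-sub (true ∷ a)  (true ∷ b)  h = ≤-refl , at-sub a b (λ i → h (suc i))
at-sub (true ∷ a)  (false ∷ b) h with h 0 refl
... | ()

rev : ∀ {n} → Vec Bool n → Vec Bool n
rev {n} r = vecOf n (λ i → at (n ∸ suc i) r)

at-rev : ∀ {n} i (r : Vec Bool n) → i < n → at i (rev r) ≡ at (n ∸ suc i) r
at-rev i r p = at-vecOf _ _ i p

flip< : ∀ {n} i → i < n → n ∸ suc i < n
flip< {suc n} i p = s≤s (m∸n≤m n i)

flip-flip : ∀ {n} i → i < n → n ∸ suc (n ∸ suc i) ≡ i
flip-flip {suc n} i (s≤s p) = m∸[m∸n]≡n p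

rev-rev : ∀ {n} (r : Vec Bool n) → rev (rev r) ≡ r
rev-rev r = ext _ _ (λ i p → trans (at-rev i (rev r) p) (trans (at-rev _ r (flip< i p)) (cong (λ k → at k r) (flip-flip i p))))

pre-suc : ∀ {n} c (r : Vec Bool n) → pre (suc c) r ≡ pre c r + tw (at c r)
pre-suc zero    []      = refl
pre-suc (suc c) []      = refl
pre-suc zero    (b ∷ r) = +-comm (tw b) 0
pre-suc (suc c) (b ∷ r) = trans (cong (tw b +_) (pre-suc c r)) (sym (+-assoc (tw b) _ _))

pre-rev′ : ∀ {n} (r : Vec Bool n) c → c ≤ n → pre c r + pre (n ∸ c) (rev r) ≡ size (rev r)
pre-rev′ r zero p = pre-all (rev r)
pre-rev′ {n} r (suc c) p = trans (cong (_+ pre (n ∸ suc c) (rev r)) (pre-suc c r)) (trans (+-assoc (pre c r) _ _)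
  (trans (cong (pre c r +_) (trans (+-comm (tw (at c r)) _) (sym e))) (pre-rev′ r c (<⇒≤ p))))
  where
  e : pre (n ∸ c) (rev r) ≡ pre (n ∸ suc c) (rev r) + tw (at c r)
  e = trans (cong (λ z → pre z (rev r)) (sym (trans (+-comm 1 _) (m∸n∸1 n c p))))
    (trans (pre-suc (n ∸ suc c) (rev r)) (cong (λ z → pre (n ∸ suc c) (rev r) + tw z) (trans (at-rev _ r (flip< c p)) (cong (λ z → at z r) (flip-flip c p)))))
    where
    m∸n∸1 : ∀ n c → c < n → n ∸ suc c + 1 ≡ n ∸ c
    m∸n∸1 (suc n) zero p = +-comm n 1
    m∸n∸1 (suc n) (suc c) (s≤s p) = m∸n∸1 n c p

size-rev : ∀ {n} (r : Vec Bool n) → size (rev r) ≡ size r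
size-rev {n} r = trans (sym (pre-rev′ r n ≤-refl)) (trans (cong₂ _+_ (pre-all r) (cong (λ z → pre z (rev r)) (n∸n≡0 n))) (+-identityʳ _))

pre-rev : ∀ {n} (r : Vec Bool n) c → c ≤ n → pre c r + pre (n ∸ c) (rev r) ≡ size r
pre-rev r c p = trans (pre-rev′ r c p) (size-rev r)

sub-rev : ∀ {n} (a b : Vec Bool n) → Sub a b → Sub (rev a) (rev b)
sub-rev {n} a b s = at-sub _ _ go
  where
  go : ∀ i → at i (rev a) ≡ true → at i (rev b) ≡ true
  go i e with i <? n
  ... | yes p = trans (at-rev i b p) (sub-at a b s _ (trans (sym (at-rev i a p)) e))
  ... | no p with trans (sym e) (at-big i (rev a) (≮⇒≥ p))
  ... | ()

pre-over : ∀ {n} c (r : Vec Bool n) → n ≤ c → pre c r ≡ size r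
pre-over zero    []      _       = refl
pre-over (suc c) []      _       = refl
pre-over (suc c) (b ∷ r) (s≤s p) = cong (tw b +_) (pre-over c r p)

-- A prefix of a reversed row is the complement of a prefix, and the sizes agree, so the two rows
-- change sides. This turns the choices of a queue running one way into a competitor of the queue
-- running the other way.
fits-rev : ∀ {n} v (y z : Vec Bool n) → (∀ c → pre c y ≤ v + pre c z) → size y ≡ size z → ∀ c → pre c (rev z) ≤ v + pre c (rev y)
fits-rev {n} v y z h e c with c ≤? n
... | no p = ≤-trans (≤-reflexive (trans (pre-over c (rev z) q) (trans (size-rev z) (trans (sym e) (sym (trans (pre-over c (rev y) q) (size-rev y))))))) (m≤n+m _ v)
  where q = ≰⇒≥ p
... | yes p = +-cancelˡ-≤ (pre (n ∸ c) z) _ _ (≤-trans (≤-reflexive (trans (l z) (sym e)))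
  (≤-trans (≤-reflexive (sym (l y))) (≤-trans (+-monoˡ-≤ (pre c (rev y)) (h (n ∸ c)))
  (≤-reflexive (trans (cong (_+ pre c (rev y)) (+-comm v _)) (+-assoc (pre (n ∸ c) z) v _))))))
  where
  l : ∀ r → pre (n ∸ c) r + pre c (rev r) ≡ size r
  l r = trans (cong (λ k → pre (n ∸ c) r + pre k (rev r)) (sym (m∸[m∸n]≡n p))) (pre-rev r (n ∸ c) (m∸n≤m n c))

-- Minimal winding: both the downward and the upward queue minimise the number of wraps

upW : ∀ {n} → ℕ → Vec Bool n → Mat n → ℕ
upW zero    X M       = 0
upW (suc k) X []      = 0
upW (suc k) X (B ∷ M) = wraps (rev B) X + upW k (dep (wraps (rev B) X) (rev B) X) M

Bigs : ∀ {n} → ℕ → ℕ → Mat n → Set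
Bigs m k       []      = ⊥
Bigs m zero    (b ∷ M) = size b ≡ m
Bigs m (suc k) (b ∷ M) = m ≤ size b × Bigs m k M

bigs-head : ∀ {n} m k (b : Vec Bool n) M → Bigs m k (b ∷ M) → m ≤ size b
bigs-head m zero    b M h = ≤-reflexive (sym h)
bigs-head m (suc k) b M h = proj₁ h

size-Sset : ∀ {n} m k (M : Mat n) → Bigs m k M → size (Sset k M) ≡ m
size-Sset m zero    (b ∷ M) h       = h
size-Sset m (suc k) (b ∷ M) (p , h) = trans (size-dep b _ (≤-trans (≤-reflexive (size-Sset m k M h)) p)) (size-Sset m k M h)

sub-Sset : ∀ {n} k (b : Vec Bool n) M → Sub (Sset k (b ∷ M)) b
sub-Sset zero    b M = sub-refl b
sub-Sset (suc k) b M = sub-dep _ b _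

sub-pre : ∀ {n} (a b : Vec Bool n) c → Sub a b → pre c a ≤ pre c b
sub-pre a b zero s = z≤n
sub-pre [] [] (suc c) s = z≤n
sub-pre (_ ∷ a) (_ ∷ b) (suc c) (p , s) = +-mono-≤ p (sub-pre a b c s)

-- The sets chosen by the upward queue, reversed again, form a system of m positions in every row.
-- Starting in row k and going down, `ahead` adds the wraps of both queues at each row.
down≤up : ∀ {n} m k (b x : Vec Bool n) M → Bigs m k (b ∷ M) → Sub x b → size x ≡ m →
  ∀ c → pre c x + Wk k (b ∷ M) ≤ pre c (Sset k (b ∷ M)) + upW k (rev x) M
down≤up m zero b x M h s e c = +-monoˡ-≤ 0 (sub-pre x b c s)
down≤up m (suc k) b x (b₂ ∷ M) (p , h) s e c =
  ≤-trans (ahead (Wk k (b₂ ∷ M)) (upW k y M) v b S x₂ x (≤-trans (≤-reflexive sS) p) (trans e (sym sS)) s ih fit c)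
    (≤-reflexive (cong (pre c (Sset (suc k) (b ∷ b₂ ∷ M)) +_) (+-comm (upW k y M) v)))
  where
  S = Sset k (b₂ ∷ M)
  sS = size-Sset m k (b₂ ∷ M) h
  v = wraps (rev b₂) (rev x)
  y = dep v (rev b₂) (rev x)
  x₂ = rev y
  sz : size (rev x) ≤ size (rev b₂)
  sz = ≤-trans (≤-reflexive (trans (size-rev x) e)) (≤-trans (bigs-head m k b₂ M h) (≤-reflexive (sym (size-rev b₂))))
  sy : size y ≡ size (rev x)
  sy = size-dep (rev b₂) (rev x) sz
  sub₂ : Sub x₂ b₂
  sub₂ = subst (Sub x₂) (rev-rev b₂) (sub-rev y (rev b₂) (sub-dep v (rev b₂) (rev x)))
  ih : ∀ c → pre c x₂ + Wk k (b₂ ∷ M) ≤ pre c S + upW k y M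
  ih c = subst (λ z → pre c x₂ + Wk k (b₂ ∷ M) ≤ pre c S + upW k z M) (rev-rev y)
    (down≤up m k b₂ x₂ M h sub₂ (trans (size-rev y) (trans sy (trans (size-rev x) e))) c)
  fit : ∀ c → pre c x ≤ v + pre c x₂
  fit c = subst (λ z → pre c z ≤ v + pre c x₂) (rev-rev x) (fits-rev v y (rev x) (pre-dep v (rev b₂) (rev x)) sy c)

-- The same comparison with the roles exchanged. The recursion goes up the rows; `g` collects the
-- wraps of the upward queue and `f` those of the downward one, while `X` stays ahead of the
-- reversed label sets.
up≤down : ∀ {n} m k (b X : Vec Bool n) M g f → Bigs m k (b ∷ M) → size X ≡ m →
  (∀ c → pre c (rev (Sset k (b ∷ M))) + g ≤ pre c X + f) → g + upW k X M ≤ f + Wk k (b ∷ M)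
up≤down {n} m zero b X M g f h e i = ≤-trans (≤-reflexive (+-identityʳ g)) (≤-trans
  (+-cancelˡ-≤ m _ _ (subst₂ (λ x y → x + g ≤ y + f) (trans (pre-all (rev b)) (trans (size-rev b) h)) (trans (pre-all X) e) (i n)))
  (≤-reflexive (sym (+-identityʳ f))))
up≤down m (suc k) b X (b₂ ∷ M) g f (p , h) e i =
  ≤-trans (≤-reflexive (sym (+-assoc g _ _))) (≤-trans
  (up≤down m k b₂ (dep v (rev b₂) X) M (g + v) (f + w) h (trans (size-dep (rev b₂) X sz) e)
    (ahead g f w (rev b₂) X (rev S) (rev S₂) sz (trans (size-rev S₂) (trans sS₂ (sym e))) (sub-rev S₂ b₂ (sub-Sset k b₂ M)) i fit))
  (≤-reflexive (trans (+-assoc f w _) (cong (f +_) (+-comm w _)))))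
  where
  S₂ = Sset k (b₂ ∷ M)
  S = Sset (suc k) (b ∷ b₂ ∷ M)
  sS₂ = size-Sset m k (b₂ ∷ M) h
  w = wraps b S₂
  v = wraps (rev b₂) X
  sz : size X ≤ size (rev b₂)
  sz = ≤-trans (≤-reflexive e) (≤-trans (bigs-head m k b₂ M h) (≤-reflexive (sym (size-rev b₂))))
  fit : ∀ c → pre c (rev S₂) ≤ w + pre c (rev S)
  fit = fits-rev w S S₂ (pre-dep w b S₂) (trans (size-Sset m (suc k) (b ∷ b₂ ∷ M) (p , h)) (sym sS₂))

-- Applied to a reversed row, these are its rightmost m balls, where charge starts its first m
-- standard subwords. They are ahead of every other choice of m balls, so the comparison with label
-- sets begins without offset.
firsts : ∀ {n} → ℕ → Vec Bool n → Vec Bool n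
firsts m r = keep m r (empty _)

size-firsts : ∀ {n} m (r : Vec Bool n) → m ≤ size r → size (firsts m r) ≡ m
size-firsts zero [] p = refl
size-firsts zero (true ∷ r) p = size-firsts 0 r z≤n
size-firsts (suc m) (true ∷ r) (s≤s p) = cong suc (size-firsts m r p)
size-firsts m (false ∷ r) p = size-firsts m r p

sub-firsts : ∀ {n} m (r : Vec Bool n) → Sub (firsts m r) r
sub-firsts m r = sub-keep m r (empty _) (sub-empty r)

pre-firsts : ∀ {n} m (z r : Vec Bool n) → Sub z r → size z ≤ m → ∀ c → pre c z ≤ pre c (firsts m r)
pre-firsts m z r s p zero = z≤n
pre-firsts m [] [] s p (suc c) = z≤n
pre-firsts zero (false ∷ z) (true ∷ r) (_ , s) p (suc c) = pre-firsts 0 z r s p c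
pre-firsts zero (true ∷ z) (true ∷ r) (_ , s) () (suc c)
pre-firsts (suc m) (true ∷ z) (true ∷ r) (_ , s) (s≤s p) (suc c) = s≤s (pre-firsts m z r s p c)
pre-firsts (suc m) (false ∷ z) (true ∷ r) (_ , s) p (suc c) = ≤-trans (pre-drop1 z c) (s≤s (pre-firsts m (drop1 z) r (sub-trans _ _ _ (drop1-sub z) s) (drop1-size z m p) c))
  where
  drop1 : ∀ {n} → Vec Bool n → Vec Bool n
  drop1 []          = []
  drop1 (true ∷ z)  = false ∷ z
  drop1 (false ∷ z) = false ∷ drop1 z
  drop1-sub : ∀ {n} (z : Vec Bool n) → Sub (drop1 z) z
  drop1-sub []          = tt
  drop1-sub (true ∷ z)  = z≤n , sub-refl z
  drop1-sub (false ∷ z) = z≤n , drop1-sub z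
  drop1-size : ∀ {n} (z : Vec Bool n) m → size z ≤ suc m → size (drop1 z) ≤ m
  drop1-size []          m p       = z≤n
  drop1-size (true ∷ z)  m (s≤s p) = p
  drop1-size (false ∷ z) m p       = drop1-size z m p
  pre-drop1 : ∀ {n} (z : Vec Bool n) c → pre c z ≤ suc (pre c (drop1 z))
  pre-drop1 z zero = z≤n
  pre-drop1 [] (suc c) = z≤n
  pre-drop1 (true ∷ z) (suc c) = ≤-refl
  pre-drop1 (false ∷ z) (suc c) = pre-drop1 z c
pre-firsts m (false ∷ z) (false ∷ r) (_ , s) p (suc c) = pre-firsts m z r s p c
pre-firsts m (true ∷ z) (false ∷ r) (() , s) p (suc c)

-- Both inequalities are read off at the full prefix, where the two compared sets have m elements
-- each and cancel.
winding : ∀ {n} m k (b : Vec Bool n) M → Bigs m k (b ∷ M) → Wk k (b ∷ M) ≡ upW k (firsts m (rev b)) M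
winding {n} m k b M h = ≤-antisym
  (+-cancelˡ-≤ m _ _ (subst₂ (λ x y → x + Wk k (b ∷ M) ≤ y + upW k X M) (trans (pre-all (rev X)) sx) (trans (pre-all (Sset k (b ∷ M))) sS)
    (subst (λ z → pre n (rev X) + Wk k (b ∷ M) ≤ pre n (Sset k (b ∷ M)) + upW k z M) (rev-rev X)
      (down≤up m k b (rev X) M h (subst (Sub (rev X)) (rev-rev b) (sub-rev X (rev b) (sub-firsts m (rev b)))) sx n))))
  (up≤down m k b X M 0 0 h sX (λ c → +-monoˡ-≤ 0 (pre-firsts m (rev S) (rev b) (sub-rev S b (sub-Sset k b M)) (≤-reflexive (trans (size-rev S) sS)) c)))
  where
  S = Sset k (b ∷ M)
  X = firsts m (rev b)
  sS = size-Sset m k (b ∷ M) h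
  sX : size X ≡ m
  sX = size-firsts m (rev b) (≤-trans (bigs-head m k b M h) (≤-reflexive (sym (size-rev b))))
  sx : size (rev X) ≡ m
  sx = trans (size-rev X) sX

-- Adding one customer to the queue

Hit : ∀ {n} → ℕ → Vec Bool n → Vec Bool n → Set
Hit u []       []       = ⊥
Hit u (b ∷ bs) (s ∷ ss) = cq b s u ≡ 0 ⊎ Hit (cq b s u) bs ss

hit-couple : ∀ {n} {u u'} (b s : Vec Bool n) → Hit u b s → u' ≤ u → que u b s ≡ que u' b s
hit-couple [] [] ()
hit-couple {u = u} {u'} (b ∷ bs) (s ∷ ss) (inj₁ e) p = cong (λ z → que z bs ss) (trans e (sym (n≤0⇒n≡0 (subst (cq b s u' ≤_) e (cq-mono b s s ≤-refl p)))))
hit-couple (b ∷ bs) (s ∷ ss) (inj₂ h) p = hit-couple bs ss h (cq-mono b s s ≤-refl p)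

-- A queue that becomes empty has forgotten its initial length. Hence a stationary length whose
-- queue empties at some moment is the final length of the queue started empty.
hit-wraps : ∀ {n} w (b s : Vec Bool n) → Hit w b s → que w b s ≡ w → wraps b s ≡ w
hit-wraps w b s h e = trans (sym (hit-couple b s h z≤n)) e

Busy : ∀ {n} → ℕ → Vec Bool n → Vec Bool n → Set
Busy i b d = at i b ≡ true → at i d ≡ true

busy-cq : ∀ b s u → (b ≡ true → dp b s u ≡ true) → cq b s (suc u) ≡ suc (cq b s u) × dp b s (suc u) ≡ dp b s u
busy-cq false true  u       h = refl , refl
busy-cq false false u       h = refl , refl
busy-cq true  true  u       h = refl , refl
busy-cq true  false (suc u) h = refl , refl
busy-cq true  false zero    h with h refl
... | ()

-- The additional customer waits during all busy services and takes the idle one at k, where the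
-- original queue is empty; so the raised queue becomes empty there, whence `Hit`.
raise : ∀ {n} u (b s : Vec Bool n) k → at k b ≡ true → at k (dep u b s) ≡ false → (∀ i → i < k → Busy i b (dep u b s)) →
  dep (suc u) b s ≡ put k (dep u b s) × que (suc u) b s ≡ que u b s × Hit (suc u) b s
raise u [] [] k () _ _
raise zero (true ∷ b) (false ∷ s) zero e f h = refl , refl , inj₁ refl
raise u (true ∷ b) (true ∷ s) zero e () h
raise (suc u) (true ∷ b) (false ∷ s) zero e () h
raise u (false ∷ b) (s ∷ ss) zero () f h
raise u (b ∷ bs) (s ∷ ss) (suc k) e f h with busy-cq b s u (h 0 (s≤s z≤n)) | raise (cq b s u) bs ss k e f (λ i p → h (suc i) (s≤s p))
... | p , q | x , y , z rewrite p | q = cong (dp b s u ∷_) x , y , inj₂ z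

raise-end : ∀ {n} u (b s : Vec Bool n) → (∀ i → Busy i b (dep u b s)) → dep (suc u) b s ≡ dep u b s × que (suc u) b s ≡ suc (que u b s)
raise-end u [] [] h = refl , refl
raise-end u (b ∷ bs) (s ∷ ss) h with busy-cq b s u (h 0) | raise-end (cq b s u) bs ss (λ i → h (suc i))
... | p , q | x , y rewrite p | q = cong (dp b s u ∷_) x , y

add-right : ∀ {n} u (b s : Vec Bool n) j k → at j s ≡ false → j ≤ k → at k b ≡ true → at k (dep u b s) ≡ false →
  (∀ i → j ≤ i → i < k → Busy i b (dep u b s)) → dep u b (put j s) ≡ put k (dep u b s) × que u b (put j s) ≡ que u b s × Hit u b (put j s)
add-right u [] [] j k _ _ () _ _
add-right zero (true ∷ b) (false ∷ s) zero zero a le e f h = refl , refl , inj₁ refl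
add-right (suc u) (true ∷ b) (false ∷ s) zero zero a le e () h
add-right u (true ∷ b) (true ∷ s) zero k () le e f h
add-right u (false ∷ b) (s ∷ ss) zero zero a le () f h
add-right u (false ∷ b) (true ∷ s) zero (suc k) () le e f h
add-right u (false ∷ b) (false ∷ s) zero (suc k) a le e f h with raise u b s k e f (λ i p → h (suc i) z≤n (s≤s p))
... | x , y , z = cong (false ∷_) x , y , inj₂ z
add-right zero (true ∷ b) (false ∷ s) zero (suc k) a le e f h with h 0 z≤n (s≤s z≤n) refl
... | ()
add-right (suc u) (true ∷ b) (false ∷ s) zero (suc k) a le e f h with raise u b s k e f (λ i p → h (suc i) z≤n (s≤s p))
... | x , y , z = cong (true ∷_) x , y , inj₂ z
add-right u (b ∷ bs) (s ∷ ss) (suc j) (suc k) a (s≤s le) e f h with add-right (cq b s u) bs ss j k a le e f (λ i p q → h (suc i) (s≤s p) (s≤s q))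
... | x , y , z = cong (dp b s u ∷_) x , y , inj₂ z

add-end : ∀ {n} u (b s : Vec Bool n) j → j < n → at j s ≡ false → (∀ i → j ≤ i → Busy i b (dep u b s)) →
  dep u b (put j s) ≡ dep u b s × que u b (put j s) ≡ suc (que u b s)
add-end u (false ∷ b) (false ∷ s) zero lt a h with raise-end u b s (λ i → h (suc i) z≤n)
... | x , y = cong (false ∷_) x , y
add-end zero (true ∷ b) (false ∷ s) zero lt a h with h 0 z≤n refl
... | ()
add-end (suc u) (true ∷ b) (false ∷ s) zero lt a h with raise-end u b s (λ i → h (suc i) z≤n)
... | x , y = cong (true ∷_) x , y
add-end u (b ∷ bs) (s ∷ ss) (suc j) (s≤s lt) a h with add-end (cq b s u) bs ss j lt a (λ i p → h (suc i) (s≤s p))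
... | x , y = cong (dp b s u ∷_) x , y

-- The customer arriving at j meets only busy services up to the last column and is counted at the
-- end. Re-entering at the start, it takes the first idle service k.
add-wrap : ∀ {n} u (b s : Vec Bool n) j k → j < n → at j s ≡ false → k < j → at k b ≡ true → at k (dep u b s) ≡ false →
  (∀ i → i < k → Busy i b (dep u b s)) → (∀ i → j ≤ i → Busy i b (dep u b s)) →
  dep (suc u) b (put j s) ≡ put k (dep u b s) × que (suc u) b (put j s) ≡ suc (que u b s) × Hit (suc u) b (put j s)
add-wrap zero (true ∷ b) (false ∷ s) (suc j) zero (s≤s lt) a kj e f g h with add-end 0 b s j lt a (λ i p → h (suc i) (s≤s p))
... | x , y = cong (true ∷_) x , y , inj₁ refl
add-wrap u (true ∷ b) (true ∷ s) (suc j) zero lt a kj e () g h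
add-wrap (suc u) (true ∷ b) (false ∷ s) (suc j) zero lt a kj e () g h
add-wrap u (false ∷ b) (s ∷ ss) (suc j) zero lt a kj () f g h
add-wrap u (b ∷ bs) (s ∷ ss) (suc j) (suc k) (s≤s lt) a (s≤s kj) e f g h
  with busy-cq b s u (g 0 (s≤s z≤n)) | add-wrap (cq b s u) bs ss j k lt a kj e f (λ i p → g (suc i) (s≤s p)) (λ i p → h (suc i) (s≤s p))
... | p , q | x , y , z rewrite p | q = cong (dp b s u ∷_) x , y , inj₂ z

-- The labelling pairs balls one at a time, the queue serves a whole set. This lemma and
-- `add-wrap-wraps` identify the pairing of one more ball with the arrival of one more customer.
add-right-wraps : ∀ {n} (b s : Vec Bool n) j k → size s ≤ size b → at j s ≡ false → j ≤ k → at k b ≡ true → at k (dep (wraps b s) b s) ≡ false →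
  (∀ i → j ≤ i → i < k → Busy i b (dep (wraps b s) b s)) →
  wraps b (put j s) ≡ wraps b s × dep (wraps b (put j s)) b (put j s) ≡ put k (dep (wraps b s) b s)
add-right-wraps b s j k sz a le e f h with add-right (wraps b s) b s j k a le e f h
... | x , y , z = w , trans (cong (λ u → dep u b (put j s)) w) x
  where w = hit-wraps (wraps b s) b (put j s) z (trans y (que-fix b s sz))

add-wrap-wraps : ∀ {n} (b s : Vec Bool n) j k → size s ≤ size b → j < n → at j s ≡ false → k < j → at k b ≡ true → at k (dep (wraps b s) b s) ≡ false →
  (∀ i → i < k → Busy i b (dep (wraps b s) b s)) → (∀ i → j ≤ i → Busy i b (dep (wraps b s) b s)) →
  wraps b (put j s) ≡ suc (wraps b s) × dep (wraps b (put j s)) b (put j s) ≡ put k (dep (wraps b s) b s)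
add-wrap-wraps b s j k sz lt a kj e f g h with add-wrap (wraps b s) b s j k lt a kj e f g h
... | x , y , z = w , trans (cong (λ u → dep u b (put j s)) w) x
  where w = hit-wraps (suc (wraps b s)) b (put j s) z (trans y (cong suc (que-fix b s sz)))

wraps-empty : ∀ {n} (b : Vec Bool n) → wraps b (empty n) ≡ 0
wraps-empty b = wraps-dom b (empty _) (sub-dom _ b (sub-empty b))

-- The Ferrari-Martin labelling as a family of queues

leT : ∀ {m n} → m ≤ n → (m ≤ᵇ n) ≡ true
leT {m} {n} p with m ≤ᵇ n | ≤⇒≤ᵇ p
... | true | _ = refl

leT⁻ : ∀ {m n} → (m ≤ᵇ n) ≡ true → m ≤ n
leT⁻ {m} {n} e = ≤ᵇ⇒≤ m n (subst T (sym e) tt)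

leF : ∀ {m n} → n < m → (m ≤ᵇ n) ≡ false
leF {m} {n} p with m ≤ᵇ n in e
... | false = refl
... | true  = ⊥-elim (<⇒≱ p (leT⁻ e))

eqT : ∀ {m n} → m ≡ n → (m ≡ᵇ n) ≡ true
eqT {m} {n} p with m ≡ᵇ n | ≡⇒≡ᵇ m n p
... | true | _ = refl

eqT⁻ : ∀ m n → (m ≡ᵇ n) ≡ true → m ≡ n
eqT⁻ m n e = ≡ᵇ⇒≡ m n (subst T (sym e) tt)

eqF : ∀ {m n} → m ≢ n → (m ≡ᵇ n) ≡ false
eqF {m} {n} p with m ≡ᵇ n in e
... | false = refl
... | true  = ⊥-elim (p (eqT⁻ m n e))

eqF⁻ : ∀ m n → (m ≡ᵇ n) ≡ false → m ≢ n
eqF⁻ m n e p with trans (sym e) (eqT p)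
... | ()

bool-iff : ∀ {a b : Bool} → (a ≡ true → b ≡ true) → (b ≡ true → a ≡ true) → a ≡ b
bool-iff {true}  {b}     f g = sym (f refl)
bool-iff {false} {false} f g = refl
bool-iff {false} {true}  f g = g refl

nth-setAt : ∀ {A : Set} (d : A) xs k a → k < length xs → nth d (setAt xs k a) k ≡ a
nth-setAt d (x ∷ xs) zero    a p       = refl
nth-setAt d (x ∷ xs) (suc k) a (s≤s p) = nth-setAt d xs k a p

nth-setAt-≢ : ∀ {A : Set} (d : A) xs k i a → i ≢ k → nth d (setAt xs k a) i ≡ nth d xs i
nth-setAt-≢ d []       k       i       a h = refl
nth-setAt-≢ d (x ∷ xs) zero    zero    a h = ⊥-elim (h refl)
nth-setAt-≢ d (x ∷ xs) zero    (suc i) a h = refl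
nth-setAt-≢ d (x ∷ xs) (suc k) zero    a h = refl
nth-setAt-≢ d (x ∷ xs) (suc k) (suc i) a h = nth-setAt-≢ d xs k i a (λ e → h (cong suc e))

length-setAt : ∀ {A : Set} (xs : List A) k a → length (setAt xs k a) ≡ length xs
length-setAt []       k       a = refl
length-setAt (x ∷ xs) zero    a = refl
length-setAt (x ∷ xs) (suc k) a = cong suc (length-setAt xs k a)

nth-toList : ∀ {n} i (r : Vec Bool n) → nth false (toList r) i ≡ at i r
nth-toList i       []      = refl
nth-toList zero    (_ ∷ r) = refl
nth-toList (suc i) (_ ∷ r) = nth-toList i r

abstract
  -- Sites with label at least k. The set is opaque so that it stays an atom in goals and is opened
  -- only through `at-gek`.
  gek : ∀ n → ℕ → List ℕ → Vec Bool n
  gek n k l = vecOf n (λ i → k ≤ᵇ nth 0 l i)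

  at-gek : ∀ n k l i → i < n → at i (gek n k l) ≡ (k ≤ᵇ nth 0 l i)
  at-gek n k l i p = at-vecOf n _ i p

data Found (q : ℕ → Bool) (f : ℕ → ℕ) (n : ℕ) : Maybe ℕ → Set where
  found : ∀ i → i < n → q (f i) ≡ true → (∀ i' → i' < i → q (f i') ≡ false) → Found q f n (just (f i))
  none  : (∀ i → i < n → q (f i) ≡ false) → Found q f n nothing

free : List Bool → List ℕ → ℕ → Bool
free occ labs k = nth false occ k ∧ (nth 0 labs k ≡ᵇ 0)

firstFree-found : ∀ occ labs (p : ℕ → Bool) (f : ℕ → ℕ) n → Found (λ i → p i ∧ free occ labs i) f n (firstFree occ labs (filterᵇ p (applyUpTo f n)))
firstFree-found occ labs p f zero = none λ _ ()
firstFree-found occ labs p f (suc n) with p (f 0) in ep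
... | true with free occ labs (f 0) in ef
...   | true = found 0 (s≤s z≤n) (cong₂ _∧_ ep ef) (λ _ ())
...   | false with firstFree occ labs (filterᵇ p (applyUpTo (λ i → f (suc i)) n)) | firstFree-found occ labs p (λ i → f (suc i)) n
...     | _ | found i lt a h = found (suc i) (s≤s lt) a λ { zero _ → cong₂ _∧_ ep ef ; (suc i') (s≤s l) → h i' l }
...     | _ | none h = none λ { zero _ → cong₂ _∧_ ep ef ; (suc i') (s≤s l) → h i' l }
firstFree-found occ labs p f (suc n) | false with firstFree occ labs (filterᵇ p (applyUpTo (λ i → f (suc i)) n)) | firstFree-found occ labs p (λ i → f (suc i)) n
...     | _ | found i lt a h = found (suc i) (s≤s lt) a λ { zero _ → cong (_∧ free occ labs (f 0)) ep ; (suc i') (s≤s l) → h i' l }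
...     | _ | none h = none λ { zero _ → cong (_∧ free occ labs (f 0)) ep ; (suc i') (s≤s l) → h i' l }

firstFree-++ : ∀ occ labs xs ys → firstFree occ labs (xs ++ ys) ≡ (Data.Maybe._<∣>_ (firstFree occ labs xs) (firstFree occ labs ys))
firstFree-++ occ labs [] ys = refl
firstFree-++ occ labs (x ∷ xs) ys with nth false occ x ∧ (nth 0 labs x ≡ᵇ 0)
... | true  = refl
... | false = firstFree-++ occ labs xs ys

∧-elim : ∀ a b → a ∧ b ≡ true → a ≡ true × b ≡ true
∧-elim true true _ = refl , refl

∧-falseʳ : ∀ a b → a ∧ b ≡ false → a ≡ true → b ≡ false
∧-falseʳ true b e _ = e

ltT : ∀ {m n} → m < n → (m <ᵇ n) ≡ true
ltT {m} {n} p with m <ᵇ n | <⇒<ᵇ p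
... | true | _ = refl

ltT⁻ : ∀ {m n} → (m <ᵇ n) ≡ true → m < n
ltT⁻ {m} {n} e = <ᵇ⇒< m n (subst T (sym e) tt)

ltF : ∀ {m n} → n ≤ m → (m <ᵇ n) ≡ false
ltF {m} {n} p with m <ᵇ n in e
... | false = refl
... | true  = ⊥-elim (<⇒≱ (ltT⁻ e) p)

-- Outcomes of the cyclic search, shaped after the hypotheses of `add-right-wraps` and
-- `add-wrap-wraps`: all columns passed over on the way fail the test.
data Cyc (n : ℕ) (q : ℕ → Bool) (j : ℕ) : Maybe ℕ → Set where
  right  : ∀ k → k < n → j ≤ k → q k ≡ true → (∀ i → j ≤ i → i < k → q i ≡ false) → Cyc n q j (just k)
  around : ∀ k → k < j → q k ≡ true → (∀ i → i < k → q i ≡ false) → (∀ i → j ≤ i → i < n → q i ≡ false) → Cyc n q j (just k)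
  stuck  : (∀ i → i < n → q i ≡ false) → Cyc n q j nothing

firstFree-cyc : ∀ n occ labs j → Cyc n (free occ labs) j (firstFree occ labs (cycFrom n j))
firstFree-cyc n occ labs j rewrite firstFree-++ occ labs (filterᵇ (λ i → j ≤ᵇ i) (upTo n)) (filterᵇ (λ i → i <ᵇ j) (upTo n))
  with firstFree occ labs (filterᵇ (λ i → j ≤ᵇ i) (upTo n)) | firstFree-found occ labs (λ i → j ≤ᵇ i) (λ i → i) n
... | _ | found k lt a h = let (x , y) = ∧-elim (j ≤ᵇ k) _ a in right k lt (leT⁻ x) y (λ i p q → ∧-falseʳ (j ≤ᵇ i) _ (h i q) (leT p))
... | _ | none g with firstFree occ labs (filterᵇ (λ i → i <ᵇ j) (upTo n)) | firstFree-found occ labs (λ i → i <ᵇ j) (λ i → i) n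
...   | _ | found k lt a h = let (x , y) = ∧-elim (k <ᵇ j) _ a in around k (ltT⁻ {k} {j} x) y
          (λ i p → ∧-falseʳ (i <ᵇ j) _ (h i p) (ltT (<-trans p (ltT⁻ {k} {j} x)))) (λ i p q → ∧-falseʳ (j ≤ᵇ i) _ (g i q) (leT p))
...   | _ | none h = stuck every
  where
  every : ∀ i → i < n → free occ labs i ≡ false
  every i p with j ≤? i
  ... | yes q = ∧-falseʳ (j ≤ᵇ i) _ (g i p) (leT q)
  ... | no q  = ∧-falseʳ (i <ᵇ j) _ (h i p) (ltT (≰⇒> q))

module Pairing {n : ℕ} (b : Vec Bool n) where

  occ : List Bool
  occ = toList b

  D : Vec Bool n → Vec Bool n
  D S = dep (wraps b S) b S

  record Inv (S : Vec Bool n) (labs : List ℕ) : Set where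
    field
      len : length labs ≡ n
      set : gek n 1 labs ≡ D S
  open Inv

  free-at : ∀ {S labs} → Inv S labs → ∀ k → k < n → free occ labs k ≡ true → at k b ≡ true × at k (D S) ≡ false × nth 0 labs k ≡ 0
  free-at {S} {labs} I k p e with ∧-elim (nth false occ k) _ e
  ... | x , y = trans (sym (nth-toList k b)) x , trans (cong (at k) (sym (set I))) (trans (at-gek n 1 labs k p) (cong (1 ≤ᵇ_) z)) , z
    where z = eqT⁻ (nth 0 labs k) 0 y

  busy-at : ∀ {S labs} → Inv S labs → ∀ k → (k < n → free occ labs k ≡ false) → Busy k b (D S)
  busy-at {S} {labs} I k h e with k <? n
  ... | no p with trans (sym e) (at-big k b (≮⇒≥ p))
  ...   | ()
  busy-at {S} {labs} I k h e | yes p = trans (cong (at k) (sym (set I))) (trans (at-gek n 1 labs k p) (l (nth 0 labs k) refl))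
    where
    l : ∀ x → nth 0 labs k ≡ x → (1 ≤ᵇ x) ≡ true
    l (suc x) _ = refl
    l zero z with trans (sym (h p)) (cong₂ _∧_ (trans (nth-toList k b) e) (eqT z))
    ... | ()

  gek-set : ∀ labs k ℓ t → length labs ≡ n → k < n → t ≤ ℓ → gek n t (setAt labs k ℓ) ≡ put k (gek n t labs)
  gek-set labs k ℓ t e p q = ext _ _ go
    where
    go : ∀ i → i < n → at i (gek n t (setAt labs k ℓ)) ≡ at i (put k (gek n t labs))
    go i r with i ≟ k
    ... | yes refl = trans (at-gek n t _ i r) (trans (cong (t ≤ᵇ_) (nth-setAt 0 labs i ℓ (subst (i <_) (sym e) p))) (trans (leT q) (sym (at-put i (gek n t labs) p))))
    ... | no ne = trans (at-gek n t _ i r) (trans (cong (t ≤ᵇ_) (nth-setAt-≢ 0 labs k i ℓ ne)) (trans (sym (at-gek n t labs i r)) (sym (at-put-≢ i k (gek n t labs) ne))))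

  gek-keep : ∀ labs k ℓ t → length labs ≡ n → k < n → nth 0 labs k ≡ 0 → ℓ < t → gek n t (setAt labs k ℓ) ≡ gek n t labs
  gek-keep labs k ℓ t e p z q = ext _ _ go
    where
    go : ∀ i → i < n → at i (gek n t (setAt labs k ℓ)) ≡ at i (gek n t labs)
    go i r with i ≟ k
    ... | yes refl = trans (at-gek n t _ i r) (trans (cong (t ≤ᵇ_) (nth-setAt 0 labs i ℓ (subst (i <_) (sym e) p)))
          (trans (leF q) (sym (trans (at-gek n t labs i r) (trans (cong (t ≤ᵇ_) z) (leF (≤-trans (s≤s z≤n) q)))))))
    ... | no ne = trans (at-gek n t _ i r) (trans (cong (t ≤ᵇ_) (nth-setAt-≢ 0 labs k i ℓ ne)) (sym (at-gek n t labs i r)))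

  -- `S` and `S'` are the processed balls of the upper row before and after this pairing. The field
  -- `cost` says that maj grows by `ℓ + 1 ∸ r` times the increase of the wraps, written additively
  -- because subtraction truncates.
  record Paired (r ℓ : ℕ) (S S' : Vec Bool n) (labs : List ℕ) (m : ℕ) (res : List ℕ × ℕ) : Set where
    field
      inv  : Inv S' (proj₁ res)
      pos  : ℕ
      pos< : pos < n
      was0 : nth 0 labs pos ≡ 0
      is   : proj₁ res ≡ setAt labs pos ℓ
      cost : proj₂ res + (ℓ + 1 ∸ r) * wraps b S ≡ m + (ℓ + 1 ∸ r) * wraps b S'

  pair : ∀ r ℓ j S labs m → 1 ≤ ℓ → j < n → at j S ≡ false → size S < size b → Inv S labs →
    Paired r ℓ S (put j S) labs m (pairBall n r occ (ℓ , j) (labs , m))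
  pair r ℓ j S labs m 1≤ℓ j<n aj sz I with firstFree occ labs (cycFrom n j) | firstFree-cyc n occ labs j
  -- Without a free ball every ball of the lower row would be a departure, of which there are only
  -- `size S`.
  ... | _ | stuck h = ⊥-elim (<⇒≱ sz (≤-trans (sub-size b (D S) (at-sub _ _ (λ i → busy-at I i (h i)))) (≤-reflexive (size-dep b S (<⇒≤ sz)))))
  ... | _ | right k k<n le q h with free-at I k k<n q
  ...   | x , y , z with add-right-wraps b S j k (<⇒≤ sz) aj le x y (λ i p p' → busy-at I i (λ _ → h i p p'))
  ...     | w , d = record
    { inv = record { len = trans (length-setAt labs k ℓ) (len I) ; set = trans (gek-set labs k ℓ 1 (len I) k<n 1≤ℓ) (trans (cong (put k) (set I)) (sym d)) }
    ; pos = k ; pos< = k<n ; was0 = z ; is = refl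
    ; cost = cong₂ (λ t u → (if t then m + (ℓ + 1 ∸ r) else m) + (ℓ + 1 ∸ r) * u) (ltF le) (sym w) }
  pair r ℓ j S labs m 1≤ℓ j<n aj sz I | _ | around k kj q h g with free-at I k (<-trans kj j<n) q
  ...   | x , y , z with add-wrap-wraps b S j k (<⇒≤ sz) j<n aj kj x y (λ i p → busy-at I i (λ _ → h i p)) (λ i p → busy-at I i (λ p' → g i p p'))
  ...     | w , d = record
    { inv = record { len = trans (length-setAt labs k ℓ) (len I) ; set = trans (gek-set labs k ℓ 1 (len I) (<-trans kj j<n) 1≤ℓ) (trans (cong (put k) (set I)) (sym d)) }
    ; pos = k ; pos< = <-trans kj j<n ; was0 = z ; is = refl
    ; cost = trans (cong (λ t → (if t then m + (ℓ + 1 ∸ r) else m) + (ℓ + 1 ∸ r) * wraps b S) (ltT kj))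
        (trans (+-assoc m _ _) (cong (m +_) (sym (trans (cong ((ℓ + 1 ∸ r) *_) w) (*-suc (ℓ + 1 ∸ r) (wraps b S)))))) }

  module Rows (r : ℕ) (up : List ℕ) (small : size (gek n 1 up) ≤ size b) where

    stepB : List ℕ × ℕ → ℕ × ℕ → List ℕ × ℕ
    stepB s x = pairBall n r occ x s

    -- labels > ℓ everywhere, and labels = ℓ in the columns < c
    mix : ℕ → ℕ → Vec Bool n
    mix ℓ c = vecOf n (λ i → if i <ᵇ c then ℓ ≤ᵇ nth 0 up i else (suc ℓ ≤ᵇ nth 0 up i))

    at-mix : ∀ ℓ c i → i < n → at i (mix ℓ c) ≡ (if i <ᵇ c then ℓ ≤ᵇ nth 0 up i else (suc ℓ ≤ᵇ nth 0 up i))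
    at-mix ℓ c i p = at-vecOf n _ i p

    mix-0 : ∀ ℓ → mix ℓ 0 ≡ gek n (suc ℓ) up
    mix-0 ℓ = ext _ _ (λ i p → trans (at-mix ℓ 0 i p) (sym (at-gek n (suc ℓ) up i p)))

    mix-n : ∀ ℓ → mix ℓ n ≡ gek n ℓ up
    mix-n ℓ = ext _ _ (λ i p → trans (at-mix ℓ n i p) (trans (cong (λ t → if t then ℓ ≤ᵇ nth 0 up i else (suc ℓ ≤ᵇ nth 0 up i)) (ltT p)) (sym (at-gek n ℓ up i p))))

    mix-same : ∀ ℓ c → nth 0 up c ≢ ℓ → mix ℓ (suc c) ≡ mix ℓ c
    mix-same ℓ c ne = ext _ _ go
      where
      go : ∀ i → i < n → at i (mix ℓ (suc c)) ≡ at i (mix ℓ c)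
      go i p rewrite at-mix ℓ (suc c) i p | at-mix ℓ c i p with <-cmp i c
      ... | tri< a _ _ rewrite ltT (m≤n⇒m≤1+n a) | ltT a = refl
      ... | tri> _ _ a rewrite ltF {i} {suc c} a | ltF {i} {c} (<⇒≤ a) = refl
      ... | tri≈ _ refl _ rewrite ltT (n<1+n i) | ltF {i} {i} ≤-refl =
            bool-iff (λ e → leT (≤∧≢⇒< (leT⁻ e) (λ q → ne (sym q)))) (λ e → leT (<⇒≤ (leT⁻ {suc ℓ} e)))

    mix-put : ∀ ℓ c → c < n → nth 0 up c ≡ ℓ → mix ℓ (suc c) ≡ put c (mix ℓ c) × at c (mix ℓ c) ≡ false
    mix-put ℓ c lt e = ext _ _ go , trans (at-mix ℓ c c lt) (trans (cong (λ t → if t then ℓ ≤ᵇ nth 0 up c else (suc ℓ ≤ᵇ nth 0 up c)) (ltF {c} ≤-refl)) (leF (s≤s (≤-reflexive e))))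
      where
      go : ∀ i → i < n → at i (mix ℓ (suc c)) ≡ at i (put c (mix ℓ c))
      go i p with <-cmp i c
      ... | tri< a ne _ rewrite at-put-≢ i c (mix ℓ c) ne | at-mix ℓ (suc c) i p | at-mix ℓ c i p | ltT (m≤n⇒m≤1+n a) | ltT a = refl
      ... | tri> _ ne a rewrite at-put-≢ i c (mix ℓ c) ne | at-mix ℓ (suc c) i p | at-mix ℓ c i p | ltF {i} {suc c} a | ltF {i} {c} (<⇒≤ a) = refl
      ... | tri≈ _ refl _ rewrite at-put i (mix ℓ i) p | at-mix ℓ (suc i) i p | ltT (n<1+n i) = leT (≤-reflexive (sym e))

    mix-small : ∀ ℓ c → 1 ≤ ℓ → size (mix ℓ c) ≤ size b
    mix-small ℓ c q = ≤-trans (sub-size (mix ℓ c) (gek n 1 up) (at-sub (mix ℓ c) (gek n 1 up) go)) small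
      where
      go : ∀ i → at i (mix ℓ c) ≡ true → at i (gek n 1 up) ≡ true
      go i e with i <? n
      ... | no p with trans (sym e) (at-big i (mix ℓ c) (≮⇒≥ p))
      ...   | ()
      go i e | yes p with trans (sym (at-mix ℓ c i p)) e
      ... | f with i <ᵇ c
      ... | true = trans (at-gek n 1 up i p) (leT (≤-trans q (leT⁻ {ℓ} {nth 0 up i} f)))
      ... | false = trans (at-gek n 1 up i p) (leT (≤-trans (s≤s z≤n) (leT⁻ {suc ℓ} {nth 0 up i} f)))

    Hk : ℕ → ℕ
    Hk k = wraps b (gek n k up)

    -- All balls with label at least ℓ have been paired. Labels assigned later are smaller, so the
    -- sets in `psets` are already final.
    record Phase (ℓ : ℕ) (st : List ℕ × ℕ) : Set where
      field
        pinv : Inv (gek n ℓ up) (proj₁ st)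
        plow : ∀ i → nth 0 (proj₁ st) i ≡ 0 ⊎ ℓ ≤ nth 0 (proj₁ st) i
        psets : ∀ k → ℓ ≤ k → gek n k (proj₁ st) ≡ D (gek n k up)
    open Phase

    record Mid (ℓ c : ℕ) (st : List ℕ × ℕ) : Set where
      field
        minv : Inv (mix ℓ c) (proj₁ st)
        mlow : ∀ i → nth 0 (proj₁ st) i ≡ 0 ⊎ ℓ ≤ nth 0 (proj₁ st) i
        msets : ∀ k → ℓ < k → gek n k (proj₁ st) ≡ D (gek n k up)
    open Mid

    phase-go : ∀ ℓ d c (f : ℕ → ℕ) → c + d ≡ n → (∀ i → f i ≡ c + i) → 1 ≤ ℓ → ∀ st → Mid ℓ c st →
      let st' = foldl stepB st (map (λ j → (ℓ , j)) (filterᵇ (λ j → nth 0 up j ≡ᵇ ℓ) (applyUpTo f d))) in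
      Mid ℓ n st' × proj₂ st' + (ℓ + 1 ∸ r) * wraps b (mix ℓ c) ≡ proj₂ st + (ℓ + 1 ∸ r) * wraps b (mix ℓ n)
    phase-go ℓ zero c f e h 1≤ℓ st I rewrite trans (sym (+-identityʳ c)) e = I , refl
    phase-go ℓ (suc d) c f e h 1≤ℓ st I with nth 0 up (f 0) ≡ᵇ ℓ in eq
    ... | false = let (x , y) = phase-go ℓ d (suc c) (λ i → f (suc i)) e' h' 1≤ℓ st I' in x , subst (λ v → _ + (ℓ + 1 ∸ r) * wraps b v ≡ _) same y
      where
      e' = trans (sym (+-suc c d)) e
      h' : ∀ i → f (suc i) ≡ suc c + i
      h' i = trans (h (suc i)) (+-suc c i)
      same : mix ℓ (suc c) ≡ mix ℓ c
      same = mix-same ℓ c (subst (λ z → nth 0 up z ≢ ℓ) (trans (h 0) (+-identityʳ c)) (eqF⁻ _ ℓ eq))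
      I' : Mid ℓ (suc c) st
      I' = record { minv = subst (λ v → Inv v (proj₁ st)) (sym same) (minv I) ; mlow = mlow I ; msets = msets I }
    ... | true = let (x , y) = phase-go ℓ d (suc c) (λ i → f (suc i)) e' h' 1≤ℓ st₁ I' in x , cst y
      where
      e' = trans (sym (+-suc c d)) e
      h' : ∀ i → f (suc i) ≡ suc c + i
      h' i = trans (h (suc i)) (+-suc c i)
      f0 : f 0 ≡ c
      f0 = trans (h 0) (+-identityʳ c)
      c<n : c < n
      c<n = subst (c <_) e (≤-trans (s≤s (m≤m+n c d)) (≤-reflexive (sym (+-suc c d))))
      mp = mix-put ℓ c c<n (subst (λ z → nth 0 up z ≡ ℓ) f0 (eqT⁻ _ ℓ eq))
      st₁ = stepB st (ℓ , f 0)
      sz : size (mix ℓ c) < size b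
      sz = ≤-trans (≤-reflexive (trans (sym (size-put c (mix ℓ c) c<n (proj₂ mp))) (cong size (sym (proj₁ mp))))) (mix-small ℓ (suc c) 1≤ℓ)
      pr : Paired r ℓ (mix ℓ c) (put c (mix ℓ c)) (proj₁ st) (proj₂ st) st₁
      pr = subst (λ z → Paired r ℓ (mix ℓ c) (put c (mix ℓ c)) (proj₁ st) (proj₂ st) (stepB st (ℓ , z))) (sym f0)
             (pair r ℓ c (mix ℓ c) (proj₁ st) (proj₂ st) 1≤ℓ c<n (proj₂ mp) sz (minv I))
      open Paired pr
      low' : ∀ i → nth 0 (setAt (proj₁ st) pos ℓ) i ≡ 0 ⊎ ℓ ≤ nth 0 (setAt (proj₁ st) pos ℓ) i
      low' i with i ≟ pos
      ... | yes refl = inj₂ (≤-reflexive (sym (nth-setAt 0 (proj₁ st) i ℓ (subst (i <_) (sym (len (minv I))) pos<))))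
      ... | no ne = subst (λ z → z ≡ 0 ⊎ ℓ ≤ z) (sym (nth-setAt-≢ 0 (proj₁ st) pos i ℓ ne)) (mlow I i)
      I' : Mid ℓ (suc c) st₁
      I' = record { minv = subst (λ v → Inv v (proj₁ st₁)) (sym (proj₁ mp)) inv
                  ; mlow = λ i → subst (λ z → nth 0 z i ≡ 0 ⊎ ℓ ≤ nth 0 z i) (sym is) (low' i)
                  ; msets = λ k q → trans (cong (gek n k) is) (trans (gek-keep (proj₁ st) pos ℓ k (len (minv I)) pos< was0 q) (msets I k q)) }
      cst : ∀ {X} → X + (ℓ + 1 ∸ r) * wraps b (mix ℓ (suc c)) ≡ proj₂ st₁ + (ℓ + 1 ∸ r) * wraps b (mix ℓ n) →
            X + (ℓ + 1 ∸ r) * wraps b (mix ℓ c) ≡ proj₂ st + (ℓ + 1 ∸ r) * wraps b (mix ℓ n)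
      cst {X} y = +-cancelʳ-≡ B _ _ (begin
          (X + A) + B ≡⟨ +-swapʳ X A B ⟩
          (X + B) + A ≡⟨ cong (_+ A) y' ⟩
          (proj₂ st₁ + C) + A ≡⟨ +-swapʳ (proj₂ st₁) C A ⟩
          (proj₂ st₁ + A) + C ≡⟨ cong (_+ C) cost ⟩
          (proj₂ st + B) + C ≡⟨ +-swapʳ (proj₂ st) B C ⟩
          (proj₂ st + C) + B ∎)
        where
        open ≡-Reasoning
        q = ℓ + 1 ∸ r
        A = q * wraps b (mix ℓ c)
        B = q * wraps b (put c (mix ℓ c))
        C = q * wraps b (mix ℓ n)
        y' : X + B ≡ proj₂ st₁ + C
        y' = subst (λ v → X + q * wraps b v ≡ proj₂ st₁ + C) (proj₁ mp) y

    phase : ∀ ℓ st → 1 ≤ ℓ → Phase (suc ℓ) st →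
      let st' = foldl stepB st (map (λ j → (ℓ , j)) (filterᵇ (λ j → nth 0 up j ≡ᵇ ℓ) (upTo n))) in
      Phase ℓ st' × proj₂ st' + (ℓ + 1 ∸ r) * Hk (suc ℓ) ≡ proj₂ st + (ℓ + 1 ∸ r) * Hk ℓ
    phase ℓ st 1≤ℓ I with phase-go ℓ n 0 (λ i → i) refl (λ _ → refl) 1≤ℓ st
      (record { minv = subst (λ v → Inv v (proj₁ st)) (sym (mix-0 ℓ)) (pinv I) ; mlow = λ i → lowr (plow I i) ; msets = λ k q → psets I k q })
      where
      lowr : ∀ {x} → x ≡ 0 ⊎ suc ℓ ≤ x → x ≡ 0 ⊎ ℓ ≤ x
      lowr (inj₁ p) = inj₁ p
      lowr (inj₂ p) = inj₂ (<⇒≤ p)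
    ... | J , c = record { pinv = iv ; plow = mlow J ; psets = ps } , cost (mix-n ℓ) (mix-0 ℓ) c
      where
      st' = foldl stepB st (map (λ j → (ℓ , j)) (filterᵇ (λ j → nth 0 up j ≡ᵇ ℓ) (upTo n)))
      cost : ∀ {v v' w w'} → v ≡ v' → w ≡ w' → proj₂ st' + (ℓ + 1 ∸ r) * wraps b w ≡ proj₂ st + (ℓ + 1 ∸ r) * wraps b v →
        proj₂ st' + (ℓ + 1 ∸ r) * wraps b w' ≡ proj₂ st + (ℓ + 1 ∸ r) * wraps b v'
      cost refl refl e = e
      iv : Inv (gek n ℓ up) (proj₁ st')
      iv = subst (λ v → Inv v (proj₁ st')) (mix-n ℓ) (minv J)
      e1 : gek n ℓ (proj₁ st') ≡ gek n 1 (proj₁ st')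
      e1 = ext _ _ (λ i p → trans (at-gek n ℓ _ i p) (trans (bool-iff (λ e → leT (≤-trans 1≤ℓ (leT⁻ {ℓ} {nth 0 (proj₁ st') i} e))) (λ e → leT (nonzero (mlow J i) (leT⁻ {1} {nth 0 (proj₁ st') i} e)))) (sym (at-gek n 1 _ i p))))
        where
        nonzero : ∀ {x} → x ≡ 0 ⊎ ℓ ≤ x → 1 ≤ x → ℓ ≤ x
        nonzero (inj₂ p) _ = p
        nonzero (inj₁ refl) ()
      ps : ∀ k → ℓ ≤ k → gek n k (proj₁ st') ≡ D (gek n k up)
      ps k q with ℓ ≟ k
      ... | yes refl = trans e1 (set iv)
      ... | no ne = msets J k (≤∧≢⇒< q ne)

    dsum : ℕ → ℕ
    dsum zero    = 0
    dsum (suc k) = (if r ≤ᵇ suc k then Hk (suc k) else 0) + dsum k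

    -- Summation by parts. With H_k the wraps of the set of labels at least k, label ℓ contributes
    -- (ℓ + 1 - r)(H_ℓ - H_(ℓ+1)) to maj, and the sum over ℓ is the sum of H_k over k ≥ r, which is
    -- `dsum`.
    phases : ∀ ℓ st T → Phase (suc ℓ) st → proj₂ st + dsum ℓ ≡ (suc ℓ ∸ r) * Hk (suc ℓ) + T →
      let st' = foldl stepB st (concatMap (λ ℓ → map (λ j → (ℓ , j)) (filterᵇ (λ j → nth 0 up j ≡ᵇ ℓ) (upTo n))) (downTo1 ℓ)) in
      Phase 1 st' × proj₂ st' ≡ (1 ∸ r) * Hk 1 + T
    phases zero st T I e = I , trans (sym (+-identityʳ _)) e
    phases (suc ℓ) st T I e rewrite LP.foldl-++ stepB st (map (λ j → (suc ℓ , j)) (filterᵇ (λ j → nth 0 up j ≡ᵇ suc ℓ) (upTo n)))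
        (concatMap (λ ℓ → map (λ j → (ℓ , j)) (filterᵇ (λ j → nth 0 up j ≡ᵇ ℓ) (upTo n))) (downTo1 ℓ)) =
      phases ℓ st₁ T (proj₁ ph) (+-cancelʳ-≡ (c₁ * Hk (suc (suc ℓ))) _ _ (begin
        (m₁ + dsum ℓ) + c₁ * H₂ ≡⟨ +-swapʳ m₁ (dsum ℓ) _ ⟩
        (m₁ + c₁ * H₂) + dsum ℓ ≡⟨ cong (_+ dsum ℓ) cs ⟩
        (m + c₁ * H₁) + dsum ℓ ≡⟨ cong (λ z → m + z + dsum ℓ) (coef ℓ) ⟩
        (m + ((if r ≤ᵇ suc ℓ then H₁ else 0) + (suc ℓ ∸ r) * H₁)) + dsum ℓ ≡⟨ regroup m _ ((suc ℓ ∸ r) * H₁) (dsum ℓ) ⟩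
        (m + dsum (suc ℓ)) + (suc ℓ ∸ r) * H₁ ≡⟨ cong (_+ (suc ℓ ∸ r) * H₁) e ⟩
        (c₁ * H₂ + T) + (suc ℓ ∸ r) * H₁ ≡⟨ trans (+-comm (c₁ * H₂ + T) _) (trans (cong ((suc ℓ ∸ r) * H₁ +_) (+-comm (c₁ * H₂) T)) (sym (+-assoc ((suc ℓ ∸ r) * H₁) T (c₁ * H₂)))) ⟩
        ((suc ℓ ∸ r) * H₁ + T) + c₁ * H₂ ∎))
      where
      open ≡-Reasoning
      st₁ = foldl stepB st (map (λ j → (suc ℓ , j)) (filterᵇ (λ j → nth 0 up j ≡ᵇ suc ℓ) (upTo n)))
      ph = phase (suc ℓ) st (s≤s z≤n) I
      m = proj₂ st
      m₁ = proj₂ st₁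
      H₁ = Hk (suc ℓ)
      H₂ = Hk (suc (suc ℓ))
      c₁ = suc (suc ℓ) ∸ r
      cs : m₁ + c₁ * H₂ ≡ m + c₁ * H₁
      cs = subst (λ z → m₁ + (z ∸ r) * H₂ ≡ m + (z ∸ r) * H₁) (+-comm (suc ℓ) 1) (proj₂ ph)
      regroup : ∀ a b c d → (a + (b + c)) + d ≡ (a + (b + d)) + c
      regroup a b c d = trans (cong (_+ d) (sym (+-assoc a b c))) (trans (+-swapʳ (a + b) c d) (cong (_+ c) (+-assoc a b d)))
      coef : ∀ ℓ → (suc (suc ℓ) ∸ r) * Hk (suc ℓ) ≡ (if r ≤ᵇ suc ℓ then Hk (suc ℓ) else 0) + (suc ℓ ∸ r) * Hk (suc ℓ)
      coef ℓ with r ≤? suc ℓ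
      ... | yes p rewrite leT p | +-∸-assoc 1 p = refl
      ... | no p rewrite leF (≰⇒> p) | m≤n⇒m∸n≡0 (≰⇒> p) | m≤n⇒m∸n≡0 (<⇒≤ (≰⇒> p)) = refl

Sset-small : ∀ {n} k (M : Mat n) → length M ≤ k → Sset k M ≡ empty n
Sset-small k       []      _       = refl
Sset-small (suc k) (b ∷ M) (s≤s p) rewrite Sset-small k M p = trans (cong (λ u → dep u b (empty _)) (wraps-empty b)) (dep-empty b)

at-empty : ∀ {n} i → at i (empty n) ≡ false
at-empty {zero}  i       = refl
at-empty {suc n} zero    = refl
at-empty {suc n} (suc i) = at-empty {n} i

nth-replicate : ∀ n i → nth 0 (replicate n 0) i ≡ 0
nth-replicate zero    i       = refl
nth-replicate (suc n) zero    = refl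
nth-replicate (suc n) (suc i) = nth-replicate n i

gek-zeros : ∀ n k → gek n (suc k) (replicate n 0) ≡ empty n
gek-zeros n k = ext _ _ (λ i p → trans (at-gek n (suc k) _ i p) (trans (cong (suc k ≤ᵇ_) (nth-replicate n i)) (sym (at-empty {n} i))))

sumTo-snoc : ∀ k f → sumTo (suc k) f ≡ f k + sumTo k f
sumTo-snoc zero    f = refl
sumTo-snoc (suc k) f = trans (cong (f 0 +_) (sumTo-snoc k (λ i → f (suc i))))
  (trans (sym (+-assoc (f 0) _ _)) (trans (cong (_+ sumTo k (λ i → f (suc i))) (+-comm (f 0) (f (suc k)))) (+-assoc (f (suc k)) _ _)))

nth-fill : ∀ {n} r (b : Vec Bool n) labs i → length labs ≡ n → i < n →
  nth 0 (fillLabels r (toList b) labs) i ≡ (if at i b then (if nth 0 labs i ≡ᵇ 0 then r else nth 0 labs i) else 0)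
nth-fill r (x ∷ b) (y ∷ labs) zero    e _       = refl
nth-fill r (x ∷ b) (y ∷ labs) (suc i) e (s≤s p) = nth-fill r b labs i (suc-injective e) p

length-fill : ∀ {n} r (b : Vec Bool n) labs → length labs ≡ n → length (fillLabels r (toList b) labs) ≡ n
length-fill r []      []         e = refl
length-fill r (x ∷ b) (y ∷ labs) e = cong suc (length-fill r b labs (suc-injective e))

Decr : ∀ {n} → Mat n → Set
Decr []          = ⊤
Decr (_ ∷ [])    = ⊤
Decr (b ∷ s ∷ M) = size s ≤ size b × Decr (s ∷ M)

decr-tail : ∀ {n} (b : Vec Bool n) M → Decr (b ∷ M) → Decr M
decr-tail b []      h = tt
decr-tail b (_ ∷ _) h = proj₂ h

decr-ʳ++ : ∀ {n} (M M' : Mat n) → Decr (M ʳ++ M') → Decr M'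
decr-ʳ++ []      M' h = h
decr-ʳ++ (b ∷ M) M' h = decr-tail b M' (decr-ʳ++ M (b ∷ M') h)

decr-head : ∀ {n} (b : Vec Bool n) M → Decr (b ∷ M) → size (head M) ≤ size b
decr-head {n} b []  h = ≤-trans (≤-reflexive (size-empty n)) z≤n
decr-head b (_ ∷ _) h = proj₁ h

-- Up consists of the rows r, …, L, and up is the labelling of row r.
record Labels {n} (r : ℕ) (Up : Mat n) (up : List ℕ) : Set where
  field
    llen  : length up ≡ n
    llow  : ∀ k → 1 ≤ k → k ≤ r → gek n k up ≡ head Up
    lsets : ∀ i → gek n (r + i) up ≡ Sset i Up
open Labels

module _ {n : ℕ} (b : Vec Bool n) (r' : ℕ) (Up : Mat n) (up : List ℕ) (lab : Labels (suc r') Up up) (sz : size (head Up) ≤ size b) where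
  open Pairing b

  private
    r = suc r'
    L = r' + length Up
    small : size (gek n 1 up) ≤ size b
    small = ≤-trans (≤-reflexive (cong size (llow lab 1 ≤-refl (s≤s z≤n)))) sz

  open Rows r up small
  open Inv
  open Phase

  private
    top : ∀ k → suc L ≤ k → gek n k up ≡ empty n
    top k p = trans (cong (λ z → gek n z up) (sym e)) (trans (lsets lab (k ∸ r)) (Sset-small (k ∸ r) Up
        (≤-trans (≤-reflexive (sym (m+n∸m≡n r (length Up)))) (∸-monoˡ-≤ r p))))
      where
      e : r + (k ∸ r) ≡ k
      e = m+[n∸m]≡n (≤-trans (s≤s (m≤m+n r' (length Up))) p)
    zeros = replicate n 0
    D-top : ∀ k → suc L ≤ k → D (gek n k up) ≡ empty n
    D-top k p rewrite top k p = trans (cong (λ u → dep u b (empty n)) (wraps-empty b)) (dep-empty b)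
    start : Phase (suc L) (zeros , 0)
    start = record
      { pinv = record { len = LP.length-replicate n ; set = trans (gek-zeros n 0) (sym (D-top (suc L) ≤-refl)) }
      ; plow = λ i → inj₁ (nth-replicate n i)
      ; psets = λ { (suc k) p → trans (gek-zeros n k) (sym (D-top (suc k) p)) } }
    start-cost : 0 + dsum L ≡ (suc L ∸ r) * Hk (suc L) + dsum L
    start-cost = sym (cong (_+ dsum L) (trans (cong ((suc L ∸ r) *_) (trans (cong (wraps b) (top (suc L) ≤-refl)) (wraps-empty b))) (*-zeroʳ (suc L ∸ r))))
    st = foldl stepB (zeros , 0) (order n L up)
    fin = phases L (zeros , 0) (dsum L) start start-cost
    dsum-low : ∀ k → k ≤ r' → dsum k ≡ 0
    dsum-low zero    _ = refl
    dsum-low (suc k) p rewrite leF {r} {suc k} (s≤s p) = dsum-low k (<⇒≤ p)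
    dsum-sum : ∀ l → dsum (r' + l) ≡ sumTo l (λ i → Hk (r + i))
    dsum-sum zero = dsum-low (r' + 0) (≤-reflexive (+-identityʳ r'))
    dsum-sum (suc l) rewrite +-suc r' l | leT {r} {suc (r' + l)} (s≤s (m≤m+n r' l)) =
      trans (cong (Hk (suc (r' + l)) +_) (dsum-sum l)) (sym (sumTo-snoc l (λ i → Hk (r + i))))
    labs = proj₁ st

  row-cost : proj₂ st ≡ sumTo (length Up) (λ i → wraps b (Sset i Up))
  row-cost = trans (proj₂ fin) (trans (cong (λ z → z * Hk 1 + dsum L) (0∸n≡0 r')) (trans (dsum-sum (length Up))
    (sumTo-cong (length Up) (λ i _ → cong (wraps b) (lsets lab i)))))

  row-labels : 1 ≤ r' → Labels r' (b ∷ Up) (fillLabels r' occ labs)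
  row-labels 1≤r' = record
    { llen = length-fill r' b labs ln
    ; llow = λ k p q → lower k p q
    ; lsets = λ { zero → trans (cong (λ z → gek n z up') (+-identityʳ r')) (lower r' 1≤r' ≤-refl)
                ; (suc i) → trans (cong (λ z → gek n z up') (+-suc r' i)) (trans (upper (r + i) (s≤s (m≤m+n r' i)))
                    (trans (psets ph (r + i) (s≤s z≤n)) (cong (λ v → dep (wraps b v) b v) (lsets lab i)))) } }
    where
    ph = proj₁ fin
    ln = len (pinv ph)
    up' = fillLabels r' occ labs
    big : ∀ i → i < n → nth 0 labs i ≢ 0 → r ≤ nth 0 labs i
    big i p ne = leT⁻ (trans (sym (at-gek n r labs i p)) (trans (cong (at i) (trans (psets ph r (s≤s z≤n)) (trans (cong (λ v → dep (wraps b v) b v)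
        (trans (llow lab r (s≤s z≤n) ≤-refl) (sym (llow lab 1 ≤-refl (s≤s z≤n))))) (sym (psets ph 1 ≤-refl))))) (trans (at-gek n 1 labs i p) (leT (n≢0⇒n>0 ne)))))
    lower : ∀ k → 1 ≤ k → k ≤ r' → gek n k up' ≡ b
    lower k p q = ext _ _ go
      where
      go : ∀ i → i < n → at i (gek n k up') ≡ at i b
      go i lt rewrite at-gek n k up' i lt | nth-fill r' b labs i ln lt with at i b | nth 0 labs i ≡ᵇ 0 in e
      ... | false | _     = leF p
      ... | true  | true  = leT q
      ... | true  | false = leT (≤-trans q (≤-trans (n≤1+n r') (big i lt (eqF⁻ _ 0 e))))
    upper : ∀ k → r' < k → gek n k up' ≡ gek n k labs
    upper k p = ext _ _ go
      where
      go : ∀ i → i < n → at i (gek n k up') ≡ at i (gek n k labs)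
      go i lt rewrite at-gek n k up' i lt | nth-fill r' b labs i ln lt with at i b in eb | nth 0 labs i ≡ᵇ 0 in e
      ... | true  | true  = trans (leF p) (sym (trans (at-gek n k labs i lt) (leF (subst (_< k) (sym (eqT⁻ _ 0 e)) (≤-trans (s≤s z≤n) p)))))
      ... | true  | false = sym (at-gek n k labs i lt)
      ... | false | _     = trans (leF {k} (≤-trans (s≤s z≤n) p)) (sym (bool-iff (λ x → trans (sym eb) (sub-at _ b (sub-dep _ b _) i
              (trans (cong (at i) (sym (psets ph k (≤-trans (s≤s z≤n) p)))) x))) (λ ())))

-- `rest` lists the rows still to be labelled, uppermost first, so `rest ʳ++ Up` is the whole matrix
-- at every stage. Decreasing row sizes ensure that each queue serves all its customers.
fmGo-ok : ∀ {n} L (rest Up : Mat n) up → length rest + length Up ≡ L → Labels (suc (length rest)) Up up → Decr (rest ʳ++ Up) →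
  let out = fmGo n L (suc (length rest)) up (map toList rest) in
  Labels 1 (rest ʳ++ Up) (proj₁ out) × proj₂ out + majA Up ≡ majA (rest ʳ++ Up)
fmGo-ok L [] Up up _ lab d = lab , refl
fmGo-ok {n} L (b ∷ rest) Up up eL lab d =
  proj₁ ih , trans (cong (_+ majA Up) (cong (_+ m₂) c)) (trans (reg (sumTo (length Up) (λ i → wraps b (Sset i Up))) m₂ (majA Up)) (proj₂ ih))
  where
  h = decr-head b Up (decr-ʳ++ rest (b ∷ Up) d)
  st : List ℕ × ℕ
  st = foldl (λ s x → pairBall n (suc (suc (length rest))) (toList b) x s) (replicate n 0 , 0) (order n L up)
  c : proj₂ st ≡ sumTo (length Up) (λ i → wraps b (Sset i Up))
  c = subst (λ l → proj₂ (foldl (λ s x → pairBall n (suc (suc (length rest))) (toList b) x s) (replicate n 0 , 0) (order n l up)) ≡ _) eL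
        (row-cost b (suc (length rest)) Up up lab h)
  lab' : Labels (suc (length rest)) (b ∷ Up) (fillLabels (suc (length rest)) (toList b) (proj₁ st))
  lab' = subst (λ l → Labels (suc (length rest)) (b ∷ Up) (fillLabels (suc (length rest)) (toList b)
           (proj₁ (foldl (λ s x → pairBall n (suc (suc (length rest))) (toList b) x s) (replicate n 0 , 0) (order n l up))))) eL
        (row-labels b (suc (length rest)) Up up lab h (s≤s z≤n))
  ih = fmGo-ok L rest (b ∷ Up) (fillLabels (suc (length rest)) (toList b) (proj₁ st)) (trans (+-suc (length rest) (length Up)) eL) lab' d
  m₂ = proj₂ (fmGo n L (suc (length rest)) (fillLabels (suc (length rest)) (toList b) (proj₁ st)) (map toList rest))
  reg : ∀ a b c → (a + b) + c ≡ b + (c + a)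
  reg a b c = trans (cong (_+ c) (+-comm a b)) (trans (+-assoc b a c) (cong (b +_) (+-comm a c)))

lists : ∀ {n} → Mat n → MLQ
lists = map toList

record FM {n} (M : Mat n) : Set where
  field
    fm-len  : length (type n (lists M)) ≡ n
    fm-sets : ∀ i → gek n (suc i) (type n (lists M)) ≡ Sset i M
    fm-maj  : maj n (lists M) ≡ majA M

fm-correct : ∀ {n} (M : Mat n) → Decr M → FM M
fm-correct {n} M d = go (reverse M) (LP.reverse-involutive M)
  where
  go : ∀ R → R ʳ++ [] ≡ M → FM M
  go [] refl = record { fm-len = LP.length-replicate n ; fm-sets = λ i → gek-zeros n i ; fm-maj = refl }
  go (top ∷ rest) refl = record
    { fm-len = subst (λ z → length (proj₁ z) ≡ n) (sym fmeq) (llen (proj₁ out))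
    ; fm-sets = λ i → subst (λ z → gek n (suc i) (proj₁ z) ≡ Sset i M) (sym fmeq) (lsets (proj₁ out) i)
    ; fm-maj = trans (cong proj₂ fmeq) (trans (sym (+-identityʳ _)) (proj₂ out)) }
    where
    L = suc (length rest)
    lab : Labels L (top ∷ []) (fillLabels L (toList top) (replicate n 0))
    lab = record { llen = length-fill L top _ (LP.length-replicate n) ; llow = lower ; lsets = λ { zero → trans (cong (λ z → gek n z up) (+-identityʳ L)) (lower L (s≤s z≤n) ≤-refl)
                 ; (suc i) → trans (upper (L + suc i) (≤-trans (s≤s (m≤m+n L i)) (≤-reflexive (sym (+-suc L i))))) (sym (trans (cong (λ u → dep u top (empty n)) (wraps-empty top)) (dep-empty top))) } }
      where
      up = fillLabels L (toList top) (replicate n 0)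
      val : ∀ i → i < n → nth 0 up i ≡ (if at i top then L else 0)
      val i p = trans (nth-fill L top _ i (LP.length-replicate n) p) (cong (λ z → if at i top then (if z ≡ᵇ 0 then L else z) else 0) (nth-replicate n i))
      lower : ∀ k → 1 ≤ k → k ≤ L → gek n k up ≡ top
      lower k p q = ext _ _ λ i lt → trans (at-gek n k up i lt) (trans (cong (k ≤ᵇ_) (val i lt)) (l (at i top)))
        where
        l : ∀ x → (k ≤ᵇ (if x then L else 0)) ≡ x
        l true  = leT q
        l false = leF p
      upper : ∀ k → L < k → gek n k up ≡ empty n
      upper k p = ext _ _ λ i lt → trans (at-gek n k up i lt) (trans (cong (k ≤ᵇ_) (val i lt)) (trans (l (at i top)) (sym (at-empty {n} i))))
        where
        l : ∀ x → (k ≤ᵇ (if x then L else 0)) ≡ false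
        l true  = leF p
        l false = leF (≤-trans (s≤s z≤n) p)
    out = fmGo-ok L rest (top ∷ []) _ (+-comm (length rest) 1) lab d
    lenM : length (lists M) ≡ L
    lenM = trans (LP.length-map toList M) (trans (LP.length-ʳ++ rest) (+-comm (length rest) 1))
    revM : reverse (lists M) ≡ toList top ∷ map toList rest
    revM = trans (sym (LP.reverse-map toList M)) (cong (map toList) (LP.reverse-involutive (top ∷ rest)))
    fmeq : fm n (lists M) ≡ fmGo n L L (fillLabels L (toList top) (replicate n 0)) (map toList rest)
    fmeq with reverse (lists M) | revM
    ... | _ | refl rewrite lenM = refl

-- Charge of a word as wraps of upward queues

data Last (Q : ℕ × ℕ → Bool) (f : ℕ → ℕ) (l : List ℕ) (acc : Maybe ℕ) : Maybe ℕ → Set where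
  lfound : ∀ i → i < length l → Q (f i , nth 0 l i) ≡ true → (∀ j → i < j → j < length l → Q (f j , nth 0 l j) ≡ false) → Last Q f l acc (just (f i))
  lnone  : (∀ i → i < length l → Q (f i , nth 0 l i) ≡ false) → Last Q f l acc acc

-- Common form of `rightmost` and `rightmostBelow`; by `lastBy-filter` it absorbs the restriction to
-- the letters that are still present.
lastBy : (ℕ × ℕ → Bool) → Maybe ℕ → List (ℕ × ℕ) → Maybe ℕ
lastBy Q = foldl (λ acc pl → if Q pl then just (proj₁ pl) else acc)

last-zip : ∀ Q f l acc → Last Q f l acc (lastBy Q acc (zip (applyUpTo f (length l)) l))
last-zip Q f [] acc = lnone λ _ ()
last-zip Q f (x ∷ l) acc with Q (f 0 , x) in e
... | true with lastBy Q (just (f 0)) (zip (applyUpTo (λ i → f (suc i)) (length l)) l) | last-zip Q (λ i → f (suc i)) l (just (f 0))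
...   | _ | lfound i p q h = lfound (suc i) (s≤s p) q (λ { (suc j) (s≤s a) (s≤s b) → h j a b })
...   | _ | lnone h = lfound 0 (s≤s z≤n) e (λ { (suc j) _ (s≤s b) → h j b })
last-zip Q f (x ∷ l) acc | false with lastBy Q acc (zip (applyUpTo (λ i → f (suc i)) (length l)) l) | last-zip Q (λ i → f (suc i)) l acc
...   | _ | lfound i p q h = lfound (suc i) (s≤s p) q (λ { (suc j) (s≤s a) (s≤s b) → h j a b })
...   | _ | lnone h = lnone (λ { zero _ → e ; (suc j) (s≤s b) → h j b })

lastBy-filter : ∀ g Q acc xs → lastBy Q acc (filterᵇ g xs) ≡ lastBy (λ pl → g pl ∧ Q pl) acc xs
lastBy-filter g Q acc [] = refl
lastBy-filter g Q acc (x ∷ xs) with g x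
... | true  = lastBy-filter g Q _ xs
... | false = lastBy-filter g Q acc xs

maxL-filter : ∀ g (f : ℕ → ℕ) l i → i < length l → g (f i , nth 0 l i) ≡ true → nth 0 l i ≤ maxL (map proj₂ (filterᵇ g (zip (applyUpTo f (length l)) l)))
maxL-filter g f (x ∷ l) zero p e with g (f 0 , x)
maxL-filter g f (x ∷ l) zero p refl | true = m≤m⊔n x _
maxL-filter g f (x ∷ l) (suc i) (s≤s p) e with g (f 0 , x)
... | true  = ≤-trans (maxL-filter g (λ i → f (suc i)) l i p e) (m≤n⊔m x _)
... | false = maxL-filter g (λ i → f (suc i)) l i p e

filter-zip-cong : ∀ g h (f : ℕ → ℕ) l → (∀ i → i < length l → g (f i , nth 0 l i) ≡ h (f i , nth 0 l i)) →
  filterᵇ g (zip (applyUpTo f (length l)) l) ≡ filterᵇ h (zip (applyUpTo f (length l)) l)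
filter-zip-cong g h f [] e = refl
filter-zip-cong g h f (x ∷ l) e with g (f 0 , x) | h (f 0 , x) | e 0 (s≤s z≤n)
... | true  | _ | refl = cong ((f 0 , x) ∷_) (filter-zip-cong g h (λ i → f (suc i)) l (λ i p → e (suc i) (s≤s p)))
... | false | _ | refl = filter-zip-cong g h (λ i → f (suc i)) l (λ i p → e (suc i) (s≤s p))

filter-filterᵇ : ∀ {A : Set} (g h : A → Bool) xs → filterᵇ h (filterᵇ g xs) ≡ filterᵇ (λ x → g x ∧ h x) xs
filter-filterᵇ g h [] = refl
filter-filterᵇ g h (x ∷ xs) with g x
... | false = filter-filterᵇ g h xs
... | true with h x
...   | true  = cong (x ∷_) (filter-filterᵇ g h xs)
...   | false = filter-filterᵇ g h xs

free-exists : ∀ {n} (x b : Vec Bool n) → Sub x b → size x < size b → ∃ λ i → i < n × at i b ≡ true × at i x ≡ false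
free-exists (false ∷ x) (true ∷ b)  _       p = 0 , s≤s z≤n , refl , refl
free-exists (true ∷ x)  (true ∷ b)  (_ , s) (s≤s p) = let (i , l , a , c) = free-exists x b s p in suc i , s≤s l , a , c
free-exists (false ∷ x) (false ∷ b) (_ , s) p = let (i , l , a , c) = free-exists x b s p in suc i , s≤s l , a , c
free-exists (true ∷ x)  (false ∷ b) (() , s) p

firsts-suc : ∀ {n} t (r : Vec Bool n) k → k < n → at k r ≡ true → at k (firsts t r) ≡ false → (∀ i → i < k → Busy i r (firsts t r)) →
  firsts (suc t) r ≡ put k (firsts t r)
firsts-suc zero (true ∷ r) zero p e f h = refl
firsts-suc (suc t) (true ∷ r) zero p e () h
firsts-suc t (false ∷ r) zero p () f h
firsts-suc zero (true ∷ r) (suc k) p e f h with h 0 (s≤s z≤n) refl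
... | ()
firsts-suc (suc t) (true ∷ r) (suc k) (s≤s p) e f h = cong (true ∷_) (firsts-suc t r k p e f (λ i q → h (suc i) (s≤s q)))
firsts-suc t (false ∷ r) (suc k) (s≤s p) e f h = cong (false ∷_) (firsts-suc t r k p e f (λ i q → h (suc i) (s≤s q)))

firsts-0 : ∀ {n} (r : Vec Bool n) → firsts 0 r ≡ empty n
firsts-0 [] = refl
firsts-0 (true ∷ r) = cong (false ∷_) (firsts-0 r)
firsts-0 (false ∷ r) = cong (false ∷_) (firsts-0 r)

sub-full : ∀ {n} (x b : Vec Bool n) → Sub x b → size b ≤ size x → x ≡ b
sub-full [] [] _ _ = refl
sub-full (true ∷ x) (true ∷ b) (_ , s) (s≤s p) = cong (true ∷_) (sub-full x b s p)
sub-full (false ∷ x) (false ∷ b) (_ , s) p = cong (false ∷_) (sub-full x b s p)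
sub-full (false ∷ x) (true ∷ b) (_ , s) p = ⊥-elim (<⇒≱ (s≤s (sub-size x b s)) p)
sub-full (true ∷ x) (false ∷ b) (() , s) p

module Word (w : List ℕ) (L : ℕ) where

  len = length w

  letter : ℕ → Vec Bool len
  letter a = vecOf len (λ i → nth 0 w i ≡ᵇ a)

  at-letter : ∀ a i → i < len → at i (letter a) ≡ (nth 0 w i ≡ᵇ a)
  at-letter a i p = at-vecOf len _ i p

  mult : ℕ → ℕ
  mult a = size (letter a)

  rletter : ℕ → Vec Bool len
  rletter a = rev (letter a)

  rowsFrom : ℕ → ℕ → Mat len
  rowsFrom a zero    = []
  rowsFrom a (suc l) = letter a ∷ rowsFrom (suc a) l

  module _ (range : ∀ i → i < len → 1 ≤ nth 0 w i × nth 0 w i ≤ L) (dec : ∀ a → 1 ≤ a → mult (suc a) ≤ mult a) where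

    -- The letters a in the first t standard subwords; columns are reversed, since charge scans to the left.
    Xs : ℕ → ℕ → Vec Bool len
    Xs zero          t = empty len
    Xs (suc zero)    t = firsts t (rletter 1)
    Xs (suc (suc a)) t = dep (wraps (rletter (suc (suc a))) (Xs (suc a) t)) (rletter (suc (suc a))) (Xs (suc a) t)

    rmult : ∀ a → size (rletter a) ≡ mult a
    rmult a = size-rev (letter a)

    size-Xs : ∀ a t → 1 ≤ a → t ≤ mult a → size (Xs a t) ≡ t
    size-Xs (suc zero) t _ p = size-firsts t (rletter 1) (≤-trans p (≤-reflexive (sym (rmult 1))))
    size-Xs (suc (suc a)) t _ p with size-Xs (suc a) t (s≤s z≤n) (≤-trans p (dec (suc a) (s≤s z≤n)))
    ... | ih = trans (size-dep (rletter (suc (suc a))) (Xs (suc a) t) (≤-trans (≤-reflexive ih) (≤-trans p (≤-reflexive (sym (rmult (suc (suc a)))))))) ih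

    sub-Xs : ∀ a t → Sub (Xs a t) (rletter a)
    sub-Xs zero t = sub-empty _
    sub-Xs (suc zero) t = sub-firsts t (rletter 1)
    sub-Xs (suc (suc a)) t = sub-dep _ (rletter (suc (suc a))) _

    mult-big : ∀ a → L < a → mult a ≡ 0
    mult-big a p = trans (cong size (ext (letter a) (empty len) (λ i q → trans (at-letter a i q) (trans (eqF (λ e → <⇒≱ p (subst (_≤ L) e (proj₂ (range i q))))) (sym (at-empty {len} i))))))
      (size-empty len)

    mult-mono : ∀ a i → 1 ≤ a → mult (a + i) ≤ mult a
    mult-mono a zero p = ≤-reflexive (cong mult (+-identityʳ a))
    mult-mono a (suc i) p = ≤-trans (≤-reflexive (cong mult (+-suc a i))) (≤-trans (dec (a + i) (≤-trans p (m≤m+n a i))) (mult-mono a i p))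

    -- The letter a takes part only in the first `mult a` standard subwords, hence the minimum.
    -- Positions are reversed as in `Xs`.
    used : ℕ → ℕ → Bool
    used t p = at (len ∸ suc p) (Xs (nth 0 w p) (t ⊓ mult (nth 0 w p)))

    remaining : ℕ → List (ℕ × ℕ)
    remaining t = filterᵇ (λ pl → not (used t (proj₁ pl))) (zip (upTo len) w)

    freeL : ℕ → ℕ → ℕ → Bool
    freeL t a p = not (used t p) ∧ (nth 0 w p ≡ᵇ a)

    free-rev : ∀ t a p → p < len → t < mult a → freeL t a p ≡ true → at (len ∸ suc p) (rletter a) ≡ true × at (len ∸ suc p) (Xs a t) ≡ false
    free-rev t a p lt tm e with ∧-elim (not (used t p)) _ e
    ... | x , y with eqT⁻ (nth 0 w p) a y
    ... | refl = trans (at-rev _ (letter a) (flip< p lt)) (trans (cong (λ z → at z (letter a)) (flip-flip p lt)) (trans (at-letter a p lt) y)) ,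
                 trans (cong (λ z → at (len ∸ suc p) (Xs a z)) (sym (m≤n⇒m⊓n≡m (<⇒≤ tm)))) (notT x)
      where
      notT : ∀ {b} → not b ≡ true → b ≡ false
      notT {false} _ = refl

    busy-rev : ∀ t a i → t < mult a → (∀ p → p < len → len ∸ suc p ≡ i → freeL t a p ≡ false) → Busy i (rletter a) (Xs a t)
    busy-rev t a i tm h e with i <? len
    ... | no q with trans (sym e) (at-big i (rletter a) (≮⇒≥ q))
    ...   | ()
    busy-rev t a i tm h e | yes q = trans (cong₂ (λ z y → at z (Xs a y)) (sym ii) (sym (m≤n⇒m⊓n≡m (<⇒≤ tm)))) (l (trans (sym (∧-dec (used t p) (nth 0 w p ≡ᵇ a) y)) (h p p<len ii)))
      where
      p = len ∸ suc i
      p<len = flip< i q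
      ii : len ∸ suc p ≡ i
      ii = flip-flip i q
      y : (nth 0 w p ≡ᵇ a) ≡ true
      y = trans (sym (at-letter a p p<len)) (trans (sym (at-rev i (letter a) q)) e)
      ∧-dec : ∀ b c → c ≡ true → not b ∧ c ≡ not b
      ∧-dec true  c _    = refl
      ∧-dec false c refl = refl
      l : not (used t p) ≡ false → at (len ∸ suc p) (Xs a (t ⊓ mult a)) ≡ true
      l f = trans (cong (λ b → at (len ∸ suc p) (Xs b (t ⊓ mult b))) (sym (eqT⁻ (nth 0 w p) a y))) (notF f)
        where
        notF : ∀ {b} → not b ≡ false → b ≡ true
        notF {true} _ = refl

    data Pick (t a prev : ℕ) : Maybe ℕ → Set where
      below : ∀ p → p < len → p < prev → freeL t a p ≡ true → (∀ i → p < i → i < prev → i < len → freeL t a i ≡ false) → Pick t a prev (just p)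
      wrapd : ∀ p → p < len → prev ≤ p → freeL t a p ≡ true → (∀ i → p < i → i < len → freeL t a i ≡ false) →
              (∀ i → i < prev → i < len → freeL t a i ≡ false) → Pick t a prev (just p)
      pnone : (∀ i → i < len → freeL t a i ≡ false) → Pick t a prev nothing

    rightmost-rem : ∀ t a → Last (λ pl → not (used t (proj₁ pl)) ∧ (proj₂ pl ≡ᵇ a)) (λ i → i) w nothing (rightmost a (remaining t))
    rightmost-rem t a rewrite lastBy-filter (λ pl → not (used t (proj₁ pl))) (λ pl → proj₂ pl ≡ᵇ a) nothing (zip (upTo len) w) =
      last-zip _ (λ i → i) w nothing

    below-rem : ∀ t a prev → Last (λ pl → not (used t (proj₁ pl)) ∧ ((proj₂ pl ≡ᵇ a) ∧ (proj₁ pl <ᵇ prev))) (λ i → i) w nothing (rightmostBelow a prev (remaining t))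
    below-rem t a prev rewrite lastBy-filter (λ pl → not (used t (proj₁ pl))) (λ pl → (proj₂ pl ≡ᵇ a) ∧ (proj₁ pl <ᵇ prev)) nothing (zip (upTo len) w) =
      last-zip _ (λ i → i) w nothing

    ∧-3 : ∀ x y z → x ∧ (y ∧ z) ≡ true → (x ∧ y ≡ true) × z ≡ true
    ∧-3 true true true _ = refl , refl

    ∧-3f : ∀ x y z → x ∧ (y ∧ z) ≡ false → z ≡ true → x ∧ y ≡ false
    ∧-3f false y z e q = refl
    ∧-3f true false z e q = refl
    ∧-3f true true .true () refl

    pick-ok : ∀ t a prev → Pick t a prev (pick a prev (remaining t))
    pick-ok t a prev with rightmostBelow a prev (remaining t) | below-rem t a prev
    ... | _ | lfound p lt q h = let (x , y) = ∧-3 (not (used t p)) _ _ q in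
          below p lt (ltT⁻ {p} {prev} y) x (λ i a' b c → ∧-3f (not (used t i)) _ _ (h i a' c) (ltT b))
    ... | _ | lnone g with rightmost a (remaining t) | rightmost-rem t a
    ...   | _ | lnone h = pnone h
    ...   | _ | lfound p lt q h with prev ≤? p
    ...     | yes le = wrapd p lt le q h (λ i a' b → ∧-3f (not (used t i)) _ _ (g i b) (ltT a'))
    ...     | no nle with trans (sym q) (∧-3f (not (used t p)) _ _ (g p lt) (ltT (≰⇒> nle)))
    ...       | ()

    -- For t up to `mult a`, the sum of the indices of the letters a in the first t standard
    -- subwords: the index of a letter is the number of wraps on the way to it from the letter 1.
    v : ℕ → ℕ → ℕ
    v zero          t = 0
    v (suc zero)    t = 0
    v (suc (suc a)) t = v (suc a) t + wraps (rletter (suc (suc a))) (Xs (suc a) t)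

    vm : ℕ → ℕ → ℕ
    vm a t = v a (t ⊓ mult a)

    -- Picking the letter a + 1 of a subword adds one customer to the queue between the two letters.
    -- A choice to the left of `prev` lies to the right after reversal; a choice made by going
    -- around is a wrap, and exactly then charge raises the index.
    extend : ∀ t a prev → 1 ≤ a → prev < len → nth 0 w prev ≡ a → Xs a (suc t) ≡ put (len ∸ suc prev) (Xs a t) → at (len ∸ suc prev) (Xs a t) ≡ false →
      t < mult (suc a) → ∀ {r} → Pick t (suc a) prev r → ∃ λ p → r ≡ just p × p < len × nth 0 w p ≡ suc a × at (len ∸ suc p) (Xs (suc a) t) ≡ false ×
        Xs (suc a) (suc t) ≡ put (len ∸ suc p) (Xs (suc a) t) ×
        wraps (rletter (suc a)) (Xs a (suc t)) ≡ (if prev <ᵇ p then 1 else 0) + wraps (rletter (suc a)) (Xs a t)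
    extend t (suc a) prev 1≤a pl pw eX pf tm (pnone h) with free-exists (Xs (suc (suc a)) t) (rletter (suc (suc a))) (sub-Xs (suc (suc a)) t)
      (≤-trans (s≤s (≤-reflexive (size-Xs (suc (suc a)) t (s≤s z≤n) (<⇒≤ tm)))) (≤-trans tm (≤-reflexive (sym (rmult (suc (suc a)))))))
    ... | i , lt , x , y with trans (sym y) (busy-rev t (suc (suc a)) i tm (λ p q _ → h p q) x)
    ...   | ()
    extend t (suc a) prev 1≤a pl pw eX pf tm (below p lt pp fr h) =
      p , refl , lt , eqT⁻ _ _ (proj₂ (∧-elim (not (used t p)) _ fr)) , proj₂ fv , trans (cong (λ z → dep (wraps B z) B z) eX) (proj₂ add) ,
      trans (cong (wraps B) eX) (trans (proj₁ add) (cong (λ z → (if z then 1 else 0) + wraps B (Xs (suc a) t)) (sym (ltF {prev} {p} (<⇒≤ pp)))))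
      where
      B = rletter (suc (suc a))
      fv = free-rev t (suc (suc a)) p lt tm fr
      add = add-right-wraps B (Xs (suc a) t) (len ∸ suc prev) (len ∸ suc p)
        (≤-trans (≤-reflexive (size-Xs (suc a) t 1≤a (≤-trans (<⇒≤ tm) (dec (suc a) 1≤a)))) (≤-trans (<⇒≤ tm) (≤-reflexive (sym (rmult (suc (suc a)))))))
        pf (∸-monoʳ-≤ len (s≤s (<⇒≤ pp))) (proj₁ fv) (proj₂ fv) (λ i x y → busy-rev t (suc (suc a)) i tm (λ q ql e → bz q ql e x y))
        where
        bz : ∀ {i} q → q < len → len ∸ suc q ≡ i → len ∸ suc prev ≤ i → i < len ∸ suc p → freeL t (suc (suc a)) q ≡ false
        bz q ql refl x y with <-cmp q prev
        ... | tri< qp _ _ = h q (≰⇒> (λ c → <⇒≱ y (∸-monoʳ-≤ len (s≤s c)))) qp ql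
        ... | tri≈ _ refl _ = trans (cong (not (used t q) ∧_) (eqF (λ e → 1+n≢n (trans (sym e) pw)))) (∧-zeroʳ (not (used t q)))
        ... | tri> _ _ gt = ⊥-elim (<⇒≱ (∸-monoʳ-< (s≤s gt) ql) x)
    extend t (suc a) prev 1≤a pl pw eX pf tm (wrapd p lt le fr h g) =
      p , refl , lt , pa , proj₂ fv , trans (cong (λ z → dep (wraps B z) B z) eX) (proj₂ add) ,
      trans (cong (wraps B) eX) (trans (proj₁ add) (cong (λ z → (if z then 1 else 0) + wraps B (Xs (suc a) t)) (sym (ltT prev<p))))
      where
      B = rletter (suc (suc a))
      pa = eqT⁻ (nth 0 w p) (suc (suc a)) (proj₂ (∧-elim (not (used t p)) _ fr))
      prev<p : prev < p
      prev<p = ≤∧≢⇒< le (λ e → 1+n≢n (trans (sym pa) (trans (cong (nth 0 w) (sym e)) pw)))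
      fv = free-rev t (suc (suc a)) p lt tm fr
      add = add-wrap-wraps B (Xs (suc a) t) (len ∸ suc prev) (len ∸ suc p)
        (≤-trans (≤-reflexive (size-Xs (suc a) t 1≤a (≤-trans (<⇒≤ tm) (dec (suc a) 1≤a)))) (≤-trans (<⇒≤ tm) (≤-reflexive (sym (rmult (suc (suc a)))))))
        (flip< prev pl) pf (∸-monoʳ-< (s≤s prev<p) lt) (proj₁ fv) (proj₂ fv)
        (λ i x → busy-rev t (suc (suc a)) i tm (λ q ql e → h q (≰⇒> (λ c → <⇒≱ (subst (_< len ∸ suc p) (sym e) x) (∸-monoʳ-≤ len (s≤s c)))) ql))
        (λ i x → busy-rev t (suc (suc a)) i tm (λ q ql e → bz q ql e x))
        where
        bz : ∀ {i} q → q < len → len ∸ suc q ≡ i → len ∸ suc prev ≤ i → freeL t (suc (suc a)) q ≡ false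
        bz q ql refl x with <-cmp q prev
        ... | tri< qp _ _ = g q qp ql
        ... | tri≈ _ refl _ = trans (cong (not (used t q) ∧_) (eqF (λ e → 1+n≢n (trans (sym e) pw)))) (∧-zeroʳ (not (used t q)))
        ... | tri> _ _ gt = ⊥-elim (<⇒≱ (∸-monoʳ-< (s≤s gt) ql) x)

    full : ∀ t a p → p < len → mult a ≤ t → 1 ≤ a → freeL t a p ≡ false
    full t a p lt le 1≤a with nth 0 w p ≡ᵇ a in e
    ... | false = ∧-zeroʳ (not (used t p))
    ... | true = trans (cong (λ b → not b ∧ true) u) refl
      where
      ea = eqT⁻ (nth 0 w p) a e
      u : used t p ≡ true
      u = trans (cong (λ z → at (len ∸ suc p) (Xs z (t ⊓ mult z))) ea) (trans (cong (λ z → at (len ∸ suc p) (Xs a z)) (m≥n⇒m⊓n≡n le))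
        (trans (cong (at (len ∸ suc p)) (sub-full (Xs a (mult a)) (rletter a) (sub-Xs a _) (≤-reflexive (trans (rmult a) (sym (size-Xs a (mult a) 1≤a ≤-refl))))))
        (trans (at-rev _ (letter a) (flip< p lt)) (trans (cong (λ z → at z (letter a)) (flip-flip p lt)) (trans (at-letter a p lt) e)))))

    pick-full : ∀ t a prev → mult a ≤ t → 1 ≤ a → ∀ {r} → Pick t a prev r → r ≡ nothing
    pick-full t a prev le 1≤a (pnone _) = refl
    pick-full t a prev le 1≤a (below p lt _ fr _) with trans (sym fr) (full t a p lt le 1≤a)
    ... | ()
    pick-full t a prev le 1≤a (wrapd p lt _ fr _ _) with trans (sym fr) (full t a p lt le 1≤a)
    ... | ()

    vm-full : ∀ t a → mult a ≤ t → vm a (suc t) ≡ vm a t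
    vm-full t a le = cong (v a) (trans (m≥n⇒m⊓n≡n (m≤n⇒m≤1+n le)) (sym (m≥n⇒m⊓n≡n le)))

    used-full : ∀ t p → mult (nth 0 w p) ≤ t → used (suc t) p ≡ used t p
    used-full t p le = cong (λ z → at (len ∸ suc p) (Xs (nth 0 w p) z)) (trans (m≥n⇒m⊓n≡n (m≤n⇒m≤1+n le)) (sym (m≥n⇒m⊓n≡n le)))

    -- Effect of the part of one extraction that selects letters from a on. The field `old` keeps
    -- smaller letters untouched, so that the contributions of different letters combine in
    -- `sel-cons`.
    record Sel (t a d : ℕ) (out : List ℕ × ℕ) : Set where
      field
        new  : ∀ p → p < len → a ≤ nth 0 w p → used (suc t) p ≡ used t p ∨ memb p (proj₁ out)
        old  : ∀ p → p < len → nth 0 w p < a → memb p (proj₁ out) ≡ false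
        gain : proj₂ out + sumTo d (λ i → vm (a + i) t) ≡ sumTo d (λ i → vm (a + i) (suc t))
    open Sel

    sel-stop : ∀ t a d → 1 ≤ a → (∀ i → mult (a + i) ≤ t) → Sel t a d ([] , 0)
    sel-stop t a d 1≤a h = record
      { new = λ p lt q → trans (used-full t p (subst (λ z → mult z ≤ t) (m+[n∸m]≡n q) (h (nth 0 w p ∸ a)))) (sym (∨-identityʳ (used t p)))
      ; old = λ _ _ _ → refl
      ; gain = sumTo-cong d (λ i _ → sym (vm-full t (a + i) (h i))) }

    sel-cons : ∀ t a d p idx out → p < len → nth 0 w p ≡ a → t < mult a → Xs a (suc t) ≡ put (len ∸ suc p) (Xs a t) → v a (suc t) ≡ idx + v a t →
      Sel t (suc a) d out → Sel t a (suc d) (p ∷ proj₁ out , idx + proj₂ out)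
    sel-cons t a d p idx out pl pw tm eX ev S = record { new = nw ; old = od ; gain = gn }
      where
      nw : ∀ q → q < len → a ≤ nth 0 w q → used (suc t) q ≡ used t q ∨ ((q ≡ᵇ p) ∨ memb q (proj₁ out))
      nw q ql le with nth 0 w q ≟ a
      ... | no ne = trans (new S q ql (≤∧≢⇒< le (λ e → ne (sym e)))) (cong (λ z → used t q ∨ (z ∨ memb q (proj₁ out))) (sym (eqF {q} {p} (λ e → ne (trans (cong (nth 0 w) e) pw)))))
      ... | yes e = trans ua (trans (lem (q ≟ p)) (cong (used t q ∨_) (sym (trans (cong ((q ≡ᵇ p) ∨_) (old S q ql (s≤s (≤-reflexive e)))) (∨-identityʳ (q ≡ᵇ p))))))
        where
        ut : used t q ≡ at (len ∸ suc q) (Xs a t)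
        ut = trans (cong (λ z → at (len ∸ suc q) (Xs z (t ⊓ mult z))) e) (cong (λ z → at (len ∸ suc q) (Xs a z)) (m≤n⇒m⊓n≡m (<⇒≤ tm)))
        ua : used (suc t) q ≡ at (len ∸ suc q) (put (len ∸ suc p) (Xs a t))
        ua = trans (cong (λ z → at (len ∸ suc q) (Xs z (suc t ⊓ mult z))) e) (trans (cong (λ z → at (len ∸ suc q) (Xs a z)) (m≤n⇒m⊓n≡m tm)) (cong (at (len ∸ suc q)) eX))
        lem : Dec (q ≡ p) → at (len ∸ suc q) (put (len ∸ suc p) (Xs a t)) ≡ used t q ∨ (q ≡ᵇ p)
        lem (yes refl) = trans (at-put _ (Xs a t) (flip< q ql)) (sym (trans (cong (used t q ∨_) (eqT {q} refl)) (∨-zeroʳ (used t q))))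
        lem (no ne) = trans (at-put-≢ _ _ (Xs a t) (λ c → ne (trans (sym (flip-flip q ql)) (trans (cong (λ z → len ∸ suc z) c) (flip-flip p pl)))))
          (trans (sym ut) (sym (trans (cong (used t q ∨_) (eqF {q} {p} ne)) (∨-identityʳ (used t q)))))
      od : ∀ q → q < len → nth 0 w q < a → (q ≡ᵇ p) ∨ memb q (proj₁ out) ≡ false
      od q ql lt = cong₂ _∨_ (eqF {q} {p} (λ e → <⇒≢ lt (trans (cong (nth 0 w) e) pw))) (old S q ql (m≤n⇒m≤1+n lt))
      vma : vm a (suc t) ≡ idx + vm a t
      vma = trans (cong (v a) (m≤n⇒m⊓n≡m tm)) (trans ev (cong (λ z → idx + v a z) (sym (m≤n⇒m⊓n≡m (<⇒≤ tm)))))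
      shift : ∀ t → sumTo d (λ i → vm (a + suc i) t) ≡ sumTo d (λ i → vm (suc a + i) t)
      shift t = sumTo-cong d (λ i _ → cong (λ z → vm z t) (+-suc a i))
      gn : (idx + proj₂ out) + (vm (a + 0) t + sumTo d (λ i → vm (a + suc i) t)) ≡ vm (a + 0) (suc t) + sumTo d (λ i → vm (a + suc i) (suc t))
      gn rewrite +-identityʳ a | shift t | shift (suc t) = trans (+-mid idx (proj₂ out) (vm a t) _) (cong₂ _+_ (sym vma) (gain S))

    -- `prev` is the position just chosen for the letter a. The last hypothesis says that the fuel
    -- suffices: letters beyond its reach have no occurrence left.
    walk-ok : ∀ t f a d prev idx → 1 ≤ a → prev < len → nth 0 w prev ≡ a → Xs a (suc t) ≡ put (len ∸ suc prev) (Xs a t) → at (len ∸ suc prev) (Xs a t) ≡ false →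
      v a (suc t) ≡ idx + v a t → suc a + d ≡ suc L → (∀ i → f ≤ i → mult (suc a + i) ≤ t) → Sel t (suc a) d (walk f (suc a) prev idx (remaining t))
    walk-ok t zero a d prev idx 1≤a pl pw eX pf ev e h = sel-stop t (suc a) d (s≤s z≤n) (λ i → h i z≤n)
    walk-ok t (suc f) (suc a) d prev idx 1≤a pl pw eX pf ev e h with t <? mult (suc (suc a)) | pick (suc (suc a)) prev (remaining t) | pick-ok t (suc (suc a)) prev
    ... | no tm | r | pk with pick-full t (suc (suc a)) prev (≮⇒≥ tm) (s≤s z≤n) pk
    ...   | refl = sel-stop t (suc (suc a)) d (s≤s z≤n) (λ i → ≤-trans (mult-mono (suc (suc a)) i (s≤s z≤n)) (≮⇒≥ tm))
    walk-ok t (suc f) (suc a) zero prev idx 1≤a pl pw eX pf ev e h | yes tm | r | pk = ⊥-elim (n≮0 (≤-trans tm (≤-reflexive (mult-big (suc (suc a)) (≤-reflexive (trans (sym e) (+-identityʳ _)))))))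
    walk-ok t (suc f) (suc a) (suc d) prev idx 1≤a pl pw eX pf ev e h | yes tm | r | pk with extend t (suc a) prev 1≤a pl pw eX pf tm pk
    ... | p , refl , lt , wp , fp , eX' , ew = sel-cons t (suc (suc a)) d p idx' _ lt wp tm eX' ev'
          (walk-ok t f (suc (suc a)) d p idx' (s≤s z≤n) lt wp eX' fp ev' (trans (sym (+-suc (suc (suc a)) d)) e)
            (λ i q → subst (λ z → mult z ≤ t) (+-suc (suc (suc a)) i) (h (suc i) (s≤s q))))
      where
      idx' = if prev <ᵇ p then suc idx else idx
      ev' : v (suc a) (suc t) + wraps (rletter (suc (suc a))) (Xs (suc a) (suc t)) ≡ idx' + (v (suc a) t + wraps (rletter (suc (suc a))) (Xs (suc a) t))
      ev' = trans (cong₂ _+_ ev ew) (l (prev <ᵇ p))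
        where
        V = v (suc a) t
        W = wraps (rletter (suc (suc a))) (Xs (suc a) t)
        l : ∀ b → (idx + V) + ((if b then 1 else 0) + W) ≡ (if b then suc idx else idx) + (V + W)
        l true  = trans (+-suc (idx + V) W) (cong suc (+-assoc idx V W))
        l false = +-assoc idx V W

    extract-ok : ∀ t → t < mult 1 → Sel t 1 L (extract (remaining t))
    extract-ok t tm with rightmost 1 (remaining t) | rightmost-rem t 1
    ... | _ | lnone h with free-exists (Xs 1 t) (rletter 1) (sub-Xs 1 t) (≤-trans (s≤s (≤-reflexive (size-Xs 1 t ≤-refl (<⇒≤ tm)))) (≤-trans tm (≤-reflexive (sym (rmult 1)))))
    ...   | i , lt , x , y with trans (sym y) (busy-rev t 1 i tm (λ p q _ → h p q) x)
    ...     | ()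
    extract-ok t tm | _ | lfound p lt q h = go L refl
      where
      wp : nth 0 w p ≡ 1
      wp = eqT⁻ _ 1 (proj₂ (∧-elim (not (used t p)) _ q))
      fv = free-rev t 1 p lt tm q
      eX : Xs 1 (suc t) ≡ put (len ∸ suc p) (Xs 1 t)
      eX = firsts-suc t (rletter 1) (len ∸ suc p) (flip< p lt) (proj₁ fv) (proj₂ fv)
        (λ i x → busy-rev t 1 i tm (λ j jl e → h j (≰⇒> (λ c → <⇒≱ (subst (_< len ∸ suc p) (sym e) x) (∸-monoʳ-≤ len (s≤s c)))) jl))
      mx : ℕ
      mx = maxL (map proj₂ (remaining t)) ∸ 1
      fuel : ∀ i → mx ≤ i → mult (2 + i) ≤ t
      fuel i le with t <? mult (2 + i)
      ... | no tm' = ≮⇒≥ tm'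
      ... | yes tm' with free-exists (Xs (2 + i) t) (rletter (2 + i)) (sub-Xs (2 + i) t) (≤-trans (s≤s (≤-reflexive (size-Xs (2 + i) t (s≤s z≤n) (<⇒≤ tm')))) (≤-trans tm' (≤-reflexive (sym (rmult (2 + i))))))
      ...   | j , jl , x , y with freeL t (2 + i) (len ∸ suc j) in fe
      ...     | false with trans (sym y) (busy-rev t (2 + i) j tm' (λ q' ql e → subst (λ z → freeL t (2 + i) z ≡ false) (trans (cong (λ z → len ∸ suc z) (sym e)) (flip-flip q' ql)) fe) x)
      ...       | ()
      fuel i le | yes tm' | j , jl , x , y | true = ⊥-elim (<⇒≱ (n<1+n i) (≤-trans (∸-monoˡ-≤ 1 big) le))
        where
        p' = len ∸ suc j
        fe' = ∧-elim (not (used t p')) _ fe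
        big : 2 + i ≤ maxL (map proj₂ (remaining t))
        big = subst (_≤ maxL (map proj₂ (remaining t))) (eqT⁻ (nth 0 w p') (2 + i) (proj₂ fe')) (maxL-filter (λ pl → not (used t (proj₁ pl))) (λ i → i) w p' (flip< j jl) (proj₁ fe'))
      go : ∀ l → L ≡ l → Sel t 1 l (p ∷ proj₁ (walk mx 2 p 0 (remaining t)) , proj₂ (walk mx 2 p 0 (remaining t)))
      go zero e with subst (1 ≤_) e (≤-trans (proj₁ (range p lt)) (proj₂ (range p lt)))
      ... | ()
      go (suc l) e = sel-cons t 1 l p 0 _ lt wp tm eX refl (walk-ok t mx 1 l p 0 ≤-refl lt wp eX (proj₂ fv) refl (cong suc (sym e)) fuel)

    remaining-next : ∀ t → t < mult 1 → filterᵇ (λ pl → not (memb (proj₁ pl) (proj₁ (extract (remaining t))))) (remaining t) ≡ remaining (suc t)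
    remaining-next t tm = trans (filter-filterᵇ (λ pl → not (used t (proj₁ pl))) _ (zip (upTo len) w))
      (filter-zip-cong _ _ (λ i → i) w (λ p lt → sym (trans (cong not (new S p lt (proj₁ (range p lt)))) (dm (used t p) (memb p (proj₁ (extract (remaining t))))))))
      where
      S = extract-ok t tm
      dm : ∀ a b → not (a ∨ b) ≡ not a ∧ not b
      dm true b = refl
      dm false b = refl

    total : ℕ → ℕ
    total t = sumTo L (λ i → vm (1 + i) t)

    nil : ∀ f → chargeGo f [] ≡ 0
    nil zero    = refl
    nil (suc f) = nil f

    remaining-end : ∀ t → mult 1 ≤ t → remaining t ≡ []
    remaining-end t le = trans (filter-zip-cong (λ pl → not (used t (proj₁ pl))) (λ _ → false) (λ i → i) w (λ p lt → l p lt)) (none-left (zip (upTo len) w))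
      where
      none-left : ∀ {A : Set} (xs : List A) → filterᵇ (λ _ → false) xs ≡ []
      none-left []       = refl
      none-left (x ∷ xs) = none-left xs
      l : ∀ p → p < len → not (used t p) ≡ false
      l p lt = trans (sym (∧-identityʳ (not (used t p)))) (trans (cong (not (used t p) ∧_) (sym (eqT {nth 0 w p} refl)))
        (full t (nth 0 w p) p lt (≤-trans (m1 (nth 0 w p) (proj₁ (range p lt))) le) (proj₁ (range p lt))))
        where
        m1 : ∀ a → 1 ≤ a → mult a ≤ mult 1
        m1 (suc a) _ = mult-mono 1 a ≤-refl

    charge-go : ∀ f t → t ≤ mult 1 → mult 1 ≤ f + t → chargeGo f (remaining t) + total t ≡ total (mult 1)
    charge-go f t le fu with t <? mult 1
    ... | no p = cong₂ _+_ (trans (cong (chargeGo f) (remaining-end t (≮⇒≥ p))) (nil f)) (cong total (≤-antisym le (≮⇒≥ p)))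
    charge-go zero t le fu | yes p = ⊥-elim (<⇒≱ p fu)
    charge-go (suc f) t le fu | yes p rewrite remaining-next t p = trans (+-assoc g _ _) (trans (cong (g +_) (+-comm (chargeGo f (remaining (suc t))) (total t)))
        (trans (sym (+-assoc g (total t) _)) (trans (cong (_+ chargeGo f (remaining (suc t))) (gain (extract-ok t p)))
        (trans (+-comm (total (suc t)) _) (charge-go f (suc t) p (≤-trans fu (≤-reflexive (sym (+-suc f t)))))))))
      where
      g = proj₂ (extract (remaining t))

    upFrom : ℕ → Vec Bool len → ℕ → ℕ
    upFrom zero    X a = 0
    upFrom (suc k) X a = wraps (rletter a) X + upFrom k (dep (wraps (rletter a) X) (rletter a) X) (suc a)

    upW-rows : ∀ k X a l → k ≤ l → upW k X (rowsFrom a l) ≡ upFrom k X a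
    upW-rows zero    X a l       _       = refl
    upW-rows (suc k) X a (suc l) (s≤s p) = cong (wraps (rletter a) X +_) (upW-rows k _ (suc a) l p)

    upFrom-snoc : ∀ k a t → upFrom (suc k) (Xs (suc a) t) (suc (suc a)) ≡ upFrom k (Xs (suc a) t) (suc (suc a)) + wraps (rletter (suc (suc (a + k)))) (Xs (suc (a + k)) t)
    upFrom-snoc zero a t rewrite +-identityʳ a = +-identityʳ _
    upFrom-snoc (suc k) a t = trans (cong (wraps (rletter (suc (suc a))) (Xs (suc a) t) +_) (upFrom-snoc k (suc a) t))
      (trans (sym (+-assoc (wraps (rletter (suc (suc a))) (Xs (suc a) t)) _ _)) (cong (λ z → upFrom (suc k) (Xs (suc a) t) (suc (suc a)) + wraps (rletter (suc (suc z))) (Xs (suc z) t)) (sym (+-suc a k))))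

    v-upFrom : ∀ k t → v (suc k) t ≡ upFrom k (Xs 1 t) 2
    v-upFrom zero t = refl
    v-upFrom (suc k) t = trans (cong (_+ wraps (rletter (suc (suc k))) (Xs (suc k) t)) (v-upFrom k t)) (sym (upFrom-snoc k 0 t))

    length-rowsFrom : ∀ a l → length (rowsFrom a l) ≡ l
    length-rowsFrom a zero    = refl
    length-rowsFrom a (suc l) = cong suc (length-rowsFrom (suc a) l)

    bigs-rows : ∀ a k l → 1 ≤ a → k < l → Bigs (mult (a + k)) k (rowsFrom a l)
    bigs-rows a zero    (suc l) p _       = cong mult (sym (+-identityʳ a))
    bigs-rows a (suc k) (suc l) p (s≤s q) = ≤-trans (≤-reflexive (cong mult (+-suc a k))) (≤-trans (mult-mono (suc a) k (s≤s z≤n)) (dec a p)) ,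
      subst (λ z → Bigs (mult z) k (rowsFrom (suc a) l)) (sym (+-suc a k)) (bigs-rows (suc a) k l (s≤s z≤n) q)

    Wk-rows : ∀ k → k < L → Wk k (rowsFrom 1 L) ≡ vm (1 + k) (mult 1)
    Wk-rows k lt = go L lt (bigs-rows 1 k L ≤-refl lt)
      where
      go : ∀ l → k < l → Bigs (mult (1 + k)) k (rowsFrom 1 l) → Wk k (rowsFrom 1 l) ≡ vm (1 + k) (mult 1)
      go (suc l) (s≤s p) B = trans (winding (mult (1 + k)) k (letter 1) (rowsFrom 2 l) B) (trans (upW-rows k _ 2 l p) (trans (sym (v-upFrom k (mult (1 + k))))
        (cong (v (1 + k)) (sym (m≥n⇒m⊓n≡n (mult-mono 1 k ≤-refl))))))

    Xs0 : ∀ a → Xs a 0 ≡ empty len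
    Xs0 zero = refl
    Xs0 (suc zero) = firsts-0 (rletter 1)
    Xs0 (suc (suc a)) rewrite Xs0 (suc a) = trans (cong (λ u → dep u (rletter (suc (suc a))) (empty len)) (wraps-empty (rletter (suc (suc a))))) (dep-empty _)

    total-0 : total 0 ≡ 0
    total-0 = z L 0
      where
      v0 : ∀ a → v a 0 ≡ 0
      v0 zero = refl
      v0 (suc zero) = refl
      v0 (suc (suc a)) rewrite v0 (suc a) | Xs0 (suc a) = wraps-empty (rletter (suc (suc a)))
      z : ∀ l a → sumTo l (λ i → vm (1 + (a + i)) 0) ≡ 0
      z zero a = refl
      z (suc l) a = cong₂ _+_ (v0 (1 + (a + 0))) (trans (sumTo-cong l (λ i _ → cong (λ x → vm (1 + x) 0) (+-suc a i))) (z l (suc a)))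

    charge-majA : chargeWord w ≡ majA (rowsFrom 1 L)
    charge-majA = trans (cong (chargeGo len) r0) (trans (sym (+-identityʳ _)) (trans (cong (chargeGo len (remaining 0) +_) (sym total-0))
      (trans (charge-go len 0 z≤n (≤-trans (size≤ (letter 1)) (≤-reflexive (sym (+-identityʳ len)))))
      (trans (sumTo-cong L (λ k lt → sym (Wk-rows k lt))) (trans (cong (λ l → sumTo l (λ k → Wk k (rowsFrom 1 L))) (sym (length-rowsFrom 1 L))) (sym (majA-Wk (rowsFrom 1 L))))))))
      where
      size≤ : ∀ {n} (r : Vec Bool n) → size r ≤ n
      size≤ []          = z≤n
      size≤ (true ∷ r)  = s≤s (size≤ r)
      size≤ (false ∷ r) = m≤n⇒m≤1+n (size≤ r)
      all-left : ∀ {A : Set} (xs : List A) → filterᵇ (λ _ → true) xs ≡ xs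
      all-left []       = refl
      all-left (x ∷ xs) = cong (x ∷_) (all-left xs)
      unused : ∀ a p → at p (Xs a 0) ≡ false
      unused a p = trans (cong (at p) (Xs0 a)) (at-empty {len} p)
      r0 : zip (upTo len) w ≡ remaining 0
      r0 = sym (trans (filter-zip-cong (λ pl → not (used 0 (proj₁ pl))) (λ _ → true) (λ i → i) w (λ p lt → cong not (unused (nth 0 w p) (len ∸ suc p)))) (all-left (zip (upTo len) w)))

-- The collapsing map on lists of rows

lift : ∀ {n} → ℕ → (Mat n → Mat n) → Mat n → Mat n
lift zero    g = g
lift (suc i) g = under (lift i g)

-- `ins` recurses from the bottom row, whereas the fold over `downTo1` begins with the operator of
-- largest index; the latter is split off here.
ins-lift : ∀ {n} i (M : Mat n) → ins (suc i) M ≡ ins i (lift i opE M)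
ins-lift zero    []      = refl
ins-lift zero    (b ∷ M) = refl
ins-lift (suc i) []      = refl
ins-lift (suc i) (b ∷ M) = cong (λ X → opE (b ∷ X)) (ins-lift i M)

rowAt : ∀ {n} → ℕ → Mat n → Vec Bool n
rowAt i       []      = empty _
rowAt zero    (r ∷ M) = r
rowAt (suc i) (r ∷ M) = rowAt i M

set2 : ∀ {n} → ℕ → Vec Bool n → Vec Bool n → Mat n → Mat n
set2 zero    b s (_ ∷ _ ∷ M) = b ∷ s ∷ M
set2 (suc i) b s (r ∷ M)     = r ∷ set2 i b s M
set2 zero    b s (r ∷ [])    = r ∷ []
set2 i       b s []          = []

lift-opE : ∀ {n} i (M : Mat n) → lift i opE M ≡ set2 i (low 0 (rowAt i M) (rowAt (suc i) M)) (upp 0 (rowAt i M) (rowAt (suc i) M)) M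
lift-opE zero    []          = refl
lift-opE zero    (_ ∷ [])    = refl
lift-opE zero    (b ∷ s ∷ M) = refl
lift-opE (suc i) []          = refl
lift-opE (suc i) (r ∷ M)     = cong (r ∷_) (lift-opE i M)

set2-set2 : ∀ {n} i (b s b' s' : Vec Bool n) M → set2 i b' s' (set2 i b s M) ≡ set2 i b' s' M
set2-set2 zero    b s b' s' []          = refl
set2-set2 zero    b s b' s' (_ ∷ [])    = refl
set2-set2 zero    b s b' s' (_ ∷ _ ∷ M) = refl
set2-set2 (suc i) b s b' s' []          = refl
set2-set2 (suc i) b s b' s' (r ∷ M)     = cong (r ∷_) (set2-set2 i b s b' s' M)

set2-id : ∀ {n} i (M : Mat n) → set2 i (rowAt i M) (rowAt (suc i) M) M ≡ M
set2-id zero    []          = refl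
set2-id zero    (_ ∷ [])    = refl
set2-id zero    (_ ∷ _ ∷ M) = refl
set2-id (suc i) []          = refl
set2-id (suc i) (r ∷ M)     = cong (r ∷_) (set2-id i M)

rowAt-set2 : ∀ {n} i (b s : Vec Bool n) M → suc i < length M → rowAt i (set2 i b s M) ≡ b × rowAt (suc i) (set2 i b s M) ≡ s
rowAt-set2 zero    b s (_ ∷ _ ∷ M) _       = refl , refl
rowAt-set2 (suc i) b s (r ∷ M)     (s≤s p) = rowAt-set2 i b s M p
rowAt-set2 zero    b s (_ ∷ [])    (s≤s ())

length-set2 : ∀ {n} i (b s : Vec Bool n) M → length (set2 i b s M) ≡ length M
length-set2 zero    b s []          = refl
length-set2 zero    b s (_ ∷ [])    = refl
length-set2 zero    b s (_ ∷ _ ∷ M) = refl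
length-set2 (suc i) b s []          = refl
length-set2 (suc i) b s (r ∷ M)     = cong suc (length-set2 i b s M)

nth-lists : ∀ {n} i (M : Mat n) → i < length M → nth [] (lists M) i ≡ toList (rowAt i M)
nth-lists zero    (r ∷ M) _       = refl
nth-lists (suc i) (r ∷ M) (s≤s p) = nth-lists i M p

clr : ∀ {n} → ℕ → Vec Bool n → Vec Bool n
clr _       []      = []
clr zero    (_ ∷ r) = false ∷ r
clr (suc i) (b ∷ r) = b ∷ clr i r

setAt-put : ∀ {n} c (r : Vec Bool n) → setAt (toList r) c true ≡ toList (put c r)
setAt-put c       []      = refl
setAt-put zero    (_ ∷ r) = refl
setAt-put (suc c) (b ∷ r) = cong (b ∷_) (setAt-put c r)

setAt-clr : ∀ {n} c (r : Vec Bool n) → setAt (toList r) c false ≡ toList (clr c r)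
setAt-clr c       []      = refl
setAt-clr zero    (_ ∷ r) = refl
setAt-clr (suc c) (b ∷ r) = cong (b ∷_) (setAt-clr c r)

lists-set2 : ∀ {n} i (b s : Vec Bool n) M → suc i < length M →
  setAt (setAt (lists M) (suc i) (toList s)) i (toList b) ≡ lists (set2 i b s M)
lists-set2 zero    b s (_ ∷ _ ∷ M) _       = refl
lists-set2 (suc i) b s (r ∷ M)     (s≤s p) = cong (toList r ∷_) (lists-set2 i b s M p)
lists-set2 zero    b s (_ ∷ [])    (s≤s ())

popL : Bool → List ℕ → List ℕ
popL true  []       = []
popL true  (_ ∷ xs) = xs
popL false xs       = xs

pushL : ℕ → Bool → List ℕ → List ℕ
pushL c true  xs = c ∷ xs
pushL c false xs = xs

-- The stack of `bracket` for two rows. A column is read from top to bottom, so the push of the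
-- upper ball precedes the pop of the lower one.
stk : ∀ {n} → ℕ → Vec Bool n → Vec Bool n → List ℕ → List ℕ
stk c []       []       st = st
stk c (b ∷ bs) (s ∷ ss) st = stk (suc c) bs ss (popL b (pushL c s st))

module _ (N' : MLQ) (i j : ℕ) where
  private
    cell : ℕ → List (ℕ × ℕ)
    cell r = if nth false (nth [] N' (r ∸ 1)) j then (r , j) ∷ [] else []
    col : ℕ → List (ℕ × ℕ)
    col k = concatMap cell (downTo1 k)
    B = nth false (nth [] N' i) j
    S = nth false (nth [] N' (suc i)) j

  bracket-other : ∀ r ws st → r ≢ suc i → r ≢ suc (suc i) → bracket (suc i) (cell r ++ ws) st ≡ bracket (suc i) ws st
  bracket-other r ws st p q with nth false (nth [] N' (r ∸ 1)) j
  ... | false = refl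
  ... | true rewrite eqF q | eqF p = refl

  bracket-low : ∀ k ws st → k ≤ i → bracket (suc i) (col k ++ ws) st ≡ bracket (suc i) ws st
  bracket-low zero    ws st p = refl
  bracket-low (suc k) ws st p = trans (cong (λ z → bracket (suc i) z st) (LP.++-assoc (cell (suc k)) (col k) ws))
    (trans (bracket-other (suc k) (col k ++ ws) st (λ e → <⇒≢ p (suc-injective e)) (λ e → <⇒≢ (m≤n⇒m≤1+n p) (suc-injective e)))
    (bracket-low k ws st (<⇒≤ p)))

  bracket-mid : ∀ ws st → bracket (suc i) (col (suc i) ++ ws) st ≡ bracket (suc i) ws (popL B st)
  bracket-mid ws st = trans (cong (λ z → bracket (suc i) z st) (LP.++-assoc (cell (suc i)) (col i) ws)) (l st)
    where
    l : ∀ st → bracket (suc i) (cell (suc i) ++ (col i ++ ws)) st ≡ bracket (suc i) ws (popL B st)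
    l [] with nth false (nth [] N' i) j
    ... | false = bracket-low i ws [] ≤-refl
    ... | true rewrite eqF {suc i} {suc (suc i)} (λ e → 1+n≢n (sym e)) | eqT {suc i} refl = bracket-low i ws [] ≤-refl
    l (x ∷ st) with nth false (nth [] N' i) j
    ... | false = bracket-low i ws (x ∷ st) ≤-refl
    ... | true rewrite eqF {suc i} {suc (suc i)} (λ e → 1+n≢n (sym e)) | eqT {suc i} refl = bracket-low i ws st ≤-refl

  bracket-hi : ∀ k ws st → bracket (suc i) (col (suc (suc i) + k) ++ ws) st ≡ bracket (suc i) ws (popL B (pushL j S st))
  bracket-hi zero ws st = trans (cong (λ z → bracket (suc i) (col z ++ ws) st) (+-identityʳ (suc (suc i))))
    (trans (cong (λ z → bracket (suc i) z st) (LP.++-assoc (cell (suc (suc i))) (col (suc i)) ws)) l)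
    where
    l : bracket (suc i) (cell (suc (suc i)) ++ (col (suc i) ++ ws)) st ≡ bracket (suc i) ws (popL B (pushL j S st))
    l with nth false (nth [] N' (suc i)) j
    ... | false = bracket-mid ws st
    ... | true rewrite eqT {suc (suc i)} refl = bracket-mid ws (j ∷ st)
  bracket-hi (suc k) ws st = trans (cong (λ z → bracket (suc i) (col z ++ ws) st) (+-suc (suc (suc i)) k))
    (trans (cong (λ z → bracket (suc i) z st) (LP.++-assoc (cell (suc (suc (suc i) + k))) (col (suc (suc i) + k)) ws))
    (trans (bracket-other (suc (suc (suc i) + k)) _ st (λ e → 1+n≰n (≤-trans (s≤s (n≤1+n _)) (≤-trans (m≤m+n (suc (suc i)) k) (≤-reflexive (suc-injective e)))))
      (λ e → 1+n≰n (≤-trans (m≤m+n (suc (suc i)) k) (≤-reflexive (suc-injective e)))))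
    (bracket-hi k ws st)))

bracket-columns : ∀ {m} (N' : MLQ) i → suc i < length N' → (bs ss : Vec Bool m) (f : ℕ → ℕ) (c : ℕ) → (∀ k → f k ≡ c + k) →
  (∀ k → nth false (nth [] N' i) (f k) ≡ at k bs) → (∀ k → nth false (nth [] N' (suc i)) (f k) ≡ at k ss) → ∀ st →
  bracket (suc i) (concatMap (λ j → concatMap (λ r → if nth false (nth [] N' (r ∸ 1)) j then (r , j) ∷ [] else []) (downTo1 (length N'))) (applyUpTo f m)) st ≡ stk c bs ss st
bracket-columns N' i lt [] [] f c hf hb hs st = refl
bracket-columns {suc m} N' i lt (b ∷ bs) (s ∷ ss) f c hf hb hs st =
  trans (cong (λ z → bracket (suc i) (concatMap (λ r → if nth false (nth [] N' (r ∸ 1)) (f 0) then (r , f 0) ∷ [] else []) (downTo1 z) ++ rest) st) (sym le))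
  (trans (bracket-hi N' i (f 0) (length N' ∸ suc (suc i)) rest st)
  (trans (cong₂ (λ x y → bracket (suc i) rest (popL x (pushL (f 0) y st))) (hb 0) (hs 0))
  (trans (cong (λ z → bracket (suc i) rest (popL b (pushL z s st))) (trans (hf 0) (+-identityʳ c)))
  (bracket-columns N' i lt bs ss (λ k → f (suc k)) (suc c) (λ k → trans (hf (suc k)) (+-suc c k)) (λ k → hb (suc k)) (λ k → hs (suc k)) _))))
  where
  rest = concatMap (λ j → concatMap (λ r → if nth false (nth [] N' (r ∸ 1)) j then (r , j) ∷ [] else []) (downTo1 (length N'))) (applyUpTo (λ k → f (suc k)) m)
  le : suc (suc i) + (length N' ∸ suc (suc i)) ≡ length N'
  le = m+[n∸m]≡n lt

mv : Bool → Bool → ℕ → Bool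
mv false true zero = true
mv _     _    _    = false

movedCols : ∀ {n} → ℕ → Vec Bool n → Vec Bool n → List ℕ
movedCols c []       []       = []
movedCols c (b ∷ bs) (s ∷ ss) = movedCols (suc c) bs ss ++ (if mv b s (car 0 bs ss) then c ∷ [] else [])

-- The stack is built from the left, the carrier from the right. The final carrier is the number of
-- unmatched closing brackets, each of which removes one entry of the initial stack; the unmatched
-- opening brackets are the balls that fall.
stk-moved : ∀ {n} c (b s : Vec Bool n) st → stk c b s st ≡ movedCols c b s ++ drop (car 0 b s) st
stk-moved c [] [] st = refl
stk-moved c (true ∷ b) (true ∷ s) st = trans (stk-moved (suc c) b s st) (cong (_++ drop (car 0 b s) st) (sym (LP.++-identityʳ (movedCols (suc c) b s))))
stk-moved c (false ∷ b) (false ∷ s) st = trans (stk-moved (suc c) b s st) (cong (_++ drop (car 0 b s) st) (sym (LP.++-identityʳ (movedCols (suc c) b s))))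
stk-moved c (true ∷ b) (false ∷ s) [] = trans (stk-moved (suc c) b s []) (trans (cong (movedCols (suc c) b s ++_) (LP.drop-[] (car 0 b s))) (cong (_++ []) (sym (LP.++-identityʳ (movedCols (suc c) b s)))))
stk-moved c (true ∷ b) (false ∷ s) (x ∷ st) = trans (stk-moved (suc c) b s st) (cong (_++ drop (car 0 b s) st) (sym (LP.++-identityʳ (movedCols (suc c) b s))))
stk-moved c (false ∷ b) (true ∷ s) st with car 0 b s | stk-moved (suc c) b s (c ∷ st)
... | zero  | e = trans e (sym (LP.++-assoc (movedCols (suc c) b s) (c ∷ []) st))
... | suc k | e = trans e (cong (_++ drop k st) (sym (LP.++-identityʳ (movedCols (suc c) b s))))

first : ∀ {n} → Vec Bool n → Vec Bool n → Maybe ℕ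
first []       []       = nothing
first (b ∷ bs) (s ∷ ss) = if mv b s (car 0 bs ss) then just 0 else Data.Maybe.map suc (first bs ss)

lastM-snoc : ∀ xs c → lastM (xs ++ c ∷ []) ≡ just c
lastM-snoc []           c = refl
lastM-snoc (x ∷ [])     c = refl
lastM-snoc (x ∷ y ∷ xs) c = lastM-snoc (y ∷ xs) c

lastM-moved : ∀ {n} c (b s : Vec Bool n) → lastM (movedCols c b s) ≡ Data.Maybe.map (c +_) (first b s)
lastM-moved c [] [] = refl
lastM-moved c (b ∷ bs) (s ∷ ss) with mv b s (car 0 bs ss)
... | true  = trans (lastM-snoc (movedCols (suc c) bs ss) c) (cong just (sym (+-identityʳ c)))
... | false = trans (cong lastM (LP.++-identityʳ (movedCols (suc c) bs ss))) (trans (lastM-moved (suc c) bs ss) (l (first bs ss)))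
  where
  l : ∀ m → Data.Maybe.map (suc c +_) m ≡ Data.Maybe.map (c +_) (Data.Maybe.map suc m)
  l nothing  = refl
  l (just x) = cong just (sym (+-suc c x))

first-none : ∀ {n} (b s : Vec Bool n) → first b s ≡ nothing → low 0 b s ≡ b × upp 0 b s ≡ s
first-none [] [] e = refl , refl
first-none (b ∷ bs) (s ∷ ss) e with mv b s (car 0 bs ss) in q | first bs ss | first-none bs ss
first-none (b ∷ bs) (s ∷ ss) e | false | nothing | ih = cong₂ _∷_ (proj₁ (l b s (car 0 bs ss) q)) (proj₁ (ih refl)) , cong₂ _∷_ (proj₂ (l b s (car 0 bs ss) q)) (proj₂ (ih refl))
  where
  l : ∀ b s v → mv b s v ≡ false → lw b s v ≡ b × ub b s v ≡ s
  l true  s     v       _ = refl , refl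
  l false false v       _ = refl , refl
  l false true  (suc v) _ = refl , refl
  l false true  zero    ()

-- Moving the leftmost falling ball in advance leaves the result of E unchanged. The moved ball
-- becomes an unmatched ball of the lower row, whence the larger carrier.
first-just : ∀ {n} (b s : Vec Bool n) c → first b s ≡ just c →
  low 0 (put c b) (clr c s) ≡ low 0 b s × upp 0 (put c b) (clr c s) ≡ upp 0 b s × car 0 (put c b) (clr c s) ≡ suc (car 0 b s) × size (put c b) ≡ suc (size b)
first-just [] [] c ()
first-just (b ∷ bs) (s ∷ ss) c e with mv b s (car 0 bs ss) in q
first-just (false ∷ bs) (true ∷ ss) .0 refl | true with car 0 bs ss
... | zero = refl , refl , refl , refl
first-just (b ∷ bs) (s ∷ ss) c e | false with first bs ss in fe
first-just (b ∷ bs) (s ∷ ss) .(suc d) refl | false | just d with first-just bs ss d fe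
... | x , y , z , w rewrite z with l b s (car 0 bs ss) q
  where
  l : ∀ b s v → mv b s v ≡ false → lw b s (suc v) ≡ lw b s v × ub b s (suc v) ≡ ub b s v × cv b s (suc v) ≡ suc (cv b s v)
  l true  true  v       _ = refl , refl , refl
  l true  false v       _ = refl , refl , refl
  l false false v       _ = refl , refl , refl
  l false true  (suc v) _ = refl , refl , refl
  l false true  zero    ()
... | lx , ly , lz = cong₂ _∷_ lx x , cong₂ _∷_ ly y , lz , trans (cong (tw b +_) w) (+-suc (tw b) _)

eDown-lists : ∀ {n} i (M : Mat n) → suc i < length M → ∀ b s → rowAt i M ≡ b → rowAt (suc i) M ≡ s →
  (first b s ≡ nothing × eDown n (suc i) (lists M) ≡ lists M) ⊎ (∃ λ c → first b s ≡ just c × eDown n (suc i) (lists M) ≡ lists (set2 i (put c b) (clr c s) M))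
eDown-lists {n} i M lt b s eb es with lastM (bracket (suc i) (colWord n (lists M)) []) | eq
  where
  lt' : suc i < length (lists M)
  lt' = ≤-trans lt (≤-reflexive (sym (LP.length-map toList M)))
  rb : nth [] (lists M) i ≡ toList b
  rb = trans (nth-lists i M (<-trans (n<1+n i) lt)) (cong toList eb)
  rs' : nth [] (lists M) (suc i) ≡ toList s
  rs' = trans (nth-lists (suc i) M lt) (cong toList es)
  mapid : ∀ m → Data.Maybe.map (0 +_) m ≡ m
  mapid nothing  = refl
  mapid (just x) = refl
  eq : lastM (bracket (suc i) (colWord n (lists M)) []) ≡ first b s
  eq = trans (cong lastM (trans (bracket-columns (lists M) i lt' b s (λ k → k) 0 (λ _ → refl)
        (λ k → trans (cong (λ z → nth false z k) rb) (nth-toList k b)) (λ k → trans (cong (λ z → nth false z k) rs') (nth-toList k s)) [])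
        (trans (stk-moved 0 b s []) (trans (cong (movedCols 0 b s ++_) (LP.drop-[] (car 0 b s))) (LP.++-identityʳ _)))))
       (trans (lastM-moved 0 b s) (mapid (first b s)))
... | nothing | e = inj₁ (sym e , refl)
... | just c  | e = inj₂ (c , sym e , trans (cong₂ (λ x y → setAt (setAt (lists M) (suc i) (setAt x c false)) i (setAt y c true))
        (trans (nth-lists (suc i) M lt) (cong toList es)) (trans (nth-lists i M (<-trans (n<1+n i) lt)) (cong toList eb)))
      (trans (cong₂ (λ x y → setAt (setAt (lists M) (suc i) x) i y) (setAt-clr c s) (setAt-put c b)) (lists-set2 i (put c b) (clr c s) M lt)))

iter-fix : ∀ {A : Set} k (f : A → A) a → f a ≡ a → iter k f a ≡ a
iter-fix zero    f a e = refl
iter-fix (suc k) f a e = trans (cong (iter k f) e) (iter-fix k f a e)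

-- Each move enlarges the lower row by one ball while `low 0 b s` stays the same, so the difference
-- of their sizes bounds the number of moves.
iter-eDown : ∀ {n} k i (M : Mat n) → suc i < length M → ∀ b s → rowAt i M ≡ b → rowAt (suc i) M ≡ s → size (low 0 b s) ≤ k + size b →
  iter k (eDown n (suc i)) (lists M) ≡ lists (set2 i (low 0 b s) (upp 0 b s) M)
iter-eDown {n} k i M lt b s eb es fu with eDown-lists i M lt b s eb es
... | inj₁ (e , d) = trans (iter-fix k _ _ d) (cong lists (sym (trans (cong₂ (λ x y → set2 i x y M) (trans (proj₁ (first-none b s e)) (sym eb)) (trans (proj₂ (first-none b s e)) (sym es))) (set2-id i M))))
iter-eDown zero i M lt b s eb es fu | inj₂ (c , e , d) with first-just b s c e
... | x , _ , _ , w = ⊥-elim (<⇒≱ (≤-trans (≤-reflexive (sym w)) (≤-trans (sub-size _ _ (sub-low 0 (put c b) (clr c s))) (≤-reflexive (cong size x)))) fu)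
iter-eDown {n} (suc k) i M lt b s eb es fu | inj₂ (c , e , d) with first-just b s c e | rowAt-set2 i (put c b) (clr c s) M lt
... | x , y , _ , w | p , q = trans (cong (iter k (eDown n (suc i))) d) (trans
    (iter-eDown k i (set2 i (put c b) (clr c s) M) (≤-trans lt (≤-reflexive (sym (length-set2 i _ _ M)))) (put c b) (clr c s) p q
      (≤-trans (≤-reflexive (cong size x)) (≤-trans fu (≤-reflexive (trans (sym (+-suc k (size b))) (cong (k +_) (sym w)))))))
    (cong lists (trans (cong₂ (λ a b → set2 i a b (set2 i (put c _) (clr c _) M)) x y) (set2-set2 i _ _ _ _ M))))

size≤n : ∀ {n} (r : Vec Bool n) → size r ≤ n
size≤n []          = z≤n
size≤n (true ∷ r)  = s≤s (size≤n r)
size≤n (false ∷ r) = m≤n⇒m≤1+n (size≤n r)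

eDownStar-lift : ∀ {n} i (M : Mat n) → suc i < length M → eDownStar n (suc i) (lists M) ≡ lists (lift i opE M)
eDownStar-lift {n} i M lt = trans (iter-eDown n i M lt _ _ refl refl (≤-trans (size≤n (low 0 (rowAt i M) (rowAt (suc i) M))) (m≤m+n n _))) (cong lists (sym (lift-opE i M)))

lift-length : ∀ {n} i (M : Mat n) → length (lift i opE M) ≡ length M
lift-length i M = trans (cong length (lift-opE i M)) (length-set2 i _ _ M)

eDownStars : ∀ {n} i (M : Mat n) → i < length M → foldl (λ X k → eDownStar n k X) (lists M) (downTo1 i) ≡ lists (ins i M)
eDownStars zero    M lt = refl
eDownStars {n} (suc i) M lt = trans (cong (λ z → foldl (λ X k → eDownStar n k X) z (downTo1 i)) (eDownStar-lift i M lt))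
  (trans (eDownStars i (lift i opE M) (≤-trans (<⇒≤ lt) (≤-reflexive (sym (lift-length i M))))) (cong lists (sym (ins-lift i M))))

card-toList : ∀ {n} (r : Vec Bool n) → card (toList r) ≡ size r
card-toList []          = refl
card-toList (true ∷ r)  = cong suc (card-toList r)
card-toList (false ∷ r) = card-toList r

-- For j ≤ i this is the length of row j of the recording tableau after i rounds, rows being counted
-- from 0; the entries are then at most i + 1.
grow : ∀ {n} → Mat n → ℕ → ℕ → ℕ
grow M i j = nth 0 (sizes (stage i M)) j

card-nth : ∀ {n} (M : Mat n) j → card (nth [] (lists M) j) ≡ nth 0 (sizes M) j
card-nth []      j       = refl
card-nth (r ∷ M) zero    = card-toList r
card-nth (r ∷ M) (suc j) = card-nth M j

Qs : ∀ {n} → Mat n → ℕ → Tab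
Qs M zero    = replicate (grow M 0 0) 1 ∷ []
Qs M (suc i) = map (λ j → nth [] (Qs M i) j ++ replicate (grow M (suc i) j ∸ grow M i j) (suc (suc i))) (upTo (suc i))
               ++ replicate (grow M (suc i) (suc i)) (suc (suc i)) ∷ []

rho-stage : ∀ {n} (M : Mat n) i → i < length M →
  foldl (rhoStep n) (lists M , (replicate (card (nth [] (lists M) 0)) 1 ∷ [])) (oneTo i) ≡ (lists (stage i M) , Qs M i)
rho-stage M zero lt = cong (λ z → lists M , replicate z 1 ∷ []) (card-nth M 0)
rho-stage {n} M (suc i) lt = trans (cong (foldl (rhoStep n) s₀) (trans (cong (map suc) (sym (LP.applyUpTo-∷ʳ (λ k → k) i))) (LP.map-++ suc (upTo i) (i ∷ []))))
  (trans (LP.foldl-++ (rhoStep n) s₀ (oneTo i) (suc i ∷ [])) (trans (cong (λ z → rhoStep n z (suc i)) (rho-stage M i (<⇒≤ lt))) (cong₂ _,_ eM eQ)))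
  where
  s₀ = (lists M , (replicate (card (nth [] (lists M) 0)) 1 ∷ []))
  eM : foldl (λ X k → eDownStar n k X) (lists (stage i M)) (downTo1 (suc i)) ≡ lists (stage (suc i) M)
  eM = eDownStars (suc i) (stage i M) (≤-trans lt (≤-reflexive (sym (k-len (stage-keep i) M))))
  M' = foldl (λ X k → eDownStar n k X) (lists (stage i M)) (downTo1 (suc i))
  eQ : map (λ j → nth [] (Qs M i) j ++ replicate (card (nth [] M' j) ∸ card (nth [] (lists (stage i M)) j)) (suc (suc i))) (upTo (suc i))
       ++ (replicate (card (nth [] M' (suc i))) (suc (suc i)) ∷ []) ≡ Qs M (suc i)
  eQ rewrite eM | card-nth (stage (suc i) M) (suc i) = cong (_++ (replicate (grow M (suc i) (suc i)) (suc (suc i)) ∷ [])) (LP.map-cong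
    (λ j → cong₂ (λ x y → nth [] (Qs M i) j ++ replicate (x ∸ y) (suc (suc i))) (card-nth (stage (suc i) M) j) (card-nth (stage i M) j)) (upTo (suc i)))

rho-lists : ∀ {n} L (M : Mat n) → length M ≡ suc L → rho n (lists M) ≡ (lists (stage L M) , Qs M L)
rho-lists {n} L M e = trans (cong (λ z → foldl (rhoStep n) (lists M , (replicate (card (nth [] (lists M) 0)) 1 ∷ [])) (oneTo (z ∸ 1))) (trans (LP.length-map toList M) e))
  (rho-stage M L (≤-reflexive (sym e)))

nsz : ∀ {n} → Mat n → ℕ → ℕ
nsz M j = nth 0 (sizes M) j

head-ins : ∀ {n} i (M : Mat n) → Sub (head M) (head (ins i M))
head-ins zero    M       = sub-refl _
head-ins (suc i) []      = sub-refl _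
head-ins (suc i) (b ∷ M) with ins i M
... | []    = sub-refl b
... | y ∷ X = sub-low 0 b y

ins-mono : ∀ {n} i (M : Mat n) → HWk i M → ∀ j → j < i → nsz M j ≤ nsz (ins i M) j
ins-mono (suc i) []      h j       lt = z≤n
ins-mono (suc i) (b ∷ M) h zero    lt = aux (ins i M)
  where
  aux : ∀ X → size b ≤ nsz (opE (b ∷ X)) 0
  aux []      = ≤-refl
  aux (y ∷ X) = sub-size b _ (sub-low 0 b y)
ins-mono (suc i) (b ∷ M) h (suc j) (s≤s lt) = aux i M j lt h (ins i M) (head-ins i M) (ins-mono i M (hw-tail b (take i M) h) j lt)
  where
  aux : ∀ i M j → j < i → HWk (suc i) (b ∷ M) → ∀ X → Sub (head M) (head X) → nsz M j ≤ nsz X j → nsz M j ≤ nsz (opE (b ∷ X)) (suc j)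
  aux i       M       j       lt h       []       sy ih = ih
  aux (suc i) []      zero    lt h       (y' ∷ X) sy ih = z≤n
  aux (suc i) (y ∷ M) zero    lt (d , _) (y' ∷ X) sy ih = dom-size _ y (dom-upp-sub b y y' d sy)
  aux i       M       (suc j) lt h       (y' ∷ X) sy ih = ih

-- The balls left in the upper row by E are matched with balls of the lower row as it was before.
-- Thus each round adds a horizontal strip, which makes the columns of the recording tableau strict.
ins-interlace : ∀ {n} i (M : Mat n) j → j < i → nsz (ins i M) (suc j) ≤ nsz M j
ins-interlace (suc i) []      j       lt = z≤n
ins-interlace (suc i) (b ∷ M) zero    lt = aux (ins i M)
  where
  aux : ∀ X → nsz (opE (b ∷ X)) 1 ≤ size b
  aux []      = z≤n
  aux (y ∷ X) = dom-size b _ (dom-upp b y)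
ins-interlace (suc i) (b ∷ M) (suc j) (s≤s lt) = ≤-trans (≤-reflexive (aux (ins i M))) (ins-interlace i M j lt)
  where
  aux : ∀ X → nsz (opE (b ∷ X)) (suc (suc j)) ≡ nsz X (suc j)
  aux []      = refl
  aux (y ∷ X) = refl

ins-beyond : ∀ {n} i (M : Mat n) j → i < j → nsz (ins i M) j ≡ nsz M j
ins-beyond zero    M       j       lt = refl
ins-beyond (suc i) []      j       lt = refl
ins-beyond (suc i) (b ∷ M) (suc (suc j)) (s≤s lt) = trans (aux (ins i M)) (ins-beyond i M (suc j) lt)
  where
  aux : ∀ X → nsz (opE (b ∷ X)) (suc (suc j)) ≡ nsz X (suc j)
  aux []      = refl
  aux (y ∷ X) = refl
ins-beyond (suc i) (b ∷ M) (suc zero) (s≤s ())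

ins-sum : ∀ {n} i (M : Mat n) → sumTo (suc i) (nsz (ins i M)) ≡ sumTo (suc i) (nsz M)
ins-sum zero    M       = refl
ins-sum (suc i) []      = refl
ins-sum (suc i) (b ∷ M) = trans (aux (ins i M)) (cong (size b +_) (ins-sum i M))
  where
  aux : ∀ X → sumTo (suc (suc i)) (nsz (opE (b ∷ X))) ≡ size b + sumTo (suc i) (nsz X)
  aux []      = refl
  aux (y ∷ X) = trans (sym (+-assoc (size (low 0 b y)) _ _)) (trans (cong (_+ sumTo i (nsz X)) (low-upp-size 0 b y)) (+-assoc (size b) _ _))

grow-mono : ∀ {n} (M : Mat n) i j → j ≤ i → grow M i j ≤ grow M (suc i) j
grow-mono M i j le = ins-mono (suc i) (stage i M) (stage-hwk i M) j (s≤s le)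

grow-interlace : ∀ {n} (M : Mat n) i j → j ≤ i → grow M (suc i) (suc j) ≤ grow M i j
grow-interlace M i j le = ins-interlace (suc i) (stage i M) j (s≤s le)

grow-beyond : ∀ {n} (M : Mat n) i j → i < j → grow M i j ≡ nsz M j
grow-beyond M zero    j lt = refl
grow-beyond M (suc i) j lt = trans (ins-beyond (suc i) (stage i M) j lt) (grow-beyond M i j (<⇒≤ lt))

grow-sum : ∀ {n} (M : Mat n) i → sumTo (suc (suc i)) (grow M (suc i)) ≡ sumTo (suc i) (grow M i) + nsz M (suc i)
grow-sum M i = trans (ins-sum (suc i) (stage i M)) (trans (sumTo-snoc (suc i) (grow M i)) (trans (+-comm (grow M i (suc i)) _) (cong (sumTo (suc i) (grow M i) +_) (grow-beyond M i (suc i) ≤-refl))))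

-- The recording tableau

nth-map-upTo : ∀ {A : Set} (d : A) (g : ℕ → A) f k j → j < k → nth d (map g (applyUpTo f k)) j ≡ g (f j)
nth-map-upTo d g f (suc k) zero    _       = refl
nth-map-upTo d g f (suc k) (suc j) (s≤s p) = nth-map-upTo d g (λ i → f (suc i)) k j p

nth-++ˡ : ∀ {A : Set} (d : A) xs ys j → j < length xs → nth d (xs ++ ys) j ≡ nth d xs j
nth-++ˡ d (x ∷ xs) ys zero    _       = refl
nth-++ˡ d (x ∷ xs) ys (suc j) (s≤s p) = nth-++ˡ d xs ys j p

nth-++ʳ : ∀ {A : Set} (d : A) xs ys j → nth d (xs ++ ys) (length xs + j) ≡ nth d ys j
nth-++ʳ d []       ys j = refl
nth-++ʳ d (x ∷ xs) ys j = nth-++ʳ d xs ys j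

length-map-upTo : ∀ {A : Set} (g : ℕ → A) k → length (map g (upTo k)) ≡ k
length-map-upTo g k = trans (LP.length-map g (upTo k)) (LP.length-upTo k)

length-Qs : ∀ {n} (M : Mat n) i → length (Qs M i) ≡ suc i
length-Qs M zero    = refl
length-Qs M (suc i) = trans (LP.length-++ (map _ (upTo (suc i)))) (trans (cong (_+ 1) (length-map-upTo _ (suc i))) (+-comm (suc i) 1))

rowQ : ∀ {n} → Mat n → ℕ → ℕ → List ℕ
rowQ M i j = nth [] (Qs M i) j

rowQ-old : ∀ {n} (M : Mat n) i j → j ≤ i → rowQ M (suc i) j ≡ rowQ M i j ++ replicate (grow M (suc i) j ∸ grow M i j) (suc (suc i))
rowQ-old M i j le = trans (nth-++ˡ [] (map _ (upTo (suc i))) _ j (≤-trans (s≤s le) (≤-reflexive (sym (length-map-upTo _ (suc i))))))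
  (nth-map-upTo [] _ (λ k → k) (suc i) j (s≤s le))

rowQ-new : ∀ {n} (M : Mat n) i → rowQ M (suc i) (suc i) ≡ replicate (grow M (suc i) (suc i)) (suc (suc i))
rowQ-new M i = trans (cong (nth [] (Qs M (suc i))) (sym (trans (+-identityʳ _) (length-map-upTo _ (suc i))))) (nth-++ʳ [] (map _ (upTo (suc i))) _ 0)

weaklyInc-++ : ∀ xs k x → weaklyInc xs ≡ true → All (_≤ x) xs → weaklyInc (xs ++ replicate k x) ≡ true
weaklyInc-++ [] zero x w a = refl
weaklyInc-++ [] (suc zero) x w a = refl
weaklyInc-++ [] (suc (suc k)) x w a = cong₂ _∧_ (leT (≤-refl {x})) (weaklyInc-++ [] (suc k) x w a)
weaklyInc-++ (y ∷ []) zero x w a = refl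
weaklyInc-++ (y ∷ []) (suc k) x w (p ∷ _) = cong₂ _∧_ (leT p) (weaklyInc-++ [] (suc k) x refl [])
weaklyInc-++ (y ∷ z ∷ xs) k x w (p ∷ a) with ∧-elim (y ≤ᵇ z) _ w
... | u , v = cong₂ _∧_ u (weaklyInc-++ (z ∷ xs) k x v a)

strictAbove-[] : ∀ r → strictAbove r [] ≡ true
strictAbove-[] []      = refl
strictAbove-[] (_ ∷ r) = refl

strictAbove-++ : ∀ l r u k x → strictAbove l u ≡ true → length (u ++ replicate k x) ≤ length l → All (_< x) l → strictAbove (l ++ r) (u ++ replicate k x) ≡ true
strictAbove-++ [] r [] zero x s p a = strictAbove-[] r
strictAbove-++ (y ∷ l) r [] zero x s p a = refl
strictAbove-++ (y ∷ l) r [] (suc k) x s (s≤s p) (q ∷ a) = cong₂ _∧_ (ltT q) (strictAbove-++ l r [] k x (strictAbove-[] l) p a)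
strictAbove-++ (y ∷ l) r (v ∷ u) k x s (s≤s p) (q ∷ a) with ∧-elim (y <ᵇ v) _ s
... | s₁ , s₂ = cong₂ _∧_ s₁ (strictAbove-++ l r u k x s₂ p a)

record RowOK {n} (M : Mat n) (i j : ℕ) : Set where
  field
    r-len : length (rowQ M i j) ≡ grow M i j
    r-pos : All (1 ≤_) (rowQ M i j)
    r-max : All (_≤ suc i) (rowQ M i j)
    r-inc : weaklyInc (rowQ M i j) ≡ true
open RowOK

rowOK-rep : ∀ {n} (M : Mat n) i j k xs → rowQ M i j ≡ xs ++ replicate k (suc i) → length xs + k ≡ grow M i j →
  All (1 ≤_) xs → All (_≤ suc i) xs → weaklyInc xs ≡ true → RowOK M i j
rowOK-rep M i j k xs e l p m w = record
  { r-len = trans (cong length e) (trans (LP.length-++ xs) (trans (cong (length xs +_) (LP.length-replicate k)) l))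
  ; r-pos = subst (All (1 ≤_)) (sym e) (AllP.++⁺ p (AllP.replicate⁺ k (s≤s z≤n)))
  ; r-max = subst (All (_≤ suc i)) (sym e) (AllP.++⁺ m (AllP.replicate⁺ k ≤-refl))
  ; r-inc = trans (cong weaklyInc e) (weaklyInc-++ xs k (suc i) w m) }

rowOK : ∀ {n} (M : Mat n) i j → j ≤ i → RowOK M i j
rowOK M zero zero z≤n = rowOK-rep M 0 0 (grow M 0 0) [] refl refl [] [] refl
rowOK M (suc i) j le with j ≟ suc i
... | yes refl = rowOK-rep M (suc i) (suc i) (grow M (suc i) (suc i)) [] (rowQ-new M i) refl [] [] refl
... | no ne = rowOK-rep M (suc i) j (grow M (suc i) j ∸ grow M i j) (rowQ M i j) (rowQ-old M i j j≤i)
    (trans (cong (_+ (grow M (suc i) j ∸ grow M i j)) (r-len ih)) (m+[n∸m]≡n (grow-mono M i j j≤i)))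
    (r-pos ih) (All.map m≤n⇒m≤1+n (r-max ih)) (r-inc ih)
  where
  j≤i : j ≤ i
  j≤i = s≤s⁻¹ (≤∧≢⇒< le ne)
  ih = rowOK M i j j≤i

strictQ : ∀ {n} (M : Mat n) i j → suc j ≤ i → strictAbove (rowQ M i j) (rowQ M i (suc j)) ≡ true
strictQ M (suc i) j le = subst₂ (λ a b → strictAbove a b ≡ true) (sym (rowQ-old M i j j≤i)) (sym (proj₂ up))
    (strictAbove-++ (rowQ M i j) _ (proj₁ (proj₁ up)) (proj₂ (proj₁ up)) (suc (suc i)) (proj₂ split)
      (≤-trans (≤-reflexive (trans (cong length (sym (proj₂ up))) (r-len (rowOK M (suc i) (suc j) le)))) (≤-trans (grow-interlace M i j j≤i) (≤-reflexive (sym (r-len (rowOK M i j j≤i))))))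
      (All.map s≤s (r-max (rowOK M i j j≤i))))
  where
  j≤i : j ≤ i
  j≤i = s≤s⁻¹ le
  split : Σ (∃ λ (us : List ℕ × ℕ) → rowQ M (suc i) (suc j) ≡ proj₁ us ++ replicate (proj₂ us) (suc (suc i))) λ u → strictAbove (rowQ M i j) (proj₁ (proj₁ u)) ≡ true
  split with suc j ≟ suc i
  ... | yes refl = (([] , grow M (suc i) (suc i)) , rowQ-new M i) , strictAbove-[] (rowQ M i j)
  ... | no ne = ((rowQ M i (suc j) , _) , rowQ-old M i (suc j) l) , strictQ M i j l
    where l = s≤s⁻¹ (≤∧≢⇒< le ne)
  up = proj₁ split

countN : ℕ → List ℕ → ℕ
countN a xs = count (λ x → x ≡ᵇ a) xs

count-++ : ∀ {A : Set} (p : A → Bool) xs ys → count p (xs ++ ys) ≡ count p xs + count p ys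
count-++ p xs ys = trans (cong length (LP.filter-++ _ xs ys)) (LP.length-++ (filterᵇ p xs))

countN-rep : ∀ a k → countN a (replicate k a) ≡ k
countN-rep a zero    = refl
countN-rep a (suc k) rewrite eqT {a} refl = cong suc (countN-rep a k)

countN-rep-≢ : ∀ a k x → x ≢ a → countN a (replicate k x) ≡ 0
countN-rep-≢ a zero    x ne = refl
countN-rep-≢ a (suc k) x ne rewrite eqF ne = countN-rep-≢ a k x ne

countN-none : ∀ a xs → All (_< a) xs → countN a xs ≡ 0
countN-none a []       [] = refl
countN-none a (x ∷ xs) (p ∷ ps) rewrite eqF (<⇒≢ p) = countN-none a xs ps

concat-snoc : ∀ {A : Set} (xss : List (List A)) ys → concat (xss ++ ys ∷ []) ≡ concat xss ++ ys
concat-snoc []         ys = LP.++-identityʳ ys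
concat-snoc (xs ∷ xss) ys = trans (cong (xs ++_) (concat-snoc xss ys)) (sym (LP.++-assoc xs (concat xss) ys))

countN-concat : ∀ a (f : ℕ → ℕ) k (g : ℕ → List ℕ) → countN a (concat (map g (applyUpTo f k))) ≡ sumTo k (λ i → countN a (g (f i)))
countN-concat a f zero    g = refl
countN-concat a f (suc k) g = trans (count-++ _ (g (f 0)) _) (cong (countN a (g (f 0)) +_) (countN-concat a (λ i → f (suc i)) k g))

list-nth : ∀ {A : Set} (d : A) xs → xs ≡ applyUpTo (nth d xs) (length xs)
list-nth d []       = refl
list-nth d (x ∷ xs) = cong (x ∷_) (list-nth d xs)

countN-Qs : ∀ {n} (M : Mat n) i a → countN a (concat (Qs M i)) ≡ sumTo (suc i) (λ j → countN a (rowQ M i j))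
countN-Qs M i a = trans (cong (λ z → countN a (concat z)) (trans (list-nth [] (Qs M i)) (trans (cong (applyUpTo (rowQ M i)) (length-Qs M i)) (sym (LP.map-applyUpTo (λ k → k) (rowQ M i) (suc i))))))
  (countN-concat a (λ k → k) (suc i) (rowQ M i))

-- The boxes added in one round are counted by the growth of the total size of the collapsed rows. E
-- moves balls without changing the total, so this growth is the size of the row that joins them.
content-Qs : ∀ {n} (M : Mat n) i a → a ≤ i → countN (suc a) (concat (Qs M i)) ≡ nsz M a
content-Qs M zero zero z≤n = trans (countN-Qs M 0 1) (trans (+-identityʳ _) (countN-rep 1 (grow M 0 0)))
content-Qs {n} M (suc i) a le = trans e₁ (go (a ≟ suc i))
  where
  open ≡-Reasoning
  F δ R : ℕ → ℕ
  F j = countN (suc a) (rowQ M i j)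
  δ j = grow M (suc i) j ∸ grow M i j
  R j = countN (suc a) (replicate (δ j) (suc (suc i)))
  g = grow M (suc i) (suc i)
  e₁ : countN (suc a) (concat (Qs M (suc i))) ≡ countN (suc a) (replicate g (suc (suc i))) + sumTo (suc i) (λ j → F j + R j)
  e₁ = trans (countN-Qs M (suc i) (suc a)) (trans (sumTo-snoc (suc i) (λ j → countN (suc a) (rowQ M (suc i) j))) (cong₂ _+_ (cong (countN (suc a)) (rowQ-new M i))
    (sumTo-cong (suc i) {λ j → countN (suc a) (rowQ M (suc i) j)} {λ j → F j + R j} (λ j p → trans (cong (countN (suc a)) (rowQ-old M i j (s≤s⁻¹ p))) (count-++ (λ x → x ≡ᵇ suc a) (rowQ M i j) (replicate (δ j) (suc (suc i))))))))
  go : Dec (a ≡ suc i) → countN (suc a) (replicate g (suc (suc i))) + sumTo (suc i) (λ j → F j + R j) ≡ nsz M a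
  go (yes refl) = trans (cong₂ _+_ (countN-rep (suc a) g) (sumTo-cong (suc i) {λ j → F j + R j} {δ} (λ j p → cong₂ _+_ (countN-none (suc a) (rowQ M i j) (All.map s≤s (r-max (rowOK M i j (s≤s⁻¹ p))))) (countN-rep (suc a) (δ j)))))
    (+-cancelˡ-≡ G (g + D) (nsz M (suc i)) (begin
      G + (g + D) ≡⟨ cong (G +_) (+-comm g D) ⟩
      G + (D + g) ≡⟨ sym (+-assoc G D g) ⟩
      (G + D) + g ≡⟨ cong (_+ g) (trans (sym (sumTo-+ (suc i) (grow M i) δ)) (sumTo-cong (suc i) {λ j → grow M i j + δ j} {grow M (suc i)} (λ j p → m+[n∸m]≡n (grow-mono M i j (s≤s⁻¹ p))))) ⟩
      sumTo (suc i) (grow M (suc i)) + g ≡⟨ trans (+-comm (sumTo (suc i) (grow M (suc i))) g) (sym (sumTo-snoc (suc i) (grow M (suc i)))) ⟩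
      sumTo (suc (suc i)) (grow M (suc i)) ≡⟨ grow-sum M i ⟩
      G + nsz M (suc i) ∎))
    where
    G = sumTo (suc i) (grow M i)
    D = sumTo (suc i) δ
  go (no ne) = trans (cong₂ _+_ (countN-rep-≢ (suc a) g (suc (suc i)) ne') (sumTo-cong (suc i) {λ j → F j + R j} {F} (λ j p → trans (cong (F j +_) (countN-rep-≢ (suc a) (δ j) (suc (suc i)) ne')) (+-identityʳ (F j)))))
    (trans (sym (countN-Qs M i (suc a))) (content-Qs M i a (s≤s⁻¹ (≤∧≢⇒< le ne))))
    where
    ne' : suc (suc i) ≢ suc a
    ne' e = ne (sym (suc-injective e))

-- The matrix of the reading word of a tableau has one ball per cell (row , letter); the ball starts in the
-- row given by the letter and is collapsed to the row of the cell.

Cells = List (ℕ × ℕ)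

letters : Cells → List ℕ
letters = map proj₂

vmap : (ℕ × ℕ → Bool) → (cs : Cells) → Vec Bool (length (letters cs))
vmap f []       = []
vmap f (c ∷ cs) = f c ∷ vmap f cs

vmap-cong : ∀ {f g} cs → All (λ c → f c ≡ g c) cs → vmap f cs ≡ vmap g cs
vmap-cong []       []       = refl
vmap-cong (c ∷ cs) (e ∷ es) = cong₂ _∷_ e (vmap-cong cs es)

-- A run of E over cells from the right, with initial carrier `v` and final carrier as index;
-- predicates on cells describe the two rows before and after. As a relation it can be composed from
-- runs over the rows of the tableau.
data Erun (f g f' g' : ℕ × ℕ → Bool) (v : ℕ) : Cells → ℕ → Set where
  done : Erun f g f' g' v [] v
  step : ∀ {c cs u} → Erun f g f' g' v cs u → lw (f c) (g c) u ≡ f' c → ub (f c) (g c) u ≡ g' c → Erun f g f' g' v (c ∷ cs) (cv (f c) (g c) u)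

erun-++ : ∀ {f g f' g' v u w} xs {ys} → Erun f g f' g' v ys u → Erun f g f' g' u xs w → Erun f g f' g' v (xs ++ ys) w
erun-++ []       r done           = r
erun-++ (x ∷ xs) r (step s a b) = step (erun-++ xs r s) a b

erun-E : ∀ {f g f' g' v u} cs → Erun f g f' g' v cs u → low v (vmap f cs) (vmap g cs) ≡ vmap f' cs × upp v (vmap f cs) (vmap g cs) ≡ vmap g' cs × car v (vmap f cs) (vmap g cs) ≡ u
erun-E [] done = refl , refl , refl
erun-E {f} {g} (c ∷ cs) (step r a b) with erun-E cs r
... | x , y , z = cong₂ _∷_ (trans (cong (lw (f c) (g c)) z) a) x , cong₂ _∷_ (trans (cong (ub (f c) (g c)) z) b) y , cong (cv (f c) (g c)) z

step′ : ∀ {f g f' g' v c cs u w} → Erun f g f' g' v cs u → ∀ {x y} → f c ≡ x → g c ≡ y → lw x y u ≡ f' c → ub x y u ≡ g' c → cv x y u ≡ w → Erun f g f' g' v (c ∷ cs) w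
step′ r refl refl a b refl = step r a b

cellsFrom : ℕ → Tab → Cells
cellsFrom j []      = []
cellsFrom j (q ∷ Q) = cellsFrom (suc j) Q ++ map (j ,_) q

letters-cells : ∀ j Q → letters (cellsFrom j Q) ≡ concat (reverse Q)
letters-cells j []      = refl
letters-cells j (q ∷ Q) = trans (LP.map-++ proj₂ (cellsFrom (suc j) Q) (map (j ,_) q)) (trans (cong₂ _++_ (letters-cells (suc j) Q) (l q))
  (sym (trans (cong concat (LP.unfold-reverse q Q)) (concat-snoc (reverse Q) q))))
  where
  l : ∀ q → map proj₂ (map (j ,_) q) ≡ q
  l []      = refl
  l (x ∷ q) = cong (x ∷_) (l q)

countLe : ℕ → List ℕ → ℕ
countLe t = count (_≤ᵇ t)

data Incr : List ℕ → Set where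
  []  : Incr []
  _∷_ : ∀ {x xs} → All (x ≤_) xs → Incr xs → Incr (x ∷ xs)

weakly-incr : ∀ xs → weaklyInc xs ≡ true → Incr xs
weakly-incr []           _ = []
weakly-incr (x ∷ [])     _ = [] ∷ []
weakly-incr (x ∷ y ∷ xs) w with weakly-incr (y ∷ xs) (proj₂ (∧-elim (x ≤ᵇ y) _ w))
... | a ∷ i = (p ∷ All.map (≤-trans p) a) ∷ (a ∷ i)
  where p = leT⁻ {x} {y} (proj₁ (∧-elim (x ≤ᵇ y) _ w))

countLe-zero : ∀ t xs → All (t <_) xs → countLe t xs ≡ 0
countLe-zero t []       []       = refl
countLe-zero t (x ∷ xs) (p ∷ ps) rewrite leF p = countLe-zero t xs ps

-- Each entry of `u` that is at most t + 1 stands above an entry of `l` that is at most t.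
strict-count : ∀ t l u → strictAbove l u ≡ true → length u ≤ length l → countLe (suc t) u ≤ countLe t l
strict-count t l [] s p = z≤n
strict-count t (x ∷ l) (y ∷ u) s (s≤s p) with ∧-elim (x <ᵇ y) _ s
... | a , b with y ≤ᵇ suc t in e
...   | false with x ≤ᵇ t
...     | true  = m≤n⇒m≤1+n (strict-count t l u b p)
...     | false = strict-count t l u b p
strict-count t (x ∷ l) (y ∷ u) s (s≤s p) | a , b | true rewrite leT (s≤s⁻¹ (≤-trans (ltT⁻ {x} {y} a) (leT⁻ e))) = s≤s (strict-count t l u b p)

data Semi : Tab → Set where
  []   : Semi []
  one  : ∀ {q} → Incr q → Semi (q ∷ [])
  more : ∀ {q r Q} → Incr q → strictAbove q r ≡ true → length r ≤ length q → Semi (r ∷ Q) → Semi (q ∷ r ∷ Q)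

semi-tail : ∀ {q Q} → Semi (q ∷ Q) → Semi Q
semi-tail (one _)        = []
semi-tail (more _ _ _ s) = s

semi-head : ∀ {q Q} → Semi (q ∷ Q) → Incr q
semi-head (one i)        = i
semi-head (more i _ _ _) = i

Entries : ℕ → Tab → Set
Entries j []      = ⊤
Entries j (q ∷ Q) = All (suc j ≤_) q × Entries (suc j) Q

entries : ∀ j Q → Semi Q → (∀ {q Q'} → Q ≡ q ∷ Q' → All (suc j ≤_) q) → Entries j Q
entries j [] s h = tt
entries j (q ∷ []) s h = h refl , tt
entries j (q ∷ r ∷ Q) (more i s l S) h = h refl , entries (suc j) (r ∷ Q) S (λ { refl → up q r s l (h refl) })
  where
  up : ∀ q r → strictAbove q r ≡ true → length r ≤ length q → All (suc j ≤_) q → All (suc (suc j) ≤_) r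
  up q [] s l a = []
  up (x ∷ q) (y ∷ r) s (s≤s l) (p ∷ a) with ∧-elim (x <ᵇ y) _ s
  ... | u , v = ≤-trans (s≤s p) (ltT⁻ {x} {y} u) ∷ up q r v l a

module Collapse (i j₀ : ℕ) (le : j₀ ≤ i) where

  -- Rows `j₀` and `j₀ + 1` in the round in which the letters i + 2 fall to their cells. Before this
  -- E, those belonging to row `j₀` or lower have come down to row `j₀ + 1`; after it they are in
  -- row `j₀`.
  lowP upP lowP' upP' : ℕ × ℕ → Bool
  lowP  (r , x) = (r ≡ᵇ j₀) ∧ (x ≤ᵇ suc i)
  upP   (r , x) = ((r ≡ᵇ suc j₀) ∧ (x ≤ᵇ suc (suc i))) ∨ ((r <ᵇ suc j₀) ∧ (x ≡ᵇ suc (suc i)))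
  lowP' (r , x) = ((r ≡ᵇ j₀) ∧ (x ≤ᵇ suc (suc i))) ∨ ((r <ᵇ j₀) ∧ (x ≡ᵇ suc (suc i)))
  upP'  (r , x) = (r ≡ᵇ suc j₀) ∧ (x ≤ᵇ suc (suc i))

  Run = Erun lowP upP lowP' upP'

  above : ∀ j Q v → suc j₀ < j → Run v (cellsFrom j Q) v
  above j [] v lt = done
  above j (q ∷ Q) v lt = erun-++ (cellsFrom (suc j) Q) (blk q) (above (suc j) Q v (m≤n⇒m≤1+n lt))
    where
    n₀ = eqF {j} {j₀} (λ e → <⇒≢ (<-trans (n<1+n j₀) lt) (sym e))
    n₁ = eqF {j} {suc j₀} (λ e → <⇒≢ lt (sym e))
    n₂ = ltF {j} {suc j₀} (<⇒≤ lt)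
    n₃ = ltF {j} {j₀} (<⇒≤ (<-trans (n<1+n j₀) lt))
    blk : ∀ q → Run v (map (j ,_) q) v
    blk []      = done
    blk (x ∷ q) = step′ (blk q) (cong (_∧ (x ≤ᵇ suc i)) n₀) (cong₂ (λ a b → (a ∧ (x ≤ᵇ suc (suc i))) ∨ (b ∧ (x ≡ᵇ suc (suc i)))) n₁ n₂)
      (sym (cong₂ (λ a b → (a ∧ (x ≤ᵇ suc (suc i))) ∨ (b ∧ (x ≡ᵇ suc (suc i)))) n₀ n₃)) (sym (cong (_∧ (x ≤ᵇ suc (suc i))) n₁)) refl

  next : ∀ Q k → Run (countLe (suc (suc i)) (nth [] Q 0) + k) (cellsFrom (suc j₀) Q) k
  next [] k = done
  next (q ∷ Q) k = erun-++ (cellsFrom (suc (suc j₀)) Q) (blk q k) (above (suc (suc j₀)) Q k ≤-refl)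
    where
    j = suc j₀
    n₀ = eqF {j} {j₀} 1+n≢n
    n₁ = eqT {j} refl
    n₂ = ltF {j} {suc j₀} ≤-refl
    n₃ = ltF {j} {j₀} (n≤1+n j₀)
    blk : ∀ q k → Run (countLe (suc (suc i)) q + k) (map (j ,_) q) k
    blk [] k = done
    blk (x ∷ q) k with x ≤ᵇ suc (suc i) in e
    ... | true = step′ (subst (λ z → Run z (map (j ,_) q) (suc k)) (+-suc (countLe (suc (suc i)) q) k) (blk q (suc k)))
          (cong (_∧ (x ≤ᵇ suc i)) n₀) (trans (cong₂ (λ a b → (a ∧ (x ≤ᵇ suc (suc i))) ∨ (b ∧ (x ≡ᵇ suc (suc i)))) n₁ n₂) (cong (_∨ false) e))
          (sym (cong₂ (λ a b → (a ∧ (x ≤ᵇ suc (suc i))) ∨ (b ∧ (x ≡ᵇ suc (suc i)))) n₀ n₃)) (sym (trans (cong (_∧ (x ≤ᵇ suc (suc i))) n₁) e)) refl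
    ... | false = step′ (blk q k)
          (cong (_∧ (x ≤ᵇ suc i)) n₀) (trans (cong₂ (λ a b → (a ∧ (x ≤ᵇ suc (suc i))) ∨ (b ∧ (x ≡ᵇ suc (suc i)))) n₁ n₂) (cong (_∨ false) e))
          (sym (cong₂ (λ a b → (a ∧ (x ≤ᵇ suc (suc i))) ∨ (b ∧ (x ≡ᵇ suc (suc i)))) n₀ n₃)) (sym (trans (cong (_∧ (x ≤ᵇ suc (suc i))) n₁) e)) refl

  level : ∀ q → Incr q → Run 0 (map (j₀ ,_) q) (countLe (suc i) q)
  level [] [] = done
  level (x ∷ q) (a ∷ inc) with x ≤? suc i
  ... | yes p rewrite leT p = step′ (level q inc) (trans (cong (_∧ (x ≤ᵇ suc i)) n₀) (leT p))
        (trans (cong₂ (λ a b → (a ∧ (x ≤ᵇ suc (suc i))) ∨ (b ∧ (x ≡ᵇ suc (suc i)))) n₁ n₂) (eqF (<⇒≢ (s≤s p))))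
        (sym (trans (cong₂ (λ a b → (a ∧ (x ≤ᵇ suc (suc i))) ∨ (b ∧ (x ≡ᵇ suc (suc i)))) n₀ n₃) (cong (_∨ false) (leT (m≤n⇒m≤1+n p)))))
        (sym (cong (_∧ (x ≤ᵇ suc (suc i))) n₁)) refl
    where
    n₀ = eqT {j₀} refl
    n₁ = eqF {j₀} {suc j₀} (λ e → 1+n≢n (sym e))
    n₂ = ltT (n<1+n j₀)
    n₃ = ltF {j₀} {j₀} ≤-refl
  ... | no np rewrite leF (≰⇒> np) = go (x ≟ suc (suc i))
    where
    n₀ = eqT {j₀} refl
    n₁ = eqF {j₀} {suc j₀} (λ e → 1+n≢n (sym e))
    n₂ = ltT (n<1+n j₀)
    n₃ = ltF {j₀} {j₀} ≤-refl
    z : countLe (suc i) q ≡ 0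
    z = countLe-zero (suc i) q (All.map (≤-trans (≰⇒> np)) a)
    ih : Run 0 (map (j₀ ,_) q) 0
    ih = subst (Run 0 (map (j₀ ,_) q)) z (level q inc)
    go : Dec (x ≡ suc (suc i)) → Run 0 (map (j₀ ,_) (x ∷ q)) (countLe (suc i) q)
    go (yes e) = subst (Run 0 (map (j₀ ,_) (x ∷ q))) (sym z) (step′ ih (trans (cong (_∧ (x ≤ᵇ suc i)) n₀) (leF (≰⇒> np)))
        (trans (cong₂ (λ a b → (a ∧ (x ≤ᵇ suc (suc i))) ∨ (b ∧ (x ≡ᵇ suc (suc i)))) n₁ n₂) (eqT e))
        (sym (trans (cong₂ (λ a b → (a ∧ (x ≤ᵇ suc (suc i))) ∨ (b ∧ (x ≡ᵇ suc (suc i)))) n₀ n₃) (cong (_∨ false) (leT (≤-reflexive e)))))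
        (sym (cong (_∧ (x ≤ᵇ suc (suc i))) n₁)) refl)
    go (no ne) = subst (Run 0 (map (j₀ ,_) (x ∷ q))) (sym z) (step′ ih (trans (cong (_∧ (x ≤ᵇ suc i)) n₀) (leF (≰⇒> np)))
        (trans (cong₂ (λ a b → (a ∧ (x ≤ᵇ suc (suc i))) ∨ (b ∧ (x ≡ᵇ suc (suc i)))) n₁ n₂) (eqF ne))
        (sym (trans (cong₂ (λ a b → (a ∧ (x ≤ᵇ suc (suc i))) ∨ (b ∧ (x ≡ᵇ suc (suc i)))) n₀ n₃) (cong (_∨ false) (leF (≤∧≢⇒< (≰⇒> np) (λ e → ne (sym e)))))))
        (sym (cong (_∧ (x ≤ᵇ suc (suc i))) n₁)) refl)

  below-run : ∀ j q → j < j₀ → Run 0 (map (j ,_) q) 0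
  below-run j []      lt = done
  below-run j (x ∷ q) lt = step′ (below-run j q lt) (cong (_∧ (x ≤ᵇ suc i)) n₀) (cong₂ (λ a b → (a ∧ (x ≤ᵇ suc (suc i))) ∨ (b ∧ (x ≡ᵇ suc (suc i)))) n₁ n₂)
      (trans (l (x ≡ᵇ suc (suc i))) (sym (cong₂ (λ a b → (a ∧ (x ≤ᵇ suc (suc i))) ∨ (b ∧ (x ≡ᵇ suc (suc i)))) n₀ n₃)))
      (trans (u (x ≡ᵇ suc (suc i))) (sym (cong (_∧ (x ≤ᵇ suc (suc i))) n₁))) (c (x ≡ᵇ suc (suc i)))
    where
    n₀ = eqF {j} {j₀} (<⇒≢ lt)
    n₁ = eqF {j} {suc j₀} (<⇒≢ (m≤n⇒m≤1+n lt))
    n₂ = ltT (m≤n⇒m≤1+n lt)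
    n₃ = ltT lt
    l : ∀ s → lw false s 0 ≡ s
    l true  = refl
    l false = refl
    u : ∀ s → ub false s 0 ≡ false
    u true  = refl
    u false = refl
    c : ∀ s → cv false s 0 ≡ 0
    c true  = refl
    c false = refl

  -- Scanned from the right, the cells below row `j₀` and then the letters i + 2 at the end of row
  -- `j₀` meet the carrier 0, so these letters fall. The remaining letters of row `j₀` that are at
  -- most i + 1 fill the carrier, and by `strict-count` they suffice for all letters of row `j₀ + 1`
  -- that are at most i + 2, so none of these falls.
  run : ∀ d j Q → j + d ≡ j₀ → Semi Q → ∃ λ k → Run 0 (cellsFrom j Q) k
  run d j [] e S = 0 , done
  run zero j (q ∷ Q) e S rewrite trans (sym (+-identityʳ j)) e = _ , erun-++ (cellsFrom (suc j₀) Q) (level q (semi-head S))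
      (subst (λ z → Run z (cellsFrom (suc j₀) Q) (countLe (suc i) q ∸ c)) (m+[n∸m]≡n (cnt S)) (next Q (countLe (suc i) q ∸ c)))
    where
    c = countLe (suc (suc i)) (nth [] Q 0)
    cnt : ∀ {Q} → Semi (q ∷ Q) → countLe (suc (suc i)) (nth [] Q 0) ≤ countLe (suc i) q
    cnt (one _) = z≤n
    cnt (more {r = r} _ s l _) = strict-count (suc i) q r s l
  run (suc d) j (q ∷ Q) e S with run d (suc j) Q (trans (sym (+-suc j d)) e) (semi-tail S)
  ... | k , r = k , erun-++ (cellsFrom (suc j) Q) (below-run j q (≤-trans (s≤s (m≤m+n j d)) (≤-reflexive (trans (sym (+-suc j d)) e)))) r

module Reading (Q : Tab) (S : Semi Q) (En : Entries 0 Q) where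

  cs : Cells
  cs = cellsFrom 0 Q

  cells-ok : All (λ c → suc (proj₁ c) ≤ proj₂ c) cs
  cells-ok = go 0 Q En
    where
    go : ∀ j Q → Entries j Q → All (λ c → suc (proj₁ c) ≤ proj₂ c) (cellsFrom j Q)
    go j []      e       = []
    go j (q ∷ Q) (a , e) = AllP.++⁺ (go (suc j) Q e) (AllP.map⁺ a)

  -- row j after the letters up to i + 1 have been collapsed (rows are numbered from 0, letters from 1)
  rowP : ℕ → ℕ → ℕ × ℕ → Bool
  rowP i j (r , x) = if j ≤ᵇ i then (r ≡ᵇ j) ∧ (x ≤ᵇ suc i) else (x ≡ᵇ suc j)

  rowsP : ℕ → ℕ → ℕ → Mat (length (letters cs))
  rowsP i j zero    = []
  rowsP i j (suc l) = vmap (rowP i j) cs ∷ rowsP i (suc j) l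

  -- Row j while the letters i + 2 pass through it: its own cells, and those letters that have still
  -- to fall to a lower row.
  fallP : ℕ → ℕ → ℕ × ℕ → Bool
  fallP i j (r , x) = ((r ≡ᵇ j) ∧ (x ≤ᵇ suc (suc i))) ∨ ((r <ᵇ j) ∧ (x ≡ᵇ suc (suc i)))

  vcong : ∀ {f g} → (∀ r x → suc r ≤ x → f (r , x) ≡ g (r , x)) → vmap f cs ≡ vmap g cs
  vcong h = vmap-cong cs (All.map (λ {c} p → h (proj₁ c) (proj₂ c) p) cells-ok)

  rowsP-above : ∀ i j l → suc i < j → rowsP i j l ≡ rowsP (suc i) j l
  rowsP-above i j zero    lt = refl
  rowsP-above i j (suc l) lt = cong₂ _∷_ (vcong (λ r x _ → trans (cong (λ b → if b then (r ≡ᵇ j) ∧ (x ≤ᵇ suc i) else (x ≡ᵇ suc j)) (leF {j} {i} (<-trans (n<1+n i) lt)))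
    (sym (cong (λ b → if b then (r ≡ᵇ j) ∧ (x ≤ᵇ suc (suc i)) else (x ≡ᵇ suc j)) (leF {j} {suc i} lt))))) (rowsP-above i (suc j) l (m≤n⇒m≤1+n lt))

  ins-rows : ∀ i d j l → j + d ≡ suc i → ins d (rowsP i j (suc (d + l))) ≡ vmap (fallP i j) cs ∷ rowsP (suc i) (suc j) (d + l)
  ins-rows i zero j l e rewrite trans (sym (+-identityʳ j)) e = cong₂ _∷_ (vcong fp) (rowsP-above i (suc (suc i)) l ≤-refl)
    where
    fp : ∀ r x → suc r ≤ x → rowP i (suc i) (r , x) ≡ fallP i (suc i) (r , x)
    fp r x p = trans (cong (λ b → if b then (r ≡ᵇ suc i) ∧ (x ≤ᵇ suc i) else (x ≡ᵇ suc (suc i))) (leF {suc i} {i} ≤-refl)) (bool-iff f g)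
      where
      f : (x ≡ᵇ suc (suc i)) ≡ true → fallP i (suc i) (r , x) ≡ true
      f q with <-cmp r (suc i)
      ... | tri< a _ _ rewrite ltT a | q = ∨-zeroʳ ((r ≡ᵇ suc i) ∧ (x ≤ᵇ suc (suc i)))
      ... | tri≈ _ refl _ rewrite eqT {suc i} refl | leT (≤-reflexive (eqT⁻ x (suc (suc i)) q)) = refl
      ... | tri> _ _ c = ⊥-elim (<⇒≱ c (s≤s⁻¹ (≤-trans p (≤-reflexive (eqT⁻ x _ q)))))
      g : fallP i (suc i) (r , x) ≡ true → (x ≡ᵇ suc (suc i)) ≡ true
      g q with r ≡ᵇ suc i in er | x ≤ᵇ suc (suc i) in ex
      ... | true  | true  = eqT (≤-antisym (leT⁻ ex) (subst (λ z → suc z ≤ x) (eqT⁻ r (suc i) er) p))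
      ... | true  | false = proj₂ (∧-elim (r <ᵇ suc i) _ q)
      ... | false | true  = proj₂ (∧-elim (r <ᵇ suc i) _ q)
      ... | false | false = proj₂ (∧-elim (r <ᵇ suc i) _ q)
  ins-rows i (suc d) j l e = trans (cong (λ X → opE (vmap (rowP i j) cs ∷ X)) (ins-rows i d (suc j) l (trans (sym (+-suc j d)) e)))
    (cong₂ (λ a b → a ∷ b ∷ rowsP (suc i) (suc (suc j)) (d + l)) (trans (cong (λ z → low 0 z (vmap upP cs)) eL) (proj₁ E))
      (trans (cong (λ z → upp 0 z (vmap upP cs)) eL) (trans (proj₁ (proj₂ E)) (vcong (λ r x _ → sym (cong (λ b → if b then (r ≡ᵇ suc j) ∧ (x ≤ᵇ suc (suc i)) else (x ≡ᵇ suc (suc j))) (leT (s≤s j≤i))))))))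
    where
    j≤i : j ≤ i
    j≤i = s≤s⁻¹ (≤-trans (s≤s (m≤m+n j d)) (≤-reflexive (trans (sym (+-suc j d)) e)))
    open Collapse i j j≤i
    rn = run j 0 Q refl S
    E = erun-E cs (proj₂ rn)
    eL : vmap (rowP i j) cs ≡ vmap lowP cs
    eL = vcong (λ r x _ → cong (λ b → if b then (r ≡ᵇ j) ∧ (x ≤ᵇ suc i) else (x ≡ᵇ suc j)) (leT j≤i))

  stage-rows : ∀ i L → i ≤ L → stage i (rowsP 0 0 (suc L)) ≡ rowsP i 0 (suc L)
  stage-rows zero L le = refl
  stage-rows (suc i) L le = trans (cong (ins (suc i)) (trans (stage-rows i L (<⇒≤ le)) (cong (λ z → rowsP i 0 (suc z)) (sym (m+[n∸m]≡n le)))))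
    (trans (ins-rows i (suc i) 0 (L ∸ suc i) refl) (trans (cong (λ z → vmap (fallP i 0) cs ∷ rowsP (suc i) 1 z) (m+[n∸m]≡n le)) (cong (_∷ rowsP (suc i) 1 L) (vcong (λ r x _ → fin r x)))))
    where
    fin : ∀ r x → fallP i 0 (r , x) ≡ rowP (suc i) 0 (r , x)
    fin r x with (r ≡ᵇ 0) ∧ (x ≤ᵇ suc (suc i))
    ... | true  = refl
    ... | false = refl

  open Word (letters cs)

  rows-word : ∀ L j l → rowsP 0 j l ≡ rowsFrom L (suc j) l
  rows-word L j zero    = refl
  rows-word L j (suc l) = cong₂ _∷_ (trans (vcong (λ r x p → z j r x p)) (lt (suc j) cs)) (rows-word L (suc j) l)
    where
    z : ∀ j r x → suc r ≤ x → rowP 0 j (r , x) ≡ (x ≡ᵇ suc j)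
    z (suc j) r x p = refl
    z zero zero x p = bool-iff (λ e → eqT (≤-antisym (leT⁻ {x} {1} e) p)) (λ e → leT (≤-reflexive (eqT⁻ x 1 e)))
    z zero (suc r) x p = sym (eqF (λ e → <⇒≱ (≤-trans (s≤s (s≤s z≤n)) p) (≤-reflexive e)))
    lt : ∀ a cs → vmap (λ c → proj₂ c ≡ᵇ a) cs ≡ vecOf (length (letters cs)) (λ i → nth 0 (letters cs) i ≡ᵇ a)
    lt a []       = refl
    lt a (c ∷ cs) = cong (_ ∷_) (lt a cs)

  size-cells : ∀ (p : ℕ → Bool) j k Q → size (vmap (λ c → (proj₁ c ≡ᵇ (k + j)) ∧ p (proj₂ c)) (cellsFrom k Q)) ≡ count p (nth [] Q j)
  size-cells p j k [] = refl
  size-cells p j k (q ∷ Q) = trans (size-++ _ (cellsFrom (suc k) Q) (map (k ,_) q)) (lem j)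
    where
    f = λ (j : ℕ) (c : ℕ × ℕ) → (proj₁ c ≡ᵇ (k + j)) ∧ p (proj₂ c)
    size-++ : ∀ f xs ys → size (vmap f (xs ++ ys)) ≡ size (vmap f xs) + size (vmap f ys)
    size-++ f []       ys = refl
    size-++ f (x ∷ xs) ys = trans (cong (tw (f x) +_) (size-++ f xs ys)) (sym (+-assoc (tw (f x)) _ _))
    here′ : ∀ q → size (vmap (f 0) (map (k ,_) q)) ≡ count p q
    here′ [] = refl
    here′ (x ∷ q) rewrite +-identityʳ k | eqT {k} refl with p x
    ... | true  = cong suc (trans (cong (λ z → size (vmap (λ c → (proj₁ c ≡ᵇ z) ∧ p (proj₂ c)) (map (k ,_) q))) (sym (+-identityʳ k))) (here′ q))
    ... | false = trans (cong (λ z → size (vmap (λ c → (proj₁ c ≡ᵇ z) ∧ p (proj₂ c)) (map (k ,_) q))) (sym (+-identityʳ k))) (here′ q)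
    nomatch : ∀ t (xs : Cells) → All (λ c → proj₁ c ≢ t) xs → size (vmap (λ c → (proj₁ c ≡ᵇ t) ∧ p (proj₂ c)) xs) ≡ 0
    nomatch t []       []       = refl
    nomatch t (c ∷ xs) (e ∷ es) rewrite eqF e = nomatch t xs es
    row-eq : ∀ k q → All (λ c → proj₁ c ≡ k) (map (k ,_) q)
    row-eq k []      = []
    row-eq k (x ∷ q) = refl ∷ row-eq k q
    ge : ∀ k Q → All (λ c → k ≤ proj₁ c) (cellsFrom k Q)
    ge k []      = []
    ge k (q ∷ Q) = AllP.++⁺ (All.map <⇒≤ (ge (suc k) Q)) (All.map (λ e → ≤-reflexive (sym e)) (row-eq k q))
    lem : ∀ j → size (vmap (f j) (cellsFrom (suc k) Q)) + size (vmap (f j) (map (k ,_) q)) ≡ count p (nth [] (q ∷ Q) j)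
    lem zero = trans (cong₂ _+_ (nomatch (k + 0) (cellsFrom (suc k) Q) (All.map (λ l e → <⇒≢ l (sym (trans e (+-identityʳ k)))) (ge (suc k) Q))) (here′ q)) refl
    lem (suc j) = trans (cong₂ _+_ (trans (cong (λ z → size (vmap (λ c → (proj₁ c ≡ᵇ z) ∧ p (proj₂ c)) (cellsFrom (suc k) Q))) (+-suc k j)) (size-cells p j (suc k) Q))
        (nomatch (k + suc j) (map (k ,_) q) (All.map (λ e e' → <⇒≢ (≤-trans (s≤s (m≤m+n k j)) (≤-reflexive (sym (+-suc k j)))) (trans (sym e) e')) (row-eq k q)))) (+-identityʳ _)

  module Record (L : ℕ) where

    M : Mat (length (letters cs))
    M = rowsP 0 0 (suc L)

    nsz-rows : ∀ i j k l → k < l → nsz (rowsP i j l) k ≡ size (vmap (rowP i (j + k)) cs)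
    nsz-rows i j zero    (suc l) _       = cong (λ z → size (vmap (rowP i z) cs)) (sym (+-identityʳ j))
    nsz-rows i j (suc k) (suc l) (s≤s p) = trans (nsz-rows i (suc j) k l p) (cong (λ z → size (vmap (rowP i z) cs)) (sym (+-suc j k)))

    grow-M : ∀ i j → i ≤ L → j ≤ i → grow M i j ≡ countLe (suc i) (nth [] Q j)
    grow-M i j le lj = trans (cong (λ X → nsz X j) (stage-rows i L le)) (trans (nsz-rows i 0 j (suc L) (s≤s (≤-trans lj le)))
      (trans (cong size (vcong (λ r x _ → cong (λ b → if b then (r ≡ᵇ j) ∧ (x ≤ᵇ suc i) else (x ≡ᵇ suc j)) (leT lj)))) (size-cells (_≤ᵇ suc i) j 0 Q)))

    incr-nth : ∀ Q → Semi Q → ∀ j → Incr (nth [] Q j)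
    incr-nth []      S j       = []
    incr-nth (q ∷ Q) S zero    = semi-head S
    incr-nth (q ∷ Q) S (suc j) = incr-nth Q (semi-tail S) j

    entries-nth : ∀ k Q → Entries k Q → ∀ j → All (suc (k + j) ≤_) (nth [] Q j)
    entries-nth k []      e       j       = []
    entries-nth k (q ∷ Q) (a , e) zero    = subst (λ z → All (suc z ≤_) q) (sym (+-identityʳ k)) a
    entries-nth k (q ∷ Q) (a , e) (suc j) = subst (λ z → All (suc z ≤_) (nth [] Q j)) (sym (+-suc k j)) (entries-nth (suc k) Q e j)

    nofilter : ∀ t q → All (t <_) q → filterᵇ (_≤ᵇ t) q ≡ []
    nofilter t []      []       = refl
    nofilter t (x ∷ q) (p ∷ ps) rewrite leF p = nofilter t q ps

    filter-sorted : ∀ t q → Incr q → filterᵇ (_≤ᵇ suc t) q ≡ filterᵇ (_≤ᵇ t) q ++ replicate (countLe (suc t) q ∸ countLe t q) (suc t)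
    filter-sorted t [] i = refl
    filter-sorted t (x ∷ q) (a ∷ i) with x ≤? t
    ... | yes p rewrite leT p | leT (m≤n⇒m≤1+n p) = cong (x ∷_) (filter-sorted t q i)
    ... | no np with x ≟ suc t
    ...   | yes refl rewrite leT (≤-refl {suc t}) | leF (n<1+n t) = trans (cong (suc t ∷_) (trans (filter-sorted t q i) (clean (countLe (suc t) q))))
            (sym (clean (suc (countLe (suc t) q))))
      where
      clean : ∀ c → filterᵇ (_≤ᵇ t) q ++ replicate (c ∸ countLe t q) (suc t) ≡ replicate c (suc t)
      clean c = cong₂ (λ x y → x ++ replicate (c ∸ y) (suc t)) (nofilter t q a) (countLe-zero t q a)
    ...   | no ne rewrite leF (≰⇒> np) | leF (≤∧≢⇒< (≰⇒> np) (λ e → ne (sym e))) = filter-sorted t q i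

    -- By `grow-M` each round adds to a row as many boxes as Q has there of the new letter. Rows of
    -- Q are sorted, so appending these boxes replays Q.
    rowQ-M : ∀ i j → i ≤ L → j ≤ i → rowQ M i j ≡ filterᵇ (_≤ᵇ suc i) (nth [] Q j)
    rowQ-M zero zero le lj = trans (cong (λ z → replicate z 1) (grow-M 0 0 z≤n z≤n)) (sym (trans (filter-sorted 0 q₀ (incr-nth Q S 0))
        (cong₂ (λ a b → a ++ replicate (countLe 1 q₀ ∸ b) 1) (nofilter 0 q₀ (entries-nth 0 Q En 0)) (countLe-zero 0 q₀ (entries-nth 0 Q En 0)))))
      where q₀ = nth [] Q 0
    rowQ-M (suc i) j le lj with j ≟ suc i
    ... | yes refl = trans (rowQ-new M i) (trans (cong (λ z → replicate z (suc (suc i))) (grow-M (suc i) (suc i) le ≤-refl))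
          (sym (trans (filter-sorted (suc i) qj (incr-nth Q S (suc i))) (cong₂ (λ a b → a ++ replicate (countLe (suc (suc i)) qj ∸ b) (suc (suc i)))
            (nofilter (suc i) qj (entries-nth 0 Q En (suc i))) (countLe-zero (suc i) qj (entries-nth 0 Q En (suc i)))))))
      where qj = nth [] Q (suc i)
    ... | no ne = trans (rowQ-old M i j j≤i) (trans (cong₂ (λ a b → a ++ replicate b (suc (suc i))) (rowQ-M i j (<⇒≤ le) j≤i)
          (cong₂ _∸_ (grow-M (suc i) j le lj) (grow-M i j (<⇒≤ le) j≤i))) (sym (filter-sorted (suc i) (nth [] Q j) (incr-nth Q S j))))
      where
      j≤i : j ≤ i
      j≤i = s≤s⁻¹ (≤∧≢⇒< lj ne)

    rowQ-full : All (All (_≤ suc L)) Q → ∀ j → j ≤ L → rowQ M L j ≡ nth [] Q j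
    rowQ-full b j le = trans (rowQ-M L j ≤-refl le) (all-in (nth [] Q j) (bnd Q b j))
      where
      all-in : ∀ q → All (_≤ suc L) q → filterᵇ (_≤ᵇ suc L) q ≡ q
      all-in []      []       = refl
      all-in (x ∷ q) (p ∷ ps) rewrite leT p = cong (x ∷_) (all-in q ps)
      bnd : ∀ Q → All (All (_≤ suc L)) Q → ∀ j → All (_≤ suc L) (nth [] Q j)
      bnd []      b        j       = []
      bnd (q ∷ Q) (p ∷ ps) zero    = p
      bnd (q ∷ Q) (p ∷ ps) (suc j) = bnd Q ps j

-- Injectivity and surjectivity of ρ, and its effect on types

E-dom : ∀ {n} (b s : Vec Bool n) → Dom b s → low 0 b s ≡ b × upp 0 b s ≡ s
E-dom [] [] _ = refl , refl
E-dom (b ∷ bs) (s ∷ ss) (d , e) with E-dom bs ss d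
... | x , y = go b s e
  where
  go : ∀ b s → tw s + size ss ≤ tw b + size bs → lw b s (car 0 bs ss) ∷ low 0 bs ss ≡ b ∷ bs × ub b s (car 0 bs ss) ∷ upp 0 bs ss ≡ s ∷ ss
  go true  s     e = cong (true ∷_) x , cong (s ∷_) y
  go false false e = cong (false ∷_) x , cong (false ∷_) y
  go false true  e with car 0 bs ss | car-size 0 bs ss
  ... | suc v | _ = cong (false ∷_) x , cong (true ∷_) y
  ... | zero  | c = ⊥-elim (<⇒≱ e (≤-reflexive (trans (sym c) (cong size y))))

hw-opE : ∀ {n} (M : Mat n) → HW M → opE M ≡ M
hw-opE []          h = refl
hw-opE (_ ∷ [])    h = refl
hw-opE (b ∷ s ∷ M) h = cong₂ (λ x y → x ∷ y ∷ M) (proj₁ (E-dom b s (proj₁ h))) (proj₂ (E-dom b s (proj₁ h)))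

hw-ins : ∀ {n} i (M : Mat n) → HW M → ins i M ≡ M
hw-ins zero    M       h = refl
hw-ins (suc i) []      h = refl
hw-ins (suc i) (b ∷ M) h = trans (cong (λ X → opE (b ∷ X)) (hw-ins i M (hw-tail b M h))) (hw-opE (b ∷ M) h)

hw-stage : ∀ {n} i (M : Mat n) → HW M → stage i M ≡ M
hw-stage zero    M h = refl
hw-stage (suc i) M h = trans (cong (ins (suc i)) (hw-stage i M h)) (hw-ins (suc i) M h)

-- By induction along the path, `g A` and `A` have a step to the same matrix, and steps are
-- injective.
morph-fix : ∀ {n} {g : Mat n → Mat n} → Morph g → ∀ {A B} → Path A B → g B ≡ B → g A ≡ A
morph-fix mg stop e = e
morph-fix {g = g} mg (_▸_ {j = j} p s) e = morph-fix mg p (step-codet (subst (Step j _) e (m-step mg s)) s)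

hw-decr : ∀ {n} (M : Mat n) → HW M → Decr M
hw-decr []          h       = tt
hw-decr (_ ∷ [])    h       = tt
hw-decr (b ∷ s ∷ M) (d , h) = dom-size b s d , hw-decr (s ∷ M) h

countLe-all : ∀ t xs → All (_≤ t) xs → countLe t xs ≡ length xs
countLe-all t []       []       = refl
countLe-all t (x ∷ xs) (p ∷ ps) rewrite leT p = cong suc (countLe-all t xs ps)

grow-count : ∀ {n} (M : Mat n) L i j → i ≤ L → j ≤ i → grow M i j ≡ countLe (suc i) (rowQ M L j)
grow-count M L i j le lj with i ≟ L
... | yes refl = sym (trans (countLe-all (suc i) (rowQ M i j) (r-max (rowOK M i j lj))) (r-len (rowOK M i j lj)))
grow-count M zero    zero    j le lj | no ne = ⊥-elim (ne refl)
grow-count M (suc L) i       j le lj | no ne = trans (grow-count M L i j i≤L lj) (sym (trans (cong (countLe (suc i)) (rowQ-old M L j (≤-trans lj i≤L)))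
    (trans (count-++ (_≤ᵇ suc i) (rowQ M L j) _) (trans (cong (countLe (suc i) (rowQ M L j) +_) (countLe-zero (suc i) (replicate δ (suc (suc L))) (AllP.replicate⁺ δ (s≤s (s≤s i≤L))))) (+-identityʳ _)))))
  where
  i≤L : i ≤ L
  i≤L = s≤s⁻¹ (≤∧≢⇒< le ne)
  δ = grow M (suc L) j ∸ grow M L j

list-ext : ∀ {A : Set} (d : A) xs ys → length xs ≡ length ys → (∀ j → j < length xs → nth d xs j ≡ nth d ys j) → xs ≡ ys
list-ext d []       []       e h = refl
list-ext d (x ∷ xs) (y ∷ ys) e h = cong₂ _∷_ (h 0 (s≤s z≤n)) (list-ext d xs ys (suc-injective e) (λ j p → h (suc j) (s≤s p)))

same-sizes : ∀ {n m} (M : Mat n) (M' : Mat m) L → sizes M ≡ sizes M' → (∀ j → j ≤ L → rowQ M L j ≡ rowQ M' L j) →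
  ∀ i → i ≤ L → sizes (stage i M) ≡ sizes (stage i M')
same-sizes M M' L z h i le = list-ext 0 _ _ (trans (len M) (trans (cong length z) (sym (len M')))) go
  where
  len : ∀ {n} (M : Mat n) → length (sizes (stage i M)) ≡ length (sizes M)
  len M = trans (LP.length-map size (stage i M)) (trans (k-len (stage-keep i) M) (sym (LP.length-map size M)))
  go : ∀ j → j < length (sizes (stage i M)) → grow M i j ≡ grow M' i j
  go j _ with j ≤? i
  ... | yes p = trans (grow-count M L i j le p) (trans (cong (countLe (suc i)) (h j (≤-trans p le))) (sym (grow-count M' L i j le p)))
  ... | no p  = trans (grow-beyond M i j (≰⇒> p)) (trans (cong (λ l → nth 0 l j) z) (sym (grow-beyond M' i j (≰⇒> p))))

Qs-cong : ∀ {n m} (M : Mat n) (M' : Mat m) i → (∀ k → k ≤ i → sizes (stage k M) ≡ sizes (stage k M')) → Qs M i ≡ Qs M' i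
Qs-cong M M' zero    h = cong (λ l → replicate (nth 0 l 0) 1 ∷ []) (h 0 z≤n)
Qs-cong M M' (suc i) h rewrite Qs-cong M M' i (λ k p → h k (m≤n⇒m≤1+n p)) =
  cong₂ (λ a b → map (λ j → nth [] (Qs M' i) j ++ replicate (nth 0 a j ∸ nth 0 b j) (suc (suc i))) (upTo (suc i)) ++ replicate (nth 0 a (suc i)) (suc (suc i)) ∷ [])
    (h (suc i) ≤-refl) (h i (n≤1+n i))

rho-injective : ∀ {n} (M M' : Mat n) L → sizes M ≡ sizes M' → (∀ j → j ≤ L → rowQ M L j ≡ rowQ M' L j) → stage L M ≡ stage L M' → M ≡ M'
rho-injective M M' L z h e = stage-inj L M M' (λ j p → same-sizes M M' L z h j (<⇒≤ p)) e

same-type : ∀ {n} (M M' : Mat n) L → length M ≡ suc L → sizes M ≡ sizes M' → (∀ j → j ≤ L → rowQ M L j ≡ rowQ M' L j) →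
  (∀ i → Sset i (stage L M) ≡ Sset i (stage L M')) → ∀ k → Sset k M ≡ Sset k M'
same-type M M' L e z h s k with common-top L M M' (≤-reflexive e) (same-sizes M M' L z h)
... | A , p , p' , _ with k <? suc L
...   | yes lt = sets-determined L M M' A e p p' (λ i → subst₂ (λ x y → Sset i x ≡ Sset i y) (eq M e) (eq M' e') (s i)) k lt
  where
  e' : length M' ≡ suc L
  e' = trans (sym (LP.length-map size M')) (trans (cong length (sym z)) (trans (LP.length-map size M) e))
  eq : ∀ {n} (M : Mat n) → length M ≡ suc L → stage L M ≡ coll (suc L) M
  eq M e = trans (stage≡coll M L (≤-reflexive e)) (cong (λ l → coll l M) e)
...   | no nlt = trans (Sset-small k M (≤-trans (≤-reflexive e) (≮⇒≥ nlt))) (sym (Sset-small k M' (≤-trans (≤-reflexive e') (≮⇒≥ nlt))))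
  where
  e' : length M' ≡ suc L
  e' = trans (sym (LP.length-map size M')) (trans (cong length (sym z)) (trans (LP.length-map size M) e))

-- The data carried along paths and through the addition of empty columns, comparable between
-- matrices with different numbers of columns: the stage sizes, which encode the recording tableau,
-- and the energy.
record Profile {n m} (L : ℕ) (A : Mat n) (B : Mat m) : Set where
  field
    p-sizes : ∀ i → i ≤ L → sizes (stage i A) ≡ sizes (stage i B)
    p-majA  : majA A ≡ majA B
open Profile

profile-trans : ∀ {n m k} {L} {A : Mat n} {B : Mat m} {C : Mat k} → Profile L A B → Profile L B C → Profile L A C
profile-trans p q = record { p-sizes = λ i l → trans (p-sizes p i l) (p-sizes q i l) ; p-majA = trans (p-majA p) (p-majA q) }

profile-sym : ∀ {n m} {L} {A : Mat n} {B : Mat m} → Profile L A B → Profile L B A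
profile-sym p = record { p-sizes = λ i l → sym (p-sizes p i l) ; p-majA = sym (p-majA p) }

profile-path : ∀ {n} L {A B : Mat n} → Path A B → Profile L A B
profile-path L p = record { p-sizes = λ i _ → path-inv (λ X → sizes (stage i X)) (λ s → step-sizes (m-step (stage-morph i) s)) p ; p-majA = path-majA p }

profile-pad : ∀ {n} L m (M : Mat n) → Profile L M (padM m M)
profile-pad L m M = record { p-sizes = λ i _ → sym (trans (cong sizes (stage-pad m i M)) (sizes-pad m (stage i M))) ; p-majA = sym (majA-pad m M) }

hw-pad : ∀ {n} m (M : Mat n) → HW M → HW (padM m M)
hw-pad m []          h       = tt
hw-pad m (_ ∷ [])    h       = tt
hw-pad m (b ∷ s ∷ M) (d , h) = dom-pad b s d , hw-pad m (s ∷ M) h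
  where
  dom-refl : ∀ {n} (r : Vec Bool n) → Dom r r
  dom-refl r = sub-dom r r (sub-refl r)
  dom-pad : ∀ {n} (b s : Vec Bool n) → Dom b s → Dom (pad m b) (pad m s)
  dom-pad [] [] d = dom-refl (empty m)
  dom-pad (b ∷ bs) (s ∷ ss) (d , e) = dom-pad bs ss d , subst₂ (λ x y → tw s + x ≤ tw b + y) (sym (size-pad m ss)) (sym (size-pad m bs)) e

-- Raise X and N' to highest weight, where the collapse of X meets N', and follow the path of N' down again.
transport : ∀ {n m} L (N' : Mat n) (X : Mat m) → HW N' → length N' ≤ suc L → length X ≤ suc L → sizes N' ≡ sizes (stage L X) →
  ∃ λ (M : Mat n) → stage L M ≡ N' × Profile L M X
transport {n} {m} L N' X h lN lX z = out (subst (λ k → ∃ λ (Y : Mat k) → length Y ≤ suc L × Profile L Y X) (+-comm m n)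
    (padM n X , ≤-trans (≤-reflexive (LP.length-map (pad n) X)) lX , profile-sym (profile-pad L n X)))
  where
  out : (∃ λ (Y : Mat (n + m)) → length Y ≤ suc L × Profile L Y X) → ∃ λ (M : Mat n) → stage L M ≡ N' × Profile L M X
  out (Y , lY , pY) with to-top Y | to-top (padM m N')
  ... | A , pA , tA | A' , pA' , tA' = M , padM-inj m _ _ (trans (sym (stage-pad m L M)) (trans (cong (stage L) (sym eB)) eC)) ,
        profile-trans (profile-pad L m M) (subst (λ Z → Profile L Z X) eB (profile-trans (profile-sym (profile-path L pB)) (profile-trans (profile-path L pA) pY)))
    where
    fixN : stage L (padM m N') ≡ padM m N'
    fixN = hw-stage L (padM m N') (hw-pad m N' h)
    fixA' : stage L A' ≡ A'
    fixA' = morph-fix (stage-morph L) pA' fixN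
    lenA : length A ≤ suc L
    lenA = ≤-trans (≤-reflexive (path-inv length step-length pA)) lY
    lenA' : length A' ≤ suc L
    lenA' = ≤-trans (≤-reflexive (trans (path-inv length step-length pA') (LP.length-map (pad m) N'))) lN
    szA : sizes (stage L A) ≡ sizes A'
    szA = trans (p-sizes (profile-path L pA) L ≤-refl) (trans (p-sizes pY L ≤-refl) (trans (sym z) (trans (sym (sizes-pad m N'))
      (trans (cong sizes (sym fixN)) (trans (sym (p-sizes (profile-path L pA') L ≤-refl)) (cong sizes fixA'))))))
    topA : stage L A ≡ A'
    topA = inits-size _ _ (proj₁ (colTop-hw _ (stage-hw L A lenA) (morph-top (stage-morph L) tA)))
      (proj₁ (colTop-hw A' (subst HW fixA' (stage-hw L A' lenA')) tA')) szA
    dn = morph-down (stage-morph L) {A} (subst (λ Z → Path Z (padM m N')) (sym topA) pA')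
    B = proj₁ dn
    pB : Path A B
    pB = proj₁ (proj₂ dn)
    eC : stage L B ≡ padM m N'
    eC = proj₂ (proj₂ dn)
    -- Stages keep the weight, so `B` has the weight of the padded `N'` and its last m columns are
    -- empty.
    un = unpad m B (wt N') (trans (sym (k-wt (stage-keep L) B)) (trans (cong wt eC) (wt-pad m N')))
    M = proj₁ un
    eB : B ≡ padM m M
    eB = proj₂ un

lookup-all : ∀ {P : ℕ → Set} w → All P w → ∀ i → i < length w → P (nth 0 w i)
lookup-all (x ∷ w) (p ∷ ps) zero    _       = p
lookup-all (x ∷ w) (p ∷ ps) (suc i) (s≤s q) = lookup-all w ps i q

countN-size : ∀ w a → size (vecOf (length w) (λ i → nth 0 w i ≡ᵇ a)) ≡ countN a w
countN-size []      a = refl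
countN-size (x ∷ w) a with x ≡ᵇ a
... | true  = cong suc (countN-size w a)
... | false = countN-size w a

all-concat-rev : ∀ {P : ℕ → Set} (Q : Tab) → All (All P) Q → All P (concat (reverse Q))
all-concat-rev         []      []       = []
all-concat-rev {P} (q ∷ Q) (p ∷ ps) = subst (All P) (sym (trans (cong concat (LP.unfold-reverse q Q)) (concat-snoc (reverse Q) q)))
  (AllP.++⁺ (all-concat-rev Q ps) p)

countN-concat-rev : ∀ a (Q : Tab) → countN a (concat (reverse Q)) ≡ countN a (concat Q)
countN-concat-rev a []      = refl
countN-concat-rev a (q ∷ Q) = trans (cong (countN a) (trans (cong concat (LP.unfold-reverse q Q)) (concat-snoc (reverse Q) q)))
  (trans (count-++ (λ x → x ≡ᵇ a) (concat (reverse Q)) q) (trans (cong (_+ countN a q) (countN-concat-rev a Q))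
  (trans (+-comm (countN a (concat Q)) (countN a q)) (sym (count-++ (λ x → x ≡ᵇ a) q (concat Q))))))

record WordMatrix (L : ℕ) (Q : Tab) : Set where
  field
    cols   : ℕ
    mat    : Mat cols
    w-len  : length mat ≡ suc L
    w-rowQ : ∀ j → j ≤ L → rowQ mat L j ≡ nth [] Q j
    w-size : ∀ a → a ≤ L → nsz mat a ≡ countN (suc a) (concat Q)
    w-maj  : majA mat ≡ charge Q
open WordMatrix

module _ (L : ℕ) (Q : Tab) (S : Semi Q) (pos : All (All (1 ≤_)) Q) (mx : All (All (_≤ suc L)) Q)
  (dec : ∀ a → 1 ≤ a → countN (suc a) (concat Q) ≤ countN a (concat Q)) where

  private
    En : Entries 0 Q
    En = entries 0 Q S (λ { refl → All.head pos })
    module Rd = Reading Q S En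
    module Rc = Rd.Record L
    w = letters Rd.cs
    module W = Word w (suc L)
    all-w : ∀ {P : ℕ → Set} → All (All P) Q → All P w
    all-w {P} a = subst (All P) (sym (letters-cells 0 Q)) (all-concat-rev Q a)
    multw : ∀ a → W.mult a ≡ countN a (concat Q)
    multw a = trans (countN-size w a) (trans (cong (countN a) (letters-cells 0 Q)) (countN-concat-rev a Q))
    lenR : ∀ i j l → length (Rd.rowsP i j l) ≡ l
    lenR i j zero    = refl
    lenR i j (suc l) = cong suc (lenR i (suc j) l)
    nszR : ∀ a j l → a < l → nsz (W.rowsFrom j l) a ≡ W.mult (j + a)
    nszR zero    j (suc l) _       = cong W.mult (sym (+-identityʳ j))
    nszR (suc a) j (suc l) (s≤s p) = trans (nszR a (suc j) l p) (cong W.mult (sym (+-suc j a)))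
    X≡ : Rc.M ≡ W.rowsFrom 1 (suc L)
    X≡ = Rd.rows-word (suc L) 0 (suc L)
    ch : chargeWord w ≡ majA (W.rowsFrom 1 (suc L))
    ch = W.charge-majA (λ i p → lookup-all w (all-w pos) i p , lookup-all w (all-w mx) i p)
      (λ a p → subst₂ _≤_ (sym (multw (suc a))) (sym (multw a)) (dec a p))

  word-matrix : WordMatrix L Q
  word-matrix = record
    { cols   = length w
    ; mat    = Rc.M
    ; w-len  = lenR 0 0 (suc L)
    ; w-rowQ = Rc.rowQ-full mx
    ; w-size = λ a p → trans (cong (λ z → nsz z a) X≡) (trans (nszR a 1 (suc L) (s≤s p)) (multw (suc a)))
    ; w-maj  = trans (cong majA X≡) (trans (sym ch) (cong chargeWord (letters-cells 0 Q))) }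

record Preimage {n} (L : ℕ) (N' : Mat n) (Q : Tab) : Set where
  field
    prei    : Mat n
    pr-len  : length prei ≡ suc L
    pr-N    : stage L prei ≡ N'
    pr-Q    : ∀ j → j ≤ L → rowQ prei L j ≡ nth [] Q j
    pr-size : ∀ a → a ≤ L → nsz prei a ≡ countN (suc a) (concat Q)
    pr-maj  : majA prei ≡ charge Q

rho-surjective : ∀ {n} L (N' : Mat n) (Q : Tab) → HW N' → length N' ≡ suc L → WordMatrix L Q →
  (∀ j → j ≤ L → nsz N' j ≡ length (nth [] Q j)) → Preimage L N' Q
rho-surjective {n} L N' Q h lN W sh = go (transport L N' X h (≤-reflexive lN) (≤-reflexive (w-len W)) szN)
  where
  X = mat W
  szN : sizes N' ≡ sizes (stage L X)
  szN = list-ext 0 _ _ (trans (LP.length-map size N') (trans lN (sym (trans (LP.length-map size (stage L X)) (trans (k-len (stage-keep L) X) (w-len W))))))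
    (λ j p → let lj = s≤s⁻¹ (≤-trans p (≤-reflexive (trans (LP.length-map size N') lN))) in
      trans (sh j lj) (trans (cong length (sym (w-rowQ W j lj))) (r-len (rowOK X L j lj))))
  go : (∃ λ (M : Mat n) → stage L M ≡ N' × Profile L M X) → Preimage L N' Q
  go (M , eM , pf) = record
    { prei    = M
    ; pr-len  = trans (sym (k-len (stage-keep L) M)) (trans (cong length eM) lN)
    ; pr-N    = eM
    ; pr-Q    = λ j p → trans (cong (λ q → nth [] q j) eQ) (w-rowQ W j p)
    ; pr-size = λ a p → trans (sym (content-Qs M L a p)) (trans (cong (λ q → countN (suc a) (concat q)) eQ) (trans (content-Qs X L a p) (w-size W a p)))
    ; pr-maj  = trans (p-majA pf) (w-maj W) }
    where
    eQ : Qs M L ≡ Qs X L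
    eQ = Qs-cong M X L (p-sizes pf)

-- Enumerations

rel-length : ∀ {A B : Set} (R : A → B → Set) → (∀ {x x' y} → R x y → R x' y → x ≡ x') → ∀ (xs : List A) (ys : List B) → Unique xs →
  (∀ {x} → x ∈ xs → ∃ λ y → y ∈ ys × R x y) → length xs ≤ length ys
rel-length R fn []       ys u h = z≤n
rel-length R fn (x ∷ xs) ys (a ∷ u) h with h (here refl)
... | y , y∈ , r with ∈-∃++ y∈
... | as , bs , refl = ≤-trans (s≤s (rel-length R fn xs (as ++ bs) u other)) (≤-reflexive (trans (cong suc (LP.length-++ as)) (trans (sym (+-suc (length as) (length bs))) (sym (LP.length-++ as)))))
  where
  other : ∀ {x'} → x' ∈ xs → ∃ λ y' → y' ∈ as ++ bs × R x' y'
  other x'∈ with h (there x'∈)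
  ... | y' , y'∈ , r' with ∈-++⁻ as y'∈
  ...   | inj₁ p = y' , ∈-++⁺ˡ p , r'
  ...   | inj₂ (there p) = y' , ∈-++⁺ʳ as p , r'
  ...   | inj₂ (here refl) = ⊥-elim (All.lookup a x'∈ (fn r r'))

-- The relation f x = y is used in both directions: injectivity makes it functional from `ys` to
-- `xs`, so both inequalities come from `rel-length`.
bij-length : ∀ {A B : Set} (f : A → B) (xs : List A) (ys : List B) → Unique xs → Unique ys →
  (∀ {x} → x ∈ xs → f x ∈ ys) → (∀ {x x'} → x ∈ xs → x' ∈ xs → f x ≡ f x' → x ≡ x') →
  (∀ {y} → y ∈ ys → ∃ λ x → x ∈ xs × f x ≡ y) → length xs ≡ length ys
bij-length f xs ys ux uy to inj onto = ≤-antisym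
  (rel-length (λ x y → x ∈ xs × f x ≡ y) (λ { (p , e) (p' , e') → inj p p' (trans e (sym e')) }) xs ys ux (λ {x} p → f x , to p , p , refl))
  (rel-length (λ y x → f x ≡ y) (λ e e' → trans (sym e) e') ys xs uy onto)

∈-filterᵇ⁺ : ∀ {A : Set} (p : A → Bool) xs {x} → x ∈ xs → p x ≡ true → x ∈ filterᵇ p xs
∈-filterᵇ⁺ p (y ∷ xs) (here refl) e rewrite e = here refl
∈-filterᵇ⁺ p (y ∷ xs) (there q) e with p y
... | true  = there (∈-filterᵇ⁺ p xs q e)
... | false = ∈-filterᵇ⁺ p xs q e

∈-filterᵇ⁻ : ∀ {A : Set} (p : A → Bool) xs {x} → x ∈ filterᵇ p xs → x ∈ xs × p x ≡ true
∈-filterᵇ⁻ p (y ∷ xs) q with p y in e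
∈-filterᵇ⁻ p (y ∷ xs) (here refl) | true = here refl , e
∈-filterᵇ⁻ p (y ∷ xs) (there q) | true = let (a , b) = ∈-filterᵇ⁻ p xs q in there a , b
... | false = let (a , b) = ∈-filterᵇ⁻ p xs q in there a , b

unique-filterᵇ : ∀ {A : Set} (p : A → Bool) {xs} → Unique xs → Unique (filterᵇ p xs)
unique-filterᵇ p u = UP.filter⁺ _ u

∈-concatMap⁺ : ∀ {A B : Set} (f : A → List B) xs {x y} → x ∈ xs → y ∈ f x → y ∈ concatMap f xs
∈-concatMap⁺ f (x ∷ xs) (here refl) q = ∈-++⁺ˡ q
∈-concatMap⁺ f (x ∷ xs) (there p)   q = ∈-++⁺ʳ (f x) (∈-concatMap⁺ f xs p q)

∈-concatMap⁻ : ∀ {A B : Set} (f : A → List B) xs {y} → y ∈ concatMap f xs → ∃ λ x → x ∈ xs × y ∈ f x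
∈-concatMap⁻ f (x ∷ xs) q with ∈-++⁻ (f x) q
... | inj₁ p = x , here refl , p
... | inj₂ p = let (x' , a , b) = ∈-concatMap⁻ f xs p in x' , there a , b

unique-concatMap : ∀ {A B : Set} (f : A → List B) xs → Unique xs → (∀ x → Unique (f x)) → (∀ {x x' y} → y ∈ f x → y ∈ f x' → x ≡ x') → Unique (concatMap f xs)
unique-concatMap f []       u       v d = []
unique-concatMap f (x ∷ xs) (a ∷ u) v d = UP.++⁺ (v x) (unique-concatMap f xs u v d)
  (λ { (p , q) → let (x' , r , s) = ∈-concatMap⁻ f xs q in All.lookup a r (d p s) })

module Product {A B C : Set} (c : A → B → C) (inj : ∀ {a a' b b'} → c a b ≡ c a' b' → a ≡ a' × b ≡ b') (as : List A) (bs : List B) where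

  prod : List C
  prod = concatMap (λ a → map (c a) bs) as

  ∈-prod⁺ : ∀ {a b} → a ∈ as → b ∈ bs → c a b ∈ prod
  ∈-prod⁺ {a} p q = ∈-concatMap⁺ _ as p (∈-map⁺ (c a) q)

  ∈-prod⁻ : ∀ {x} → x ∈ prod → ∃ λ a → ∃ λ b → a ∈ as × b ∈ bs × x ≡ c a b
  ∈-prod⁻ p with ∈-concatMap⁻ (λ a → map (c a) bs) as p
  ... | a , a∈ , q with ∈-map⁻ (c a) q
  ... | b , b∈ , e = a , b , a∈ , b∈ , e

  unique-prod : Unique as → Unique bs → Unique prod
  unique-prod u v = unique-concatMap _ as u (λ a → UP.map⁺ (λ e → proj₂ (inj e)) v) d
    where
    d : ∀ {a a' y} → y ∈ map (c a) bs → y ∈ map (c a') bs → a ≡ a'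
    d {a} {a'} p q with ∈-map⁻ (c a) p | ∈-map⁻ (c a') q
    ... | _ , _ , refl | _ , _ , e = proj₁ (inj e)

∷-inj : ∀ {A : Set} {x y : A} {xs ys : List A} → x ∷ xs ≡ y ∷ ys → x ≡ y × xs ≡ ys
∷-inj refl = refl , refl

∷-inj′ : ∀ {A : Set} {x y : A} {xs ys : List A} → x ∷ xs ≡ y ∷ ys → xs ≡ ys × x ≡ y
∷-inj′ refl = refl , refl

∈-subsets⁺ : ∀ {n} (r : Vec Bool n) → toList r ∈ subsets n (size r)
∈-subsets⁺ [] = here refl
∈-subsets⁺ {suc n} (true ∷ r) = ∈-++⁺ˡ (∈-map⁺ (true ∷_) (∈-subsets⁺ r))
∈-subsets⁺ {suc n} (false ∷ r) with size r | ∈-subsets⁺ r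
... | zero  | p = ∈-map⁺ (false ∷_) p
... | suc k | p = ∈-++⁺ʳ (map (true ∷_) (subsets n k)) (∈-map⁺ (false ∷_) p)

∈-subsets⁻ : ∀ n k {l} → l ∈ subsets n k → ∃ λ (r : Vec Bool n) → l ≡ toList r × size r ≡ k
∈-subsets⁻ zero zero (here refl) = [] , refl , refl
∈-subsets⁻ (suc n) zero p with ∈-map⁻ (false ∷_) p
... | l , q , refl with ∈-subsets⁻ n zero q
... | r , refl , e = false ∷ r , refl , e
∈-subsets⁻ (suc n) (suc k) p with ∈-++⁻ (map (true ∷_) (subsets n k)) p
... | inj₁ q with ∈-map⁻ (true ∷_) q
...   | l , q' , refl with ∈-subsets⁻ n k q'
...     | r , refl , e = true ∷ r , refl , cong suc e
∈-subsets⁻ (suc n) (suc k) p | inj₂ q with ∈-map⁻ (false ∷_) q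
...   | l , q' , refl with ∈-subsets⁻ n (suc k) q'
...     | r , refl , e = false ∷ r , refl , e

unique-subsets : ∀ n k → Unique (subsets n k)
unique-subsets zero zero = [] ∷ []
unique-subsets zero (suc k) = []
unique-subsets (suc n) zero = UP.map⁺ ∷-injectiveʳ (unique-subsets n zero)
unique-subsets (suc n) (suc k) = UP.++⁺ (UP.map⁺ ∷-injectiveʳ (unique-subsets n k)) (UP.map⁺ ∷-injectiveʳ (unique-subsets n (suc k))) d
  where
  d : ∀ {l} → l ∈ map (true ∷_) (subsets n k) × l ∈ map (false ∷_) (subsets n (suc k)) → ⊥
  d (p , q) with ∈-map⁻ (true ∷_) p | ∈-map⁻ (false ∷_) q
  ... | _ , _ , refl | _ , _ , ()

∈-rows⁺ : ∀ {n} (M : Mat n) → lists M ∈ rowsOfSizes n (sizes M)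
∈-rows⁺ [] = here refl
∈-rows⁺ {n} (r ∷ M) = Product.∈-prod⁺ _∷_ ∷-inj (subsets n (size r)) (rowsOfSizes n (sizes M)) (∈-subsets⁺ r) (∈-rows⁺ M)

∈-rows⁻ : ∀ n cs {M} → M ∈ rowsOfSizes n cs → ∃ λ (X : Mat n) → M ≡ lists X × sizes X ≡ cs
∈-rows⁻ n [] (here refl) = [] , refl , refl
∈-rows⁻ n (c ∷ cs) p with Product.∈-prod⁻ _∷_ ∷-inj (subsets n c) (rowsOfSizes n cs) p
... | l , M , a , b , refl with ∈-subsets⁻ n c a | ∈-rows⁻ n cs b
... | r , refl , e | X , refl , e' = r ∷ X , refl , cong₂ _∷_ e e'

unique-rows : ∀ n cs → Unique (rowsOfSizes n cs)
unique-rows n [] = [] ∷ []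
unique-rows n (c ∷ cs) = Product.unique-prod _∷_ ∷-inj (subsets n c) (rowsOfSizes n cs) (unique-subsets n c) (unique-rows n cs)

toList-inj : ∀ {n} (r s : Vec Bool n) → toList r ≡ toList s → r ≡ s
toList-inj []      []      _ = refl
toList-inj (a ∷ r) (b ∷ s) e = cong₂ _∷_ (∷-injectiveˡ e) (toList-inj r s (∷-injectiveʳ e))

lists-inj : ∀ {n} (M M' : Mat n) → lists M ≡ lists M' → M ≡ M'
lists-inj []      []        _ = refl
lists-inj (r ∷ M) (r' ∷ M') e = cong₂ _∷_ (toList-inj r r' (∷-injectiveˡ e)) (lists-inj M M' (∷-injectiveʳ e))
lists-inj []      (_ ∷ _)   ()
lists-inj (_ ∷ _) []        ()

∈-vecs⁺ : ∀ m β → All (_≤ m) β → β ∈ vecsUpTo (length β) m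
∈-vecs⁺ m []      []       = here refl
∈-vecs⁺ m (x ∷ β) (p ∷ ps) = Product.∈-prod⁺ (λ v x → x ∷ v) ∷-inj′ (vecsUpTo (length β) m) (upTo (suc m)) (∈-vecs⁺ m β ps) (∈-upTo⁺ (s≤s p))

∈-vecs⁻ : ∀ n m {β} → β ∈ vecsUpTo n m → length β ≡ n × All (_≤ m) β
∈-vecs⁻ zero m (here refl) = refl , []
∈-vecs⁻ (suc n) m p with Product.∈-prod⁻ (λ v x → x ∷ v) ∷-inj′ (vecsUpTo n m) (upTo (suc m)) p
... | v , x , a , b , refl = let (e , q) = ∈-vecs⁻ n m a in cong suc e , s≤s⁻¹ (∈-upTo⁻ b) ∷ q

unique-upTo : ∀ k → Unique (upTo k)
unique-upTo k = UP.upTo⁺ k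

unique-vecs : ∀ n m → Unique (vecsUpTo n m)
unique-vecs zero m = [] ∷ []
unique-vecs (suc n) m = Product.unique-prod (λ v x → x ∷ v) ∷-inj′ (vecsUpTo n m) (upTo (suc m)) (unique-vecs n m) (unique-upTo (suc m))

∈-oneTo⁺ : ∀ {a k} → 1 ≤ a → a ≤ k → a ∈ oneTo k
∈-oneTo⁺ {suc a} p q = ∈-map⁺ suc (∈-upTo⁺ q)

∈-oneTo⁻ : ∀ {a k} → a ∈ oneTo k → 1 ≤ a × a ≤ k
∈-oneTo⁻ {k = k} p with ∈-map⁻ suc p
... | x , q , refl = s≤s z≤n , ∈-upTo⁻ q

∈-seqs⁺ : ∀ k s → All (1 ≤_) s → All (_≤ k) s → s ∈ seqs (length s) k
∈-seqs⁺ k []      []       []       = here refl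
∈-seqs⁺ k (x ∷ s) (p ∷ ps) (q ∷ qs) = Product.∈-prod⁺ (λ v x → x ∷ v) ∷-inj′ (seqs (length s) k) (oneTo k) (∈-seqs⁺ k s ps qs) (∈-oneTo⁺ p q)

∈-seqs⁻ : ∀ m k {s} → s ∈ seqs m k → length s ≡ m × All (1 ≤_) s × All (_≤ k) s
∈-seqs⁻ zero k (here refl) = refl , [] , []
∈-seqs⁻ (suc m) k p with Product.∈-prod⁻ (λ v x → x ∷ v) ∷-inj′ (seqs m k) (oneTo k) p
... | v , x , a , b , refl = let (e , q , r) = ∈-seqs⁻ m k a ; (y , z) = ∈-oneTo⁻ b in cong suc e , y ∷ q , z ∷ r

unique-seqs : ∀ m k → Unique (seqs m k)
unique-seqs zero k = [] ∷ []
unique-seqs (suc m) k = Product.unique-prod (λ v x → x ∷ v) ∷-inj′ (seqs m k) (oneTo k) (unique-seqs m k) (UP.map⁺ suc-injective (unique-upTo k))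

∈-fillings⁺ : ∀ k (Q : Tab) → All (All (1 ≤_)) Q → All (All (_≤ k)) Q → Q ∈ fillings (map length Q) k
∈-fillings⁺ k []      []       []       = here refl
∈-fillings⁺ k (q ∷ Q) (p ∷ ps) (r ∷ rs) = Product.∈-prod⁺ _∷_ ∷-inj (seqs (length q) k) (fillings (map length Q) k) (∈-seqs⁺ k q p r) (∈-fillings⁺ k Q ps rs)

∈-fillings⁻ : ∀ μ k {Q} → Q ∈ fillings μ k → map length Q ≡ μ × All (All (1 ≤_)) Q × All (All (_≤ k)) Q
∈-fillings⁻ [] k (here refl) = refl , [] , []
∈-fillings⁻ (m ∷ μ) k p with Product.∈-prod⁻ _∷_ ∷-inj (seqs m k) (fillings μ k) p
... | q , Q , a , b , refl = let (e , x , y) = ∈-seqs⁻ m k a ; (e' , xs , ys) = ∈-fillings⁻ μ k b in cong₂ _∷_ e e' , x ∷ xs , y ∷ ys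

unique-fillings : ∀ μ k → Unique (fillings μ k)
unique-fillings [] k = [] ∷ []
unique-fillings (m ∷ μ) k = Product.unique-prod _∷_ ∷-inj (seqs m k) (fillings μ k) (unique-seqs m k) (unique-fillings μ k)

all-true : ∀ {A : Set} (p : A → Bool) xs → (∀ {x} → x ∈ xs → p x ≡ true) → all p xs ≡ true
all-true p []       h = refl
all-true p (x ∷ xs) h = cong₂ _∧_ (h (here refl)) (all-true p xs (λ q → h (there q)))

all-true⁻ : ∀ {A : Set} (p : A → Bool) xs → all p xs ≡ true → ∀ {x} → x ∈ xs → p x ≡ true
all-true⁻ p (x ∷ xs) e q with ∧-elim (p x) (all p xs) e
all-true⁻ p (x ∷ xs) e (here refl) | a , b = a
all-true⁻ p (x ∷ xs) e (there q)   | a , b = all-true⁻ p xs b q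

record SSYT (μ ν : List ℕ) (Q : Tab) : Set where
  field
    shape : map length Q ≡ μ
    pos   : All (All (1 ≤_)) Q
    bound : All (All (_≤ length ν)) Q
    inc   : all weaklyInc Q ≡ true
    str   : colsStrict Q ≡ true
    cont  : hasContent ν Q ≡ true
open SSYT

∈-ssyt⁺ : ∀ {μ ν Q} → SSYT μ ν Q → Q ∈ ssyt μ ν
∈-ssyt⁺ {μ} {ν} {Q} s = ∈-filterᵇ⁺ _ (fillings μ (length ν)) (subst (λ z → Q ∈ fillings z (length ν)) (shape s) (∈-fillings⁺ (length ν) Q (pos s) (bound s)))
  (cong₂ _∧_ (inc s) (cong₂ _∧_ (str s) (cont s)))

∈-ssyt⁻ : ∀ {μ ν Q} → Q ∈ ssyt μ ν → SSYT μ ν Q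
∈-ssyt⁻ {μ} {ν} {Q} p with ∈-filterᵇ⁻ _ (fillings μ (length ν)) p
... | q , e with ∈-fillings⁻ μ (length ν) q | ∧-elim (all weaklyInc Q) _ e
... | a , b , c | x , y with ∧-elim (colsStrict Q) _ y
... | z , w = record { shape = a ; pos = b ; bound = c ; inc = x ; str = z ; cont = w }

unique-ssyt : ∀ μ ν → Unique (ssyt μ ν)
unique-ssyt μ ν = unique-filterᵇ _ (unique-fillings μ (length ν))

eqList-sound : ∀ {A : Set} (eq : A → A → Bool) → (∀ x y → eq x y ≡ true → x ≡ y) → ∀ xs ys → eqList eq xs ys ≡ true → xs ≡ ys
eqList-sound eq h []       []       e = refl
eqList-sound eq h (x ∷ xs) (y ∷ ys) e with ∧-elim (eq x y) _ e
... | a , b = cong₂ _∷_ (h x y a) (eqList-sound eq h xs ys b)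

eqList-refl : ∀ {A : Set} (eq : A → A → Bool) → (∀ x → eq x x ≡ true) → ∀ xs → eqList eq xs xs ≡ true
eqList-refl eq h []       = refl
eqList-refl eq h (x ∷ xs) = cong₂ _∧_ (h x) (eqList-refl eq h xs)

eqℕs-sound : ∀ xs ys → eqℕs xs ys ≡ true → xs ≡ ys
eqℕs-sound = eqList-sound _≡ᵇ_ eqT⁻

eqℕs-refl : ∀ xs → eqℕs xs xs ≡ true
eqℕs-refl = eqList-refl _≡ᵇ_ (λ x → eqT {x} refl)

eqMLQ-sound : ∀ xs ys → eqMLQ xs ys ≡ true → xs ≡ ys
eqMLQ-sound = eqList-sound _ (eqList-sound eqBool l)
  where
  l : ∀ x y → eqBool x y ≡ true → x ≡ y
  l true  true  _ = refl
  l false false _ = refl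

eqMLQ-refl : ∀ xs → eqMLQ xs xs ≡ true
eqMLQ-refl = eqList-refl _ (eqList-refl eqBool l)
  where
  l : ∀ x → eqBool x x ≡ true
  l true  = refl
  l false = refl

dropNil : Tab → Tab
dropNil []            = []
dropNil ([] ∷ R)      = dropNil R
dropNil ((x ∷ q) ∷ R) = (x ∷ q) ∷ R

-- `dropE` is local to `trimT`. Evaluating `trimT` at `reverse R` exposes the list `R` that it
-- receives, and `dropNil` repeats its clauses.
trim-rev : ∀ R → trimT (reverse R) ≡ reverse (dropNil R)
trim-rev R with reverse (reverse R) | LP.reverse-involutive R
trim-rev []            | _ | refl = refl
trim-rev ((x ∷ q) ∷ R) | _ | refl = refl
trim-rev ([] ∷ R)      | _ | refl with reverse (reverse R) | LP.reverse-involutive R | trim-rev R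
... | _ | refl | ih = ih

consT : List ℕ → Tab → Tab
consT []      []      = []
consT (x ∷ q) []      = (x ∷ q) ∷ []
consT q       (r ∷ R) = q ∷ r ∷ R

trimF : Tab → Tab
trimF []      = []
trimF (q ∷ Q) = consT q (trimF Q)

trimT≡trimF : ∀ Q → trimT Q ≡ trimF Q
trimT≡trimF Q = trans (trans (cong trimT (sym (LP.reverse-involutive Q))) (trim-rev (reverse Q))) (go Q)
  where
  snoc : Tab → List ℕ → Tab
  snoc []      []      = []
  snoc []      (x ∷ q) = (x ∷ q) ∷ []
  snoc (r ∷ R) q       = (r ∷ R) ++ q ∷ []
  drop-snoc : ∀ R q → dropNil (R ++ q ∷ []) ≡ snoc (dropNil R) q
  drop-snoc []            []      = refl
  drop-snoc []            (x ∷ q) = refl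
  drop-snoc ([] ∷ R)      q       = drop-snoc R q
  drop-snoc ((x ∷ r) ∷ R) q       = refl
  rev-snoc : ∀ R q → reverse (snoc R q) ≡ consT q (reverse R)
  rev-snoc []      []      = refl
  rev-snoc []      (x ∷ q) = refl
  rev-snoc (r ∷ R) q with reverse (r ∷ R) in e
  ... | []     = ⊥-elim (bad (trans (sym (LP.length-reverse (r ∷ R))) (cong length e)))
    where bad : ∀ {k} → suc k ≡ 0 → ⊥
          bad ()
  ... | y ∷ ys = trans (LP.reverse-++ (r ∷ R) (q ∷ [])) (trans (cong (q ∷_) e) (c q))
    where
    c : ∀ q → q ∷ y ∷ ys ≡ consT q (y ∷ ys)
    c []      = refl
    c (_ ∷ _) = refl
  go : ∀ Q → reverse (dropNil (reverse Q)) ≡ trimF Q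
  go []      = refl
  go (q ∷ Q) = trans (cong (λ z → reverse (dropNil z)) (LP.unfold-reverse q Q)) (trans (cong reverse (drop-snoc (reverse Q) q)) (trans (rev-snoc (dropNil (reverse Q)) q) (cong (consT q) (go Q))))

nth-consT : ∀ q R j → nth [] (consT q R) j ≡ nth [] (q ∷ R) j
nth-consT []      []      zero    = refl
nth-consT []      []      (suc j) = refl
nth-consT (x ∷ q) []      j       = refl
nth-consT []      (r ∷ R) j       = refl
nth-consT (x ∷ q) (r ∷ R) j       = refl

nth-trimF : ∀ Q j → nth [] (trimF Q) j ≡ nth [] Q j
nth-trimF []      j       = refl
nth-trimF (q ∷ Q) zero    = nth-consT q (trimF Q) 0
nth-trimF (q ∷ Q) (suc j) = trans (nth-consT q (trimF Q) (suc j)) (nth-trimF Q j)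

trimF-ext : ∀ A B → (∀ j → nth [] A j ≡ nth [] B j) → trimF A ≡ trimF B
trimF-ext []      []      h = refl
trimF-ext []      (b ∷ B) h = trans (trimF-ext [] B (λ j → h (suc j))) (trans (sym (c (trimF B) (sym (trimF-ext [] B (λ j → h (suc j)))))) (cong (λ z → consT z (trimF B)) (h 0)))
  where
  c : ∀ T → T ≡ [] → consT [] T ≡ T
  c .[] refl = refl
trimF-ext (a ∷ A) []      h = trans (trans (cong (λ z → consT z (trimF A)) (h 0)) (c (trimF A) (trimF-ext A [] (λ j → h (suc j))))) (trimF-ext A [] (λ j → h (suc j)))
  where
  c : ∀ T → T ≡ [] → consT [] T ≡ T
  c .[] refl = refl
trimF-ext (a ∷ A) (b ∷ B) h = cong₂ consT (h 0) (trimF-ext A B (λ j → h (suc j)))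

eqTab-sound : ∀ A B → eqTab A B ≡ true → ∀ j → nth [] A j ≡ nth [] B j
eqTab-sound A B e j = trans (sym (nth-trimF A j)) (trans (cong (λ z → nth [] z j)
  (trans (sym (trimT≡trimF A)) (trans (eqList-sound eqℕs eqℕs-sound (trimT A) (trimT B) e) (trimT≡trimF B)))) (nth-trimF B j))

eqTab-complete : ∀ A B → (∀ j → nth [] A j ≡ nth [] B j) → eqTab A B ≡ true
eqTab-complete A B h = trans (cong (λ z → eqList eqℕs (trimT A) z) (trans (trimT≡trimF B) (trans (sym (trimF-ext A B h)) (sym (trimT≡trimF A))))) (eqList-refl eqℕs eqℕs-refl (trimT A))

hits : ℕ → List ℕ → List ℕ → Tab → MLQ → Bool
hits n λp β Q M = eqMLQ (proj₁ (rho n M)) (mkM (maxL λp) β) ∧ eqTab (proj₂ (rho n M)) Q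

-- The search inside rhoInv is a local function; the first clause below lets unification supply its name
-- in the type of search.
mutual
  rhoInv-first : ∀ n λp β Q M₀ post pre → mlqs n λp ≡ pre ++ M₀ ∷ post → All (λ M → hits n λp β Q M ≡ false) pre → hits n λp β Q M₀ ≡ true → rhoInv n λp β Q ≡ just M₀
  rhoInv-first n λp β Q M₀ post pre e a c rewrite e = search n λp β Q M₀ post pre a c

  search : ∀ n λp β Q M₀ post pre → All (λ M → hits n λp β Q M ≡ false) pre → hits n λp β Q M₀ ≡ true → _≡_ {A = Maybe MLQ} _ (just M₀)
  search n λp β Q M₀ post [] a c rewrite c = refl
  search n λp β Q M₀ post (M ∷ pre) (p ∷ a) c rewrite p = search n λp β Q M₀ post pre a c

rhoInv-unique : ∀ n λp β Q M₀ → M₀ ∈ mlqs n λp → hits n λp β Q M₀ ≡ true → (∀ {M} → M ∈ mlqs n λp → hits n λp β Q M ≡ true → M ≡ M₀) → rhoInv n λp β Q ≡ just M₀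
rhoInv-unique n λp β Q M₀ m h un with ∈-∃++ m
... | pre , post , e = rhoInv-first n λp β Q M₀ post pre e (All.tabulate misses) h
  where
  uq : Unique (pre ++ M₀ ∷ post)
  uq = subst Unique e (unique-rows n (conj λp))
  disj : ∀ (pre : List MLQ) → Unique (pre ++ M₀ ∷ post) → ∀ {M} → M ∈ pre → M ≢ M₀
  disj (x ∷ pre) (a ∷ u) (here refl) refl = All.lookup a (∈-++⁺ʳ pre (here refl)) refl
  disj (x ∷ pre) (a ∷ u) (there q) = disj pre u q
  misses : ∀ {M} → M ∈ pre → hits n λp β Q M ≡ false
  misses {M} q with hits n λp β Q M in e'
  ... | false = refl
  ... | true  = ⊥-elim (disj pre uq q (un (subst (M ∈_) (sym e) (∈-++⁺ˡ q)) e'))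

open FM

-- Sorting and conjugation

cn : List ℕ → ℕ → ℕ
cn β i = count (λ a → suc i ≤ᵇ a) β

count-∷ : ∀ {A : Set} (p : A → Bool) x xs → count p (x ∷ xs) ≡ tw (p x) + count p xs
count-∷ p x xs with p x
... | true  = refl
... | false = refl

count-insert : ∀ (p : ℕ → Bool) x xs → count p (insertDesc x xs) ≡ tw (p x) + count p xs
count-insert p x [] = count-∷ p x []
count-insert p x (y ∷ ys) with y <ᵇ x
... | true  = count-∷ p x (y ∷ ys)
... | false = trans (count-∷ p y (insertDesc x ys)) (trans (cong (tw (p y) +_) (count-insert p x ys))
  (trans (sym (+-assoc (tw (p y)) (tw (p x)) _)) (trans (cong (_+ count p ys) (+-comm (tw (p y)) (tw (p x)))) (trans (+-assoc (tw (p x)) (tw (p y)) _) (cong (tw (p x) +_) (sym (count-∷ p y ys)))))))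

count-sortC : ∀ (p : ℕ → Bool) → p 0 ≡ false → ∀ β → count p (sortC β) ≡ count p β
count-sortC p e [] = refl
count-sortC p e (zero ∷ β) rewrite e = count-sortC p e β
count-sortC p e (suc x ∷ β) = trans (count-insert p (suc x) (sortC β)) (trans (cong (tw (p (suc x)) +_) (count-sortC p e β)) (sym (count-∷ p (suc x) β)))

maxL-insert : ∀ x xs → maxL (insertDesc x xs) ≡ x ⊔ maxL xs
maxL-insert x [] = refl
maxL-insert x (y ∷ ys) with y <ᵇ x
... | true  = refl
... | false = trans (cong (y ⊔_) (maxL-insert x ys)) (trans (sym (⊔-assoc y x (maxL ys))) (trans (cong (_⊔ maxL ys) (⊔-comm y x)) (⊔-assoc x y (maxL ys))))

maxL-sortC : ∀ β → maxL (sortC β) ≡ maxL β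
maxL-sortC [] = refl
maxL-sortC (zero ∷ β) = maxL-sortC β
maxL-sortC (suc x ∷ β) = trans (maxL-insert (suc x) (sortC β)) (cong (suc x ⊔_) (maxL-sortC β))

conj-sortC : ∀ β → conj (sortC β) ≡ map (cn β) (upTo (maxL β))
conj-sortC β = trans (cong (λ k → map (λ r → count (λ a → r ≤ᵇ a) (sortC β)) (oneTo k)) (maxL-sortC β))
  (trans (sym (LP.map-∘ (upTo (maxL β)))) (LP.map-cong (λ i → count-sortC (λ a → suc i ≤ᵇ a) refl β) (upTo (maxL β))))

length-conj : ∀ β → length (conj (sortC β)) ≡ maxL β
length-conj β = trans (cong length (conj-sortC β)) (length-map-upTo (cn β) (maxL β))

maxL-≤ : ∀ β → All (_≤ maxL β) β
maxL-≤ []      = []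
maxL-≤ (x ∷ β) = m≤m⊔n x (maxL β) ∷ All.map (λ p → ≤-trans p (m≤n⊔m x (maxL β))) (maxL-≤ β)

maxL-least : ∀ m β → All (_≤ m) β → maxL β ≤ m
maxL-least m []      []       = z≤n
maxL-least m (x ∷ β) (p ∷ ps) = ⊔-lub p (maxL-least m β ps)

cn-zero : ∀ β i → All (_≤ i) β → cn β i ≡ 0
cn-zero []      i []       = refl
cn-zero (x ∷ β) i (p ∷ ps) rewrite leF {suc i} {x} (s≤s p) = cn-zero β i ps

cn-beyond : ∀ β i → maxL β ≤ i → cn β i ≡ 0
cn-beyond β i p = cn-zero β i (All.map (λ q → ≤-trans q p) (maxL-≤ β))

cn-decr : ∀ β i → cn β (suc i) ≤ cn β i
cn-decr []      i = z≤n
cn-decr (x ∷ β) i with suc (suc i) ≤? x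
... | yes p rewrite leT p | leT {suc i} {x} (<⇒≤ p) = s≤s (cn-decr β i)
... | no np rewrite leF {suc (suc i)} {x} (≰⇒> np) with suc i ≤ᵇ x
...   | true  = m≤n⇒m≤1+n (cn-decr β i)
...   | false = cn-decr β i

nth-default : ∀ {A : Set} (d : A) xs j → length xs ≤ j → nth d xs j ≡ d
nth-default d []       j       _       = refl
nth-default d (x ∷ xs) (suc j) (s≤s p) = nth-default d xs j p

nth-conj : ∀ β i → nth 0 (conj (sortC β)) i ≡ cn β i
nth-conj β i with i <? maxL β
... | yes p = trans (cong (λ l → nth 0 l i) (conj-sortC β)) (nth-map-upTo 0 (cn β) (λ k → k) (maxL β) i p)
... | no np = trans (nth-default 0 (conj (sortC β)) i (≤-trans (≤-reflexive (length-conj β)) (≮⇒≥ np))) (sym (cn-beyond β i (≮⇒≥ np)))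

nth-map : ∀ {A B : Set} (f : A → B) (d : A) (d' : B) → f d ≡ d' → ∀ xs j → nth d' (map f xs) j ≡ f (nth d xs j)
nth-map f d d' e []       j       = sym e
nth-map f d d' e (x ∷ xs) zero    = refl
nth-map f d d' e (x ∷ xs) (suc j) = nth-map f d d' e xs j

-- The matrices M_β and nonwrapping matrices of given type

bits : ℕ → (β : List ℕ) → Vec Bool (length β)
bits k []      = []
bits k (x ∷ β) = (k ≤ᵇ x) ∷ bits k β

at-bits : ∀ k β i → i < length β → at i (bits k β) ≡ (k ≤ᵇ nth 0 β i)
at-bits k (x ∷ β) zero    _       = refl
at-bits k (x ∷ β) (suc i) (s≤s p) = at-bits k β i p

gek-bits : ∀ k β → gek (length β) k β ≡ bits k β
gek-bits k β = ext _ _ (λ i p → trans (at-gek (length β) k β i p) (sym (at-bits k β i p)))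

size-gek : ∀ n k β → length β ≡ n → size (gek n k β) ≡ count (λ a → k ≤ᵇ a) β
size-gek .(length β) k β refl = trans (cong size (gek-bits k β)) (l β)
  where
  l : ∀ β → size (bits k β) ≡ count (λ a → k ≤ᵇ a) β
  l [] = refl
  l (x ∷ β) with k ≤ᵇ x
  ... | true  = cong suc (l β)
  ... | false = l β

toList-gek : ∀ n k β → length β ≡ n → toList (gek n k β) ≡ map (λ b → k ≤ᵇ b) β
toList-gek .(length β) k β refl = trans (cong toList (gek-bits k β)) (l β)
  where
  l : ∀ β → toList (bits k β) ≡ map (λ b → k ≤ᵇ b) β
  l []      = refl
  l (x ∷ β) = cong ((k ≤ᵇ x) ∷_) (l β)

gek-ext : ∀ n s t → length s ≡ n → length t ≡ n → (∀ k → gek n (suc k) s ≡ gek n (suc k) t) → s ≡ t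
gek-ext n s t es et h = list-ext 0 s t (trans es (sym et)) (λ i p → eq i (≤-trans p (≤-reflexive es)))
  where
  le : ∀ s t i → (∀ k → gek n (suc k) s ≡ gek n (suc k) t) → i < n → nth 0 s i ≤ nth 0 t i
  le s t i h p with nth 0 s i in e
  ... | zero  = z≤n
  ... | suc k = leT⁻ (trans (sym (at-gek n (suc k) t i p)) (trans (cong (at i) (sym (h k))) (trans (at-gek n (suc k) s i p) (leT (≤-reflexive (sym e))))))
  eq : ∀ i → i < n → nth 0 s i ≡ nth 0 t i
  eq i p = ≤-antisym (le s t i h p) (le t s i (λ k → sym (h k)) p)

gek-sub : ∀ n k β → Sub (gek n (suc k) β) (gek n k β)
gek-sub n k β = at-sub _ _ go
  where
  go : ∀ i → at i (gek n (suc k) β) ≡ true → at i (gek n k β) ≡ true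
  go i e with i <? n
  ... | yes p = trans (at-gek n k β i p) (leT (<⇒≤ (leT⁻ {suc k} {nth 0 β i} (trans (sym (at-gek n (suc k) β i p)) e))))
  ... | no np with trans (sym e) (at-big i (gek n (suc k) β) (≮⇒≥ np))
  ...   | ()

gek-big : ∀ n k β → All (_≤ k) β → gek n (suc k) β ≡ empty n
gek-big n k β a = ext _ _ (λ i p → trans (at-gek n (suc k) β i p) (trans (leF (s≤s (l β a i))) (sym (at-empty {n} i))))
  where
  l : ∀ β → All (_≤ k) β → ∀ i → nth 0 β i ≤ k
  l []      []       i       = z≤n
  l (x ∷ β) (p ∷ ps) zero    = p
  l (x ∷ β) (p ∷ ps) (suc i) = l β ps i

keyFrom : ∀ n → List ℕ → ℕ → ℕ → Mat n
keyFrom n β r zero    = []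
keyFrom n β r (suc k) = gek n r β ∷ keyFrom n β (suc r) k

length-key : ∀ n β r k → length (keyFrom n β r k) ≡ k
length-key n β r zero    = refl
length-key n β r (suc k) = cong suc (length-key n β (suc r) k)

hw-key : ∀ n β r k → HW (keyFrom n β r k)
hw-key n β r zero          = tt
hw-key n β r (suc zero)    = tt
hw-key n β r (suc (suc k)) = sub-dom _ _ (gek-sub n r β) , hw-key n β (suc r) (suc k)

lists-key : ∀ n β r k (f : ℕ → ℕ) → length β ≡ n → (∀ i → f i ≡ r + i) → lists (keyFrom n β r k) ≡ map (λ r → map (λ b → r ≤ᵇ b) β) (applyUpTo f k)
lists-key n β r zero    f e h = refl
lists-key n β r (suc k) f e h = cong₂ _∷_ (trans (toList-gek n r β e) (cong (λ z → map (λ b → z ≤ᵇ b) β) (sym (trans (h 0) (+-identityʳ r)))))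
  (lists-key n β (suc r) k (λ i → f (suc i)) e (λ i → trans (h (suc i)) (+-suc r i)))

lists-mkM : ∀ n β K → length β ≡ n → lists (keyFrom n β 1 K) ≡ mkM K β
lists-mkM n β K e = trans (lists-key n β 1 K suc e (λ _ → refl)) (cong (map (λ r → map (λ b → r ≤ᵇ b) β)) (sym (LP.map-applyUpTo (λ k → k) suc K)))

dep-sub : ∀ {n} (b s : Vec Bool n) → Sub s b → dep 0 b s ≡ s
dep-sub []          []          _       = refl
dep-sub (true ∷ b)  (true ∷ s)  (_ , q) = cong (true ∷_) (dep-sub b s q)
dep-sub (true ∷ b)  (false ∷ s) (_ , q) = cong (false ∷_) (dep-sub b s q)
dep-sub (false ∷ b) (false ∷ s) (_ , q) = cong (false ∷_) (dep-sub b s q)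
dep-sub (false ∷ b) (true ∷ s)  (() , _)

Sset-key : ∀ n β r k i → i < k → Sset i (keyFrom n β r k) ≡ gek n (r + i) β
Sset-key n β r (suc k) zero    _       = cong (λ z → gek n z β) (sym (+-identityʳ r))
Sset-key n β r (suc k) (suc i) (s≤s p) rewrite Sset-key n β (suc r) k i p = trans (cong (λ u → dep u (gek n r β) S) (wraps-dom _ S (sub-dom S _ sb)))
  (trans (dep-sub _ S sb) (cong (λ z → gek n z β) (sym (+-suc r i))))
  where
  S = gek n (suc r + i) β
  sub≤ : ∀ i → Sub (gek n (r + i) β) (gek n r β)
  sub≤ zero    = subst (λ z → Sub (gek n z β) (gek n r β)) (sym (+-identityʳ r)) (sub-refl _)
  sub≤ (suc i) = subst (λ z → Sub (gek n z β) (gek n r β)) (sym (+-suc r i)) (sub-trans _ _ _ (gek-sub n (r + i) β) (sub≤ i))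
  sb : Sub S (gek n r β)
  sb = subst (λ z → Sub (gek n z β) (gek n r β)) (+-suc r i) (sub≤ (suc i))

Sset-mk : ∀ n β K → All (_≤ K) β → ∀ i → Sset i (keyFrom n β 1 K) ≡ gek n (suc i) β
Sset-mk n β K a i with i <? K
... | yes p = Sset-key n β 1 K i p
... | no np = trans (Sset-small i (keyFrom n β 1 K) (≤-trans (≤-reflexive (length-key n β 1 K)) (≮⇒≥ np))) (sym (gek-big n i β (All.map (λ q → ≤-trans q (≮⇒≥ np)) a)))

-- Empty rows on top. ρ keeps the number of rows, the largest part of λ, while an MLQ of shape μ has
-- only as many rows as the largest part of μ; the difference is made up of such rows.
top : ∀ n → ℕ → Mat n
top n m = replicate m (empty n)

Sset-top : ∀ {n} k (A : Mat n) m → Sset k (A ++ top n m) ≡ Sset k A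
Sset-top {n} k [] m = z k m
  where
  z : ∀ k m → Sset k (top n m) ≡ empty n
  z k       zero    = refl
  z zero    (suc m) = refl
  z (suc k) (suc m) rewrite z k m = trans (cong (λ u → dep u (empty n) (empty n)) (wraps-empty (empty n))) (dep-empty (empty n))
Sset-top zero    (b ∷ A) m = refl
Sset-top (suc k) (b ∷ A) m rewrite Sset-top k A m = refl

hw-top : ∀ {n} (A : Mat n) m → HW A → HW (A ++ top n m)
hw-top [] zero h = tt
hw-top [] (suc zero) h = tt
hw-top {n} [] (suc (suc m)) h = sub-dom (empty n) (empty n) (sub-refl _) , hw-top [] (suc m) tt
hw-top (b ∷ []) zero h = tt
hw-top {n} (b ∷ []) (suc m) h = sub-dom (empty n) b (sub-empty b) , hw-top [] (suc m) tt
hw-top (b ∷ s ∷ A) m (d , h) = d , hw-top (s ∷ A) m h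

wt-top : ∀ {n} (A : Mat n) m → wt (A ++ top n m) ≡ wt A
wt-top {n} [] zero = refl
wt-top {n} [] (suc m) = trans (cong (Vec.zipWith _+_ (toN (empty n))) (wt-top [] m)) (toN-empty n)
wt-top (r ∷ A) m = cong (Vec.zipWith _+_ (toN r)) (wt-top A m)

size-0 : ∀ {n} (r : Vec Bool n) → size r ≡ 0 → r ≡ empty n
size-0 []          e = refl
size-0 (false ∷ r) e = cong (false ∷_) (size-0 r e)

take-top : ∀ {n} ℓ (A : Mat n) → (∀ j → ℓ ≤ j → nsz A j ≡ 0) → A ≡ take ℓ A ++ top n (length A ∸ ℓ)
take-top zero    []      h = refl
take-top (suc ℓ) []      h = refl
take-top zero    (r ∷ A) h = cong₂ _∷_ (size-0 r (h 0 z≤n)) (take-top 0 A (λ j _ → h (suc j) z≤n))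
take-top (suc ℓ) (r ∷ A) h = cong (r ∷_) (take-top ℓ A (λ j p → h (suc j) (s≤s p)))

hw-take : ∀ {n} ℓ (A : Mat n) → HW A → HW (take ℓ A)
hw-take zero          A           h       = tt
hw-take (suc ℓ)       []          h       = tt
hw-take (suc zero)    (b ∷ A)     h       = tt
hw-take (suc (suc ℓ)) (b ∷ [])    h       = tt
hw-take (suc (suc ℓ)) (b ∷ s ∷ A) (d , h) = d , hw-take (suc ℓ) (s ∷ A) h

size-Sset-decr : ∀ {n} k (M : Mat n) → Decr M → size (Sset k M) ≡ nsz M k
size-Sset-decr {n} k [] d = size-empty n
size-Sset-decr zero    (b ∷ M) d = refl
size-Sset-decr (suc k) (b ∷ M) d = trans (size-dep b _ (≤-trans (≤-reflexive ih) (≤-trans (le k M (decr-tail b M d)) (decr-head b M d)))) ih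
  where
  ih = size-Sset-decr k M (decr-tail b M d)
  le : ∀ {n} k (M : Mat n) → Decr M → nsz M k ≤ size (head M)
  le k       []          d = z≤n
  le zero    (b ∷ M)     d = ≤-refl
  le (suc k) (b ∷ M)     d = ≤-trans (le k M (decr-tail b M d)) (decr-head b M d)

hw-majA : ∀ {n} (M : Mat n) → HW M → majA M ≡ 0
hw-majA []      h = refl
hw-majA (b ∷ M) h = cong₂ _+_ (hw-majA M (hw-tail b M h)) (z (length M) (λ k → w k))
  where
  w : ∀ k → wraps b (Sset k M) ≡ 0
  w k = wraps-dom b (Sset k M) (dom-trans b (head M) (Sset k M) (hw-head b M h) (sub-dom _ _ (subst (λ x → Sub x (head M)) (sym (sset-lset k M (hw-tail b M h))) (lset-sub k M))))
  z : ∀ l {f : ℕ → ℕ} → (∀ k → f k ≡ 0) → sumTo l f ≡ 0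
  z zero    h = refl
  z (suc l) h = cong₂ _+_ (h 0) (z l (λ k → h (suc k)))

-- A queue that ends empty has served all waiting and arriving customers. This holds for the run
-- over every final segment of columns, which yields `Dom`.
que-0-dom : ∀ {n} u (b s : Vec Bool n) → que u b s ≡ 0 → Dom b s × u + size s ≤ size b
que-0-dom u [] [] e = tt , ≤-reflexive (trans (+-identityʳ u) e)
que-0-dom u (true ∷ b) (true ∷ s) e with que-0-dom u b s e
... | d , p = (d , s≤s (≤-trans (m≤n+m (size s) u) p)) , ≤-trans (≤-reflexive (+-suc u (size s))) (s≤s p)
que-0-dom u (false ∷ b) (true ∷ s) e with que-0-dom (suc u) b s e
... | d , p = (d , ≤-trans (s≤s (m≤n+m (size s) u)) p) , ≤-trans (≤-reflexive (+-suc u (size s))) p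
que-0-dom u (false ∷ b) (false ∷ s) e with que-0-dom u b s e
... | d , p = (d , ≤-trans (m≤n+m (size s) u) p) , p
que-0-dom zero (true ∷ b) (false ∷ s) e with que-0-dom 0 b s e
... | d , p = (d , m≤n⇒m≤1+n p) , m≤n⇒m≤1+n p
que-0-dom (suc u) (true ∷ b) (false ∷ s) e with que-0-dom u b s e
... | d , p = (d , m≤n⇒m≤1+n (≤-trans (m≤n+m (size s) u) p)) , s≤s p

-- Dominance of adjacent rows is forced by the summands of level 0 alone, the wraps of a whole row
-- into the next one.
majA-hw : ∀ {n} (M : Mat n) → majA M ≡ 0 → HW M
majA-hw []          e = tt
majA-hw (b ∷ [])    e = tt
majA-hw (b ∷ s ∷ M) e = proj₁ (que-0-dom 0 b s (m+n≡0⇒m≡0 (wraps b s) (m+n≡0⇒n≡0 (majA (s ∷ M)) e))) , majA-hw (s ∷ M) (m+n≡0⇒m≡0 (majA (s ∷ M)) e)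

-- Dominance order between the shapes

sub2 : ∀ k a b a' b' → a' + b' ≡ a + b → a ≤ a' → b ≤ a' → (k ⊓ a') + (k ⊓ b') ≤ (k ⊓ a) + (k ⊓ b)
sub2 k a b a' b' e p q with k ≤? a | k ≤? b
... | yes ka | _ = +-mono-≤ (≤-trans (m⊓n≤m k a') (≤-reflexive (sym (m≤n⇒m⊓n≡m ka)))) (⊓-monoʳ-≤ k b'≤b)
  where
  b'≤b : b' ≤ b
  b'≤b = +-cancelˡ-≤ a' _ _ (≤-trans (≤-reflexive e) (+-monoˡ-≤ b p))
... | no _ | yes kb = ≤-trans (+-mono-≤ (≤-trans (m⊓n≤m k a') (≤-reflexive (sym (m≤n⇒m⊓n≡m kb)))) (⊓-monoʳ-≤ k b'≤a)) (≤-reflexive (+-comm (k ⊓ b) (k ⊓ a)))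
  where
  b'≤a : b' ≤ a
  b'≤a = +-cancelˡ-≤ a' _ _ (≤-trans (≤-reflexive (trans e (+-comm a b))) (+-monoˡ-≤ a q))
... | no na | no nb = ≤-trans (+-mono-≤ (m⊓n≤n k a') (m⊓n≤n k b')) (≤-reflexive (trans e (cong₂ _+_ (sym (m≥n⇒m⊓n≡n (<⇒≤ (≰⇒> na)))) (sym (m≥n⇒m⊓n≡n (<⇒≤ (≰⇒> nb)))))))

-- By `sum-take-sortC` the sum of the first k parts of the partition whose conjugate lists the row
-- sizes. E replaces two row sizes by a wider pair with the same sum, and the minimum with k is
-- concave, so the sum cannot grow; this gives μ ≤ λ.
ksum : ∀ {n} → ℕ → Mat n → ℕ
ksum k []      = 0
ksum k (r ∷ M) = (k ⊓ size r) + ksum k M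

ksum-opE : ∀ {n} k (M : Mat n) → ksum k (opE M) ≤ ksum k M
ksum-opE k []          = ≤-refl
ksum-opE k (_ ∷ [])    = ≤-refl
ksum-opE k (b ∷ s ∷ M) = ≤-trans (≤-reflexive (sym (+-assoc (k ⊓ size (low 0 b s)) _ _))) (≤-trans (+-monoˡ-≤ (ksum k M)
  (sub2 k (size b) (size s) _ _ (low-upp-size 0 b s) (sub-size b _ (sub-low 0 b s)) (dom-size _ s (dom-low b s)))) (≤-reflexive (+-assoc (k ⊓ size b) _ _)))

ksum-ins : ∀ {n} k i (M : Mat n) → ksum k (ins i M) ≤ ksum k M
ksum-ins k zero    M       = ≤-refl
ksum-ins k (suc i) []      = ≤-refl
ksum-ins k (suc i) (b ∷ M) = ≤-trans (ksum-opE k (b ∷ ins i M)) (+-monoʳ-≤ (k ⊓ size b) (ksum-ins k i M))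

ksum-stage : ∀ {n} k i (M : Mat n) → ksum k (stage i M) ≤ ksum k M
ksum-stage k zero    M = ≤-refl
ksum-stage k (suc i) M = ≤-trans (ksum-ins k (suc i) (stage i M)) (ksum-stage k i M)

ksum-nsz : ∀ {n} k (M : Mat n) → ksum k M ≡ sumTo (length M) (λ r → k ⊓ nsz M r)
ksum-nsz k []      = refl
ksum-nsz k (r ∷ M) = cong ((k ⊓ size r) +_) (ksum-nsz k M)

tsum : ∀ {n} → Mat n → ℕ
tsum M = sum (sizes M)

tsum-nsz : ∀ {n} (M : Mat n) → tsum M ≡ sumTo (length M) (nsz M)
tsum-nsz []      = refl
tsum-nsz (r ∷ M) = cong (size r +_) (tsum-nsz M)

tsum-stage : ∀ {n} i (M : Mat n) → tsum (stage i M) ≡ tsum M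
tsum-stage zero M = refl
tsum-stage (suc i) M = trans (ti (suc i) (stage i M)) (tsum-stage i M)
  where
  to : ∀ {n} (M : Mat n) → tsum (opE M) ≡ tsum M
  to [] = refl
  to (_ ∷ []) = refl
  to (b ∷ s ∷ M) = trans (sym (+-assoc (size (low 0 b s)) _ _)) (trans (cong (_+ tsum M) (low-upp-size 0 b s)) (+-assoc (size b) _ _))
  ti : ∀ {n} i (M : Mat n) → tsum (ins i M) ≡ tsum M
  ti zero M = refl
  ti (suc i) [] = refl
  ti (suc i) (b ∷ M) = trans (to (b ∷ ins i M)) (cong (size b +_) (ti i M))

data Desc : List ℕ → Set where
  []  : Desc []
  _∷_ : ∀ {x xs} → All (_≤ x) xs → Desc xs → Desc (x ∷ xs)

insert-all : ∀ m x xs → x ≤ m → All (_≤ m) xs → All (_≤ m) (insertDesc x xs)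
insert-all m x [] p a = p ∷ []
insert-all m x (y ∷ ys) p (q ∷ a) with y <ᵇ x
... | true  = p ∷ q ∷ a
... | false = q ∷ insert-all m x ys p a

insert-desc : ∀ x xs → Desc xs → Desc (insertDesc x xs)
insert-desc x [] d = [] ∷ []
insert-desc x (y ∷ ys) (a ∷ d) with y <ᵇ x in e
... | true  = (<⇒≤ (ltT⁻ {y} {x} e) ∷ All.map (λ p → ≤-trans p (<⇒≤ (ltT⁻ {y} {x} e))) a) ∷ (a ∷ d)
... | false = insert-all y x ys (≮⇒≥ (λ p → case (trans (sym e) (ltT p)))) a ∷ insert-desc x ys d
  where case : false ≡ true → ⊥
        case ()

sortC-desc : ∀ β → Desc (sortC β)
sortC-desc []          = []
sortC-desc (zero ∷ β)  = sortC-desc β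
sortC-desc (suc x ∷ β) = insert-desc (suc x) (sortC β) (sortC-desc β)

sum-layers : ∀ m xs → All (_≤ m) xs → sum xs ≡ sumTo m (cn xs)
sum-layers m [] [] = sym (z m)
  where
  z : ∀ m → sumTo m (λ _ → 0) ≡ 0
  z zero    = refl
  z (suc m) = z m
sum-layers m (x ∷ xs) (p ∷ ps) = trans (cong₂ _+_ (sym (layer m x p)) (sum-layers m xs ps)) (trans (sym (sumTo-+ m (λ r → if suc r ≤ᵇ x then 1 else 0) (cn xs))) (sumTo-cong m (λ i _ → c i)))
  where
  c : ∀ i → (if suc i ≤ᵇ x then 1 else 0) + cn xs i ≡ cn (x ∷ xs) i
  c i with suc i ≤ᵇ x
  ... | true  = refl
  ... | false = refl
  layer : ∀ m x → x ≤ m → sumTo m (λ r → if suc r ≤ᵇ x then 1 else 0) ≡ x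
  layer zero    zero    p       = refl
  layer (suc m) zero    p       = layer m zero z≤n
  layer (suc m) (suc x) (s≤s p) = cong suc (layer m x p)

cn-take : ∀ k xs i → Desc xs → cn (take k xs) i ≡ k ⊓ cn xs i
cn-take zero    xs       i d = refl
cn-take (suc k) []       i d = sym (⊓-zeroʳ (suc k))
cn-take (suc k) (x ∷ xs) i (a ∷ d) with suc i ≤? x
... | yes p rewrite leT p = cong suc (cn-take k xs i d)
... | no np rewrite leF {suc i} {x} (≰⇒> np) = trans (cn-take k xs i d) (trans (cong (k ⊓_) z) (trans (⊓-zeroʳ k) (sym (cong (suc k ⊓_) z))))
  where
  z : cn xs i ≡ 0
  z = cn-zero xs i (All.map (λ q → ≤-trans q (s≤s⁻¹ (≰⇒> np))) a)

sum-take-sortC : ∀ m k β → maxL β ≤ m → sum (take k (sortC β)) ≡ sumTo m (λ r → k ⊓ cn β r)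
sum-take-sortC m k β p = trans (sum-layers m (take k (sortC β)) (AllP.take⁺ k bnd)) (sumTo-cong m (λ i _ → trans (cn-take k (sortC β) i (sortC-desc β)) (cong (k ⊓_) (count-sortC (λ a → suc i ≤ᵇ a) refl β))))
  where
  bnd : All (_≤ m) (sortC β)
  bnd = All.map (λ q → ≤-trans q (≤-trans (≤-reflexive (maxL-sortC β)) p)) (maxL-≤ (sortC β))

sum-sortC : ∀ m β → maxL β ≤ m → sum (sortC β) ≡ sumTo m (cn β)
sum-sortC m β p = trans (sum-layers m (sortC β) bnd) (sumTo-cong m (λ i _ → count-sortC (λ a → suc i ≤ᵇ a) refl β))
  where
  bnd : All (_≤ m) (sortC β)
  bnd = All.map (λ q → ≤-trans q (≤-trans (≤-reflexive (maxL-sortC β)) p)) (maxL-≤ (sortC β))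

weight-lists : ∀ {n} (M : Mat n) → weight n (lists M) ≡ toList (wt M)
weight-lists {n} [] = sym (toList-rep n)
  where
  toList-rep : ∀ n → toList (Vec.replicate n 0) ≡ replicate n 0
  toList-rep zero    = refl
  toList-rep (suc n) = cong (0 ∷_) (toList-rep n)
weight-lists {n} (r ∷ M) = trans (cong (zipWith _+_ (map (λ b → if b then 1 else 0) (toList r))) (weight-lists M)) (l r (wt M))
  where
  l : ∀ {n} (r : Vec Bool n) w → zipWith _+_ (map (λ b → if b then 1 else 0) (toList r)) (toList w) ≡ toList (Vec.zipWith _+_ (toN r) w)
  l []          []      = refl
  l (true ∷ r)  (x ∷ w) = cong (suc x ∷_) (l r w)
  l (false ∷ r) (x ∷ w) = cong (x ∷_) (l r w)

-- The bijection and the comparison of coefficients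

imgN : ∀ {n} → Mat n → Mat n
imgN M = stage (length M ∸ 1) M

imgQ : ∀ {n} → Mat n → Tab
imgQ M = Qs M (length M ∸ 1)

rho-img : ∀ {n} (M : Mat n) → rho n (lists M) ≡ (lists (imgN M) , imgQ M)
rho-img []      = refl
rho-img (r ∷ M) = rho-lists (length M) (r ∷ M) refl

pred-len : ∀ {A : Set} (xs : List A) → length xs ≤ suc (length xs ∸ 1)
pred-len []       = z≤n
pred-len (x ∷ xs) = ≤-refl

imgN-hw : ∀ {n} (M : Mat n) → HW (imgN M)
imgN-hw M = stage-hw (length M ∸ 1) M (pred-len M)

imgQ-len : ∀ {n} (M : Mat n) j → length (nth [] (imgQ M) j) ≡ nsz (imgN M) j
imgQ-len M j with j ≤? length M ∸ 1
... | yes p = r-len (rowOK M (length M ∸ 1) j p)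
... | no np = trans (cong length (nth-default [] (imgQ M) j (≤-trans (≤-reflexive (length-Qs M (length M ∸ 1))) (≰⇒> np))))
  (sym (nth-default 0 (sizes (imgN M)) j (≤-trans (≤-reflexive (trans (LP.length-map size (imgN M)) (k-len (stage-keep (length M ∸ 1)) M))) (≤-trans (pred-len M) (≰⇒> np)))))

all-nth : ∀ {A : Set} {P : A → Set} (d : A) xs → (∀ j → j < length xs → P (nth d xs j)) → All P xs
all-nth d []       h = []
all-nth d (x ∷ xs) h = h 0 (s≤s z≤n) ∷ all-nth d xs (λ j p → h (suc j) (s≤s p))

imgQ-row : ∀ {n} (M : Mat n) j → j < length (imgQ M) → RowOK M (length M ∸ 1) j
imgQ-row M j p = rowOK M (length M ∸ 1) j (s≤s⁻¹ (≤-trans p (≤-reflexive (length-Qs M (length M ∸ 1)))))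

imgQ-bound : ∀ {n} (M : Mat n) → All (All (_≤ length M)) (imgQ M)
imgQ-bound []      = [] ∷ []
imgQ-bound (r ∷ M) = all-nth [] (imgQ (r ∷ M)) (λ j p → r-max (imgQ-row (r ∷ M) j p))

imgQ-strict : ∀ {n} (M : Mat n) j → strictAbove (nth [] (imgQ M) j) (nth [] (imgQ M) (suc j)) ≡ true
imgQ-strict M j with suc j ≤? length M ∸ 1
... | yes p = strictQ M (length M ∸ 1) j p
... | no np = trans (cong (strictAbove (nth [] (imgQ M) j)) (nth-default [] (imgQ M) (suc j) (≤-trans (≤-reflexive (length-Qs M (length M ∸ 1))) (≰⇒> np)))) (strictAbove-[] (nth [] (imgQ M) j))

imgQ-content : ∀ {n} (M : Mat n) a → a < length M → countN (suc a) (concat (imgQ M)) ≡ nsz M a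
imgQ-content (r ∷ M) a p = content-Qs (r ∷ M) (length M) a (s≤s⁻¹ p)

cols-strict : ∀ Q → (∀ j → strictAbove (nth [] Q j) (nth [] Q (suc j)) ≡ true) → colsStrict Q ≡ true
cols-strict []          h = refl
cols-strict (q ∷ [])    h = refl
cols-strict (q ∷ r ∷ Q) h = cong₂ _∧_ (h 0) (cols-strict (r ∷ Q) (λ j → h (suc j)))

semi-of : ∀ Q → all weaklyInc Q ≡ true → colsStrict Q ≡ true → (∀ j → length (nth [] Q (suc j)) ≤ length (nth [] Q j)) → Semi Q
semi-of [] i s d = []
semi-of (q ∷ []) i s d = one (weakly-incr q (proj₁ (∧-elim (weaklyInc q) _ i)))
semi-of (q ∷ r ∷ Q) i s d = more (weakly-incr q (proj₁ (∧-elim (weaklyInc q) _ i))) (proj₁ (∧-elim (strictAbove q r) _ s)) (d 0)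
  (semi-of (r ∷ Q) (proj₂ (∧-elim (weaklyInc q) _ i)) (proj₂ (∧-elim (strictAbove q r) _ s)) (λ j → d (suc j)))

nth-take : ∀ {A : Set} (d : A) ℓ xs → (∀ j → ℓ ≤ j → nth d xs j ≡ d) → ∀ j → nth d (take ℓ xs) j ≡ nth d xs j
nth-take d zero    xs       h j       = sym (h j z≤n)
nth-take d (suc ℓ) []       h j       = refl
nth-take d (suc ℓ) (x ∷ xs) h zero    = refl
nth-take d (suc ℓ) (x ∷ xs) h (suc j) = nth-take d ℓ xs (λ j p → h (suc j) (s≤s p)) j

concat-take : ∀ {A : Set} ℓ (xss : List (List A)) → (∀ j → ℓ ≤ j → nth [] xss j ≡ []) → concat (take ℓ xss) ≡ concat xss
concat-take zero    []         h = refl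
concat-take zero    (xs ∷ xss) h = trans (concat-take 0 xss (λ j _ → h (suc j) z≤n)) (cong (_++ concat xss) (sym (h 0 z≤n)))
concat-take (suc ℓ) []         h = refl
concat-take (suc ℓ) (xs ∷ xss) h = cong (xs ++_) (concat-take ℓ xss (λ j p → h (suc j) (s≤s p)))

decr-of : ∀ {n} (M : Mat n) → (∀ i → nsz M (suc i) ≤ nsz M i) → Decr M
decr-of []          h = tt
decr-of (_ ∷ [])    h = tt
decr-of (b ∷ s ∷ M) h = h 0 , decr-of (s ∷ M) (λ i → h (suc i))

countN-big : ∀ a (Q : Tab) k → All (All (_≤ k)) Q → k < a → countN a (concat Q) ≡ 0
countN-big a Q k b p = countN-none a (concat Q) (AllP.concat⁺ (All.map (All.map (λ q → ≤-trans (s≤s q) p)) b))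

sum-lengths : ∀ {A B : Set} (f : A → List B) xs → length (concatMap f xs) ≡ sum (map (λ x → length (f x)) xs)
sum-lengths f []       = refl
sum-lengths f (x ∷ xs) = trans (LP.length-++ (f x)) (cong (length (f x) +_) (sum-lengths f xs))

length-prod : ∀ {A B C : Set} (c : A → B → C) as bs → length (concatMap (λ a → map (c a) bs) as) ≡ length as * length bs
length-prod c []       bs = refl
length-prod c (a ∷ as) bs = trans (LP.length-++ (map (c a) bs)) (cong₂ _+_ (LP.length-map (c a) bs) (length-prod c as bs))

module Main (n : ℕ) (α : List ℕ) where

  K : ℕ
  K = maxL α

  ν : List ℕ
  ν = conj (sortC α)

  len-ν : length ν ≡ K
  len-ν = length-conj α

  len-M : (M : Mat n) → sizes M ≡ ν → length M ≡ K
  len-M M e = trans (sym (LP.length-map size M)) (trans (cong length e) len-ν)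

  nsz-M : (M : Mat n) → sizes M ≡ ν → ∀ i → nsz M i ≡ cn α i
  nsz-M M e i = trans (cong (λ l → nth 0 l i) e) (nth-conj α i)

  decr-M : (M : Mat n) → sizes M ≡ ν → Decr M
  decr-M M e = decr-of M (λ i → subst₂ _≤_ (sym (nsz-M M e (suc i))) (sym (nsz-M M e i)) (cn-decr α i))

  row-length : ∀ β (Q : Tab) → map length Q ≡ conj (sortC β) → ∀ j → length (nth [] Q j) ≡ cn β j
  row-length β Q e j = trans (sym (nth-map length [] 0 refl Q j)) (trans (cong (λ l → nth 0 l j) e) (nth-conj β j))

  content : ∀ μ Q → SSYT μ ν Q → ∀ a → countN (suc a) (concat Q) ≡ cn α a
  content μ Q s a with a <? K
  ... | yes p = trans (eqT⁻ _ _ (all-true⁻ (λ b → countN b (concat Q) ≡ᵇ nth 0 ν (b ∸ 1)) (oneTo (length ν)) (cont s) (∈-oneTo⁺ (s≤s z≤n) (≤-trans p (≤-reflexive (sym len-ν)))))) (nth-conj α a)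
  ... | no np = trans (countN-big (suc a) Q K (subst (λ k → All (All (_≤ k)) Q) len-ν (bound s)) (s≤s (≮⇒≥ np))) (sym (cn-beyond α a (≮⇒≥ np)))

  -- Tableaux are compared row by row with default `[]`, since `imgQ` may end in empty rows whereas
  -- a tableau from the enumeration of its shape has none.
  record Inverse (X : Mat n) (Q : Tab) : Set where
    field
      mlq   : Mat n
      i-ν   : sizes mlq ≡ ν
      i-N   : imgN mlq ≡ X
      i-Q   : ∀ j → nth [] (imgQ mlq) j ≡ nth [] Q j
      i-maj : majA mlq ≡ charge Q
  open Inverse

  module _ (β : List ℕ) (Q : Tab) (X : Mat n) (h : HW X) (lX : length X ≡ K) (sz : ∀ j → nsz X j ≡ cn β j) (s : SSYT (conj (sortC β)) ν Q) where

    private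
      rl : ∀ j → length (nth [] Q j) ≡ cn β j
      rl = row-length β Q (shape s)

      bound-K : ∀ k → K ≡ k → All (All (_≤ k)) Q
      bound-K k e = subst (λ k → All (All (_≤ k)) Q) (trans len-ν e) (bound s)

      none-in : ∀ w → All (1 ≤_) w → All (_≤ 0) w → w ≡ []
      none-in []      _       _       = refl
      none-in (x ∷ w) (p ∷ _) (q ∷ _) = ⊥-elim (<⇒≱ p q)

      charge-0 : K ≡ 0 → 0 ≡ charge Q
      charge-0 e = cong chargeWord (sym (none-in (concat (reverse Q)) (all-concat-rev Q (pos s)) (all-concat-rev Q (bound-K 0 e))))

      rows-0 : K ≡ 0 → ∀ j → nth {A = List ℕ} [] ([] ∷ []) j ≡ nth [] Q j
      rows-0 e j = trans (r0 j) (sym (length-0 _ (trans (rl j) (trans (sym (sz j)) (cong (λ Y → nsz Y j) (length-0 X (trans lX e)))))))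
        where
        r0 : ∀ j → nth {A = List ℕ} [] ([] ∷ []) j ≡ []
        r0 zero    = refl
        r0 (suc j) = refl

      dec : ∀ a → 1 ≤ a → countN (suc a) (concat Q) ≤ countN a (concat Q)
      dec (suc a) _ = subst₂ _≤_ (sym (content (conj (sortC β)) Q s (suc a))) (sym (content (conj (sortC β)) Q s a)) (cn-decr α a)

      semi : Semi Q
      semi = semi-of Q (inc s) (str s) (λ j → subst₂ _≤_ (sym (rl (suc j))) (sym (rl j)) (cn-decr β j))

    module _ (L : ℕ) (e : K ≡ suc L) (p : Preimage L X Q) where
      open Preimage p

      private
        N≡ : imgN prei ≡ X
        N≡ = trans (cong (λ k → stage (k ∸ 1) prei) pr-len) pr-N

        sizes≡ : sizes prei ≡ ν
        sizes≡ = list-ext 0 (sizes prei) ν (trans (LP.length-map size prei) (trans pr-len (sym (trans len-ν e))))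
          (λ j q → trans (pr-size j (s≤s⁻¹ (≤-trans q (≤-reflexive (trans (LP.length-map size prei) pr-len))))) (trans (content (conj (sortC β)) Q s j) (sym (nth-conj α j))))

        rows : ∀ j → nth [] (imgQ prei) j ≡ nth [] Q j
        rows j with j ≤? L
        ... | yes q = trans (cong (λ k → nth [] (Qs prei (k ∸ 1)) j) pr-len) (pr-Q j q)
        ... | no nq = trans (length-0 _ (trans (imgQ-len prei j) (trans (cong (λ Y → nsz Y j) N≡) z))) (sym (length-0 _ (trans (rl j) (trans (sym (sz j)) z))))
          where
          z : nsz X j ≡ 0
          z = nth-default 0 (sizes X) j (≤-trans (≤-reflexive (trans (LP.length-map size X) (trans lX e))) (≰⇒> nq))

      inverse-suc : Inverse X Q
      inverse-suc = record { mlq = prei ; i-ν = sizes≡ ; i-N = N≡ ; i-Q = rows ; i-maj = pr-maj }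

    inverse′ : ∀ k → K ≡ k → Inverse X Q
    -- For the empty shape there are no rows, and ρ records a single empty row.
    inverse′ zero    e = record { mlq = [] ; i-ν = sym (length-0 ν (trans len-ν e)) ; i-N = sym (length-0 X (trans lX e)) ; i-Q = rows-0 e ; i-maj = charge-0 e }
    inverse′ (suc L) e = inverse-suc L e (rho-surjective L X Q h (trans lX e) (word-matrix L Q semi (pos s) (bound-K (suc L) e) dec) (λ j _ → trans (sz j) (sym (rl j))))

    inverse : Inverse X Q
    inverse = inverse′ K refl

  injective : (M M' : Mat n) → sizes M ≡ ν → sizes M' ≡ ν → imgN M ≡ imgN M' → (∀ j → nth [] (imgQ M) j ≡ nth [] (imgQ M') j) → M ≡ M'
  injective M M' e e' eN eQ = rho-injective M M' (length M ∸ 1) (trans e (sym e'))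
      (λ j _ → trans (eQ j) (cong (λ k → nth [] (Qs M' (k ∸ 1)) j) lens)) (trans eN (cong (λ k → stage (k ∸ 1) M') lens))
    where
    lens : length M' ≡ length M
    lens = trans (len-M M' e') (sym (len-M M e))

  type-of : (M M' : Mat n) → sizes M ≡ ν → sizes M' ≡ ν → (∀ i → Sset i (imgN M) ≡ Sset i (imgN M')) → (∀ j → nth [] (imgQ M) j ≡ nth [] (imgQ M') j) →
    type n (lists M) ≡ type n (lists M')
  type-of M M' e e' eN eQ = gek-ext n _ _ (fm-len F) (fm-len F') (λ k → trans (fm-sets F k) (trans (sets M M' (trans e (sym e')) eN eQ k) (sym (fm-sets F' k))))
    where
    F = fm-correct M (decr-M M e)
    F' = fm-correct M' (decr-M M' e')
    sets : (M M' : Mat n) → sizes M ≡ sizes M' → (∀ i → Sset i (imgN M) ≡ Sset i (imgN M')) → (∀ j → nth [] (imgQ M) j ≡ nth [] (imgQ M') j) → ∀ k → Sset k M ≡ Sset k M'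
    sets []      []        z s q k = refl
    sets (r ∷ M) (r' ∷ M') z s q k = same-type (r ∷ M) (r' ∷ M') (length M) refl z (λ j _ → trans (q j) (cong (λ l → nth [] (Qs (r' ∷ M') l) j) ll))
        (λ i → trans (s i) (cong (λ l → Sset i (stage l (r' ∷ M'))) ll)) k
      where
      ll : length M' ≡ length M
      ll = suc-injective (trans (sym (LP.length-map size (r' ∷ M'))) (trans (cong length (sym z)) (LP.length-map size (r ∷ M))))
    sets []      (_ ∷ _)   () s q k
    sets (_ ∷ _) []        () s q k

  -- `M_β` and the image of `M` have the same label sets. Hence the preimages of both with recording
  -- tableau Q have the same type by `type-of`, and the search for the preimage of `M_β` can be
  -- replaced by `M`.
  inv-type : ∀ β Q (M : Mat n) → length β ≡ n → All (_≤ K) β → SSYT (conj (sortC β)) ν Q → sizes M ≡ ν →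
    (∀ i → Sset i (imgN M) ≡ gek n (suc i) β) → (∀ j → nth [] (imgQ M) j ≡ nth [] Q j) → invTypeIs n α β Q ≡ eqℕs (type n (lists M)) α
  inv-type β Q M lβ bβ s eM sN sQ = go
    where
    szK : ∀ j → nsz (keyFrom n β 1 K) j ≡ cn β j
    szK j = trans (sym (size-Sset-decr j (keyFrom n β 1 K) (hw-decr _ (hw-key n β 1 K)))) (trans (cong size (Sset-mk n β K bβ j)) (size-gek n (suc j) β lβ))
    I : Inverse (keyFrom n β 1 K) Q
    I = inverse β Q (keyFrom n β 1 K) (hw-key n β 1 K) (length-key n β 1 K) szK s
    B = mlq I
    eB = i-ν I
    nB = i-N I
    qB = i-Q I
    hit : ∀ (X : Mat n) → hits n (sortC α) β Q (lists X) ≡ eqMLQ (lists (imgN X)) (mkM (maxL (sortC α)) β) ∧ eqTab (imgQ X) Q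
    hit X = cong (λ z → eqMLQ (proj₁ z) (mkM (maxL (sortC α)) β) ∧ eqTab (proj₂ z) Q) (rho-img X)
    mk : lists (keyFrom n β 1 K) ≡ mkM (maxL (sortC α)) β
    mk = trans (lists-mkM n β K lβ) (cong (λ k → mkM k β) (sym (maxL-sortC α)))
    hB : hits n (sortC α) β Q (lists B) ≡ true
    hB = trans (hit B) (cong₂ _∧_ (trans (cong (eqMLQ (lists (imgN B))) (sym (trans (cong lists nB) mk))) (eqMLQ-refl (lists (imgN B)))) (eqTab-complete (imgQ B) Q qB))
    uniq : ∀ {Y} → Y ∈ mlqs n (sortC α) → hits n (sortC α) β Q Y ≡ true → Y ≡ lists B
    uniq {Y} m h with ∈-rows⁻ n ν m
    ... | X , refl , eX with ∧-elim (eqMLQ (lists (imgN X)) (mkM (maxL (sortC α)) β)) _ (trans (sym (hit X)) h)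
    ... | a , b = cong lists (injective X B eX eB (lists-inj _ _ (trans (eqMLQ-sound _ _ a) (sym (trans (cong lists nB) mk)))) (λ j → trans (eqTab-sound (imgQ X) Q b j) (sym (qB j))))
    rI : rhoInv n (sortC α) β Q ≡ just (lists B)
    rI = rhoInv-unique n (sortC α) β Q (lists B) (subst (λ c → lists B ∈ rowsOfSizes n c) eB (∈-rows⁺ B)) hB uniq
    ty : type n (lists B) ≡ type n (lists M)
    ty = type-of B M eB eM (λ i → trans (cong (Sset i) nB) (trans (Sset-mk n β K bβ i) (sym (sN i)))) (λ j → trans (qB j) (sym (sQ j)))
    go : invTypeIs n α β Q ≡ eqℕs (type n (lists M)) α
    go with rhoInv n (sortC α) β Q | rI
    ... | _ | refl = cong (λ t → eqℕs t α) ty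

  -- The triple (β, Q, N) with β the type of the nonwrapping image N. Cutting both lists at the
  -- largest part of β removes the empty rows, so that Q and N occur in the enumerations belonging
  -- to β.
  triple : MLQ → List ℕ × (Tab × MLQ)
  triple M = type n (proj₁ (rho n M)) , take (maxL (type n (proj₁ (rho n M)))) (proj₂ (rho n M)) , take (maxL (type n (proj₁ (rho n M)))) (proj₁ (rho n M))

  module Image (M : Mat n) (eM : sizes M ≡ ν) where

    X = imgN M
    F = fm-correct X (hw-decr X (imgN-hw M))

    β : List ℕ
    β = type n (lists X)

    ℓ = maxL β

    lβ : length β ≡ n
    lβ = fm-len F

    lX : length X ≡ K
    lX = trans (k-len (stage-keep (length M ∸ 1)) M) (len-M M eM)

    szX : ∀ j → nsz X j ≡ cn β j
    szX j = trans (sym (size-Sset-decr j X (hw-decr X (imgN-hw M)))) (trans (cong size (sym (fm-sets F j))) (size-gek n (suc j) β lβ))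

    bβ : All (_≤ K) β
    bβ = all-nth 0 β (λ i p → ≮⇒≥ (λ q → bad i (≤-trans p (≤-reflexive lβ)) q))
      where
      bad : ∀ i → i < n → K < nth 0 β i → ⊥
      bad i p q with trans (sym (leT q)) (trans (sym (at-gek n (suc K) β i p)) (trans (cong (at i) (trans (fm-sets F K) (Sset-small K X (≤-reflexive lX)))) (at-empty {n} i)))
      ... | ()

    ℓ≤K : ℓ ≤ K
    ℓ≤K = maxL-least K β bβ

    zX : ∀ j → ℓ ≤ j → nsz X j ≡ 0
    zX j p = trans (szX j) (cn-beyond β j p)

    zQ : ∀ j → ℓ ≤ j → nth [] (imgQ M) j ≡ []
    zQ j p = length-0 _ (trans (imgQ-len M j) (zX j p))

    Q = take ℓ (imgQ M)

    nQ : ∀ j → nth [] Q j ≡ nth [] (imgQ M) j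
    nQ = nth-take [] ℓ (imgQ M) zQ

    Y = take ℓ X

    X≡ : X ≡ Y ++ top n (length X ∸ ℓ)
    X≡ = take-top ℓ X zX

    hwY : HW Y
    hwY = hw-take ℓ X (imgN-hw M)

    ssytQ : SSYT (conj (sortC β)) ν Q
    ssytQ = record
      { shape = list-ext 0 _ _ (trans (LP.length-map length Q) (trans (LP.length-take ℓ (imgQ M)) (trans (m≤n⇒m⊓n≡m lQ) (sym (length-conj β)))))
                  (λ j _ → trans (nth-map length [] 0 refl Q j) (trans (cong length (nQ j)) (trans (imgQ-len M j) (trans (szX j) (sym (nth-conj β j))))))
      ; pos = AllP.take⁺ ℓ (all-nth [] (imgQ M) (λ j p → r-pos (imgQ-row M j p)))
      ; bound = AllP.take⁺ ℓ (subst (λ k → All (All (_≤ k)) (imgQ M)) (trans (len-M M eM) (sym len-ν)) (imgQ-bound M))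
      ; inc = all-true weaklyInc Q (λ q → All.lookup (AllP.take⁺ ℓ (all-nth {P = λ q → weaklyInc q ≡ true} [] (imgQ M) (λ j p → r-inc (imgQ-row M j p)))) q)
      ; str = cols-strict Q (λ j → subst₂ (λ a b → strictAbove a b ≡ true) (sym (nQ j)) (sym (nQ (suc j))) (imgQ-strict M j))
      ; cont = all-true (λ b → countN b (concat Q) ≡ᵇ nth 0 ν (b ∸ 1)) (oneTo (length ν)) ct }
      where
      lQ : ℓ ≤ length (imgQ M)
      lQ = ≤-trans ℓ≤K (≤-trans (≤-reflexive (sym (len-M M eM))) (≤-trans (pred-len M) (≤-reflexive (sym (length-Qs M (length M ∸ 1))))))
      ct : ∀ {b} → b ∈ oneTo (length ν) → (countN b (concat Q) ≡ᵇ nth 0 ν (b ∸ 1)) ≡ true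
      ct {b} q with ∈-oneTo⁻ q
      ct {suc a} q | _ , p = eqT (trans (cong (countN (suc a)) (concat-take ℓ (imgQ M) zQ)) (trans (imgQ-content M a (≤-trans p (≤-reflexive (trans len-ν (sym (len-M M eM))))))
        (cong (λ l → nth 0 l a) eM)))

    -- `inverse` yields a preimage of the same pair whose energy is `charge Q`; by injectivity of ρ
    -- it is `M`.
    charge-maj : charge Q ≡ majA M
    charge-maj = trans (sym (i-maj I)) (cong majA (injective (mlq I) M (i-ν I) eM (i-N I) (λ j → trans (i-Q I j) (nQ j))))
      where
      I : Inverse X Q
      I = inverse β Q X (imgN-hw M) lX szX ssytQ

    inv : invTypeIs n α β Q ≡ eqℕs (type n (lists M)) α
    inv = inv-type β Q M lβ bβ ssytQ eM (λ i → sym (fm-sets F i)) (λ j → sym (nQ j))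

    szY : sizes Y ≡ conj (sortC β)
    szY = list-ext 0 _ _ (trans (LP.length-map size Y) (trans (LP.length-take ℓ X) (trans (m≤n⇒m⊓n≡m (≤-trans ℓ≤K (≤-reflexive (sym lX)))) (sym (length-conj β)))))
      (λ j _ → trans (nszY j) (trans (szX j) (sym (nth-conj β j))))
      where
      nszY : ∀ j → nsz Y j ≡ nsz X j
      nszY j = trans (cong (λ l → nth 0 l j) (sym (LP.take-map ℓ X))) (nth-take 0 ℓ (sizes X) zX j)

    FY = fm-correct Y (hw-decr Y hwY)

    typeY : type n (lists Y) ≡ β
    typeY = gek-ext n _ _ (fm-len FY) lβ (λ k → trans (fm-sets FY k) (trans (sym (Sset-top k Y (length X ∸ ℓ))) (trans (cong (Sset k) (sym X≡)) (sym (fm-sets F k)))))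

    majY : maj n (lists Y) ≡ 0
    majY = trans (fm-maj FY) (hw-majA Y hwY)

    weightY : weight n (lists Y) ≡ weight n (lists M)
    weightY = trans (weight-lists Y) (trans (cong toList (trans (sym (wt-top Y (length X ∸ ℓ))) (trans (cong wt (sym X≡)) (k-wt (stage-keep (length M ∸ 1)) M)))) (sym (weight-lists M)))

    dominated : dominatedᵇ (sortC β) (sortC α) ≡ true
    dominated = cong₂ _∧_ (eqT sums) (all-true _ (oneTo (length (sortC β) + length (sortC α))) (λ {k} _ → leT (prefix k)))
      where
      toX : ∀ (f : ℕ → ℕ) → sumTo K (λ r → f (cn β r)) ≡ sumTo (length X) (λ r → f (nsz X r))
      toX f = trans (sumTo-cong K (λ r _ → cong f (sym (szX r)))) (cong (λ l → sumTo l (λ r → f (nsz X r))) (sym lX))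
      toM : ∀ (f : ℕ → ℕ) → sumTo (length M) (λ r → f (nsz M r)) ≡ sumTo K (λ r → f (cn α r))
      toM f = trans (cong (λ l → sumTo l (λ r → f (nsz M r))) (len-M M eM)) (sumTo-cong K (λ r _ → cong f (nsz-M M eM r)))
      sums : sum (sortC β) ≡ sum (sortC α)
      sums = trans (sum-sortC K β ℓ≤K) (trans (toX (λ x → x)) (trans (sym (tsum-nsz X)) (trans (tsum-stage (length M ∸ 1) M) (trans (tsum-nsz M) (trans (toM (λ x → x)) (sym (sum-sortC K α ≤-refl)))))))
      prefix : ∀ k → sum (take k (sortC β)) ≤ sum (take k (sortC α))
      prefix k = subst₂ _≤_ (sym (trans (sum-take-sortC K k β ℓ≤K) (trans (toX (k ⊓_)) (sym (ksum-nsz k X))))) (trans (ksum-nsz k M) (trans (toM (k ⊓_)) (sym (sum-take-sortC K k α ≤-refl))))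
        (ksum-stage k (length M ∸ 1) M)

    β∈ : β ∈ compsBelow n α
    β∈ = ∈-filterᵇ⁺ _ (vecsUpTo n K) (subst (λ k → β ∈ vecsUpTo k K) lβ (∈-vecs⁺ K β bβ)) dominated

    Y∈ : lists Y ∈ mlqs n (sortC β)
    Y∈ = subst (λ c → lists Y ∈ rowsOfSizes n c) szY (∈-rows⁺ Y)

    triple≡ : triple (lists M) ≡ (β , Q , lists Y)
    triple≡ = trans (cong (λ z → type n (proj₁ z) , take (maxL (type n (proj₁ z))) (proj₂ z) , take (maxL (type n (proj₁ z))) (proj₁ z)) (rho-img M))
      (cong (λ z → β , Q , z) (LP.take-map ℓ X))

  module Count (d : ℕ) (e : List ℕ) where

    lhsP : MLQ → Bool
    lhsP M = eqℕs (type n M) α ∧ (maj n M ≡ᵇ d) ∧ eqℕs (weight n M) e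

    Ks : List ℕ → List Tab
    Ks β = filterᵇ (λ Q → invTypeIs n α β Q ∧ (charge Q ≡ᵇ d)) (ssyt (conj (sortC β)) ν)

    As : List ℕ → List MLQ
    As β = filterᵇ (λ M → eqℕs (type n M) β ∧ (maj n M ≡ᵇ 0) ∧ eqℕs (weight n M) e) (mlqs n (sortC β))

    xs : List MLQ
    xs = filterᵇ lhsP (mlqs n (sortC α))

    pairs : List ℕ → List (Tab × MLQ)
    pairs β = concatMap (λ Q → map (Q ,_) (As β)) (Ks β)

    ys : List (List ℕ × (Tab × MLQ))
    ys = concatMap (λ β → map (β ,_) (pairs β)) (compsBelow n α)

    ,-inj : ∀ {A B : Set} {a a' : A} {b b' : B} → (a , b) ≡ (a' , b') → a ≡ a' × b ≡ b'
    ,-inj refl = refl , refl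

    length-ys : length ys ≡ rhsCoeff n α d e
    length-ys = trans (sum-lengths (λ β → map (β ,_) (pairs β)) (compsBelow n α)) (cong sum (LP.map-cong (λ β → trans (LP.length-map (β ,_) (pairs β)) (length-prod _,_ (Ks β) (As β))) (compsBelow n α)))

    unique-pairs : ∀ β → Unique (pairs β)
    unique-pairs β = Product.unique-prod _,_ ,-inj (Ks β) (As β) (unique-filterᵇ _ (unique-ssyt (conj (sortC β)) ν)) (unique-filterᵇ _ (unique-rows n (conj (sortC β))))

    unique-ys : Unique ys
    unique-ys = unique-concatMap _ (compsBelow n α) (unique-filterᵇ _ (unique-vecs n K)) (λ β → UP.map⁺ (λ e → proj₂ (,-inj e)) (unique-pairs β)) dj
      where
      dj : ∀ {β β' y} → y ∈ map (β ,_) (pairs β) → y ∈ map (β' ,_) (pairs β') → β ≡ β'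
      dj p q with ∈-map⁻ _ p | ∈-map⁻ _ q
      ... | _ , _ , refl | _ , _ , refl = refl

    ∈-ys⁺ : ∀ {β Q M} → β ∈ compsBelow n α → Q ∈ Ks β → M ∈ As β → (β , Q , M) ∈ ys
    ∈-ys⁺ {β} b q m = ∈-concatMap⁺ (λ β → map (β ,_) (pairs β)) (compsBelow n α) b (∈-map⁺ (β ,_) (Product.∈-prod⁺ _,_ ,-inj (Ks β) (As β) q m))

    ∈-ys⁻ : ∀ {y} → y ∈ ys → ∃ λ β → ∃ λ Q → ∃ λ M → y ≡ (β , Q , M) × β ∈ compsBelow n α × Q ∈ Ks β × M ∈ As β
    ∈-ys⁻ p with ∈-concatMap⁻ (λ β → map (β ,_) (pairs β)) (compsBelow n α) p
    ... | β , b , q with ∈-map⁻ (β ,_) q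
    ... | _ , r , refl with Product.∈-prod⁻ _,_ ,-inj (Ks β) (As β) r
    ... | Q , M , x , y , refl = β , Q , M , refl , b , x , y

    ∧-3⁻ : ∀ a b c → a ∧ b ∧ c ≡ true → a ≡ true × b ≡ true × c ≡ true
    ∧-3⁻ true true true _ = refl , refl , refl

    to : ∀ {M} → M ∈ xs → triple M ∈ ys
    to {M'} p with ∈-filterᵇ⁻ lhsP (mlqs n (sortC α)) p
    ... | m , h with ∈-rows⁻ n ν m
    ... | M , refl , eM with ∧-3⁻ (eqℕs (type n (lists M)) α) _ _ h
    ... | ht , hm , hw = subst (_∈ ys) (sym triple≡) (∈-ys⁺ β∈
        (∈-filterᵇ⁺ _ (ssyt (conj (sortC β)) ν) (∈-ssyt⁺ ssytQ) (cong₂ _∧_ (trans inv ht) (trans (cong (_≡ᵇ d) (trans charge-maj (sym (fm-maj (fm-correct M (decr-M M eM)))))) hm)))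
        (∈-filterᵇ⁺ _ (mlqs n (sortC β)) Y∈ (cong₂ _∧_ (trans (cong (λ t → eqℕs t β) typeY) (eqℕs-refl β)) (cong₂ _∧_ (cong (_≡ᵇ 0) majY) (trans (cong (λ t → eqℕs t e) weightY) hw)))))
      where open Image M eM

    inj : ∀ {M M'} → M ∈ xs → M' ∈ xs → triple M ≡ triple M' → M ≡ M'
    inj p p' eq with ∈-filterᵇ⁻ lhsP (mlqs n (sortC α)) p | ∈-filterᵇ⁻ lhsP (mlqs n (sortC α)) p'
    ... | m , _ | m' , _ with ∈-rows⁻ n ν m | ∈-rows⁻ n ν m'
    ... | M , refl , eM | M' , refl , eM' = cong lists (injective M M' eM eM' eN eQ)
      where
      module I = Image M eM
      module J = Image M' eM'
      tr : (I.β , I.Q , lists I.Y) ≡ (J.β , J.Q , lists J.Y)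
      tr = trans (sym I.triple≡) (trans eq J.triple≡)
      eY : I.Y ≡ J.Y
      eY = lists-inj _ _ (cong (λ z → proj₂ (proj₂ z)) tr)
      eN : imgN M ≡ imgN M'
      eN = trans I.X≡ (trans (cong₂ (λ y k → y ++ top n k) eY (cong₂ _∸_ (trans I.lX (sym J.lX)) (cong (λ z → maxL (proj₁ z)) tr))) (sym J.X≡))
      eQ : ∀ j → nth [] (imgQ M) j ≡ nth [] (imgQ M') j
      eQ j = trans (sym (I.nQ j)) (trans (cong (λ z → nth [] (proj₁ (proj₂ z)) j) tr) (J.nQ j))

    onto : ∀ {y} → y ∈ ys → ∃ λ M → M ∈ xs × triple M ≡ y
    onto p with ∈-ys⁻ p
    ... | β , Q , M' , refl , b , q , m with ∈-vecs⁻ n K (proj₁ (∈-filterᵇ⁻ _ (vecsUpTo n K) b)) | ∈-filterᵇ⁻ (λ Q → invTypeIs n α β Q ∧ (charge Q ≡ᵇ d)) (ssyt (conj (sortC β)) ν) q | ∈-filterᵇ⁻ (λ M → eqℕs (type n M) β ∧ (maj n M ≡ᵇ 0) ∧ eqℕs (weight n M) e) (mlqs n (sortC β)) m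
    ... | lβ , bβ | q∈ , hq | m∈ , hm with ∈-rows⁻ n (conj (sortC β)) m∈ | ∧-3⁻ (eqℕs (type n M') β) (maj n M' ≡ᵇ 0) (eqℕs (weight n M') e) hm | ∧-elim (invTypeIs n α β Q) _ hq
    ... | Y , refl , eY | ht , h0 , hw | hi , hc = go (inverse β Q X hwX lX szX s)
      where
      s : SSYT (conj (sortC β)) ν Q
      s = ∈-ssyt⁻ q∈
      nY : ∀ j → nsz Y j ≡ cn β j
      nY j = trans (cong (λ l → nth 0 l j) eY) (nth-conj β j)
      FY = fm-correct Y (decr-of Y (λ i → subst₂ _≤_ (sym (nY (suc i))) (sym (nY i)) (cn-decr β i)))
      tY : type n (lists Y) ≡ β
      tY = eqℕs-sound _ β ht
      hwY : HW Y
      hwY = majA-hw Y (trans (sym (fm-maj FY)) (eqT⁻ _ 0 h0))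
      lY : length Y ≡ maxL β
      lY = trans (sym (LP.length-map size Y)) (trans (cong length eY) (length-conj β))
      ℓ≤K : maxL β ≤ K
      ℓ≤K = maxL-least K β bβ
      X : Mat n
      X = Y ++ top n (K ∸ maxL β)
      hwX : HW X
      hwX = hw-top Y (K ∸ maxL β) hwY
      lX : length X ≡ K
      lX = trans (LP.length-++ Y) (trans (cong₂ _+_ lY (LP.length-replicate (K ∸ maxL β))) (m+[n∸m]≡n ℓ≤K))
      setX : ∀ i → Sset i X ≡ gek n (suc i) β
      setX i = trans (Sset-top i Y (K ∸ maxL β)) (trans (sym (fm-sets FY i)) (cong (gek n (suc i)) tY))
      szX : ∀ j → nsz X j ≡ cn β j
      szX j = trans (sym (size-Sset-decr j X (hw-decr X hwX))) (trans (cong size (setX j)) (size-gek n (suc j) β lβ))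
      go : Inverse X Q → ∃ λ M → M ∈ xs × triple M ≡ (β , Q , lists Y)
      go record { mlq = M ; i-ν = eM ; i-N = nM ; i-Q = qM ; i-maj = mM } = lists M , ∈-filterᵇ⁺ lhsP (mlqs n (sortC α)) (subst (λ c → lists M ∈ rowsOfSizes n c) eM (∈-rows⁺ M)) ok , tr
        where
        module I = Image M eM
        tyM : eqℕs (type n (lists M)) α ≡ true
        tyM = trans (sym (inv-type β Q M lβ bβ s eM (λ i → trans (cong (Sset i) nM) (setX i)) qM)) hi
        ok : lhsP (lists M) ≡ true
        ok = cong₂ _∧_ tyM (cong₂ _∧_ (trans (cong (_≡ᵇ d) (trans (fm-maj (fm-correct M (decr-M M eM))) mM)) hc)
          (trans (cong (λ t → eqℕs t e) (trans (weight-lists M) (trans (cong toList (trans (sym (k-wt (stage-keep (length M ∸ 1)) M)) (trans (cong wt nM) (wt-top Y (K ∸ maxL β))))) (sym (weight-lists Y))))) hw))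
        eβ : I.β ≡ β
        eβ = gek-ext n _ _ I.lβ lβ (λ k → trans (fm-sets I.F k) (trans (cong (Sset k) nM) (setX k)))
        eQ : I.Q ≡ Q
        eQ = list-ext [] _ _ (trans (sym (LP.length-map length I.Q)) (trans (cong length (trans (shape I.ssytQ) (trans (cong (λ b → conj (sortC b)) eβ) (sym (shape s))))) (LP.length-map length Q)))
          (λ j _ → trans (I.nQ j) (qM j))
        eYY : I.Y ≡ Y
        eYY = trans (cong₂ take (trans (cong maxL eβ) (sym lY)) nM) (take-++ Y)
          where
          take-++ : ∀ {Z : Mat n} (Y : Mat n) → take (length Y) (Y ++ Z) ≡ Y
          take-++ []      = refl
          take-++ (r ∷ Y) = cong (r ∷_) (take-++ Y)
        tr : triple (lists M) ≡ (β , Q , lists Y)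
        tr = trans I.triple≡ (cong₂ _,_ eβ (cong₂ _,_ eQ (cong lists eYY)))

    -- Both coefficients are lengths of lists. On the right, the concatenation over β gives the sum
    -- and the pairs of a tableau and a nonwrapping queue give the product; the atom contains no q,
    -- so the degree d is carried by the tableau alone.
    theorem : fCoeff n α d e ≡ rhsCoeff n α d e
    theorem = trans (bij-length triple xs ys (unique-filterᵇ lhsP (unique-rows n ν)) unique-ys to inj onto) length-ys

theorem4p4 : (n : ℕ) (α : Vec ℕ n) → length (sortC (toList α)) < n →
    (d : ℕ) (e : Vec ℕ n) →
    fCoeff n (toList α) d (toList e) ≡ rhsCoeff n (toList α) d (toList e)
theorem4p4 n α _ d e = Main.Count.theorem n (toList α) d (toList e)
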